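{- Let $T$ be a quadratic starlike tree containing $K_{1,3}$ as a proper induced subgraph. Then its characteristic polynomial has one of the two forms (I) $f_T(x)=x^{t_1}(x^2-1)^{t_2}(x^2-2)^{t_3}((x^2-x-1)(x^2+x-1))^{t_4}(x^2-3)^{t_5}(x^2-c)$, where $c\ge 4$ and $t_1,\dots,t_5\ge0$ are integers and $\lambda_1(T)$ is a root of $x^2-c$; or (II) $f_T(x)=x^{t_1}(x^2-1)^{t_2}(x^2-2)^{t_3}((x^2-x-1)(x^2+x-1))^{t_4}(x^2-3)^{t_5}(x^2-ax+b)(x^2+ax+b)$, where $a>0$, $b$, $t_1,\dots,t_5\ge0$ are integers, $\Delta=a^2-4b>0$ is a square-free number, and $\lambda_1(T)$ is a root of $x^2-ax+b$.
   Context: Eigenvalues are those of the adjacency matrix, $\lambda_1(T)$ the largest, $f_T(x)=\det(xI-A(T))$. A graph is quadratic if every irreducible factor over $\mathbb{Q}$ of its characteristic polynomial has degree at most $2$. A starlike tree is a tree with a center vertex $u$ such that $T-u$ is a disjoint union of paths, each joined by an edge from one endpoint to $u$. In this paper "square-free number" is used to mean a positive integer that is not a perfect square (so that $x^2\pm ax+b$ is irreducible over $\mathbb{Q}$). -}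

module Defs where

open import Level using (0ℓ)
open import Data.Bool using (Bool; true; false; if_then_else_; _∧_)
open import Data.Nat as ℕ using (ℕ; zero; suc)
open import Data.Integer as ℤ using (ℤ; +_; -[1+_])
open import Data.Rational as ℚ using (ℚ)
open import Data.Fin using (Fin; zero; suc; toℕ; punchIn)
open import Data.Fin.Properties using () renaming (_≟_ to _≟ᶠ_)
open import Data.Maybe using (Maybe; just; nothing)
open import Data.Product using (Σ; ∃; _×_; _,_)
open import Data.Sum using (_⊎_)
open import Data.List using (List; []; _∷_; map; length; _++_)
open import Function using (_∘_)
open import Function.Bundles using (_↔_; Inverse)
open import Relation.Nullary using (¬_; ⌊_⌋)
open import Relation.Binary using (Rel; IsTotalOrder)
open import Relation.Binary.PropositionalEquality using (_≡_)
open import Algebra.Bundles using (CommutativeRing)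
open import Algebra.Bundles.Raw using (RawRing)

Graph : ℕ → Set
Graph n = Fin n → Fin n → Bool

module _ {c ℓ} (R : RawRing c ℓ) where
  open RawRing R

  sumFin : ∀ {n} → (Fin n → Carrier) → Carrier
  sumFin {zero}  f = 0#
  sumFin {suc n} f = f zero + sumFin (f ∘ suc)

  alt : ℕ → Carrier → Carrier
  alt zero    x = x
  alt (suc k) x = - alt k x

  det : ∀ n → (Fin n → Fin n → Carrier) → Carrier
  det zero    M = 1#
  det (suc n) M =
    sumFin (λ j → alt (toℕ j) (M zero j * det n (λ i k → M (suc i) (punchIn j k))))

  charMatrix : ∀ {n} → Carrier → Graph n → Fin n → Fin n → Carrier
  charMatrix x A i j =
    (if ⌊ i ≟ᶠ j ⌋ then x else 0#) + (- (if A i j then 1# else 0#))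

-- Polynomials over ℚ: coefficient lists, lowest degree first.

Poly : Set
Poly = List ℚ

coeff : Poly → ℕ → ℚ
coeff []       _       = ℚ.0ℚ
coeff (a ∷ p)  zero    = a
coeff (a ∷ p)  (suc i) = coeff p i

_≈ₚ_ : Poly → Poly → Set
p ≈ₚ q = ∀ i → coeff p i ≡ coeff q i

_+ₚ_ : Poly → Poly → Poly
[]      +ₚ q       = q
(a ∷ p) +ₚ []      = a ∷ p
(a ∷ p) +ₚ (b ∷ q) = (a ℚ.+ b) ∷ (p +ₚ q)

-ₚ_ : Poly → Poly
-ₚ p = map ℚ.-_ p

_*ₚ_ : Poly → Poly → Poly
[]      *ₚ q = []
(a ∷ p) *ₚ q = map (a ℚ.*_) q +ₚ (ℚ.0ℚ ∷ (p *ₚ q))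

_^ₚ_ : Poly → ℕ → Poly
p ^ₚ zero  = ℚ.1ℚ ∷ []
p ^ₚ suc k = p *ₚ (p ^ₚ k)

polyRawRing : RawRing 0ℓ 0ℓ
polyRawRing = record
  { Carrier = Poly ; _≈_ = _≈ₚ_ ; _+_ = _+ₚ_ ; _*_ = _*ₚ_ ; -_ = -ₚ_
  ; 0# = [] ; 1# = ℚ.1ℚ ∷ [] }

X : Poly
X = ℚ.0ℚ ∷ ℚ.1ℚ ∷ []

C : ℤ → Poly
C z = (z ℚ./ 1) ∷ []

charPoly : ∀ {n} → Graph n → Poly
charPoly {n} A = det polyRawRing n (charMatrix polyRawRing X A)

DegLe : ℕ → Poly → Set
DegLe d p = ∀ i → d ℕ.< i → coeff p i ≡ ℚ.0ℚ

IsConstant : Poly → Set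
IsConstant = DegLe 0

-- irreducible over ℚ: non-constant (so nonzero and not a unit), and in
-- every factorisation one factor is constant (necessarily a nonzero
-- constant, i.e. a unit)
Irreducible : Poly → Set
Irreducible g = ¬ IsConstant g × (∀ h k → g ≈ₚ (h *ₚ k) → IsConstant h ⊎ IsConstant k)

_∣ₚ_ : Poly → Poly → Set
g ∣ₚ f = ∃ λ h → f ≈ₚ (g *ₚ h)

Quadratic : ∀ {n} → Graph n → Set
Quadratic A = ∀ g → Irreducible g → g ∣ₚ charPoly A → DegLe 2 g

-- Starlike trees: isomorphic to the canonical starlike tree with
-- k branches (paths) of lengths len i, attached at an endpoint to a centre.

StarV : (k : ℕ) → (Fin k → ℕ) → Set
StarV k len = Maybe (Σ (Fin k) (λ i → Fin (len i)))

starAdj : ∀ k len → StarV k len → StarV k len → Bool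
starAdj k len nothing         nothing           = false
starAdj k len nothing         (just (i , j))    = ⌊ toℕ j ℕ.≟ 0 ⌋
starAdj k len (just (i , j))  nothing           = ⌊ toℕ j ℕ.≟ 0 ⌋
starAdj k len (just (i , j))  (just (i' , j'))  =
  ⌊ i ≟ᶠ i' ⌋ ∧ (⌊ suc (toℕ j) ℕ.≟ toℕ j' ⌋ Data.Bool.∨ ⌊ suc (toℕ j') ℕ.≟ toℕ j ⌋)

StarlikeTree : ∀ {n} → Graph n → Set
StarlikeTree {n} A =
  Σ ℕ λ k → Σ (Fin k → ℕ) λ len → Σ (Fin n ↔ StarV k len) λ φ →
    ∀ u v → A u v ≡ starAdj k len (Inverse.to φ u) (Inverse.to φ v)

k13 : Fin 4 → Fin 4 → Bool
k13 zero    zero    = false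
k13 zero    (suc _) = true
k13 (suc _) zero    = true
k13 (suc _) (suc _) = false

ContainsK13Properly : ∀ {n} → Graph n → Set
ContainsK13Properly {n} A =
  4 ℕ.< n × (Σ (Fin 4 → Fin n) λ φ →
    (∀ i j → φ i ≡ φ j → i ≡ j) × (∀ i j → A (φ i) (φ j) ≡ k13 i j))

-- Real closed fields (used to speak about the largest eigenvalue λ₁).

hornerCR : (R : CommutativeRing 0ℓ 0ℓ) → List (CommutativeRing.Carrier R) →
           CommutativeRing.Carrier R → CommutativeRing.Carrier R
hornerCR R []       x = CommutativeRing.0# R
hornerCR R (a ∷ as) x = CommutativeRing._+_ R a (CommutativeRing._*_ R x (hornerCR R as x))

record RealClosedField : Set₁ where
  field
    cring : CommutativeRing 0ℓ 0ℓ
  open CommutativeRing cring public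
  field
    _≤_         : Rel Carrier 0ℓ
    isTotalOrder : IsTotalOrder _≈_ _≤_
    +-mono-≤    : ∀ {x y} z → x ≤ y → (x + z) ≤ (y + z)
    *-nonneg    : ∀ {x y} → 0# ≤ x → 0# ≤ y → 0# ≤ (x * y)
    nontrivial  : ¬ (1# ≈ 0#)
    inverse     : ∀ x → ¬ (x ≈ 0#) → ∃ λ y → (x * y) ≈ 1#
    sqrt        : ∀ x → 0# ≤ x → ∃ λ y → (y * y) ≈ x
    oddRoot     : ∀ m (as : List Carrier) → length as ≡ suc (2 ℕ.* m) →
                  ∃ λ x → hornerCR cring (as ++ (1# ∷ [])) x ≈ 0#

module _ (R : RealClosedField) where
  open RealClosedField R

  fromℕR : ℕ → Carrier
  fromℕR zero    = 0#
  fromℕR (suc n) = 1# + fromℕR n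

  fromℤR : ℤ → Carrier
  fromℤR (+ n)    = fromℕR n
  fromℤR -[1+ n ] = - fromℕR (suc n)

  IsEigenvalue : ∀ {n} → Graph n → Carrier → Set
  IsEigenvalue {n} A λ' = det rawRing n (charMatrix rawRing λ' A) ≈ 0#

  IsLargestEigenvalue : ∀ {n} → Graph n → Carrier → Set
  IsLargestEigenvalue A λ' = IsEigenvalue A λ' × (∀ μ → IsEigenvalue A μ → μ ≤ λ')

sq- : ℤ → Poly
sq- k = C (ℤ.- k) ++ (ℚ.0ℚ ∷ ℚ.1ℚ ∷ [])

commonPart : ℕ → ℕ → ℕ → ℕ → ℕ → Poly
commonPart t1 t2 t3 t4 t5 =
  (X ^ₚ t1) *ₚ ((sq- (+ 1) ^ₚ t2) *ₚ ((sq- (+ 2) ^ₚ t3) *ₚ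
  ((((C -[1+ 0 ] ++ (ℚ.- ℚ.1ℚ ∷ ℚ.1ℚ ∷ [])) *ₚ (C -[1+ 0 ] ++ (ℚ.1ℚ ∷ ℚ.1ℚ ∷ []))) ^ₚ t4)
   *ₚ (sq- (+ 3) ^ₚ t5))))

quad : ℤ → ℤ → Poly
quad a b = C b ++ ((a ℚ./ 1) ∷ ℚ.1ℚ ∷ [])

NonSquarePos : ℤ → Set
NonSquarePos Δ = (+ 0) ℤ.< Δ × ¬ (∃ λ m → Δ ≡ + (m ℕ.* m))

FormI : ∀ {n} → Graph n → Set₁
FormI A = ∃ λ (c : ℕ) → ∃ λ t1 → ∃ λ t2 → ∃ λ t3 → ∃ λ t4 → ∃ λ t5 →
  4 ℕ.≤ c ×
  charPoly A ≈ₚ (commonPart t1 t2 t3 t4 t5 *ₚ sq- (+ c)) ×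
  (∀ (R : RealClosedField) (λ₁ : RealClosedField.Carrier R) → IsLargestEigenvalue R A λ₁ →
     let open RealClosedField R in (λ₁ * λ₁ + - fromℤR R (+ c)) ≈ 0#)

FormII : ∀ {n} → Graph n → Set₁
FormII A = ∃ λ (a : ℕ) → ∃ λ (b : ℤ) → ∃ λ t1 → ∃ λ t2 → ∃ λ t3 → ∃ λ t4 → ∃ λ t5 →
  0 ℕ.< a ×
  NonSquarePos ((+ a) ℤ.* (+ a) ℤ.- (+ 4) ℤ.* b) ×
  charPoly A ≈ₚ (commonPart t1 t2 t3 t4 t5 *ₚ (quad (ℤ.- (+ a)) b *ₚ quad (+ a) b)) ×
  (∀ (R : RealClosedField) (λ₁ : RealClosedField.Carrier R) → IsLargestEigenvalue R A λ₁ →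
     let open RealClosedField R in
     (λ₁ * λ₁ + - (fromℤR R (+ a) * λ₁) + fromℤR R b) ≈ 0#)

{-# OPTIONS --safe #-}
-- The characteristic polynomial f of a starlike tree with branch lengths ls is star x ls, obtained by peeling off
-- one branch at a time; let q = paths x ls be that of the tree without its centre.  Then
--   f(x) q(y) - f(y) q(x) = (x - y) B(x , y),
-- where B is built by sums and products from values of path polynomials, so that B(x , y) > 0 for x, y ≥ 2
-- (and B(ω , ω̄) > 0 for conjugate non-real ω).  Hence f has at most one root ≥ 2, counted with multiplicity, and
-- no non-real root.  The estimates are made in iterated quadratic extensions of ℤ that carry a cone of nonnegative
-- elements.
--
-- A factor of f over ℚ of least positive degree is irreducible, hence of degree at most 2, and it is integral by
-- Gauss' lemma.  Since f is even or odd, f is a product of x, x² - c and (x² - ax + b)(x² + ax + b), and all of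
-- these with no root ≥ 2 are x, x² - 1, x² - 2, x² - 3 and (x² - x - 1)(x² + x - 1); at most one factor is different.
-- If there were none, then f(2) = 2^t₁ 3^t₂ 2^t₃ 5^t₄; but f(2) ≤ 4 for a tree with at least three branches, and
-- comparing the degree of f with the number of edges, read off the second coefficient, leaves at most four vertices.
-- The factorisation is reached under a double negation, which a bounded search for its parameters removes.
--
-- In a real closed field the remaining factor has a root ≥ 2, and every other factor is positive there and beyond.
module Submission where

open import Defs
open import Level using (0ℓ)
open import Data.Bool using (Bool; true; false; if_then_else_; _∧_; _∨_)
open import Data.Nat as ℕ using (ℕ; zero; suc; z≤n; s≤s)
import Data.Nat.Properties as ℕₚ
open import Data.Integer as ℤ using (ℤ; +_; -[1+_]; +0; +[1+_])
import Data.Integer.Properties as ℤₚ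
open import Data.Rational as ℚ using (ℚ)
import Data.Rational.Properties as ℚₚ
open import Data.Fin as Fin using (Fin; zero; suc; toℕ; punchIn)
import Data.Fin.Properties as Finₚ
open import Data.Maybe using (Maybe; just; nothing)
open import Data.Product using (Σ; ∃; _×_; _,_; proj₁; proj₂)
open import Data.Sum using (_⊎_; inj₁; inj₂; map₁; map₂)
open import Data.Empty using (⊥-elim)
open import Data.List using (List; []; _∷_; map; length; _++_; tabulate; allFin)
open import Function using (_∘_; _∋_; id)
open import Function.Bundles using (_↔_; Inverse; mk⇔)
open import Relation.Nullary using (¬_; Dec; yes; no; ⌊_⌋)
open import Relation.Binary.PropositionalEquality as ≡ using (_≡_; _≢_; refl; cong; cong₂; subst)
open import Algebra.Bundles using (CommutativeRing)
import Algebra.Properties.Ring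
import Algebra.Properties.Semiring.Mult.TCOptimised
import Algebra.Properties.AbelianGroup
import Algebra.Solver.Ring as RingSolver
open import Algebra.Solver.Ring.AlmostCommutativeRing using (fromCommutativeRing; _-Raw-AlmostCommutative⟶_)
open import Relation.Nullary.Decidable using (_×-dec_; _⊎-dec_; ¬?; map′; decidable-stable)
import Relation.Binary.Reasoning.Setoid
open import Algebra.Structures using (IsCommutativeRing)
import Data.List.Properties as Listₚ
open import Data.List.Relation.Unary.All as All using (All; []; _∷_)
import Data.List.Relation.Unary.All.Properties as Allₚ
open import Data.List.Relation.Unary.AllPairs using ([]; _∷_)
open import Data.List.Relation.Unary.Any using (here; there)
open import Data.List.Relation.Unary.Unique.Propositional using (Unique)
import Data.List.Relation.Unary.Unique.Propositional.Properties as Uniqueₚ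
open import Data.List.Membership.Propositional using (_∈_)
import Data.List.Membership.Propositional.Properties as ∈ₚ
open import Data.List.Membership.Propositional.Properties.WithK using (unique∧set⇒bag)
open import Data.List.Relation.Binary.BagAndSetEquality using (∼bag⇒↭)
open import Data.List.Relation.Binary.Permutation.Propositional as Perm using (_↭_)
import Data.List.Relation.Binary.Permutation.Propositional.Properties as Permₚ
open import Data.Nat.ListAction using (sum)
import Data.Bool.Properties as Boolₚ
open import Relation.Binary.Definitions using (tri<; tri≈; tri>)
import Data.Nat.Coprimality as Coprimality
import Data.Rational.Unnormalised as ℚᵘ
import Data.Rational.Unnormalised.Properties as ℚᵘₚ
open import Data.Nat.Primality using (Prime; euclidsLemma; prime⇒nonTrivial; prime⇒nonZero; prime[2])
open import Data.Nat.Primality.Factorisation using (factorise)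
import Data.Nat.Divisibility as ℕ∣
open import Data.Integer.Divisibility.Signed using (_∣_; divides; ∣ᵤ⇒∣; ∣⇒∣ᵤ; _∣?_; ∣m+n∣m⇒∣n; ∣m+n∣n⇒∣m; ∣m⇒∣m*n; ∣n⇒∣m*n)
open import Data.Nat.Induction using (<-wellFounded)
open import Induction.WellFounded using (Acc; acc)
import Relation.Nullary.Decidable as Decidable
open import Data.Nat.Solver using (module +-*-Solver)
open import Relation.Binary using (IsTotalOrder)

-- Removing the centre leaves paths, whose eigenvalues lie below 2, so interlacing allows at most
-- one eigenvalue from 2 on: this is the origin of the threshold 2. Interlacing and the reality of
-- the spectrum belong to real symmetric matrices, but the data are integers and a `RealClosedField`
-- enters only together with λ₁. The Bezoutian replaces both facts, being an identity with integer
-- coefficients. Roots are adjoined formally. Such an extension has zero divisors when the quadratic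
-- splits, and nothing in it is decided; a cone without -1 suffices, since 1 + r with r in the cone
-- is then nonzero, and a factor x - α can be cancelled because it is monic. Irreducibility over ℚ
-- quantifies over all factorisations, so an irreducible factor is reached only by contradiction;
-- this is where the double negation comes from. The factor x² - 3 has the value 1 at 2, so f(2)
-- says nothing about its multiplicity. The edge count controls it, and it also bounds the
-- parameters of the search.

-- Integers in a commutative ring and the ring solver

module RingKit (R : CommutativeRing 0ℓ 0ℓ) where
  open CommutativeRing R public renaming (refl to ≈-refl; sym to ≈-sym; trans to ≈-trans; reflexive to ≈-reflexive) hiding (zero)
  open Algebra.Properties.Ring ring public
  open Algebra.Properties.AbelianGroup +-abelianGroup public using (⁻¹-∙-comm)
  open Algebra.Properties.Semiring.Mult.TCOptimised semiring using (×1-homo-*; ×-homo-+; 1+×) renaming (_×_ to _⋆_)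
  open Relation.Binary.Reasoning.Setoid setoid public

  -- With this form of multiple `fromℕ 1` reduces to `1#`, so that `con (+ 1)` in a solver equation
  -- is `1#` on the nose.
  fromℕ : ℕ → Carrier
  fromℕ n = n ⋆ 1#

  fromℕ-suc : ∀ n → fromℕ (suc n) ≈ 1# + fromℕ n
  fromℕ-suc n = 1+× n 1#

  fromℤ : ℤ → Carrier
  fromℤ (+ n)    = fromℕ n
  fromℤ -[1+ n ] = - fromℕ (suc n)

  fromℤ-⊖ : ∀ m n → fromℤ (m ℤ.⊖ n) ≈ fromℕ m + - fromℕ n
  fromℤ-⊖ zero    zero    = ≈-sym (-‿inverseʳ 0#)
  fromℤ-⊖ zero    (suc n) = ≈-sym (+-identityˡ _)
  fromℤ-⊖ (suc m) zero    = ≈-sym (≈-trans (+-congˡ -0#≈0#) (+-identityʳ _))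
  fromℤ-⊖ (suc m) (suc n) = begin
    fromℤ (suc m ℤ.⊖ suc n)                    ≈⟨ ≈-reflexive (cong fromℤ (ℤₚ.[1+m]⊖[1+n]≡m⊖n m n)) ⟩
    fromℤ (m ℤ.⊖ n)                            ≈⟨ fromℤ-⊖ m n ⟩
    fromℕ m + - fromℕ n                        ≈⟨ +-congʳ (+-identityˡ _) ⟨
    (0# + fromℕ m) + - fromℕ n                 ≈⟨ +-congʳ (+-congʳ (-‿inverseʳ 1#)) ⟨
    ((1# + - 1#) + fromℕ m) + - fromℕ n        ≈⟨ +-congʳ (+-assoc _ _ _) ⟩
    (1# + (- 1# + fromℕ m)) + - fromℕ n        ≈⟨ +-congʳ (+-congˡ (+-comm _ _)) ⟩
    (1# + (fromℕ m + - 1#)) + - fromℕ n        ≈⟨ +-congʳ (+-assoc _ _ _) ⟨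
    ((1# + fromℕ m) + - 1#) + - fromℕ n        ≈⟨ +-assoc _ _ _ ⟩
    (1# + fromℕ m) + (- 1# + - fromℕ n)        ≈⟨ +-congˡ (⁻¹-∙-comm 1# (fromℕ n)) ⟩
    (1# + fromℕ m) + - (1# + fromℕ n)          ≈⟨ +-cong (1+× m 1#) (-‿cong (1+× n 1#)) ⟨
    fromℕ (suc m) + - fromℕ (suc n)            ∎

  fromℤ-+ : ∀ i j → fromℤ (i ℤ.+ j) ≈ fromℤ i + fromℤ j
  fromℤ-+ (+ m)    (+ n)    = ×-homo-+ 1# m n
  fromℤ-+ (+ m)    -[1+ n ] = fromℤ-⊖ m (suc n)
  fromℤ-+ -[1+ m ] (+ n)    = ≈-trans (fromℤ-⊖ n (suc m)) (+-comm _ _)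
  fromℤ-+ -[1+ m ] -[1+ n ] = begin
    - fromℕ (suc (suc (m ℕ.+ n)))        ≈⟨ -‿cong (≈-reflexive (cong fromℕ (cong suc (≡.sym (ℕₚ.+-suc m n))))) ⟩
    - fromℕ (suc m ℕ.+ suc n)            ≈⟨ -‿cong (×-homo-+ 1# (suc m) (suc n)) ⟩
    - (fromℕ (suc m) + fromℕ (suc n))    ≈⟨ ⁻¹-∙-comm _ _ ⟨
    - fromℕ (suc m) + - fromℕ (suc n)    ∎

  fromℤ-neg : ∀ i → fromℤ (ℤ.- i) ≈ - fromℤ i
  fromℤ-neg +0       = ≈-sym -0#≈0#
  fromℤ-neg +[1+ n ] = ≈-refl
  fromℤ-neg -[1+ n ] = ≈-sym (-‿involutive _)

  fromℤ-* : ∀ i j → fromℤ (i ℤ.* j) ≈ fromℤ i * fromℤ j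
  fromℤ-* (+ m) (+ n) = begin
    fromℤ (+ m ℤ.* + n)   ≈⟨ ≈-reflexive (cong fromℤ (ℤₚ.pos-* m n)) ⟨
    fromℕ (m ℕ.* n)       ≈⟨ ×1-homo-* m n ⟩
    fromℕ m * fromℕ n     ∎
  fromℤ-* (+ m) -[1+ n ] = begin
    fromℤ (+ m ℤ.* -[1+ n ])       ≈⟨ ≈-reflexive (cong fromℤ (ℤₚ.neg-distribʳ-* (+ m) (+ suc n))) ⟨
    fromℤ (ℤ.- (+ m ℤ.* + suc n))  ≈⟨ fromℤ-neg (+ m ℤ.* + suc n) ⟩
    - fromℤ (+ m ℤ.* + suc n)      ≈⟨ -‿cong (fromℤ-* (+ m) (+ suc n)) ⟩
    - (fromℕ m * fromℕ (suc n))    ≈⟨ -‿distribʳ-* _ _ ⟩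
    fromℕ m * - fromℕ (suc n)      ∎
  fromℤ-* -[1+ m ] j = begin
    fromℤ (-[1+ m ] ℤ.* j)         ≈⟨ ≈-reflexive (cong fromℤ (ℤₚ.neg-distribˡ-* (+ suc m) j)) ⟨
    fromℤ (ℤ.- (+ suc m ℤ.* j))    ≈⟨ fromℤ-neg (+ suc m ℤ.* j) ⟩
    - fromℤ (+ suc m ℤ.* j)        ≈⟨ -‿cong (pos j) ⟩
    - (fromℕ (suc m) * fromℤ j)    ≈⟨ -‿distribˡ-* _ _ ⟩
    - fromℕ (suc m) * fromℤ j      ∎
    where
    pos : ∀ j → fromℤ (+ suc m ℤ.* j) ≈ fromℕ (suc m) * fromℤ j
    pos (+ n) = begin
      fromℤ (+ suc m ℤ.* + n)   ≈⟨ ≈-reflexive (cong fromℤ (ℤₚ.pos-* (suc m) n)) ⟨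
      fromℕ (suc m ℕ.* n)       ≈⟨ ×1-homo-* (suc m) n ⟩
      fromℕ (suc m) * fromℕ n   ∎
    pos -[1+ n ] = begin
      fromℤ (+ suc m ℤ.* -[1+ n ])       ≈⟨ ≈-reflexive (cong fromℤ (ℤₚ.neg-distribʳ-* (+ suc m) (+ suc n))) ⟨
      fromℤ (ℤ.- (+ suc m ℤ.* + suc n))  ≈⟨ fromℤ-neg (+ suc m ℤ.* + suc n) ⟩
      - fromℤ (+ suc m ℤ.* + suc n)      ≈⟨ -‿cong (pos (+ suc n)) ⟩
      - (fromℕ (suc m) * fromℕ (suc n))  ≈⟨ -‿distribʳ-* _ _ ⟩
      fromℕ (suc m) * - fromℕ (suc n)    ∎

  private
    coefficients : ℤ.+-*-rawRing -Raw-AlmostCommutative⟶ fromCommutativeRing R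
    coefficients = record
      { ⟦_⟧ = fromℤ ; +-homo = fromℤ-+ ; *-homo = fromℤ-* ; -‿homo = fromℤ-neg
      ; 0-homo = ≈-refl ; 1-homo = ≈-refl }

    coeff≟ : ∀ i j → Maybe (fromℤ i ≈ fromℤ j)
    coeff≟ i j with i ℤ.≟ j
    ... | yes i≡j = just (≈-reflexive (cong fromℤ i≡j))
    ... | no  _   = nothing

  open RingSolver ℤ.+-*-rawRing (fromCommutativeRing R) coefficients coeff≟ public
    using (solve; _:=_; _:+_; _:*_; :-_; _:-_; con)

-- Polynomials as coefficient lists over a commutative ring

module Sequences (K : CommutativeRing 0ℓ 0ℓ) where
  open RingKit K

  Seq : Set
  Seq = ℕ → Carrier

  infix 4 _≋_
  _≋_ : Seq → Seq → Set
  f ≋ g = ∀ i → f i ≈ g i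

  -- The Cauchy product. The laws of multiplication are proved for sequences, which have neither
  -- length nor trailing zeros, and reach lists through `coef-*`.
  conv : Seq → Seq → Seq
  conv f g zero    = f 0 * g 0
  conv f g (suc n) = f 0 * g (suc n) + conv (f ∘ suc) g n

  conv-cong : ∀ {f f′ g g′} → f ≋ f′ → g ≋ g′ → conv f g ≋ conv f′ g′
  conv-cong f≋ g≋ zero    = *-cong (f≋ 0) (g≋ 0)
  conv-cong f≋ g≋ (suc n) = +-cong (*-cong (f≋ 0) (g≋ (suc n))) (conv-cong (f≋ ∘ suc) g≋ n)

  conv-+ˡ : ∀ f g h → conv (λ i → f i + g i) h ≋ (λ i → conv f h i + conv g h i)
  conv-+ˡ f g h zero    = distribʳ _ _ _
  conv-+ˡ f g h (suc n) = begin
    (f 0 + g 0) * h (suc n) + conv (λ i → f (suc i) + g (suc i)) h n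
      ≈⟨ +-cong (distribʳ _ _ _) (conv-+ˡ (f ∘ suc) (g ∘ suc) h n) ⟩
    (f 0 * h (suc n) + g 0 * h (suc n)) + (conv (f ∘ suc) h n + conv (g ∘ suc) h n)
      ≈⟨ solve 4 (λ a b c d → (a :+ b) :+ (c :+ d) := (a :+ c) :+ (b :+ d)) ≈-refl _ _ _ _ ⟩
    _ ∎

  conv-scaleˡ : ∀ c f h → conv (λ i → c * f i) h ≋ (λ i → c * conv f h i)
  conv-scaleˡ c f h zero    = *-assoc _ _ _
  conv-scaleˡ c f h (suc n) = begin
    (c * f 0) * h (suc n) + conv (λ i → c * f (suc i)) h n   ≈⟨ +-cong (*-assoc _ _ _) (conv-scaleˡ c (f ∘ suc) h n) ⟩
    c * (f 0 * h (suc n)) + c * conv (f ∘ suc) h n           ≈⟨ distribˡ _ _ _ ⟨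
    _ ∎

  conv-zeroˡ : ∀ {f} g → (∀ i → f i ≈ 0#) → ∀ n → conv f g n ≈ 0#
  conv-zeroˡ g f≈0 zero    = ≈-trans (*-congʳ (f≈0 0)) (zeroˡ _)
  conv-zeroˡ g f≈0 (suc n) = begin
    _        ≈⟨ +-cong (≈-trans (*-congʳ (f≈0 0)) (zeroˡ _)) (conv-zeroˡ g (f≈0 ∘ suc) n) ⟩
    0# + 0#  ≈⟨ +-identityˡ _ ⟩
    0#       ∎

  conv-sucʳ : ∀ f g n → conv f g (suc n) ≈ conv f (g ∘ suc) n + f (suc n) * g 0
  conv-sucʳ f g zero    = ≈-refl
  conv-sucʳ f g (suc n) = ≈-trans (+-congˡ (conv-sucʳ (f ∘ suc) g n)) (≈-sym (+-assoc _ _ _))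

  conv-comm : ∀ f g → conv f g ≋ conv g f
  conv-comm f g zero    = *-comm _ _
  conv-comm f g (suc n) = begin
    f 0 * g (suc n) + conv (f ∘ suc) g n   ≈⟨ +-cong (*-comm _ _) (conv-comm (f ∘ suc) g n) ⟩
    g (suc n) * f 0 + conv g (f ∘ suc) n   ≈⟨ +-comm _ _ ⟩
    conv g (f ∘ suc) n + g (suc n) * f 0   ≈⟨ conv-sucʳ g f n ⟨
    conv g f (suc n)                       ∎

  conv-assoc : ∀ f g h → conv (conv f g) h ≋ conv f (conv g h)
  conv-assoc f g h zero    = *-assoc _ _ _
  conv-assoc f g h (suc n) = begin
    (f 0 * g 0) * h (suc n) + conv (λ i → f 0 * g (suc i) + conv (f ∘ suc) g i) h n
      ≈⟨ +-congˡ (conv-+ˡ (λ i → f 0 * g (suc i)) (conv (f ∘ suc) g) h n) ⟩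
    (f 0 * g 0) * h (suc n) + (conv (λ i → f 0 * g (suc i)) h n + conv (conv (f ∘ suc) g) h n)
      ≈⟨ +-cong (*-assoc _ _ _) (+-cong (conv-scaleˡ (f 0) (g ∘ suc) h n) (conv-assoc (f ∘ suc) g h n)) ⟩
    f 0 * (g 0 * h (suc n)) + (f 0 * conv (g ∘ suc) h n + conv (f ∘ suc) (conv g h) n)
      ≈⟨ +-assoc _ _ _ ⟨
    (f 0 * (g 0 * h (suc n)) + f 0 * conv (g ∘ suc) h n) + conv (f ∘ suc) (conv g h) n
      ≈⟨ +-congʳ (distribˡ _ _ _) ⟨
    _ ∎

  Below : ℕ → Seq → Set
  Below m f = ∀ i → m ℕ.≤ i → f i ≈ 0#

  conv-top : ∀ a b {f g} → Below (suc a) f → Below (suc b) g → conv f g (a ℕ.+ b) ≈ f a * g b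
  conv-top zero zero f< g< = ≈-refl
  conv-top zero (suc b) {f} {g} f< g< = begin
    f 0 * g (suc b) + conv (f ∘ suc) g b  ≈⟨ +-congˡ (conv-zeroˡ g (λ i → f< (suc i) (s≤s z≤n)) b) ⟩
    f 0 * g (suc b) + 0#                  ≈⟨ +-identityʳ _ ⟩
    f 0 * g (suc b)                       ∎
  conv-top (suc a) b {f} {g} f< g< = begin
    f 0 * g (suc a ℕ.+ b) + conv (f ∘ suc) g (a ℕ.+ b)
      ≈⟨ +-cong (≈-trans (*-congˡ (g< _ (s≤s (ℕₚ.m≤n+m b a)))) (zeroʳ _)) (conv-top a b (λ i le → f< (suc i) (s≤s le)) g<) ⟩
    0# + f (suc a) * g b   ≈⟨ +-identityˡ _ ⟩
    f (suc a) * g b        ∎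

  -- The bounds are asymmetric on purpose: degree at most a times degree below b stays below a + b,
  -- and b = 0 covers the zero polynomial.
  conv-below : ∀ a b {f g} → Below (suc a) f → Below b g → Below (a ℕ.+ b) (conv f g)
  conv-below zero b {f} {g} f< g< zero le = ≈-trans (*-congˡ (g< 0 le)) (zeroʳ _)
  conv-below zero b {f} {g} f< g< (suc i) le = begin
    f 0 * g (suc i) + conv (f ∘ suc) g i
      ≈⟨ +-cong (≈-trans (*-congˡ (g< _ le)) (zeroʳ _)) (conv-zeroˡ g (λ i → f< (suc i) (s≤s z≤n)) i) ⟩
    0# + 0#  ≈⟨ +-identityˡ _ ⟩
    0#       ∎
  conv-below (suc a) b {f} {g} f< g< (suc i) (s≤s le) = begin
    f 0 * g (suc i) + conv (f ∘ suc) g i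
      ≈⟨ +-cong (≈-trans (*-congˡ (g< _ (ℕₚ.≤-trans (ℕₚ.m≤n+m b a) (ℕₚ.m≤n⇒m≤1+n le)))) (zeroʳ _))
                (conv-below a b (λ i le → f< (suc i) (s≤s le)) g< i le) ⟩
    0# + 0#  ≈⟨ +-identityˡ _ ⟩
    0#       ∎

module Polynomials (K : CommutativeRing 0ℓ 0ℓ) where
  open RingKit K
  open Sequences K public

  Pol : Set
  Pol = List Carrier

  coef : Pol → Seq
  coef []      _       = 0#
  coef (a ∷ p) zero    = a
  coef (a ∷ p) (suc i) = coef p i

  infix  4 _≈ᵖ_
  infixl 6 _+ᵖ_
  infixl 7 _*ᵖ_

  -- A record rather than the bare pointwise equation, so that `p` and `q` can be recovered from the
  -- type.
  record _≈ᵖ_ (p q : Pol) : Set where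
    constructor eq
    field at : coef p ≋ coef q
  open _≈ᵖ_ public

  _+ᵖ_ : Pol → Pol → Pol
  []      +ᵖ q       = q
  (a ∷ p) +ᵖ []      = a ∷ p
  (a ∷ p) +ᵖ (b ∷ q) = (a + b) ∷ (p +ᵖ q)

  -ᵖ_ : Pol → Pol
  -ᵖ p = map (-_) p

  _*ᵖ_ : Pol → Pol → Pol
  []      *ᵖ q = []
  (a ∷ p) *ᵖ q = map (a *_) q +ᵖ (0# ∷ (p *ᵖ q))

  coef-+ : ∀ p q → coef (p +ᵖ q) ≋ (λ i → coef p i + coef q i)
  coef-+ []      q       i       = ≈-sym (+-identityˡ _)
  coef-+ (a ∷ p) []      i       = ≈-sym (+-identityʳ _)
  coef-+ (a ∷ p) (b ∷ q) zero    = ≈-refl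
  coef-+ (a ∷ p) (b ∷ q) (suc i) = coef-+ p q i

  coef-- : ∀ p → coef (-ᵖ p) ≋ (λ i → - coef p i)
  coef-- []      i       = ≈-sym -0#≈0#
  coef-- (a ∷ p) zero    = ≈-refl
  coef-- (a ∷ p) (suc i) = coef-- p i

  coef-scale : ∀ c p → coef (map (c *_) p) ≋ (λ i → c * coef p i)
  coef-scale c []      i       = ≈-sym (zeroʳ c)
  coef-scale c (a ∷ p) zero    = ≈-refl
  coef-scale c (a ∷ p) (suc i) = coef-scale c p i

  coef-* : ∀ p q → coef (p *ᵖ q) ≋ conv (coef p) (coef q)
  coef-* []      q i       = ≈-sym (conv-zeroˡ (coef q) (λ _ → ≈-refl) i)
  coef-* (a ∷ p) q zero    = begin
    coef (map (a *_) q +ᵖ (0# ∷ (p *ᵖ q))) 0  ≈⟨ coef-+ (map (a *_) q) _ 0 ⟩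
    coef (map (a *_) q) 0 + 0#                ≈⟨ +-identityʳ _ ⟩
    coef (map (a *_) q) 0                     ≈⟨ coef-scale a q 0 ⟩
    a * coef q 0                              ∎
  coef-* (a ∷ p) q (suc i) = begin
    coef (map (a *_) q +ᵖ (0# ∷ (p *ᵖ q))) (suc i)  ≈⟨ coef-+ (map (a *_) q) _ (suc i) ⟩
    coef (map (a *_) q) (suc i) + coef (p *ᵖ q) i   ≈⟨ +-cong (coef-scale a q (suc i)) (coef-* p q i) ⟩
    a * coef q (suc i) + conv (coef p) (coef q) i   ∎

  *ᵖ-cong : ∀ {p p′ q q′} → p ≈ᵖ p′ → q ≈ᵖ q′ → (p *ᵖ q) ≈ᵖ (p′ *ᵖ q′)
  *ᵖ-cong {p} {p′} {q} {q′} p≈ q≈ .at i =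
    ≈-trans (coef-* p q i) (≈-trans (conv-cong (at p≈) (at q≈) i) (≈-sym (coef-* p′ q′ i)))

  *ᵖ-comm : ∀ p q → (p *ᵖ q) ≈ᵖ (q *ᵖ p)
  *ᵖ-comm p q .at i =
    ≈-trans (coef-* p q i) (≈-trans (conv-comm (coef p) (coef q) i) (≈-sym (coef-* q p i)))

  *ᵖ-assoc : ∀ p q r → ((p *ᵖ q) *ᵖ r) ≈ᵖ (p *ᵖ (q *ᵖ r))
  *ᵖ-assoc p q r .at i = begin
    coef ((p *ᵖ q) *ᵖ r) i                       ≈⟨ coef-* (p *ᵖ q) r i ⟩
    conv (coef (p *ᵖ q)) (coef r) i              ≈⟨ conv-cong (coef-* p q) (λ _ → ≈-refl) i ⟩
    conv (conv (coef p) (coef q)) (coef r) i     ≈⟨ conv-assoc (coef p) (coef q) (coef r) i ⟩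
    conv (coef p) (conv (coef q) (coef r)) i     ≈⟨ conv-cong (λ _ → ≈-refl) (coef-* q r) i ⟨
    conv (coef p) (coef (q *ᵖ r)) i              ≈⟨ coef-* p (q *ᵖ r) i ⟨
    coef (p *ᵖ (q *ᵖ r)) i                       ∎

  *ᵖ-distribʳ : ∀ r p q → ((p +ᵖ q) *ᵖ r) ≈ᵖ ((p *ᵖ r) +ᵖ (q *ᵖ r))
  *ᵖ-distribʳ r p q .at i = begin
    coef ((p +ᵖ q) *ᵖ r) i                                 ≈⟨ coef-* (p +ᵖ q) r i ⟩
    conv (coef (p +ᵖ q)) (coef r) i                        ≈⟨ conv-cong (coef-+ p q) (λ _ → ≈-refl) i ⟩
    conv (λ i → coef p i + coef q i) (coef r) i            ≈⟨ conv-+ˡ (coef p) (coef q) (coef r) i ⟩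
    conv (coef p) (coef r) i + conv (coef q) (coef r) i    ≈⟨ +-cong (coef-* p r i) (coef-* q r i) ⟨
    coef (p *ᵖ r) i + coef (q *ᵖ r) i                      ≈⟨ coef-+ (p *ᵖ r) (q *ᵖ r) i ⟨
    coef ((p *ᵖ r) +ᵖ (q *ᵖ r)) i                          ∎

  *ᵖ-identityˡ : ∀ p → ((1# ∷ []) *ᵖ p) ≈ᵖ p
  *ᵖ-identityˡ p .at zero    = ≈-trans (coef-* (1# ∷ []) p 0) (*-identityˡ _)
  *ᵖ-identityˡ p .at (suc i) = begin
    coef ((1# ∷ []) *ᵖ p) (suc i)                         ≈⟨ coef-* (1# ∷ []) p (suc i) ⟩
    1# * coef p (suc i) + conv (λ _ → 0#) (coef p) i      ≈⟨ +-cong (*-identityˡ _) (conv-zeroˡ (coef p) (λ _ → ≈-refl) i) ⟩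
    coef p (suc i) + 0#                                   ≈⟨ +-identityʳ _ ⟩
    coef p (suc i)                                        ∎

  private
    sequenceLaw : ∀ {p q f g} → coef p ≋ f → coef q ≋ g → f ≋ g → p ≈ᵖ q
    sequenceLaw p≋ q≋ f≋g .at i = ≈-trans (p≋ i) (≈-trans (f≋g i) (≈-sym (q≋ i)))

  +ᵖ-cong : ∀ {p p′ q q′} → p ≈ᵖ p′ → q ≈ᵖ q′ → (p +ᵖ q) ≈ᵖ (p′ +ᵖ q′)
  +ᵖ-cong {p} {p′} {q} {q′} p≈ q≈ = sequenceLaw (coef-+ p q) (coef-+ p′ q′) (λ i → +-cong (at p≈ i) (at q≈ i))

  +ᵖ-comm : ∀ p q → (p +ᵖ q) ≈ᵖ (q +ᵖ p)
  +ᵖ-comm p q = sequenceLaw (coef-+ p q) (coef-+ q p) (λ i → +-comm _ _)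

  ≈ᵖ-trans : ∀ {p q r} → p ≈ᵖ q → q ≈ᵖ r → p ≈ᵖ r
  ≈ᵖ-trans pq qr .at i = ≈-trans (at pq i) (at qr i)

  +ᵖ-assoc : ∀ p q r → ((p +ᵖ q) +ᵖ r) ≈ᵖ (p +ᵖ (q +ᵖ r))
  +ᵖ-assoc p q r = sequenceLaw
    (λ i → ≈-trans (coef-+ (p +ᵖ q) r i) (+-congʳ (coef-+ p q i)))
    (λ i → ≈-trans (coef-+ p (q +ᵖ r) i) (+-congˡ (coef-+ q r i)))
    (λ i → +-assoc _ _ _)

  -ᵖ-cong : ∀ {p q} → p ≈ᵖ q → (-ᵖ p) ≈ᵖ (-ᵖ q)
  -ᵖ-cong {p} {q} p≈ = sequenceLaw (coef-- p) (coef-- q) (λ i → -‿cong (at p≈ i))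

  -ᵖ-inverseˡ : ∀ p → ((-ᵖ p) +ᵖ p) ≈ᵖ []
  -ᵖ-inverseˡ p = sequenceLaw (λ i → ≈-trans (coef-+ (-ᵖ p) p i) (+-congʳ (coef-- p i))) (λ _ → ≈-refl) (λ i → -‿inverseˡ _)

  isCommutativeRingᵖ : IsCommutativeRing _≈ᵖ_ _+ᵖ_ _*ᵖ_ -ᵖ_ [] (1# ∷ [])
  isCommutativeRingᵖ = record
    { isRing = record
      { +-isAbelianGroup = record
        { isGroup = record
          { isMonoid = record
            { isSemigroup = record
              { isMagma = record
                { isEquivalence = record
                  { refl = eq (λ _ → ≈-refl) ; sym = λ e → eq (λ i → ≈-sym (at e i)) ; trans = ≈ᵖ-trans }
                ; ∙-cong = +ᵖ-cong }
              ; assoc = +ᵖ-assoc }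
            ; identity = (λ p → eq (λ _ → ≈-refl)) , (λ p → +ᵖ-comm p []) }
          ; inverse = -ᵖ-inverseˡ , (λ p → ≈ᵖ-trans (+ᵖ-comm p (-ᵖ p)) (-ᵖ-inverseˡ p))
          ; ⁻¹-cong = -ᵖ-cong }
        ; comm = +ᵖ-comm }
      ; *-cong = *ᵖ-cong
      ; *-assoc = *ᵖ-assoc
      ; *-identity = *ᵖ-identityˡ , (λ p → ≈ᵖ-trans (*ᵖ-comm p (1# ∷ [])) (*ᵖ-identityˡ p))
      ; distrib = (λ r p q → ≈ᵖ-trans (*ᵖ-comm r (p +ᵖ q)) (≈ᵖ-trans (*ᵖ-distribʳ r p q) (+ᵖ-cong (*ᵖ-comm p r) (*ᵖ-comm q r))))
                , *ᵖ-distribʳ }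
    ; *-comm = *ᵖ-comm }

  polRing : CommutativeRing 0ℓ 0ℓ
  polRing = record { isCommutativeRing = isCommutativeRingᵖ }

  _belowᵖ_ : Pol → ℕ → Set
  p belowᵖ m = Below m (coef p)

  belowᵖ-length : ∀ p → p belowᵖ length p
  belowᵖ-length []      i       le       = ≈-refl
  belowᵖ-length (a ∷ p) (suc i) (s≤s le) = belowᵖ-length p i le

  *ᵖ-top : ∀ a b p q → p belowᵖ suc a → q belowᵖ suc b → coef (p *ᵖ q) (a ℕ.+ b) ≈ coef p a * coef q b
  *ᵖ-top a b p q p< q< = ≈-trans (coef-* p q (a ℕ.+ b)) (conv-top a b p< q<)

  *ᵖ-below : ∀ a b p q → p belowᵖ suc a → q belowᵖ b → (p *ᵖ q) belowᵖ (a ℕ.+ b)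
  *ᵖ-below a b p q p< q< i le = ≈-trans (coef-* p q i) (conv-below a b p< q< i le)

  Monicᵖ : ℕ → Pol → Set
  Monicᵖ d p = coef p d ≈ 1# × (p belowᵖ suc d)

  -- The top coefficient of p reappears as that of gp, since g leads with 1; starting from the
  -- length of p, one coefficient after the other vanishes. Zero divisors in `K` do no harm, which
  -- matters for the rings obtained by adjoining roots.
  monic-cancel : ∀ d g p → Monicᵖ d g → (g *ᵖ p) ≈ᵖ [] → p ≈ᵖ []
  monic-cancel d g p (lead , g<) gp≈0 .at i = go (length p) (belowᵖ-length p) i z≤n
    where
    go : ∀ m → p belowᵖ m → p belowᵖ 0
    go zero    p< = p<
    go (suc m) p< = go m below
      where
      below : p belowᵖ m
      below i le with i ℕ.≟ m
      ... | no i≢m = p< i (ℕₚ.≤∧≢⇒< le (i≢m ∘ ≡.sym))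
      ... | yes refl = begin
        coef p m                  ≈⟨ *-identityˡ _ ⟨
        1# * coef p m             ≈⟨ *-congʳ lead ⟨
        coef g d * coef p m       ≈⟨ *ᵖ-top d m g p g< p< ⟨
        coef (g *ᵖ p) (d ℕ.+ m)   ≈⟨ at gp≈0 (d ℕ.+ m) ⟩
        0#                        ∎

  private module P = RingKit polRing

  monic-cancelˡ : ∀ d g p q → Monicᵖ d g → (g *ᵖ p) ≈ᵖ (g *ᵖ q) → p ≈ᵖ q
  monic-cancelˡ d g p q monic gp≈gq = P.x∙y⁻¹≈ε⇒x≈y p q (monic-cancel d g (p +ᵖ (-ᵖ q)) monic
    (P.≈-trans (P.distribˡ g p (-ᵖ q)) (P.≈-trans (P.+-cong gp≈gq (P.≈-sym (P.-‿distribʳ-* g q))) (P.-‿inverseʳ (g *ᵖ q)))))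

-- The polynomial of a starlike tree and its Bezoutian

module Star (R : CommutativeRing 0ℓ 0ℓ) where
  open RingKit R

  mutual
    -- The characteristic polynomial of a path (a Chebyshev polynomial of the second kind in x/2),
    -- taken at an element of an arbitrary ring: the same recursion gives the polynomial, its value
    -- at 2 and its values at algebraic numbers.
    path : Carrier → ℕ → Carrier
    path x zero    = 1#
    path x (suc l) = x * path x l + - path⁻ x l

    -- The characteristic polynomial of the path with one vertex less; 0 when there is no such path.
    path⁻ : Carrier → ℕ → Carrier
    path⁻ x zero    = 0#
    path⁻ x (suc l) = path x l

  paths : Carrier → List ℕ → Carrier
  paths x []       = 1#
  paths x (l ∷ ls) = path x l * paths x ls

  -- The edge from the centre to a branch is a bridge: the product for the graph without it is
  -- diminished by the product for the graph without its two ends.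
  star : Carrier → List ℕ → Carrier
  star x []       = x
  star x (l ∷ ls) = path x l * star x ls + - (path⁻ x l * paths x ls)

  -- The Christoffel-Darboux kernel of the path polynomials, which are orthogonal polynomials.
  christoffel : Carrier → Carrier → ℕ → Carrier
  christoffel x y zero    = 0#
  christoffel x y (suc l) = christoffel x y l + path x l * path y l

  -- This is q(x) q(y) (1 + Σ K/(p(x) p(y))), with p the polynomial and K the kernel of each branch.
  -- It arises from f/q = x - Σ p⁻/p, where by Christoffel-Darboux each branch adds (x - y) K/(p(x)
  -- p(y)) to the difference of the values at x and y.
  bezout : Carrier → Carrier → List ℕ → Carrier
  bezout x y []       = 1#
  bezout x y (l ∷ ls) = (path x l * path y l) * bezout x y ls + (paths x ls * paths y ls) * christoffel x y l

  christoffel-darboux : ∀ x y l → path x l * path⁻ y l + - (path⁻ x l * path y l) ≈ (x + - y) * christoffel x y l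
  christoffel-darboux x y zero    =
    solve 2 (λ x y → con (+ 1) :* con (+ 0) :+ (:- (con (+ 0) :* con (+ 1))) := (x :- y) :* con (+ 0)) ≈-refl x y
  christoffel-darboux x y (suc l) = begin
    (x * px + - px⁻) * py + - (px * (y * py + - py⁻))
      ≈⟨ solve 6 (λ x y px px⁻ py py⁻ → (x :* px :+ (:- px⁻)) :* py :+ (:- (px :* (y :* py :+ (:- py⁻))))
            := (px :* py⁻ :+ (:- (px⁻ :* py))) :+ (x :- y) :* (px :* py)) ≈-refl x y px px⁻ py py⁻ ⟩
    (px * py⁻ + - (px⁻ * py)) + (x + - y) * (px * py)   ≈⟨ +-congʳ (christoffel-darboux x y l) ⟩
    (x + - y) * christoffel x y l + (x + - y) * (px * py) ≈⟨ distribˡ _ _ _ ⟨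
    (x + - y) * christoffel x y (suc l) ∎
    where
    px  = path x l
    px⁻ = path⁻ x l
    py  = path y l
    py⁻ = path⁻ y l

  star-bezout : ∀ x y ls → star x ls * paths y ls + - (star y ls * paths x ls) ≈ (x + - y) * bezout x y ls
  star-bezout x y [] = solve 2 (λ x y → x :* con (+ 1) :+ (:- (y :* con (+ 1))) := (x :- y) :* con (+ 1)) ≈-refl x y
  star-bezout x y (l ∷ ls) = begin
    (px * fx + - (px⁻ * qx)) * (py * qy) + - ((py * fy + - (py⁻ * qy)) * (px * qx))
      ≈⟨ solve 8 (λ px px⁻ py py⁻ fx fy qx qy →
           (px :* fx :+ (:- (px⁻ :* qx))) :* (py :* qy) :+ (:- ((py :* fy :+ (:- (py⁻ :* qy))) :* (px :* qx)))
           := (px :* py) :* (fx :* qy :+ (:- (fy :* qx))) :+ (qx :* qy) :* (px :* py⁻ :+ (:- (px⁻ :* py))))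
           ≈-refl px px⁻ py py⁻ fx fy qx qy ⟩
    (px * py) * (fx * qy + - (fy * qx)) + (qx * qy) * (px * py⁻ + - (px⁻ * py))
      ≈⟨ +-cong (*-congˡ (star-bezout x y ls)) (*-congˡ (christoffel-darboux x y l)) ⟩
    (px * py) * ((x + - y) * bezout x y ls) + (qx * qy) * ((x + - y) * christoffel x y l)
      ≈⟨ solve 5 (λ p q d b c → p :* (d :* b) :+ q :* (d :* c) := d :* (p :* b :+ q :* c)) ≈-refl _ _ _ _ _ ⟩
    (x + - y) * bezout x y (l ∷ ls) ∎
    where
    px  = path x l
    px⁻ = path⁻ x l
    py  = path y l
    py⁻ = path⁻ y l
    fx  = star x ls
    fy  = star y ls
    qx  = paths x ls
    qy  = paths y ls

  mutual
    path-cong : ∀ {x y} l → x ≈ y → path x l ≈ path y l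
    path-cong zero    e = ≈-refl
    path-cong (suc l) e = +-cong (*-cong e (path-cong l e)) (-‿cong (path⁻-cong l e))

    path⁻-cong : ∀ {x y} l → x ≈ y → path⁻ x l ≈ path⁻ y l
    path⁻-cong zero    e = ≈-refl
    path⁻-cong (suc l) e = path-cong l e

  paths-cong : ∀ {x y} ls → x ≈ y → paths x ls ≈ paths y ls
  paths-cong []       e = ≈-refl
  paths-cong (l ∷ ls) e = *-cong (path-cong l e) (paths-cong ls e)

  star-cong : ∀ {x y} ls → x ≈ y → star x ls ≈ star y ls
  star-cong []       e = e
  star-cong (l ∷ ls) e =
    +-cong (*-cong (path-cong l e) (star-cong ls e)) (-‿cong (*-cong (path⁻-cong l e) (paths-cong ls e)))

  Sign : Carrier → Set
  Sign s = s ≈ 1# ⊎ s ≈ - 1#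

  sign-neg : ∀ {s} → Sign s → Sign (- s)
  sign-neg (inj₁ e) = inj₂ (-‿cong e)
  sign-neg (inj₂ e) = inj₁ (≈-trans (-‿cong e) (-‿involutive _))

  sign-* : ∀ {s t} → Sign s → Sign t → Sign (s * t)
  sign-* (inj₁ e) (inj₁ f) = inj₁ (≈-trans (*-cong e f) (*-identityˡ _))
  sign-* (inj₁ e) (inj₂ f) = inj₂ (≈-trans (*-cong e f) (*-identityˡ _))
  sign-* (inj₂ e) (inj₁ f) = inj₂ (≈-trans (*-cong e f) (*-identityʳ _))
  sign-* (inj₂ e) (inj₂ f) = inj₁ (≈-trans (*-cong e f) (solve 0 ((:- con (+ 1)) :* (:- con (+ 1)) := con (+ 1)) ≈-refl))

  -- The sign is (-1)^l. Carrying it as an element with s = ±1 avoids powers and splits on parity;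
  -- the path with one vertex less has the opposite sign.
  path-parity : ∀ x l → ∃ λ s → Sign s × path (- x) l ≈ s * path x l × path⁻ (- x) l ≈ (- s) * path⁻ x l
  path-parity x zero    = 1# , inj₁ ≈-refl , ≈-sym (*-identityˡ _) , ≈-sym (zeroʳ _)
  path-parity x (suc l) with path-parity x l
  ... | s , sgn , e , e⁻ = - s , sign-neg sgn
      , (begin
          - x * path (- x) l + - path⁻ (- x) l       ≈⟨ +-cong (*-congˡ e) (-‿cong e⁻) ⟩
          - x * (s * path x l) + - (- s * path⁻ x l)
            ≈⟨ solve 4 (λ x s p q → (:- x) :* (s :* p) :+ (:- ((:- s) :* q)) := (:- s) :* (x :* p :+ (:- q))) ≈-refl x s _ _ ⟩
          - s * path x (suc l)                       ∎)
      , ≈-trans e (*-congʳ (≈-sym (-‿involutive s)))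

  star-parity : ∀ x ls → ∃ λ s → Sign s × star (- x) ls ≈ s * star x ls × paths (- x) ls ≈ (- s) * paths x ls
  star-parity x []       = - 1# , inj₂ ≈-refl
    , solve 1 (λ x → (:- x) := (:- con (+ 1)) :* x) ≈-refl x
    , solve 0 (con (+ 1) := (:- (:- con (+ 1))) :* con (+ 1)) ≈-refl
  star-parity x (l ∷ ls) with path-parity x l | star-parity x ls
  ... | s , sgn , e , e⁻ | t , tgn , f , g = s * t , sign-* sgn tgn
    , (begin
        path (- x) l * star (- x) ls + - (path⁻ (- x) l * paths (- x) ls)
          ≈⟨ +-cong (*-cong e f) (-‿cong (*-cong e⁻ g)) ⟩
        (s * path x l) * (t * star x ls) + - ((- s * path⁻ x l) * (- t * paths x ls))
          ≈⟨ solve 6 (λ s t p f p⁻ q → (s :* p) :* (t :* f) :+ (:- (((:- s) :* p⁻) :* ((:- t) :* q)))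
                        := (s :* t) :* (p :* f :+ (:- (p⁻ :* q)))) ≈-refl s t _ _ _ _ ⟩
        (s * t) * star x (l ∷ ls) ∎)
    , (begin
        path (- x) l * paths (- x) ls         ≈⟨ *-cong e g ⟩
        (s * path x l) * (- t * paths x ls)
          ≈⟨ solve 4 (λ s t p q → (s :* p) :* ((:- t) :* q) := (:- (s :* t)) :* (p :* q)) ≈-refl s t _ _ ⟩
        - (s * t) * paths x (l ∷ ls)          ∎)

-- Ring homomorphisms and evaluation

record Hom (R S : CommutativeRing 0ℓ 0ℓ) : Set where
  private
    module R = CommutativeRing R
    module S = RingKit S
  field
    ⟦_⟧    : R.Carrier → S.Carrier
    ⟦⟧-cong : ∀ {x y} → x R.≈ y → ⟦ x ⟧ S.≈ ⟦ y ⟧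
    +-homo : ∀ x y → ⟦ x R.+ y ⟧ S.≈ ⟦ x ⟧ S.+ ⟦ y ⟧
    *-homo : ∀ x y → ⟦ x R.* y ⟧ S.≈ ⟦ x ⟧ S.* ⟦ y ⟧
    1-homo : ⟦ R.1# ⟧ S.≈ S.1#

  0-homo : ⟦ R.0# ⟧ S.≈ S.0#
  0-homo = begin
    z                     ≈⟨ S.solve 1 (λ a → a S.:= (a S.:+ a) S.:- a) S.≈-refl z ⟩
    (z S.+ z) S.+ S.- z   ≈⟨ S.+-congʳ (+-homo _ _) ⟨
    ⟦ R.0# R.+ R.0# ⟧ S.+ S.- z   ≈⟨ S.+-congʳ (⟦⟧-cong (R.+-identityˡ _)) ⟩
    z S.+ S.- z           ≈⟨ S.-‿inverseʳ z ⟩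
    S.0#                  ∎
    where
    open S using (begin_; step-≈-⟩; step-≈-⟨; _∎)
    z = ⟦ R.0# ⟧

  neg-homo : ∀ x → ⟦ R.- x ⟧ S.≈ S.- ⟦ x ⟧
  neg-homo x = begin
    n                                 ≈⟨ S.solve 2 (λ n a → n S.:= (n S.:+ a) S.:- a) S.≈-refl n ⟦ x ⟧ ⟩
    (n S.+ ⟦ x ⟧) S.+ S.- ⟦ x ⟧       ≈⟨ S.+-congʳ (+-homo _ _) ⟨
    ⟦ R.- x R.+ x ⟧ S.+ S.- ⟦ x ⟧     ≈⟨ S.+-congʳ (⟦⟧-cong (R.-‿inverseˡ x)) ⟩
    ⟦ R.0# ⟧ S.+ S.- ⟦ x ⟧            ≈⟨ S.+-congʳ 0-homo ⟩
    S.0# S.+ S.- ⟦ x ⟧                ≈⟨ S.+-identityˡ _ ⟩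
    S.- ⟦ x ⟧                         ∎
    where
    open S using (begin_; step-≈-⟩; step-≈-⟨; _∎)
    n = ⟦ R.- x ⟧

  fromℕ-homo : ∀ n → ⟦ RingKit.fromℕ R n ⟧ S.≈ S.fromℕ n
  fromℕ-homo zero    = 0-homo
  fromℕ-homo (suc n) = S.≈-trans (⟦⟧-cong (RingKit.fromℕ-suc R n))
    (S.≈-trans (+-homo _ _) (S.≈-trans (S.+-cong 1-homo (fromℕ-homo n)) (S.≈-sym (S.fromℕ-suc n))))

  fromℤ-homo : ∀ z → ⟦ RingKit.fromℤ R z ⟧ S.≈ S.fromℤ z
  fromℤ-homo (+ n)    = fromℕ-homo n
  fromℤ-homo -[1+ n ] = S.≈-trans (neg-homo _) (S.-‿cong (fromℕ-homo (suc n)))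

  private
    module RS = Star R
    module SS = Star S

  mutual
    path-homo : ∀ x l → ⟦ RS.path x l ⟧ S.≈ SS.path ⟦ x ⟧ l
    path-homo x zero    = 1-homo
    path-homo x (suc l) = S.≈-trans (+-homo _ _) (S.+-cong
      (S.≈-trans (*-homo _ _) (S.*-congˡ (path-homo x l)))
      (S.≈-trans (neg-homo _) (S.-‿cong (path⁻-homo x l))))

    path⁻-homo : ∀ x l → ⟦ RS.path⁻ x l ⟧ S.≈ SS.path⁻ ⟦ x ⟧ l
    path⁻-homo x zero    = 0-homo
    path⁻-homo x (suc l) = path-homo x l

  paths-homo : ∀ x ls → ⟦ RS.paths x ls ⟧ S.≈ SS.paths ⟦ x ⟧ ls
  paths-homo x []       = 1-homo
  paths-homo x (l ∷ ls) = S.≈-trans (*-homo _ _) (S.*-cong (path-homo x l) (paths-homo x ls))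

  star-homo : ∀ x ls → ⟦ RS.star x ls ⟧ S.≈ SS.star ⟦ x ⟧ ls
  star-homo x []       = S.≈-refl
  star-homo x (l ∷ ls) = S.≈-trans (+-homo _ _) (S.+-cong
      (S.≈-trans (*-homo _ _) (S.*-cong (path-homo x l) (star-homo x ls)))
      (S.≈-trans (neg-homo _) (S.-‿cong (S.≈-trans (*-homo _ _) (S.*-cong (path⁻-homo x l) (paths-homo x ls))))))

  christoffel-homo : ∀ x y l → ⟦ RS.christoffel x y l ⟧ S.≈ SS.christoffel ⟦ x ⟧ ⟦ y ⟧ l
  christoffel-homo x y zero    = 0-homo
  christoffel-homo x y (suc l) = S.≈-trans (+-homo _ _) (S.+-cong (christoffel-homo x y l)
    (S.≈-trans (*-homo _ _) (S.*-cong (path-homo x l) (path-homo y l))))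

  bezout-homo : ∀ x y ls → ⟦ RS.bezout x y ls ⟧ S.≈ SS.bezout ⟦ x ⟧ ⟦ y ⟧ ls
  bezout-homo x y []       = 1-homo
  bezout-homo x y (l ∷ ls) = S.≈-trans (+-homo _ _) (S.+-cong
    (S.≈-trans (*-homo _ _) (S.*-cong (S.≈-trans (*-homo _ _) (S.*-cong (path-homo x l) (path-homo y l))) (bezout-homo x y ls)))
    (S.≈-trans (*-homo _ _) (S.*-cong (S.≈-trans (*-homo _ _) (S.*-cong (paths-homo x ls) (paths-homo y ls))) (christoffel-homo x y l))))

ℤRing : CommutativeRing 0ℓ 0ℓ
ℤRing = ℤₚ.+-*-commutativeRing

module ℤ[x] = Polynomials ℤRing

module PolynomialHoms (K : CommutativeRing 0ℓ 0ℓ) where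
  open RingKit K
  open Polynomials K

  constant : Hom K polRing
  constant = record
    { ⟦_⟧ = λ c → c ∷ []
    ; ⟦⟧-cong = λ e → eq λ { zero → e ; (suc i) → ≈-refl }
    ; +-homo = λ x y → eq λ { zero → ≈-refl ; (suc i) → ≈-refl }
    ; *-homo = λ x y → eq λ { zero → ≈-sym (+-identityʳ _) ; (suc i) → ≈-refl }
    ; 1-homo = eq λ _ → ≈-refl }

  constantTerm : Hom polRing K
  constantTerm = record
    { ⟦_⟧ = λ p → coef p 0
    ; ⟦⟧-cong = λ e → at e 0
    ; +-homo = λ p q → coef-+ p q 0
    ; *-homo = λ p q → coef-* p q 0
    ; 1-homo = ≈-refl }

module Evaluation (S : CommutativeRing 0ℓ 0ℓ) where
  open RingKit S
  open ℤ[x] using (Pol; coef; at; _+ᵖ_; _*ᵖ_; polRing)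

  module _ (x : Carrier) where
    eval : Pol → Carrier
    eval []      = 0#
    eval (a ∷ p) = fromℤ a + x * eval p

    eval-zero : ∀ p → (∀ i → coef p i ≡ + 0) → eval p ≈ 0#
    eval-zero []      e = ≈-refl
    eval-zero (a ∷ p) e = begin
      fromℤ a + x * eval p    ≈⟨ +-cong (≈-reflexive (cong fromℤ (e 0))) (*-congˡ (eval-zero p (e ∘ suc))) ⟩
      0# + x * 0#             ≈⟨ solve 1 (λ x → con (+ 0) :+ x :* con (+ 0) := con (+ 0)) ≈-refl x ⟩
      0#                      ∎

    eval-coef : ∀ p q → (∀ i → coef p i ≡ coef q i) → eval p ≈ eval q
    eval-coef []      q       e = ≈-sym (eval-zero q (λ i → ≡.sym (e i)))
    eval-coef (a ∷ p) []      e = eval-zero (a ∷ p) e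
    eval-coef (a ∷ p) (b ∷ q) e = +-cong (≈-reflexive (cong fromℤ (e 0))) (*-congˡ (eval-coef p q (e ∘ suc)))

    eval-+ : ∀ p q → eval (p +ᵖ q) ≈ eval p + eval q
    eval-+ []      q       = ≈-sym (+-identityˡ _)
    eval-+ (a ∷ p) []      = ≈-sym (+-identityʳ _)
    eval-+ (a ∷ p) (b ∷ q) = begin
      fromℤ (a ℤ.+ b) + x * eval (p +ᵖ q)                 ≈⟨ +-cong (fromℤ-+ a b) (*-congˡ (eval-+ p q)) ⟩
      (fromℤ a + fromℤ b) + x * (eval p + eval q)         ≈⟨ solve 5 (λ a b x p q → (a :+ b) :+ x :* (p :+ q) := (a :+ x :* p) :+ (b :+ x :* q)) ≈-refl _ _ _ _ _ ⟩
      (fromℤ a + x * eval p) + (fromℤ b + x * eval q)     ∎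

    eval-scale : ∀ c p → eval (map (c ℤ.*_) p) ≈ fromℤ c * eval p
    eval-scale c []      = ≈-sym (zeroʳ _)
    eval-scale c (a ∷ p) = begin
      fromℤ (c ℤ.* a) + x * eval (map (c ℤ.*_) p)   ≈⟨ +-cong (fromℤ-* c a) (*-congˡ (eval-scale c p)) ⟩
      fromℤ c * fromℤ a + x * (fromℤ c * eval p)    ≈⟨ solve 4 (λ c a x p → c :* a :+ x :* (c :* p) := c :* (a :+ x :* p)) ≈-refl _ _ _ _ ⟩
      fromℤ c * (fromℤ a + x * eval p)              ∎

    eval-* : ∀ p q → eval (p *ᵖ q) ≈ eval p * eval q
    eval-* []      q = ≈-sym (zeroˡ _)
    eval-* (a ∷ p) q = begin
      eval (map (a ℤ.*_) q +ᵖ (+ 0 ∷ (p *ᵖ q)))         ≈⟨ eval-+ (map (a ℤ.*_) q) _ ⟩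
      eval (map (a ℤ.*_) q) + (0# + x * eval (p *ᵖ q))  ≈⟨ +-cong (eval-scale a q) (+-congˡ (*-congˡ (eval-* p q))) ⟩
      fromℤ a * eval q + (0# + x * (eval p * eval q))   ≈⟨ solve 4 (λ a x p q → a :* q :+ (con (+ 0) :+ x :* (p :* q)) := (a :+ x :* p) :* q) ≈-refl _ _ _ _ ⟩
      (fromℤ a + x * eval p) * eval q                   ∎

    evaluate : Hom polRing S
    evaluate = record
      { ⟦_⟧ = eval
      ; ⟦⟧-cong = λ {p} {q} e → eval-coef p q (at e)
      ; +-homo = eval-+
      ; *-homo = eval-*
      ; 1-homo = solve 1 (λ x → con (+ 1) :+ x :* con (+ 0) := con (+ 1)) ≈-refl x }

    eval-X : eval (+ 0 ∷ + 1 ∷ []) ≈ x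
    eval-X = solve 1 (λ x → con (+ 0) :+ x :* (con (+ 1) :+ x :* con (+ 0)) := x) ≈-refl x

X₁ : ℤ[x].Pol
X₁ = + 0 ∷ + 1 ∷ []

-- Ordered quadratic extensions

module QuadraticExtension (K : CommutativeRing 0ℓ 0ℓ) (t n : CommutativeRing.Carrier K) where
  open RingKit K

  -- p +ω q stands for p + qω, where ω² = tω + n.
  infix 5 _+ω_
  record Ext : Set where
    -- Without eta the operations reduce only on explicit pairs, so that terms over towers of
    -- extensions stay folded; `re-*` and `im-*` give the components.
    no-eta-equality
    pattern
    constructor _+ω_
    field
      re im : Carrier
  open Ext public

  infix 4 _≈ᵉ_
  record _≈ᵉ_ (z w : Ext) : Set where
    constructor _&_
    field
      re≈ : re z ≈ re w
      im≈ : im z ≈ im w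
  open _≈ᵉ_ public

  _+ᵉ_ _*ᵉ_ : Ext → Ext → Ext
  (p +ω q) +ᵉ (p′ +ω q′) = p + p′ +ω q + q′
  (p +ω q) *ᵉ (p′ +ω q′) = p * p′ + n * (q * q′) +ω (p * q′ + q * p′) + t * (q * q′)

  -ᵉ_ : Ext → Ext
  -ᵉ (p +ω q) = - p +ω - q

  ω : Ext
  ω = 0# +ω 1#

  ≈ᵉ-refl : ∀ {z} → z ≈ᵉ z
  ≈ᵉ-refl = ≈-refl & ≈-refl

  *ᵉ-assoc : ∀ x y z → ((x *ᵉ y) *ᵉ z) ≈ᵉ (x *ᵉ (y *ᵉ z))
  *ᵉ-assoc (p +ω q) (p′ +ω q′) (p″ +ω q″) =
    solve 8 (λ t n p q p′ q′ p″ q″ →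
      (p :* p′ :+ n :* (q :* q′)) :* p″ :+ n :* (((p :* q′ :+ q :* p′) :+ t :* (q :* q′)) :* q″)
      := p :* (p′ :* p″ :+ n :* (q′ :* q″)) :+ n :* (q :* ((p′ :* q″ :+ q′ :* p″) :+ t :* (q′ :* q″))))
      ≈-refl t n p q p′ q′ p″ q″
    & solve 8 (λ t n p q p′ q′ p″ q″ →
      ((p :* p′ :+ n :* (q :* q′)) :* q″ :+ ((p :* q′ :+ q :* p′) :+ t :* (q :* q′)) :* p″)
        :+ t :* (((p :* q′ :+ q :* p′) :+ t :* (q :* q′)) :* q″)
      := (p :* ((p′ :* q″ :+ q′ :* p″) :+ t :* (q′ :* q″)) :+ q :* (p′ :* p″ :+ n :* (q′ :* q″)))
        :+ t :* (q :* ((p′ :* q″ :+ q′ :* p″) :+ t :* (q′ :* q″))))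
      ≈-refl t n p q p′ q′ p″ q″

  *ᵉ-comm : ∀ x y → (x *ᵉ y) ≈ᵉ (y *ᵉ x)
  *ᵉ-comm (p +ω q) (p′ +ω q′) =
    solve 5 (λ n p q p′ q′ → p :* p′ :+ n :* (q :* q′) := p′ :* p :+ n :* (q′ :* q)) ≈-refl n p q p′ q′
    & solve 5 (λ t p q p′ q′ → (p :* q′ :+ q :* p′) :+ t :* (q :* q′) := (p′ :* q :+ q′ :* p) :+ t :* (q′ :* q)) ≈-refl t p q p′ q′

  *ᵉ-identityˡ : ∀ x → ((1# +ω 0#) *ᵉ x) ≈ᵉ x
  *ᵉ-identityˡ (p +ω q) =
    solve 3 (λ n p q → con (+ 1) :* p :+ n :* (con (+ 0) :* q) := p) ≈-refl n p q
    & solve 3 (λ t p q → (con (+ 1) :* q :+ con (+ 0) :* p) :+ t :* (con (+ 0) :* q) := q) ≈-refl t p q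

  *ᵉ-identityʳ : ∀ x → (x *ᵉ (1# +ω 0#)) ≈ᵉ x
  *ᵉ-identityʳ (p +ω q) =
    solve 3 (λ n p q → p :* con (+ 1) :+ n :* (q :* con (+ 0)) := p) ≈-refl n p q
    & solve 3 (λ t p q → (p :* con (+ 0) :+ q :* con (+ 1)) :+ t :* (q :* con (+ 0)) := q) ≈-refl t p q

  *ᵉ-distribˡ : ∀ x y z → (x *ᵉ (y +ᵉ z)) ≈ᵉ ((x *ᵉ y) +ᵉ (x *ᵉ z))
  *ᵉ-distribˡ (p +ω q) (p′ +ω q′) (p″ +ω q″) =
    solve 7 (λ n p q p′ q′ p″ q″ → p :* (p′ :+ p″) :+ n :* (q :* (q′ :+ q″))
      := (p :* p′ :+ n :* (q :* q′)) :+ (p :* p″ :+ n :* (q :* q″))) ≈-refl n p q p′ q′ p″ q″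
    & solve 7 (λ t p q p′ q′ p″ q″ → (p :* (q′ :+ q″) :+ q :* (p′ :+ p″)) :+ t :* (q :* (q′ :+ q″))
      := ((p :* q′ :+ q :* p′) :+ t :* (q :* q′)) :+ ((p :* q″ :+ q :* p″) :+ t :* (q :* q″))) ≈-refl t p q p′ q′ p″ q″

  *ᵉ-distribʳ : ∀ x y z → ((y +ᵉ z) *ᵉ x) ≈ᵉ ((y *ᵉ x) +ᵉ (z *ᵉ x))
  *ᵉ-distribʳ (p +ω q) (p′ +ω q′) (p″ +ω q″) =
    solve 7 (λ n p q p′ q′ p″ q″ → (p′ :+ p″) :* p :+ n :* ((q′ :+ q″) :* q)
      := (p′ :* p :+ n :* (q′ :* q)) :+ (p″ :* p :+ n :* (q″ :* q))) ≈-refl n p q p′ q′ p″ q″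
    & solve 7 (λ t p q p′ q′ p″ q″ → ((p′ :+ p″) :* q :+ (q′ :+ q″) :* p) :+ t :* ((q′ :+ q″) :* q)
      := ((p′ :* q :+ q′ :* p) :+ t :* (q′ :* q)) :+ ((p″ :* q :+ q″ :* p) :+ t :* (q″ :* q))) ≈-refl t p q p′ q′ p″ q″

  isCommutativeRingᵉ : IsCommutativeRing _≈ᵉ_ _+ᵉ_ _*ᵉ_ -ᵉ_ (0# +ω 0#) (1# +ω 0#)
  isCommutativeRingᵉ = record
    { isRing = record
      { +-isAbelianGroup = record
        { isGroup = record
          { isMonoid = record
            { isSemigroup = record
              { isMagma = record
                { isEquivalence = record
                  { refl = ≈ᵉ-refl
                  ; sym = λ (e & f) → ≈-sym e & ≈-sym f
                  ; trans = λ (e & f) (e′ & f′) → ≈-trans e e′ & ≈-trans f f′ }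
                ; ∙-cong = λ { {_ +ω _} {_ +ω _} {_ +ω _} {_ +ω _} (e & f) (e′ & f′) → +-cong e e′ & +-cong f f′ } }
              ; assoc = λ { (_ +ω _) (_ +ω _) (_ +ω _) → +-assoc _ _ _ & +-assoc _ _ _ } }
            ; identity = (λ { (_ +ω _) → +-identityˡ _ & +-identityˡ _ }) , (λ { (_ +ω _) → +-identityʳ _ & +-identityʳ _ }) }
          ; inverse = (λ { (_ +ω _) → -‿inverseˡ _ & -‿inverseˡ _ }) , (λ { (_ +ω _) → -‿inverseʳ _ & -‿inverseʳ _ })
          ; ⁻¹-cong = λ { {_ +ω _} {_ +ω _} (e & f) → -‿cong e & -‿cong f } }
        ; comm = λ { (_ +ω _) (_ +ω _) → +-comm _ _ & +-comm _ _ } }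
      ; *-cong = λ { {_ +ω _} {_ +ω _} {_ +ω _} {_ +ω _} (e & f) (e′ & f′) →
          +-cong (*-cong e e′) (*-congˡ (*-cong f f′))
          & +-cong (+-cong (*-cong e f′) (*-cong f e′)) (*-congˡ (*-cong f f′)) }
      ; *-assoc = *ᵉ-assoc
      ; *-identity = *ᵉ-identityˡ , *ᵉ-identityʳ
      ; distrib = *ᵉ-distribˡ , *ᵉ-distribʳ }
    ; *-comm = *ᵉ-comm }

  re-* : ∀ z w → re (z *ᵉ w) ≡ re z * re w + n * (im z * im w)
  re-* (p +ω q) (p′ +ω q′) = refl

  im-* : ∀ z w → im (z *ᵉ w) ≡ (re z * im w + im z * re w) + t * (im z * im w)
  im-* (p +ω q) (p′ +ω q′) = refl

  extRing : CommutativeRing 0ℓ 0ℓ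
  extRing = record { isCommutativeRing = isCommutativeRingᵉ }

  embed : Hom K extRing
  embed = record
    { ⟦_⟧ = λ p → p +ω 0#
    ; ⟦⟧-cong = λ e → e & ≈-refl
    ; +-homo = λ x y → ≈-refl & ≈-sym (+-identityˡ _)
    ; *-homo = λ x y → solve 3 (λ n x y → x :* y := x :* y :+ n :* (con (+ 0) :* con (+ 0))) ≈-refl n x y
        & solve 3 (λ t x y → con (+ 0) := (x :* con (+ 0) :+ con (+ 0) :* y) :+ t :* (con (+ 0) :* con (+ 0))) ≈-refl t x y
    ; 1-homo = ≈-refl & ≈-refl }

-- A preordering without subtraction: all that the positivity argument needs from an order.
record Cone (K : CommutativeRing 0ℓ 0ℓ) : Set₁ where
  open CommutativeRing K
  field
    Nonneg      : Carrier → Set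
    nonneg-resp : ∀ {x y} → x ≈ y → Nonneg x → Nonneg y
    nonneg-0    : Nonneg 0#
    nonneg-1    : Nonneg 1#
    nonneg-+    : ∀ {x y} → Nonneg x → Nonneg y → Nonneg (x + y)
    nonneg-*    : ∀ {x y} → Nonneg x → Nonneg y → Nonneg (x * y)
    -1-negative : ¬ Nonneg (- 1#)

module ConeStar (K : CommutativeRing 0ℓ 0ℓ) (cone : Cone K) where
  open RingKit K
  open Cone cone public
  open Star K

  -- Being at least 1 stands for strict positivity: it passes to products, and `-1-negative` alone
  -- makes such an element nonzero. A cone offers neither antisymmetry nor a decision, so strictness
  -- has to be witnessed.
  Positive : Carrier → Set
  Positive z = ∃ λ r → Nonneg r × z ≈ 1# + r

  positive⇒nonneg : ∀ {z} → Positive z → Nonneg z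
  positive⇒nonneg (r , r≥0 , e) = nonneg-resp (≈-sym e) (nonneg-+ nonneg-1 r≥0)

  positive-1 : Positive 1#
  positive-1 = 0# , nonneg-0 , ≈-sym (+-identityʳ _)

  positive-+ : ∀ {z w} → Positive z → Nonneg w → Positive (z + w)
  positive-+ (r , r≥0 , e) w≥0 = _ , nonneg-+ r≥0 w≥0 , ≈-trans (+-congʳ e) (+-assoc _ _ _)

  positive-* : ∀ {z w} → Positive z → Positive w → Positive (z * w)
  positive-* {z} {w} (r , r≥0 , e) (s , s≥0 , f) = r + (1# + r) * s , nonneg-+ r≥0 (nonneg-* (nonneg-+ nonneg-1 r≥0) s≥0)
    , ≈-trans (*-cong e f) (solve 2 (λ r s → (con (+ 1) :+ r) :* (con (+ 1) :+ s) := con (+ 1) :+ (r :+ (con (+ 1) :+ r) :* s)) ≈-refl r s)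

  positive-resp : ∀ {z w} → z ≈ w → Positive z → Positive w
  positive-resp e (r , r≥0 , f) = r , r≥0 , ≈-trans (≈-sym e) f

  positive≉0 : ∀ {z} → Positive z → ¬ (z ≈ 0#)
  positive≉0 {z} (r , r≥0 , e) z≈0 = -1-negative (nonneg-resp (begin
    r               ≈⟨ solve 1 (λ r → r := (con (+ 1) :+ r) :- con (+ 1)) ≈-refl r ⟩
    (1# + r) + - 1# ≈⟨ +-congʳ e ⟨
    z + - 1#        ≈⟨ +-congʳ z≈0 ⟩
    0# + - 1#       ≈⟨ +-identityˡ _ ⟩
    - 1#            ∎) r≥0)

  module AboveTwo {x a : Carrier} (a≥0 : Nonneg a) (x≈2+a : x ≈ fromℤ (+ 2) + a) where
    -- For x = 2 + a the recursion reads p(l+1) - p(l) = a p(l) + (p(l) - p(l-1)), so the increments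
    -- stay nonnegative and the values stay at least 1.
    path-grows : ∀ l → Positive (path x l) × ∃ λ d → Nonneg d × path x l ≈ path⁻ x l + d
    path-grows zero    = positive-1 , 1# , nonneg-1 , ≈-sym (+-identityˡ _)
    path-grows (suc l) with path-grows l
    ... | pos , d , d≥0 , e = positive-resp (≈-sym step) (positive-+ pos step≥0) , _ , step≥0 , step
      where
      step≥0 : Nonneg (a * path x l + d)
      step≥0 = nonneg-+ (nonneg-* a≥0 (positive⇒nonneg pos)) d≥0
      step : path x (suc l) ≈ path x l + (a * path x l + d)
      step = begin
        x * path x l + - path⁻ x l   ≈⟨ +-congʳ (*-congʳ x≈2+a) ⟩
        (fromℤ (+ 2) + a) * path x l + - path⁻ x l
          ≈⟨ solve 3 (λ a p q → (con (+ 2) :+ a) :* p :+ (:- q) := (p :+ a :* p) :+ (p :- q)) ≈-refl a (path x l) (path⁻ x l) ⟩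
        (path x l + a * path x l) + (path x l + - path⁻ x l)   ≈⟨ +-congˡ (+-congʳ e) ⟩
        (path x l + a * path x l) + ((path⁻ x l + d) + - path⁻ x l)
          ≈⟨ solve 4 (λ a p q d → (p :+ a :* p) :+ ((q :+ d) :- q) := p :+ (a :* p :+ d)) ≈-refl a (path x l) (path⁻ x l) d ⟩
        path x l + (a * path x l + d) ∎

    path-positive : ∀ l → Positive (path x l)
    path-positive l = proj₁ (path-grows l)

    paths-positive : ∀ ls → Positive (paths x ls)
    paths-positive []       = positive-1
    paths-positive (l ∷ ls) = positive-* (path-positive l) (paths-positive ls)

  module TwoPoints {x y a b : Carrier} (a≥0 : Nonneg a) (x≈ : x ≈ fromℤ (+ 2) + a)
                   (b≥0 : Nonneg b) (y≈ : y ≈ fromℤ (+ 2) + b) where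
    module X = AboveTwo a≥0 x≈
    module Y = AboveTwo b≥0 y≈

    christoffel-nonneg : ∀ l → Nonneg (christoffel x y l)
    christoffel-nonneg zero    = nonneg-0
    christoffel-nonneg (suc l) = nonneg-+ (christoffel-nonneg l)
      (nonneg-* (positive⇒nonneg (X.path-positive l)) (positive⇒nonneg (Y.path-positive l)))

    bezout-positive : ∀ ls → Positive (bezout x y ls)
    bezout-positive []       = positive-1
    bezout-positive (l ∷ ls) = positive-+
      (positive-* (positive-* (X.path-positive l) (Y.path-positive l)) (bezout-positive ls))
      (nonneg-* (nonneg-* (positive⇒nonneg (X.paths-positive ls)) (positive⇒nonneg (Y.paths-positive ls))) (christoffel-nonneg l))

  open Polynomials K using (Pol; polRing; monic-cancelˡ)
  open PolynomialHoms K
  private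
    module P = RingKit polRing
    module PS = Star polRing
    open Hom constant using () renaming (⟦_⟧ to C₁)

  -- The star polynomial has at most one root ≥ 2, counted with multiplicity:
  -- dividing star-bezout at (x , α) by x - α leaves the positive value bezout β α at x = β.
  no-two-roots : ∀ ls {α β a b} → Nonneg a → α ≈ fromℤ (+ 2) + a → Nonneg b → β ≈ fromℤ (+ 2) + b →
    star α ls ≈ 0# → ∀ k →
    let x = β ∷ 1# ∷ [] in ¬ (PS.star x ls P.≈ ((x P.+ P.- C₁ α) P.* (x P.+ P.- C₁ β)) P.* k)
  no-two-roots ls {α} {β} a≥0 α≈ b≥0 β≈ fα≈0 k fx≈ =
    positive≉0 (TwoPoints.bezout-positive b≥0 β≈ a≥0 α≈ ls) (begin
      bezout β α ls                    ≈⟨ bezout-homo x y ls ⟨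
      ⟦ PS.bezout x y ls ⟧             ≈⟨ ⟦⟧-cong quotients ⟩
      ⟦ (x P.+ P.- C₁ β) P.* (k P.* PS.paths y ls) ⟧   ≈⟨ *-homo (x P.+ P.- C₁ β) (k P.* PS.paths y ls) ⟩
      (β + - β) * ⟦ k P.* PS.paths y ls ⟧   ≈⟨ *-congʳ (-‿inverseʳ β) ⟩
      0# * ⟦ k P.* PS.paths y ls ⟧     ≈⟨ zeroˡ _ ⟩
      0#                               ∎)
    where
    open Hom constantTerm
    -- The variable is written as β + X: evaluation at β becomes the constant term, and x - β has
    -- constant term 0.
    x y : Pol
    x = β ∷ 1# ∷ []
    y = C₁ α
    fy≈0 : PS.star y ls P.≈ P.0#
    fy≈0 = P.≈-trans (P.≈-sym (Hom.star-homo constant α ls)) (P.≈-trans (Hom.⟦⟧-cong constant fα≈0) (Hom.0-homo constant))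
    cleared : (x P.+ P.- y) P.* PS.bezout x y ls P.≈ (x P.+ P.- y) P.* ((x P.+ P.- C₁ β) P.* (k P.* PS.paths y ls))
    cleared = P.≈-trans (P.≈-sym (PS.star-bezout x y ls))
      (P.≈-trans (P.+-cong (P.*-congʳ fx≈) (P.-‿cong (P.*-congʳ fy≈0)))
        (P.solve 5 (λ u v k q r → ((u P.:* v) P.:* k) P.:* q P.:+ (P.:- (P.con (+ 0) P.:* r)) P.:= u P.:* (v P.:* (k P.:* q)))
          P.≈-refl (x P.+ P.- y) (x P.+ P.- C₁ β) k (PS.paths y ls) (PS.paths x ls)))
    quotients : PS.bezout x y ls P.≈ (x P.+ P.- C₁ β) P.* (k P.* PS.paths y ls)
    quotients = monic-cancelˡ 1 (x P.+ P.- y) (PS.bezout x y ls) ((x P.+ P.- C₁ β) P.* (k P.* PS.paths y ls))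
      (≈-refl , λ { (suc (suc i)) _ → ≈-refl ; (suc zero) (s≤s ()) }) cleared

-- S = {p + qω | p, q ≥ 0} is closed under addition and multiplication since t, n ≥ 0;
-- Nonneg consists of the elements that a power of some fixed ε ∈ S moves into S.
module ConeExtension (K : CommutativeRing 0ℓ 0ℓ) (cone : Cone K) {t n : CommutativeRing.Carrier K}
                     (t≥0 : Cone.Nonneg cone t) (n≥0 : Cone.Nonneg cone n) where
  open RingKit K
  open ConeStar K cone using (Positive; positive-+; positive≉0)
  open Cone cone
  open QuadraticExtension K t n public
  private module E = RingKit extRing

  record Orthant (z : Ext) : Set where
    constructor _,_
    field
      re≥0 : Nonneg (re z)
      im≥0 : Nonneg (im z)
  open Orthant public

  orthant-resp : ∀ {z w} → z ≈ᵉ w → Orthant z → Orthant w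
  orthant-resp (e & f) (p≥0 , q≥0) = nonneg-resp e p≥0 , nonneg-resp f q≥0

  orthant-+ : ∀ {z w} → Orthant z → Orthant w → Orthant (z E.+ w)
  orthant-+ {_ +ω _} {_ +ω _} (a , b) (c , d) = nonneg-+ a c , nonneg-+ b d

  orthant-* : ∀ {z w} → Orthant z → Orthant w → Orthant (z E.* w)
  orthant-* {_ +ω _} {_ +ω _} (a , b) (c , d) = nonneg-+ (nonneg-* a c) (nonneg-* n≥0 (nonneg-* b d))
    , nonneg-+ (nonneg-+ (nonneg-* a d) (nonneg-* b c)) (nonneg-* t≥0 (nonneg-* b d))

  module Clearing (ε : Ext) (ε∈S : Orthant ε) where
    infixr 8 ε^_
    ε^_ : ℕ → Ext
    ε^ zero  = E.1#
    ε^ suc k = ε E.* (ε^ k)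

    ε^-+ : ∀ j k → (ε^ (j ℕ.+ k)) ≈ᵉ ((ε^ j) E.* (ε^ k))
    ε^-+ zero    k = E.≈-sym (E.*-identityˡ _)
    ε^-+ (suc j) k = E.≈-trans (E.*-congˡ (ε^-+ j k)) (E.≈-sym (E.*-assoc _ _ _))

    orthant-ε^ : ∀ k → Orthant (ε^ k)
    orthant-ε^ zero    = nonneg-1 , nonneg-0
    orthant-ε^ (suc k) = orthant-* ε∈S (orthant-ε^ k)

    -- If `ε^ k` moved -1 into the orthant, both coordinates of `ε^ k` would be nonpositive; a
    -- coordinate that is at least 1 forbids this. Two elements cleared by ε^j and ε^k have a sum
    -- and a product cleared by ε^(j+k).
    extendedCone : (∀ k → Positive (re (ε^ k)) ⊎ Positive (im (ε^ k))) → Cone extRing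
    extendedCone visible = record
      { Nonneg = λ z → ∃ λ k → Orthant ((ε^ k) E.* z)
      ; nonneg-resp = λ e (k , o) → k , orthant-resp (E.*-congˡ e) o
      ; nonneg-0 = 0 , orthant-resp (E.≈-sym (E.zeroʳ E.1#)) (nonneg-0 , nonneg-0)
      ; nonneg-1 = 0 , orthant-resp (E.≈-sym (E.*-identityʳ E.1#)) (nonneg-1 , nonneg-0)
      ; nonneg-+ = λ {x} {y} (j , o) (k , o′) → j ℕ.+ k , orthant-resp (E.≈-trans
          (E.solve 4 (λ e f x y → f E.:* (e E.:* x) E.:+ e E.:* (f E.:* y) E.:= (e E.:* f) E.:* (x E.:+ y)) E.≈-refl (ε^ j) (ε^ k) x y)
          (E.*-congʳ (E.≈-sym (ε^-+ j k)))) (orthant-+ (orthant-* (orthant-ε^ k) o) (orthant-* (orthant-ε^ j) o′))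
      ; nonneg-* = λ {x} {y} (j , o) (k , o′) → j ℕ.+ k , orthant-resp (E.≈-trans
          (E.solve 4 (λ e f x y → (e E.:* x) E.:* (f E.:* y) E.:= (e E.:* f) E.:* (x E.:* y)) E.≈-refl (ε^ j) (ε^ k) x y)
          (E.*-congʳ (E.≈-sym (ε^-+ j k)))) (orthant-* o o′)
      ; -1-negative = λ (k , o) → notBoth (ε^ k) (orthant-resp
          (E.≈-trans (E.≈-sym (E.-‿distribʳ-* (ε^ k) E.1#)) (E.-‿cong (E.*-identityʳ (ε^ k)))) o) (visible k) }
      where
      impossible : ∀ {z} → Positive z → ¬ Nonneg (- z)
      impossible pos -z≥0 = positive≉0 (positive-+ pos -z≥0) (-‿inverseʳ _)
      notBoth : ∀ z → Orthant (E.- z) → ¬ (Positive (re z) ⊎ Positive (im z))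
      notBoth (_ +ω _) (o , _) (inj₁ pos) = impossible pos o
      notBoth (_ +ω _) (_ , o) (inj₂ pos) = impossible pos o

-- Roots that are at least 2

starPoly : List ℕ → ℤ[x].Pol
starPoly = Star.star ℤ[x].polRing X₁

-- x² - ax + b
quadratic : ℤ → ℤ → ℤ[x].Pol
quadratic a b = b ∷ ℤ.- a ∷ + 1 ∷ []

module _ where
  open RingKit ℤRing using (fromℕ; fromℕ-suc; fromℤ)

  fromℕ-ℤ : ∀ n → fromℕ n ≡ + n
  fromℕ-ℤ zero    = refl
  fromℕ-ℤ (suc n) = ≡.trans (fromℕ-suc n) (cong (ℤ._+_ (+ 1)) (fromℕ-ℤ n))

  fromℤ-ℤ : ∀ z → fromℤ z ≡ z
  fromℤ-ℤ (+ n)    = fromℕ-ℤ n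
  fromℤ-ℤ -[1+ n ] = cong ℤ.-_ (fromℕ-ℤ (suc n))

module QuadraticRoots (R : CommutativeRing 0ℓ 0ℓ) where
  open RingKit R
  open Evaluation R
  open Star R

  eval-quadratic : ∀ x a b {r s} → r + s ≈ fromℤ a → r * s ≈ fromℤ b →
    eval x (quadratic a b) ≈ (x + - r) * (x + - s)
  eval-quadratic x a b {r} {s} root-sum root-prod = begin
    fromℤ b + x * (fromℤ (ℤ.- a) + x * (1# + x * 0#))
      ≈⟨ +-cong (≈-sym root-prod) (*-congˡ (+-congʳ (≈-trans (fromℤ-neg a) (-‿cong (≈-sym root-sum))))) ⟩
    r * s + x * (- (r + s) + x * (1# + x * 0#))
      ≈⟨ solve 3 (λ x r s → r :* s :+ x :* ((:- (r :+ s)) :+ x :* (con (+ 1) :+ x :* con (+ 0))) := (x :- r) :* (x :- s)) ≈-refl x r s ⟩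
    (x + - r) * (x + - s) ∎

  eval-star : ∀ x ls → eval x (starPoly ls) ≈ star x ls
  eval-star x ls = ≈-trans (Hom.star-homo (evaluate x) X₁ ls) (star-cong ls (eval-X x))

  eval-root : ∀ a b {r s} → r + s ≈ fromℤ a → r * s ≈ fromℤ b → eval r (quadratic a b) ≈ 0#
  eval-root a b {r} {s} root-sum root-prod = ≈-trans (eval-quadratic r a b root-sum root-prod)
    (≈-trans (*-congʳ (-‿inverseʳ r)) (zeroˡ _))

module RootsAboveTwo (K : CommutativeRing 0ℓ 0ℓ) (cone : Cone K) where
  open RingKit K
  open ConeStar K cone
  open Star K using (star)
  open Evaluation K using (eval; evaluate)
  open QuadraticRoots K
  open Polynomials K using (Pol; polRing)
  open PolynomialHoms K using (constant)
  private
    module P = RingKit polRing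
    module PE = Evaluation polRing
    module PQ = QuadraticRoots polRing

  nonneg-fromℕ : ∀ m → Nonneg (fromℕ m)
  nonneg-fromℕ zero    = nonneg-0
  nonneg-fromℕ (suc m) = nonneg-resp (≈-sym (fromℕ-suc m)) (nonneg-+ nonneg-1 (nonneg-fromℕ m))

  positive-fromℕ : ∀ m → Positive (fromℕ (suc m))
  positive-fromℕ m = fromℕ m , nonneg-fromℕ m , fromℕ-suc m

  C₁ : Carrier → Pol
  C₁ = Hom.⟦_⟧ constant

  constant-quadratic : ∀ a b {r s} → r + s ≈ fromℤ a → r * s ≈ fromℤ b → ∀ x →
    PE.eval x (quadratic a b) P.≈ (x P.+ P.- C₁ r) P.* (x P.+ P.- C₁ s)
  constant-quadratic a b {r} {s} root-sum root-prod x = PQ.eval-quadratic x a b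
    (P.≈-trans (P.≈-sym (+-homo r s)) (P.≈-trans (⟦⟧-cong root-sum) (fromℤ-homo a)))
    (P.≈-trans (P.≈-sym (*-homo r s)) (P.≈-trans (⟦⟧-cong root-prod) (fromℤ-homo b)))
    where open Hom constant

  -- Carries `no-two-roots` over to a factor p with integer coefficients: its evaluation at the
  -- polynomial β + X over `K`, where the roots α and β exist, exhibits the two linear factors.
  no-two-factors : ∀ ls {α β a b} → Nonneg a → α ≈ fromℤ (+ 2) + a → Nonneg b → β ≈ fromℤ (+ 2) + b →
    ∀ p k → starPoly ls ℤ[x].≈ᵖ (p ℤ[x].*ᵖ k) → eval α p ≈ 0# →
    let x = β ∷ 1# ∷ [] in ∀ r → ¬ (PE.eval x p P.≈ ((x P.+ P.- C₁ α) P.* (x P.+ P.- C₁ β)) P.* r)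
  no-two-factors ls {α} {β} a≥0 α≈ b≥0 β≈ p k F≈pk pα≈0 r px≈ =
    no-two-roots ls a≥0 α≈ b≥0 β≈
      (begin
        star α ls                 ≈⟨ eval-star α ls ⟨
        eval α (starPoly ls)      ≈⟨ Hom.⟦⟧-cong (evaluate α) F≈pk ⟩
        eval α (p ℤ[x].*ᵖ k)      ≈⟨ Hom.*-homo (evaluate α) p k ⟩
        eval α p * eval α k       ≈⟨ *-congʳ pα≈0 ⟩
        0# * eval α k             ≈⟨ zeroˡ _ ⟩
        0#                        ∎)
      (r P.* PE.eval x k)
      (P.≈-trans (P.≈-sym (PQ.eval-star x ls)) (P.≈-trans (Hom.⟦⟧-cong (PE.evaluate x) F≈pk)
        (P.≈-trans (Hom.*-homo (PE.evaluate x) p k) (P.≈-trans (P.*-congʳ px≈)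
          (P.*-assoc ((x P.+ P.- C₁ α) P.* (x P.+ P.- C₁ β)) r (PE.eval x k))))))
    where x = β ∷ 1# ∷ []

-- The result of an adjunction is again a ring with a cone, so that adjunctions can be iterated;
-- `lift-nonneg` keeps an earlier root at least 2 after the next one is adjoined.
record Above (K : CommutativeRing 0ℓ 0ℓ) (cone : Cone K) (a b : ℤ) : Set₁ where
  field
    L      : CommutativeRing 0ℓ 0ℓ
    coneL  : Cone L
    lift   : Hom K L
  open RingKit L
  open Cone coneL
  field
    lift-nonneg : ∀ {z} → Cone.Nonneg cone z → Nonneg (Hom.⟦_⟧ lift z)
    α ᾱ a₂      : Carrier
    a₂≥0        : Nonneg a₂
    α≈2+a₂      : α ≈ fromℤ (+ 2) + a₂
    root-sum         : α + ᾱ ≈ fromℤ a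
    root-prod        : α * ᾱ ≈ fromℤ b

-- With X = x - 2 the polynomial x² - ax + b becomes X² - uX - v for u = a - 4 and v = 2a - 4 - b.
module ShiftedRoot (R : CommutativeRing 0ℓ 0ℓ) where
  open RingKit R

  shifted-root : ∀ a b u v (r : Carrier) → a ≡ u ℤ.+ + 4 → b ≡ + 2 ℤ.* u ℤ.+ + 4 ℤ.- v →
    r * r ≈ fromℤ u * r + fromℤ v →
    let α = fromℤ (+ 2) + r in α * (fromℤ a + - α) ≈ fromℤ b
  shifted-root _ _ u v r refl refl r²≈ = begin
    (fromℤ (+ 2) + r) * (fromℤ (u ℤ.+ + 4) + - (fromℤ (+ 2) + r))
      ≈⟨ *-congˡ (+-congʳ (fromℤ-+ u (+ 4))) ⟩
    (fromℤ (+ 2) + r) * ((fromℤ u + fromℤ (+ 4)) + - (fromℤ (+ 2) + r))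
      ≈⟨ solve 2 (λ u r → (con (+ 2) :+ r) :* ((u :+ con (+ 4)) :- (con (+ 2) :+ r))
           := ((con (+ 2) :* u :+ con (+ 4)) :+ u :* r) :- r :* r) ≈-refl (fromℤ u) r ⟩
    ((fromℤ (+ 2) * fromℤ u + fromℤ (+ 4)) + fromℤ u * r) + - (r * r)
      ≈⟨ +-congˡ (-‿cong r²≈) ⟩
    ((fromℤ (+ 2) * fromℤ u + fromℤ (+ 4)) + fromℤ u * r) + - (fromℤ u * r + fromℤ v)
      ≈⟨ solve 3 (λ c w v → (c :+ w) :- (w :+ v) := c :- v) ≈-refl (fromℤ (+ 2) * fromℤ u + fromℤ (+ 4)) (fromℤ u * r) (fromℤ v) ⟩
    (fromℤ (+ 2) * fromℤ u + fromℤ (+ 4)) + - fromℤ v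
      ≈⟨ +-cong (≈-trans (fromℤ-+ (+ 2 ℤ.* u) (+ 4)) (+-congʳ (fromℤ-* (+ 2) u))) (fromℤ-neg v) ⟨
    fromℤ (+ 2 ℤ.* u ℤ.+ + 4) + fromℤ (ℤ.- v)
      ≈⟨ fromℤ-+ (+ 2 ℤ.* u ℤ.+ + 4) (ℤ.- v) ⟨
    fromℤ (+ 2 ℤ.* u ℤ.+ + 4 ℤ.- v) ∎

module AdjoinRoot (K : CommutativeRing 0ℓ 0ℓ) (cone : Cone K) where
  open RingKit K
  open ConeStar K cone
  open RootsAboveTwo K cone using (nonneg-fromℕ; positive-fromℕ)

  -- For u ≥ 0 the root of X² = uX + v is ω itself, which lies in the orthant. Nothing needs
  -- clearing, so ε = 1.
  adjoin-root⁺ : ∀ u v → Above K cone (+ u ℤ.+ + 4) (+ 2 ℤ.* + u ℤ.+ + 4 ℤ.- + v)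
  adjoin-root⁺ u v = record
    { L = extRing ; coneL = coneE ; lift = embed
    ; lift-nonneg = λ z≥0 → 0 , orthant-resp (E.≈-sym (E.*-identityˡ _)) (z≥0 , nonneg-0)
    ; α = E.fromℤ (+ 2) E.+ ω ; ᾱ = E.fromℤ (+ u ℤ.+ + 4) E.+ E.- (E.fromℤ (+ 2) E.+ ω) ; a₂ = ω
    ; a₂≥0 = 0 , orthant-resp (E.≈-sym (E.*-identityˡ _)) (nonneg-0 , nonneg-1)
    ; α≈2+a₂ = E.≈-refl
    ; root-sum = E.solve 2 (λ x y → x E.:+ (y E.:- x) E.:= y) E.≈-refl (E.fromℤ (+ 2) E.+ ω) (E.fromℤ (+ u ℤ.+ + 4))
    ; root-prod = ShiftedRoot.shifted-root extRing _ _ (+ u) (+ v) ω refl refl ω²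
    }
    where
    open ConeExtension K cone {fromℕ u} {fromℕ v} (nonneg-fromℕ u) (nonneg-fromℕ v)
    module E = RingKit extRing
    open Clearing E.1# (nonneg-1 , nonneg-0)
    visible : ∀ k → Positive (re (ε^ k))
    visible zero    = positive-1
    visible (suc k) = positive-resp (re≈ (E.≈-sym (E.*-identityˡ (ε^ k)))) (visible k)
    coneE : Cone extRing
    coneE = extendedCone (inj₁ ∘ visible)
    ω² : ω E.* ω E.≈ E.fromℕ u E.* ω E.+ E.fromℕ v
    ω² = E.≈-trans
      (solve 2 (λ t n → con (+ 0) :* con (+ 0) :+ n :* (con (+ 1) :* con (+ 1))
          := (t :* con (+ 0) :+ n :* (con (+ 0) :* con (+ 1))) :+ n) ≈-refl (fromℕ u) (fromℕ v)
       & solve 1 (λ t → (con (+ 0) :* con (+ 1) :+ con (+ 1) :* con (+ 0)) :+ t :* (con (+ 1) :* con (+ 1))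
          := ((t :* con (+ 1) :+ con (+ 0) :* con (+ 0)) :+ t :* (con (+ 0) :* con (+ 1))) :+ con (+ 0)) ≈-refl (fromℕ u))
      (E.+-cong (E.*-congʳ (Hom.fromℕ-homo embed u)) (Hom.fromℕ-homo embed v))

  -- The root of X² + tX - v is X = ω - t with ω² = tω + v, and ωX = v ≥ 0.
  adjoin-root⁻ : ∀ t-1 v → Above K cone (-[1+ t-1 ] ℤ.+ + 4) (+ 2 ℤ.* -[1+ t-1 ] ℤ.+ + 4 ℤ.- + v)
  adjoin-root⁻ t-1 v = record
    { L = extRing ; coneL = coneE ; lift = embed
    ; lift-nonneg = λ z≥0 → 0 , orthant-resp (E.≈-sym (E.*-identityˡ _)) (z≥0 , nonneg-0)
    ; α = E.fromℤ (+ 2) E.+ r ; ᾱ = E.fromℤ (-[1+ t-1 ] ℤ.+ + 4) E.+ E.- (E.fromℤ (+ 2) E.+ r) ; a₂ = r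
    ; a₂≥0 = 1 , orthant-resp (E.≈-sym ωr) (nonneg-fromℕ v , nonneg-0)
    ; α≈2+a₂ = E.≈-refl
    ; root-sum = E.solve 2 (λ x y → x E.:+ (y E.:- x) E.:= y) E.≈-refl (E.fromℤ (+ 2) E.+ r) (E.fromℤ (-[1+ t-1 ] ℤ.+ + 4))
    ; root-prod = ShiftedRoot.shifted-root extRing _ _ -[1+ t-1 ] (+ v) r refl refl r²
    }
    where
    t = fromℕ (suc t-1)
    open ConeExtension K cone {t} {fromℕ v} (nonneg-fromℕ (suc t-1)) (nonneg-fromℕ v)
    module E = RingKit extRing
    open Clearing ω (nonneg-0 , nonneg-1)
    -- Multiplication by ω turns the coordinate q of p + qω into tq + p, and t ≥ 1 because u is
    -- strictly negative here.
    visible : ∀ k → Positive (im (ε^ suc k))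
    visible zero    = positive-resp
      (solve 1 (λ t → con (+ 1) := (con (+ 0) :* con (+ 0) :+ con (+ 1) :* con (+ 1)) :+ t :* (con (+ 1) :* con (+ 0))) ≈-refl t) positive-1
    visible (suc k) = positive-resp
      (≈-trans (solve 3 (λ t p q → t :* q :+ p := (con (+ 0) :* q :+ con (+ 1) :* p) :+ t :* (con (+ 1) :* q)) ≈-refl t
        (re (ε^ suc k)) (im (ε^ suc k))) (≈-reflexive (≡.sym (im-* ω (ε^ suc k)))))
      (positive-+ (positive-* (positive-fromℕ t-1) (visible k)) (re≥0 (orthant-ε^ (suc k))))
    coneE : Cone extRing
    coneE = extendedCone λ { zero → inj₁ positive-1 ; (suc k) → inj₂ (visible k) }
    r : Ext
    r = - t +ω 1#
    ωr : (ε^ 1) E.* r E.≈ (fromℕ v +ω 0#)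
    ωr = E.≈-trans (E.*-congʳ (E.*-identityʳ ω))
      ( solve 2 (λ t n → con (+ 0) :* (:- t) :+ n :* (con (+ 1) :* con (+ 1)) := n) ≈-refl t (fromℕ v)
      & solve 1 (λ t → (con (+ 0) :* con (+ 1) :+ con (+ 1) :* (:- t)) :+ t :* (con (+ 1) :* con (+ 1)) := con (+ 0)) ≈-refl t)
    r² : r E.* r E.≈ E.fromℤ -[1+ t-1 ] E.* r E.+ E.fromℕ v
    r² = E.≈-trans
      (solve 2 (λ t n → (:- t) :* (:- t) :+ n :* (con (+ 1) :* con (+ 1))
          := ((:- t) :* (:- t) :+ n :* ((:- con (+ 0)) :* con (+ 1))) :+ n) ≈-refl t (fromℕ v)
       & solve 1 (λ t → ((:- t) :* con (+ 1) :+ con (+ 1) :* (:- t)) :+ t :* (con (+ 1) :* con (+ 1))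
          := (((:- t) :* con (+ 1) :+ (:- con (+ 0)) :* (:- t)) :+ t :* ((:- con (+ 0)) :* con (+ 1))) :+ con (+ 0)) ≈-refl t)
      (E.+-cong (E.*-congʳ (E.-‿cong (Hom.fromℕ-homo embed (suc t-1)))) (Hom.fromℕ-homo embed v))

  adjoin-root : ∀ u v → Above K cone (u ℤ.+ + 4) (+ 2 ℤ.* u ℤ.+ + 4 ℤ.- + v)
  adjoin-root (+ u)    v = adjoin-root⁺ u v
  adjoin-root -[1+ t ] v = adjoin-root⁻ t v

ℤCone : Cone ℤRing
ℤCone = record
  { Nonneg = λ z → ∃ λ m → z ≡ + m
  ; nonneg-resp = λ { refl z≥0 → z≥0 }
  ; nonneg-0 = 0 , refl
  ; nonneg-1 = 1 , refl
  ; nonneg-+ = λ { (m , refl) (n , refl) → m ℕ.+ n , refl }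
  ; nonneg-* = λ { (m , refl) (n , refl) → m ℕ.* n , ≡.sym (ℤₚ.pos-* m n) }
  ; -1-negative = λ { (_ , ()) } }

-- X² - uX - v in terms of x = X + 2
shifted : ℤ → ℤ → ℤ[x].Pol
shifted u v = quadratic (u ℤ.+ + 4) (+ 2 ℤ.* u ℤ.+ + 4 ℤ.- v)

-- With v, v′ ≥ 0 each quadratic has a root that is at least 2. The second root is adjoined over the
-- ring of the first, whether or not the quadratics share roots: `no-two-roots` counts
-- multiplicities, so equal quadratics are covered.
two-roots-impossible : ∀ ls u v u′ v′ k →
  ¬ (starPoly ls ℤ[x].≈ᵖ ((shifted u (+ v) ℤ[x].*ᵖ shifted u′ (+ v′)) ℤ[x].*ᵖ k))
two-roots-impossible ls u v u′ v′ k F≈ =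
  no-two-factors ls (S.lift-nonneg F.a₂≥0)
    (≈-trans (⟦⟧-cong F.α≈2+a₂) (≈-trans (+-homo _ _) (+-congʳ (fromℤ-homo (+ 2)))))
    S.a₂≥0 S.α≈2+a₂ (g₁ ℤ[x].*ᵖ g₂) k F≈
    (≈-trans (Hom.*-homo (evaluate ⟦ F.α ⟧) g₁ g₂) (≈-trans (*-congʳ (eval-root a b sum₁ prod₁)) (zeroˡ _)))
    ((x P.+ P.- C₁ ⟦ F.ᾱ ⟧) P.* (x P.+ P.- C₁ S.ᾱ))
    (P.≈-trans (Hom.*-homo (PE.evaluate x) g₁ g₂)
      (P.≈-trans (P.*-cong (constant-quadratic a b sum₁ prod₁ x) (constant-quadratic a′ b′ S.root-sum S.root-prod x))
        (P.solve 4 (λ p q r s → (p P.:* q) P.:* (r P.:* s) P.:= (p P.:* r) P.:* (q P.:* s)) P.≈-refl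
          (x P.+ P.- C₁ ⟦ F.α ⟧) (x P.+ P.- C₁ ⟦ F.ᾱ ⟧) (x P.+ P.- C₁ S.α) (x P.+ P.- C₁ S.ᾱ))))
  where
  g₁ = shifted u (+ v)
  g₂ = shifted u′ (+ v′)
  a  = u ℤ.+ + 4
  b  = + 2 ℤ.* u ℤ.+ + 4 ℤ.- + v
  a′ = u′ ℤ.+ + 4
  b′ = + 2 ℤ.* u′ ℤ.+ + 4 ℤ.- + v′
  first = AdjoinRoot.adjoin-root ℤRing ℤCone u v
  module F = Above first
  second = AdjoinRoot.adjoin-root F.L F.coneL u′ v′
  module S = Above second
  open RingKit S.L
  open RootsAboveTwo S.L S.coneL
  open QuadraticRoots S.L
  open Evaluation S.L using (evaluate)
  open Hom S.lift
  module P = RingKit (Polynomials.polRing S.L)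
  module PE = Evaluation (Polynomials.polRing S.L)
  x = S.α ∷ 1# ∷ []
  sum₁ : ⟦ F.α ⟧ + ⟦ F.ᾱ ⟧ ≈ fromℤ a
  sum₁ = ≈-trans (≈-sym (+-homo _ _)) (≈-trans (⟦⟧-cong F.root-sum) (fromℤ-homo a))
  prod₁ : ⟦ F.α ⟧ * ⟦ F.ᾱ ⟧ ≈ fromℤ b
  prod₁ = ≈-trans (≈-sym (*-homo _ _)) (≈-trans (⟦⟧-cong F.root-prod) (fromℤ-homo b))

-- Both roots of x² - ax + b exceed 2: here α - 2 = m + ω and ᾱ - 2 = m + e - ω with ω² = eω + n,
-- their product w = m² + em - n is positive, and m + ω clears ᾱ - 2.
double-root-impossible : ∀ ls m e n w k → suc m ℕ.* suc m ℕ.+ e ℕ.* suc m ≡ w ℕ.+ n →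
  ¬ (starPoly ls ℤ[x].≈ᵖ (shifted (+ (suc m ℕ.+ suc m ℕ.+ e)) (ℤ.- + w) ℤ[x].*ᵖ k))
double-root-impossible ls m-1 e n w k m²+em≡w+n F≈ =
  no-two-factors ls {r} {s} {α₂} {ᾱ₂}
    (0 , orthant-resp (E.≈-sym (E.*-identityˡ α₂)) α₂∈S) (E.≈-refl {r})
    (1 , orthant-resp (E.≈-sym α₂ᾱ₂) ((w , refl) , nonneg-0)) (E.≈-refl {s})
    (shifted u (ℤ.- + w)) k F≈ (eval-root a b {r} {s} root-sum root-prod) P.1#
    (P.≈-trans (constant-quadratic a b {r} {s} root-sum root-prod x) (P.≈-sym (P.*-identityʳ _)))
  where
  m = suc m-1
  u = + (m ℕ.+ m ℕ.+ e)
  a = u ℤ.+ + 4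
  b = + 2 ℤ.* u ℤ.+ + 4 ℤ.- (ℤ.- + w)
  module Z = RingKit ℤRing
  open ConeStar ℤRing ℤCone
  open ConeExtension ℤRing ℤCone {+ e} {+ n} (e , refl) (n , refl)
  module E = RingKit extRing
  α₂ ᾱ₂ : Ext
  α₂ = + m +ω + 1
  ᾱ₂ = + (m ℕ.+ e) +ω ℤ.- + 1
  α₂∈S : Orthant α₂
  α₂∈S = (m , refl) , (1 , refl)
  open Clearing α₂ α₂∈S
  -- The product of m + ω and p + qω has the first coordinate mp + nq, which stays at least 1
  -- because m is a successor.
  visible : ∀ k → Positive (re (ε^ k))
  visible zero    = positive-1
  visible (suc k) = subst Positive (≡.sym (re-* α₂ (ε^ k))) (positive-+ (positive-* (+ m-1 , (m-1 , refl) , refl) (visible k))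
    (nonneg-* (n , refl) (nonneg-* nonneg-1 (im≥0 (orthant-ε^ k)))))
  open RootsAboveTwo extRing (extendedCone (inj₁ ∘ visible))
  open QuadraticRoots extRing
  module P = RingKit (Polynomials.polRing extRing)
  r s : Ext
  r = E.fromℤ (+ 2) E.+ α₂
  s = E.fromℤ (+ 2) E.+ ᾱ₂
  x = s ∷ E.1# ∷ []
  m²+em : + m ℤ.* + m ℤ.+ + e ℤ.* + m ≡ + w ℤ.+ + n
  m²+em = ≡.trans (cong₂ ℤ._+_ (≡.sym (ℤₚ.pos-* m m)) (≡.sym (ℤₚ.pos-* e m))) (cong +_ m²+em≡w+n)
  norm : α₂ E.* ᾱ₂ E.≈ (+ w +ω + 0)
  norm = (≡.trans (Z.solve 3 (λ m e n → m Z.:* (m Z.:+ e) Z.:+ n Z.:* (Z.con (+ 1) Z.:* (Z.:- Z.con (+ 1)))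
              Z.:= (m Z.:* m Z.:+ e Z.:* m) Z.:- n) refl (+ m) (+ e) (+ n))
            (≡.trans (cong (ℤ._- + n) m²+em) (Z.solve 2 (λ w n → (w Z.:+ n) Z.:- n Z.:= w) refl (+ w) (+ n))))
       & Z.solve 2 (λ m e → (m Z.:* (Z.:- Z.con (+ 1)) Z.:+ Z.con (+ 1) Z.:* (m Z.:+ e)) Z.:+ e Z.:* (Z.con (+ 1) Z.:* (Z.:- Z.con (+ 1)))
              Z.:= Z.con (+ 0)) refl (+ m) (+ e)
  α₂ᾱ₂ : (ε^ 1) E.* ᾱ₂ E.≈ (+ w +ω + 0)
  α₂ᾱ₂ = E.≈-trans (E.*-congʳ (E.*-identityʳ α₂)) norm
  embed-ℤ : ∀ z → E.fromℤ z E.≈ (z +ω + 0)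
  embed-ℤ z = E.≈-trans (E.≈-sym (Hom.fromℤ-homo embed z)) (fromℤ-ℤ z & refl)
  sum₂ : α₂ E.+ ᾱ₂ E.≈ E.fromℤ u
  sum₂ = E.≈-trans (cong +_ (≡.sym (ℕₚ.+-assoc m m e)) & refl) (E.≈-sym (embed-ℤ u))
  root-sum : r E.+ s E.≈ E.fromℤ a
  root-sum = E.≈-trans (E.solve 2 (λ r s → (E.con (+ 2) E.:+ r) E.:+ (E.con (+ 2) E.:+ s) E.:= (r E.:+ s) E.:+ E.con (+ 4)) E.≈-refl α₂ ᾱ₂)
    (E.≈-trans (E.+-congʳ sum₂) (E.≈-sym (E.fromℤ-+ u (+ 4))))
  root-prod : r E.* s E.≈ E.fromℤ b
  root-prod = E.≈-trans (E.solve 2 (λ r s → (E.con (+ 2) E.:+ r) E.:* (E.con (+ 2) E.:+ s)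
             E.:= (E.con (+ 2) E.:* (r E.:+ s) E.:+ E.con (+ 4)) E.:+ r E.:* s) E.≈-refl α₂ ᾱ₂)
    (E.≈-trans (E.+-cong (E.+-congʳ (E.*-congˡ {E.fromℤ (+ 2)} sum₂)) (E.≈-trans norm (E.≈-sym (embed-ℤ (+ w)))))
    (E.≈-trans (E.+-cong (E.+-congʳ (E.≈-sym (E.fromℤ-* (+ 2) u))) (E.≈-sym (E.≈-reflexive (cong E.fromℤ (ℤₚ.neg-involutive (+ w))))))
    (E.≈-trans (E.+-congʳ (E.≈-sym (E.fromℤ-+ (+ 2 ℤ.* u) (+ 4)))) (E.≈-sym (E.fromℤ-+ (+ 2 ℤ.* u ℤ.+ + 4) (ℤ.- (ℤ.- + w)))))))

-- Absence of non-real roots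

square-nonneg : ∀ i → i ℤ.* i ≡ + (ℤ.∣ i ∣ ℕ.* ℤ.∣ i ∣)
square-nonneg (+ n)    = ≡.sym (ℤₚ.pos-* n n)
square-nonneg -[1+ n ] = refl

i*i≡0⇒i≡0 : ∀ i → i ℤ.* i ≡ + 0 → i ≡ + 0
i*i≡0⇒i≡0 i e with ℤₚ.i*j≡0⇒i≡0∨j≡0 i e
... | inj₁ i≡0 = i≡0
... | inj₂ i≡0 = i≡0

4i≡+m⇒i≡+k : ∀ i {m} → + 4 ℤ.* i ≡ + m → ∃ λ k → i ≡ + k
4i≡+m⇒i≡+k (+ k)    _ = k , refl
4i≡+m⇒i≡+k -[1+ k ] ()

2i≡0⇒i≡0 : ∀ i → + 2 ℤ.* i ≡ + 0 → i ≡ + 0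
2i≡0⇒i≡0 i e with ℤₚ.i*j≡0⇒i≡0∨j≡0 (+ 2) e
... | inj₂ i≡0 = i≡0

x²+dy²≡0 : ∀ d x y → + (ℤ.∣ x ∣ ℕ.* ℤ.∣ x ∣ ℕ.+ suc d ℕ.* (ℤ.∣ y ∣ ℕ.* ℤ.∣ y ∣)) ≡ + 0 → x ≡ + 0 × y ≡ + 0
x²+dy²≡0 d x y e = i*i≡0⇒i≡0 x (≡.trans (square-nonneg x) (cong +_ (ℕₚ.m+n≡0⇒m≡0 (ℤ.∣ x ∣ ℕ.* ℤ.∣ x ∣) sum≡0)))
  , i*i≡0⇒i≡0 y (≡.trans (square-nonneg y) (cong +_ (ℕₚ.m+n≡0⇒m≡0 (ℤ.∣ y ∣ ℕ.* ℤ.∣ y ∣) (ℕₚ.m+n≡0⇒n≡0 (ℤ.∣ x ∣ ℕ.* ℤ.∣ x ∣) sum≡0))))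
  where
  sum≡0 = ℤₚ.+-injective e

module NormIdentities (R : CommutativeRing 0ℓ 0ℓ) where
  open RingKit R

  conjugate-+ : ∀ a p q p′ q′ → (p + p′) + a * (q + q′) ≈ (p + a * q) + (p′ + a * q′)
  conjugate-+ = solve 5 (λ a p q p′ q′ → (p :+ p′) :+ a :* (q :+ q′) := (p :+ a :* q) :+ (p′ :+ a :* q′)) ≈-refl

  conjugate-*₁ : ∀ a n p q p′ q′ →
    (p * p′ + n * (q * q′)) + a * ((p * q′ + q * p′) + a * (q * q′)) ≈ (p + a * q) * (p′ + a * q′) + n * (- q * - q′)
  conjugate-*₁ = solve 6 (λ a n p q p′ q′ → (p :* p′ :+ n :* (q :* q′)) :+ a :* ((p :* q′ :+ q :* p′) :+ a :* (q :* q′))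
    := (p :+ a :* q) :* (p′ :+ a :* q′) :+ n :* ((:- q) :* (:- q′))) ≈-refl

  conjugate-*₂ : ∀ a p q p′ q′ →
    - ((p * q′ + q * p′) + a * (q * q′)) ≈ ((p + a * q) * - q′ + - q * (p′ + a * q′)) + a * (- q * - q′)
  conjugate-*₂ = solve 5 (λ a p q p′ q′ → :- ((p :* q′ :+ q :* p′) :+ a :* (q :* q′))
    := ((p :+ a :* q) :* (:- q′) :+ (:- q) :* (p′ :+ a :* q′)) :+ a :* ((:- q) :* (:- q′))) ≈-refl

  conjugate-1 : ∀ a → 1# + a * 0# ≈ 1#
  conjugate-1 = solve 1 (λ a → con (+ 1) :+ a :* con (+ 0) := con (+ 1)) ≈-refl

  norm₁ : ∀ a b p q → p * (p + a * q) + - b * (q * - q) ≈ p * p + a * (p * q) + b * (q * q)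
  norm₁ = solve 4 (λ a b p q → p :* (p :+ a :* q) :+ (:- b) :* (q :* (:- q)) := p :* p :+ a :* (p :* q) :+ b :* (q :* q)) ≈-refl

  norm₂ : ∀ a p q → (p * - q + q * (p + a * q)) + a * (q * - q) ≈ 0#
  norm₂ = solve 3 (λ a p q → (p :* (:- q) :+ q :* (p :+ a :* q)) :+ a :* (q :* (:- q)) := con (+ 0)) ≈-refl

  4norm-split : ∀ a b p q → fromℤ (+ 4) * (p * p + a * (p * q) + b * (q * q))
    ≈ fromℤ (+ 4) * (p * p + a * (p * q)) + (fromℤ (+ 4) * b) * (q * q)
  4norm-split = solve 4 (λ a b p q → con (+ 4) :* (p :* p :+ a :* (p :* q) :+ b :* (q :* q))
    := con (+ 4) :* (p :* p :+ a :* (p :* q)) :+ (con (+ 4) :* b) :* (q :* q)) ≈-refl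

  complete-square : ∀ a d p q → fromℤ (+ 4) * (p * p + a * (p * q)) + (a * a + d) * (q * q)
    ≈ (fromℤ (+ 2) * p + a * q) * (fromℤ (+ 2) * p + a * q) + d * (q * q)
  complete-square = solve 4 (λ a d p q → con (+ 4) :* (p :* p :+ a :* (p :* q)) :+ (a :* a :+ d) :* (q :* q)
    := (con (+ 2) :* p :+ a :* q) :* (con (+ 2) :* p :+ a :* q) :+ d :* (q :* q)) ≈-refl

  drop-zero : ∀ p a → fromℤ (+ 2) * p ≈ fromℤ (+ 2) * p + a * 0#
  drop-zero = solve 2 (λ p a → con (+ 2) :* p := con (+ 2) :* p :+ a :* con (+ 0)) ≈-refl

  ω-ω̄ : ∀ a m → fromℤ (+ 2) * (1# + m) ≈ ((0# + - (0# + a * 1#)) * 0# + (1# + 1#) * (1# + m)) + a * ((1# + 1#) * 0#)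
  ω-ω̄ = solve 2 (λ a m → con (+ 2) :* (con (+ 1) :+ m) := ((con (+ 0) :- (con (+ 0) :+ a :* con (+ 1))) :* con (+ 0)
      :+ (con (+ 1) :+ con (+ 1)) :* (con (+ 1) :+ m)) :+ a :* ((con (+ 1) :+ con (+ 1)) :* con (+ 0))) ≈-refl

  ω+ω̄ : ∀ a → 0# + (0# + a * 1#) ≈ a
  ω+ω̄ = solve 1 (λ a → con (+ 0) :+ (con (+ 0) :+ a :* con (+ 1)) := a) ≈-refl

  norm-ω : ∀ a b → 0# * 0# + a * (0# * 1#) + b * (1# * 1#) ≈ b
  norm-ω = solve 2 (λ a b → con (+ 0) :* con (+ 0) :+ a :* (con (+ 0) :* con (+ 1)) :+ b :* (con (+ 1) :* con (+ 1)) := b) ≈-refl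

  annihilate : ∀ x y → 0# * x + - (y * 0#) ≈ 0#
  annihilate = solve 2 (λ x y → con (+ 0) :* x :+ (:- (y :* con (+ 0))) := con (+ 0)) ≈-refl

  annihilateˡ : ∀ x y → 0# * x + - (0# * y) ≈ 0#
  annihilateˡ = solve 2 (λ x y → con (+ 0) :* x :+ (:- (con (+ 0) :* y)) := con (+ 0)) ≈-refl

  *-interchange : ∀ p p′ q q′ → (p * p′) * (q * q′) ≈ (p * q) * (p′ * q′)
  *-interchange = solve 4 (λ p p′ q q′ → (p :* p′) :* (q :* q′) := (p :* q) :* (p′ :* q′)) ≈-refl

  1≈0+1*1 : 1# ≈ 0# + 1# * 1#
  1≈0+1*1 = solve 0 (con (+ 1) := con (+ 0) :+ con (+ 1) :* con (+ 1)) ≈-refl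

-- For a non-real root ω with conjugate ω̄ the factor bezout ω ω̄ of star-bezout is a sum of norms.
module NonRealRoot (a b : ℤ) (d : ℕ) (4b≡a²+d : + 4 ℤ.* b ≡ a ℤ.* a ℤ.+ +[1+ d ]) where
  open QuadraticExtension ℤRing a (ℤ.- b)
  private
    module Z = NormIdentities ℤRing
    module E = RingKit extRing
    module EI = NormIdentities extRing
  open Star extRing
  open QuadraticRoots extRing
  open Evaluation extRing using (eval; evaluate)

  conj : Ext → Ext
  conj (p +ω q) = p ℤ.+ a ℤ.* q +ω ℤ.- q

  conjugate : Hom extRing extRing
  conjugate = record
    { ⟦_⟧ = conj
    ; ⟦⟧-cong = λ { {_ +ω _} {_ +ω _} (refl & refl) → refl & refl }
    ; +-homo = λ { (p +ω q) (p′ +ω q′) → Z.conjugate-+ a p q p′ q′ & ℤₚ.neg-distrib-+ q q′ }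
    ; *-homo = λ { (p +ω q) (p′ +ω q′) → Z.conjugate-*₁ a (ℤ.- b) p q p′ q′ & Z.conjugate-*₂ a p q p′ q′ }
    ; 1-homo = Z.conjugate-1 a & refl }
  open Hom conjugate

  norm : Ext → ℤ
  norm (p +ω q) = p ℤ.* p ℤ.+ a ℤ.* (p ℤ.* q) ℤ.+ b ℤ.* (q ℤ.* q)

  *-conjugate : ∀ z → z E.* ⟦ z ⟧ E.≈ (norm z +ω + 0)
  *-conjugate (p +ω q) =
    Z.norm₁ a b p q
    & Z.norm₂ a p q

  -- Completing the square, with the factor 4 to stay integral; the coefficient of q² is 4b - a² = d
  -- + 1, so both squares vanish together with the norm.
  4norm : ∀ p q → + 4 ℤ.* norm (p +ω q) ≡ + (ℤ.∣ + 2 ℤ.* p ℤ.+ a ℤ.* q ∣ ℕ.* ℤ.∣ + 2 ℤ.* p ℤ.+ a ℤ.* q ∣ ℕ.+ suc d ℕ.* (ℤ.∣ q ∣ ℕ.* ℤ.∣ q ∣))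
  4norm p q = begin
    + 4 ℤ.* norm (p +ω q)
      ≡⟨ Z.4norm-split a b p q ⟩
    + 4 ℤ.* (p ℤ.* p ℤ.+ a ℤ.* (p ℤ.* q)) ℤ.+ (+ 4 ℤ.* b) ℤ.* (q ℤ.* q)
      ≡⟨ cong (λ c → + 4 ℤ.* (p ℤ.* p ℤ.+ a ℤ.* (p ℤ.* q)) ℤ.+ c ℤ.* (q ℤ.* q)) 4b≡a²+d ⟩
    + 4 ℤ.* (p ℤ.* p ℤ.+ a ℤ.* (p ℤ.* q)) ℤ.+ (a ℤ.* a ℤ.+ +[1+ d ]) ℤ.* (q ℤ.* q)
      ≡⟨ Z.complete-square a +[1+ d ] p q ⟩
    x ℤ.* x ℤ.+ +[1+ d ] ℤ.* (q ℤ.* q)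
      ≡⟨ cong₂ ℤ._+_ (square-nonneg x) (≡.trans (cong (ℤ._*_ +[1+ d ]) (square-nonneg q)) (≡.sym (ℤₚ.pos-* (suc d) _))) ⟩
    + (ℤ.∣ x ∣ ℕ.* ℤ.∣ x ∣ ℕ.+ suc d ℕ.* (ℤ.∣ q ∣ ℕ.* ℤ.∣ q ∣)) ∎
    where
    open ≡.≡-Reasoning
    x = + 2 ℤ.* p ℤ.+ a ℤ.* q

  norm-nonneg : ∀ z → ∃ λ m → norm z ≡ + m
  norm-nonneg (p +ω q) = 4i≡+m⇒i≡+k (norm (p +ω q)) (4norm p q)

  norm≡0 : ∀ z → norm z ≡ + 0 → z E.≈ E.0#
  norm≡0 (p +ω q) n≡0 = p≡0 & proj₂ x≡0×q≡0
    where
    x≡0×q≡0 : + 2 ℤ.* p ℤ.+ a ℤ.* q ≡ + 0 × q ≡ + 0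
    x≡0×q≡0 = x²+dy²≡0 d _ q (≡.trans (≡.sym (4norm p q)) (cong (ℤ._*_ (+ 4)) n≡0))
    p≡0 : p ≡ + 0
    p≡0 = 2i≡0⇒i≡0 p (≡.trans (Z.drop-zero p a)
      (≡.trans (cong (λ q → + 2 ℤ.* p ℤ.+ a ℤ.* q) (≡.sym (proj₂ x≡0×q≡0))) (proj₁ x≡0×q≡0)))

  -- The square of 2ω - a is negative, so the ring admits no order. But norms are natural numbers,
  -- and at (ω , ω̄) the Bezoutian is built from products of conjugate values only.
  natural : Cone extRing
  natural = record
    { Nonneg = λ z → ∃ λ m → z E.≈ (+ m +ω + 0)
    ; nonneg-resp = λ e (m , f) → m , E.≈-trans (E.≈-sym e) f
    ; nonneg-0 = 0 , E.≈-refl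
    ; nonneg-1 = 1 , E.≈-refl
    ; nonneg-+ = λ (m , e) (n , f) → m ℕ.+ n , E.+-cong e f
    ; nonneg-* = λ (m , e) (n , f) → m ℕ.* n , E.≈-trans (E.*-cong e f) (E.≈-trans (E.≈-sym (Hom.*-homo embed (+ m) (+ n))) (≡.sym (ℤₚ.pos-* m n) & refl))
    ; -1-negative = λ { (_ , (() & _)) } }
  open ConeStar extRing natural using (Nonneg; Positive; nonneg-0; nonneg-*; positive-1; positive-+; positive-*; positive-resp; positive⇒nonneg)

  ω̄ : Ext
  ω̄ = ⟦ ω ⟧

  -- A positive element is here a positive integer, and ω - ω̄ = 2ω - a has the ω-coordinate 2.
  difference-regular : ∀ {z} → Positive z → ¬ ((ω E.+ E.- ω̄) E.* z E.≈ E.0#)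
  difference-regular {z} (r , (m , r≈m) , z≈1+r) e = 2m≢0 (≡.trans (Z.ω-ω̄ a (+ m)) (im≈ e′))
    where
    2m≢0 : ¬ (+ 2 ℤ.* (+ 1 ℤ.+ + m) ≡ + 0)
    2m≢0 ()
    e′ : (ω E.+ E.- ω̄) E.* (+ 1 ℤ.+ + m +ω + 0) E.≈ E.0#
    e′ = E.≈-trans (E.*-congˡ {ω E.+ E.- ω̄} {+ 1 ℤ.+ + m +ω + 0} {z}
      (E.≈-sym (E.≈-trans {z} {E.1# E.+ r} z≈1+r (E.+-congˡ {E.1#} {r} {+ m +ω + 0} r≈m)))) e

  path-conjugate : ∀ l → path ω l E.* path ω̄ l E.≈ (norm (path ω l) +ω + 0)
  path-conjugate l = E.≈-trans (E.*-congˡ {path ω l} (E.≈-sym (path-homo ω l))) (*-conjugate (path ω l))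

  path-nonneg : ∀ l → Nonneg (path ω l E.* path ω̄ l)
  path-nonneg l = let m , e = norm-nonneg (path ω l) in m , E.≈-trans (path-conjugate l) (e & refl)

  christoffel-positive : ∀ l → Positive (christoffel ω ω̄ (suc l))
  christoffel-positive zero    = positive-resp (EI.1≈0+1*1) positive-1
  christoffel-positive (suc l) = positive-+ (christoffel-positive l) (path-nonneg (suc l))

  -- No path has a non-real eigenvalue: if `path ω l` vanished, so would its conjugate, and
  -- Christoffel-Darboux would give (ω - ω̄) K = 0 for a kernel K that starts with 1 and otherwise
  -- adds norms.
  path-nonzero : ∀ l → ¬ (path ω l E.≈ E.0#)
  path-nonzero zero    (() & _)
  path-nonzero (suc l) e = difference-regular (christoffel-positive l) (E.≈-trans
    (E.≈-sym (christoffel-darboux ω ω̄ (suc l)))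
    (E.≈-trans (E.+-cong (E.*-congʳ {path⁻ ω̄ (suc l)} e) (E.-‿cong (E.*-congˡ {path⁻ ω (suc l)}
        (E.≈-trans (E.≈-sym (path-homo ω (suc l))) (E.≈-trans (⟦⟧-cong e) 0-homo)))))
      (EI.annihilate (path⁻ ω̄ (suc l)) (path⁻ ω (suc l)))))

  norm-positive : ∀ z → (∃ λ m → norm z ≡ + m) → ¬ (z E.≈ E.0#) → Positive (norm z +ω + 0)
  norm-positive z (zero  , e) z≉0 = ⊥-elim (z≉0 (norm≡0 z e))
  norm-positive z (suc m , e) z≉0 = (+ m +ω + 0) , (m , E.≈-refl) , (e & refl)

  path-positive : ∀ l → Positive (path ω l E.* path ω̄ l)
  path-positive l = positive-resp (E.≈-sym (path-conjugate l))
    (norm-positive (path ω l) (norm-nonneg (path ω l)) (path-nonzero l))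

  paths-positive : ∀ ls → Positive (paths ω ls E.* paths ω̄ ls)
  paths-positive []       = positive-resp (E.≈-sym (E.*-identityˡ E.1#)) positive-1
  paths-positive (l ∷ ls) = positive-resp
    (EI.*-interchange (path ω l) (path ω̄ l) (paths ω ls) (paths ω̄ ls))
    (positive-* (path-positive l) (paths-positive ls))

  christoffel-nonneg : ∀ l → Nonneg (christoffel ω ω̄ l)
  christoffel-nonneg zero    = nonneg-0
  christoffel-nonneg (suc l) = positive⇒nonneg (christoffel-positive l)

  bezout-positive : ∀ ls → Positive (bezout ω ω̄ ls)
  bezout-positive []       = positive-1
  bezout-positive (l ∷ ls) = positive-+ (positive-* (path-positive l) (bezout-positive ls))
    (nonneg-* (positive⇒nonneg (paths-positive ls)) (christoffel-nonneg l))

  embed-ℤ : ∀ z → (z +ω + 0) E.≈ E.fromℤ z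
  embed-ℤ z = E.≈-trans (≡.sym (fromℤ-ℤ z) & refl) (Hom.fromℤ-homo embed z)

  non-real-impossible : ∀ ls k → ¬ (starPoly ls ℤ[x].≈ᵖ (quadratic a b ℤ[x].*ᵖ k))
  non-real-impossible ls k F≈gk = difference-regular (bezout-positive ls) (E.≈-trans (E.≈-sym (star-bezout ω ω̄ ls))
    (E.≈-trans (E.+-cong (E.*-congʳ {paths ω̄ ls} star-ω) (E.-‿cong (E.*-congʳ {paths ω ls} star-ω̄)))
      (EI.annihilateˡ (paths ω̄ ls) (paths ω ls))))
    where
    root-sum : ω E.+ ω̄ E.≈ E.fromℤ a
    root-sum = E.≈-trans (Z.ω+ω̄ a & refl) (embed-ℤ a)
    root-prod : ω E.* ω̄ E.≈ E.fromℤ b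
    root-prod = E.≈-trans (*-conjugate ω) (E.≈-trans
      (Z.norm-ω a b & refl)
      (embed-ℤ b))
    star-ω : star ω ls E.≈ E.0#
    star-ω = E.≈-trans (E.≈-sym (eval-star ω ls)) (E.≈-trans (Hom.⟦⟧-cong (evaluate ω) F≈gk)
      (E.≈-trans (Hom.*-homo (evaluate ω) (quadratic a b) k)
        (E.≈-trans (E.*-congʳ {eval ω k} (eval-root a b {ω} {ω̄} root-sum root-prod)) (E.zeroˡ (eval ω k)))))
    star-ω̄ : star ω̄ ls E.≈ E.0#
    star-ω̄ = E.≈-trans (E.≈-sym (star-homo ω ls)) (E.≈-trans (⟦⟧-cong star-ω) 0-homo)

-- The characteristic determinant of a starlike tree

module Determinants (R : CommutativeRing 0ℓ 0ℓ) {V : Set} (M : V → V → CommutativeRing.Carrier R) where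
  open RingKit R

  -- Laplace expansion along row r; F is the minor of the remaining rows as a function of the remaining columns.
  laplace : V → (List V → Carrier) → List V → Carrier
  laplace r F []       = 0#
  laplace r F (c ∷ cs) = M r c * F cs + - laplace r (F ∘ (c ∷_)) cs

  -- The determinant with rows `rs` and columns `cs`. Lists of vertices can be shortened and
  -- permuted without the renumbering that `Fin` indices require; lists of unequal length give 0.
  minor : List V → List V → Carrier
  minor []       []      = 1#
  minor []       (_ ∷ _) = 0#
  minor (r ∷ rs) cs      = laplace r (minor rs) cs

  laplace-cong : ∀ r {F G} cs → (∀ ds → F ds ≈ G ds) → laplace r F cs ≈ laplace r G cs
  laplace-cong r []       e = ≈-refl
  laplace-cong r (c ∷ cs) e = +-cong (*-congˡ (e cs)) (-‿cong (laplace-cong r cs (e ∘ (c ∷_))))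

  laplace-neg : ∀ r F cs → laplace r (λ ds → - F ds) cs ≈ - laplace r F cs
  laplace-neg r F []       = ≈-sym -0#≈0#
  laplace-neg r F (c ∷ cs) = begin
    M r c * - F cs + - laplace r (λ ds → - F (c ∷ ds)) cs    ≈⟨ +-congˡ (-‿cong (laplace-neg r (F ∘ (c ∷_)) cs)) ⟩
    M r c * - F cs + - - laplace r (F ∘ (c ∷_)) cs
      ≈⟨ solve 3 (λ m f l → m :* (:- f) :+ (:- (:- l)) := :- (m :* f :+ (:- l))) ≈-refl _ _ _ ⟩
    - laplace r F (c ∷ cs) ∎

  laplace-+ : ∀ r F G cs → laplace r (λ ds → F ds + G ds) cs ≈ laplace r F cs + laplace r G cs
  laplace-+ r F G []       = ≈-sym (+-identityˡ _)
  laplace-+ r F G (c ∷ cs) = begin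
    M r c * (F cs + G cs) + - laplace r (λ ds → F (c ∷ ds) + G (c ∷ ds)) cs
      ≈⟨ +-congˡ (-‿cong (laplace-+ r (F ∘ (c ∷_)) (G ∘ (c ∷_)) cs)) ⟩
    M r c * (F cs + G cs) + - (laplace r (F ∘ (c ∷_)) cs + laplace r (G ∘ (c ∷_)) cs)
      ≈⟨ solve 5 (λ m f g l k → m :* (f :+ g) :+ (:- (l :+ k)) := (m :* f :+ (:- l)) :+ (m :* g :+ (:- k))) ≈-refl _ _ _ _ _ ⟩
    laplace r F (c ∷ cs) + laplace r G (c ∷ cs) ∎

  laplace-scale : ∀ r a F cs → laplace r (λ ds → a * F ds) cs ≈ a * laplace r F cs
  laplace-scale r a F []       = ≈-sym (zeroʳ a)
  laplace-scale r a F (c ∷ cs) = begin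
    M r c * (a * F cs) + - laplace r (λ ds → a * F (c ∷ ds)) cs   ≈⟨ +-congˡ (-‿cong (laplace-scale r a (F ∘ (c ∷_)) cs)) ⟩
    M r c * (a * F cs) + - (a * laplace r (F ∘ (c ∷_)) cs)
      ≈⟨ solve 4 (λ m a f l → m :* (a :* f) :+ (:- (a :* l)) := a :* (m :* f :+ (:- l))) ≈-refl _ _ _ _ ⟩
    a * laplace r F (c ∷ cs) ∎

  -- The first column is used by r, by s or by neither. The first two kinds of terms change places
  -- with opposite signs, the third is the induction.
  laplace-antisym : ∀ r s F cs → laplace r (laplace s F) cs ≈ - laplace s (laplace r F) cs
  laplace-antisym r s F []       = ≈-sym -0#≈0#
  laplace-antisym r s F (c ∷ cs) = begin
    M r c * laplace s F cs + - laplace r (λ ds → M s c * F ds + - laplace s (F ∘ (c ∷_)) ds) cs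
      ≈⟨ +-congˡ (-‿cong (expand r s)) ⟩
    M r c * laplace s F cs + - (M s c * laplace r F cs + - laplace r (laplace s (F ∘ (c ∷_))) cs)
      ≈⟨ +-congˡ (-‿cong (+-congˡ (-‿cong (laplace-antisym r s (F ∘ (c ∷_)) cs)))) ⟩
    M r c * laplace s F cs + - (M s c * laplace r F cs + - - laplace s (laplace r (F ∘ (c ∷_))) cs)
      ≈⟨ solve 3 (λ a b l → a :+ (:- (b :+ (:- (:- l)))) := :- (b :+ (:- (a :+ (:- l))))) ≈-refl _ _ _ ⟩
    - (M s c * laplace r F cs + - (M r c * laplace s F cs + - laplace s (laplace r (F ∘ (c ∷_))) cs))
      ≈⟨ -‿cong (+-congˡ (-‿cong (expand s r))) ⟨
    - laplace s (laplace r F) (c ∷ cs) ∎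
    where
    expand : ∀ r s → laplace r (λ ds → M s c * F ds + - laplace s (F ∘ (c ∷_)) ds) cs
      ≈ M s c * laplace r F cs + - laplace r (laplace s (F ∘ (c ∷_))) cs
    expand r s = ≈-trans (laplace-+ r (λ ds → M s c * F ds) (λ ds → - laplace s (F ∘ (c ∷_)) ds) cs)
      (+-cong (laplace-scale r (M s c) F cs) (laplace-neg r (laplace s (F ∘ (c ∷_))) cs))

  row-swap : ∀ ps r s rs cs → minor (ps ++ r ∷ s ∷ rs) cs ≈ - minor (ps ++ s ∷ r ∷ rs) cs
  row-swap []       r s rs cs = laplace-antisym r s (minor rs) cs
  row-swap (p ∷ ps) r s rs cs = ≈-trans (laplace-cong p cs (row-swap ps r s rs)) (laplace-neg p (minor (ps ++ s ∷ r ∷ rs)) cs)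

  Alternating : (List V → Carrier) → Set
  Alternating F = ∀ ps c d cs → F (ps ++ c ∷ d ∷ cs) ≈ - F (ps ++ d ∷ c ∷ cs)

  laplace-alternating : ∀ r {F} → Alternating F → Alternating (laplace r F)
  laplace-alternating r {F} anti [] c d cs = begin
    M r c * F (d ∷ cs) + - (M r d * F (c ∷ cs) + - laplace r (λ ds → F (c ∷ d ∷ ds)) cs)
      ≈⟨ +-congˡ (-‿cong (+-congˡ (-‿cong (≈-trans (laplace-cong r cs (anti [] c d)) (laplace-neg r _ cs))))) ⟩
    M r c * F (d ∷ cs) + - (M r d * F (c ∷ cs) + - - laplace r (λ ds → F (d ∷ c ∷ ds)) cs)
      ≈⟨ solve 3 (λ a b l → a :+ (:- (b :+ (:- (:- l)))) := :- (b :+ (:- (a :+ (:- l))))) ≈-refl _ _ _ ⟩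
    - laplace r F (d ∷ c ∷ cs) ∎
  laplace-alternating r {F} anti (p ∷ ps) c d cs = begin
    M r p * F (ps ++ c ∷ d ∷ cs) + - laplace r (F ∘ (p ∷_)) (ps ++ c ∷ d ∷ cs)
      ≈⟨ +-cong (*-congˡ (anti ps c d cs)) (-‿cong (laplace-alternating r (λ qs → anti (p ∷ qs)) ps c d cs)) ⟩
    M r p * - F (ps ++ d ∷ c ∷ cs) + - - laplace r (F ∘ (p ∷_)) (ps ++ d ∷ c ∷ cs)
      ≈⟨ solve 3 (λ m f l → m :* (:- f) :+ (:- (:- l)) := :- (m :* f :+ (:- l))) ≈-refl _ _ _ ⟩
    - laplace r F (p ∷ ps ++ d ∷ c ∷ cs) ∎

  column-swap : ∀ rs → Alternating (minor rs)
  column-swap []       []       c d cs = ≈-sym -0#≈0#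
  column-swap []       (p ∷ ps) c d cs = ≈-sym -0#≈0#
  column-swap (r ∷ rs) = laplace-alternating r (column-swap rs)

  principal : List V → Carrier
  principal vs = minor vs vs

  principal-swap : ∀ ps v w vs → principal (ps ++ v ∷ w ∷ vs) ≈ principal (ps ++ w ∷ v ∷ vs)
  principal-swap ps v w vs = ≈-trans (row-swap ps v w vs _)
    (≈-trans (-‿cong (column-swap (ps ++ w ∷ v ∷ vs) ps v w vs)) (-‿involutive _))

  -- The prefix `ps` collects the vertices that `prep` and `swap` leave in front, because
  -- `principal` does not recurse along its list.
  principal-↭-prefix : ∀ ps {vs ws} → vs ↭ ws → principal (ps ++ vs) ≈ principal (ps ++ ws)
  principal-↭-prefix ps Perm.refl = ≈-refl
  principal-↭-prefix ps (Perm.prep {xs} {ys} x p) = subst (λ zs → principal zs ≈ principal (ps ++ x ∷ ys)) (Listₚ.++-assoc ps (x ∷ []) xs)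
    (subst (λ zs → principal ((ps ++ x ∷ []) ++ xs) ≈ principal zs) (Listₚ.++-assoc ps (x ∷ []) ys) (principal-↭-prefix (ps ++ x ∷ []) p))
  principal-↭-prefix ps (Perm.swap {xs} {ys} x y p) = ≈-trans (principal-swap ps x y xs)
    (subst (λ zs → principal zs ≈ principal (ps ++ y ∷ x ∷ ys)) (Listₚ.++-assoc ps (y ∷ x ∷ []) xs)
    (subst (λ zs → principal ((ps ++ y ∷ x ∷ []) ++ xs) ≈ principal zs) (Listₚ.++-assoc ps (y ∷ x ∷ []) ys) (principal-↭-prefix (ps ++ y ∷ x ∷ []) p)))
  principal-↭-prefix ps (Perm.trans p q) = ≈-trans (principal-↭-prefix ps p) (principal-↭-prefix ps q)

  principal-↭ : ∀ {vs ws} → vs ↭ ws → principal vs ≈ principal ws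
  principal-↭ = principal-↭-prefix []

  alt-cong : ∀ k {x y} → x ≈ y → alt rawRing k x ≈ alt rawRing k y
  alt-cong zero    e = e
  alt-cong (suc k) e = -‿cong (alt-cong k e)

  sum-cong : ∀ {n} {f g : Fin n → Carrier} → (∀ i → f i ≈ g i) → sumFin rawRing f ≈ sumFin rawRing g
  sum-cong {zero}  e = ≈-refl
  sum-cong {suc n} e = +-cong (e zero) (sum-cong (e ∘ suc))

  sum-neg : ∀ {n} (f : Fin n → Carrier) → sumFin rawRing (λ i → - f i) ≈ - sumFin rawRing f
  sum-neg {zero}  f = ≈-sym -0#≈0#
  sum-neg {suc n} f = ≈-trans (+-congˡ (sum-neg (f ∘ suc))) (⁻¹-∙-comm _ _)

  -- `alt` negates the j-th summand j times, while `laplace` negates the whole tail at each step;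
  -- one negation at a time is drawn out of the sum.
  laplace-tabulate : ∀ n r F (g : Fin (suc n) → V) →
    sumFin rawRing (λ j → alt rawRing (toℕ j) (M r (g j) * F (tabulate (g ∘ punchIn j)))) ≈ laplace r F (tabulate g)
  laplace-tabulate zero    r F g = +-congˡ (≈-sym -0#≈0#)
  laplace-tabulate (suc n) r F g = +-congˡ (≈-trans
    (sum-neg (λ j → alt rawRing (toℕ j) (M r (g (suc j)) * F (g zero ∷ tabulate (g ∘ suc ∘ punchIn j)))))
    (-‿cong (laplace-tabulate n r (F ∘ (g zero ∷_)) (g ∘ suc))))

  det-minor : ∀ n N (f g : Fin n → V) → (∀ i j → N i j ≈ M (f i) (g j)) → det rawRing n N ≈ minor (tabulate f) (tabulate g)
  det-minor zero    N f g e = ≈-refl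
  det-minor (suc n) N f g e = ≈-trans
    (sum-cong (λ j → alt-cong (toℕ j) (*-cong (e zero j)
      (det-minor n _ (f ∘ suc) (g ∘ punchIn j) (λ i k → e (suc i) (punchIn j k))))))
    (laplace-tabulate n (f zero) (minor (tabulate (f ∘ suc))) g)

  zero-row : ∀ r F {cs} → All (λ c → M r c ≈ 0#) cs → laplace r F cs ≈ 0#
  zero-row r F []       = ≈-refl
  zero-row r F (_∷_ {x = c} {xs = cs} e es) = begin
    M r c * F cs + - laplace r (F ∘ (c ∷_)) cs   ≈⟨ +-cong (*-congʳ e) (-‿cong (zero-row r (F ∘ (c ∷_)) es)) ⟩
    0# * F cs + - 0#                             ≈⟨ solve 1 (λ f → con (+ 0) :* f :+ (:- con (+ 0)) := con (+ 0)) ≈-refl _ ⟩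
    0#                                           ∎

  laplace-zero : ∀ r F cs → (∀ ds → F ds ≈ 0#) → laplace r F cs ≈ 0#
  laplace-zero r F []       e = ≈-refl
  laplace-zero r F (c ∷ cs) e = begin
    M r c * F cs + - laplace r (F ∘ (c ∷_)) cs   ≈⟨ +-cong (*-congˡ (e cs)) (-‿cong (laplace-zero r (F ∘ (c ∷_)) cs (e ∘ (c ∷_)))) ⟩
    M r c * 0# + - 0#                            ≈⟨ solve 1 (λ f → f :* con (+ 0) :+ (:- con (+ 0)) := con (+ 0)) ≈-refl _ ⟩
    0#                                           ∎

  zero-column : ∀ v {rs} → All (λ r → M r v ≈ 0#) rs → ∀ ds → minor rs (v ∷ ds) ≈ 0#
  zero-column v []                              ds = ≈-refl
  zero-column v (_∷_ {x = r} {xs = rs} e es) ds = begin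
    M r v * minor rs ds + - laplace r (λ es → minor rs (v ∷ es)) ds
      ≈⟨ +-cong (*-congʳ e) (-‿cong (laplace-zero r _ ds (zero-column v es))) ⟩
    0# * minor rs ds + - 0#
      ≈⟨ solve 1 (λ f → con (+ 0) :* f :+ (:- con (+ 0)) := con (+ 0)) ≈-refl _ ⟩
    0# ∎

  Detached : V → List V → Set
  Detached v = All (λ u → M v u ≈ 0# × M u v ≈ 0#)

  principal-isolated : ∀ v {vs} → Detached v vs → principal (v ∷ vs) ≈ M v v * principal vs
  principal-isolated v {vs} far = begin
    M v v * principal vs + - laplace v (minor vs ∘ (v ∷_)) vs   ≈⟨ +-congˡ (-‿cong (zero-row v _ (All.map proj₁ far))) ⟩
    M v v * principal vs + - 0#                                 ≈⟨ solve 1 (λ a → a :+ (:- con (+ 0)) := a) ≈-refl _ ⟩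
    M v v * principal vs                                        ∎

  -- Row v can be nonzero only in the columns v and w. In the minor left by column w, column v has
  -- its only nonzero entry in row w, and the two entries -1 cancel in sign.
  principal-pendant : ∀ v w {vs} → Detached v vs → M v w ≈ - 1# → M w v ≈ - 1# →
    principal (v ∷ w ∷ vs) ≈ M v v * principal (w ∷ vs) + - principal vs
  principal-pendant v w {vs} far vw wv = +-congˡ (-‿cong (begin
    M v w * minor (w ∷ vs) (v ∷ vs) + - laplace v (λ ds → minor (w ∷ vs) (v ∷ w ∷ ds)) vs
      ≈⟨ +-cong (*-cong vw (+-cong (*-congʳ wv) (-‿cong (laplace-zero w _ vs (zero-column v (All.map proj₂ far))))))
                (-‿cong (zero-row v _ (All.map proj₁ far))) ⟩
    - 1# * (- 1# * principal vs + - 0#) + - 0#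
      ≈⟨ solve 1 (λ p → (:- con (+ 1)) :* ((:- con (+ 1)) :* p :+ (:- con (+ 0))) :+ (:- con (+ 0)) := p) ≈-refl _ ⟩
    principal vs ∎))

isYes-false : ∀ {P : Set} (p? : Dec P) → ¬ P → ⌊ p? ⌋ ≡ false
isYes-false (yes p) ¬p = ⊥-elim (¬p p)
isYes-false (no _)  ¬p = refl

isYes-true : ∀ {P : Set} (p? : Dec P) → P → ⌊ p? ⌋ ≡ true
isYes-true (yes _)  p = refl
isYes-true (no ¬p) p = ⊥-elim (¬p p)

module StarVertices (k : ℕ) (len : Fin k → ℕ) where
  Vertex : Set
  Vertex = StarV k len

  -- The m vertices of branch i nearest to the centre, outermost first.
  segment : ∀ i m → m ℕ.≤ len i → List Vertex
  segment i zero    _ = []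
  segment i (suc m) p = just (i , Fin.fromℕ< p) ∷ segment i m (ℕₚ.<⇒≤ p)

  branches : List (Fin k) → List Vertex
  branches []       = []
  branches (i ∷ is) = segment i (len i) ℕₚ.≤-refl ++ branches is

  Inner : Fin k → ℕ → Vertex → Set
  Inner i m v = ∃ λ j → v ≡ just (i , j) × toℕ j ℕ.< m

  segment-inner : ∀ i m p → All (Inner i m) (segment i m p)
  segment-inner i zero    p = []
  segment-inner i (suc m) p = (_ , refl , s≤s (ℕₚ.≤-reflexive (Finₚ.toℕ-fromℕ< p)))
    ∷ All.map (λ (j , e , lt) → j , e , ℕₚ.m≤n⇒m≤1+n lt) (segment-inner i m (ℕₚ.<⇒≤ p))

  OnBranch : List (Fin k) → Vertex → Set
  OnBranch is v = ∃ λ i → ∃ λ j → i ∈ is × v ≡ just (i , j)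

  branches-on : ∀ is → All (OnBranch is) (branches is)
  branches-on []       = []
  branches-on (i ∷ is) = Allₚ.++⁺
    (All.map (λ (j , e , _) → i , j , here refl , e) (segment-inner i (len i) ℕₚ.≤-refl))
    (All.map (λ (i′ , j , i′∈ , e) → i′ , j , there i′∈ , e) (branches-on is))

  ∈-segment : ∀ i j m p → toℕ j ℕ.< m → just (i , j) ∈ segment i m p
  ∈-segment i j (suc m) p (s≤s j≤m) with toℕ j ℕ.≟ m
  ... | yes refl = here (cong (λ j → just (i , j)) (≡.sym (Finₚ.fromℕ<-toℕ j p)))
  ... | no j≢m   = there (∈-segment i j m (ℕₚ.<⇒≤ p) (ℕₚ.≤∧≢⇒< j≤m j≢m))

  ∈-branches : ∀ {i is} j → i ∈ is → just (i , j) ∈ branches is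
  ∈-branches {i} j (here refl) = ∈ₚ.∈-++⁺ˡ (∈-segment i j (len i) ℕₚ.≤-refl (Finₚ.toℕ<n j))
  ∈-branches     j (there {x = i′} i∈) = ∈ₚ.∈-++⁺ʳ (segment i′ (len i′) ℕₚ.≤-refl) (∈-branches j i∈)

  just-injective₁ : ∀ {i i′ j j′} → _≡_ {A = Vertex} (just (i , j)) (just (i′ , j′)) → i ≡ i′
  just-injective₁ refl = refl

  segment-unique : ∀ i m p → Unique (segment i m p)
  segment-unique i zero    p = []
  segment-unique i (suc m) p =
    All.map (λ { (j , refl , lt) refl → ℕₚ.<-irrefl (Finₚ.toℕ-fromℕ< p) lt }) (segment-inner i m (ℕₚ.<⇒≤ p))
    ∷ segment-unique i m (ℕₚ.<⇒≤ p)

  branches-unique : ∀ {is} → Unique is → Unique (branches is)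
  branches-unique [] = []
  branches-unique {i ∷ is} (i∉ ∷ u) = Uniqueₚ.++⁺ (segment-unique i (len i) ℕₚ.≤-refl) (branches-unique u)
    (λ (v∈ , v∈′) → disjoint (All.lookup (segment-inner i (len i) ℕₚ.≤-refl) v∈) (All.lookup (branches-on is) v∈′))
    where
    disjoint : ∀ {v} → Inner i (len i) v → ¬ OnBranch is v
    disjoint (j , refl , _) (i′ , j′ , i′∈ , refl) = All.lookup i∉ i′∈ refl

  vertices : List Vertex
  vertices = nothing ∷ branches (allFin k)

  vertices-unique : Unique vertices
  vertices-unique = All.map (λ { (_ , _ , _ , refl) () }) (branches-on (allFin k)) ∷ branches-unique (Uniqueₚ.allFin⁺ k)

  ∈-vertices : ∀ v → v ∈ vertices
  ∈-vertices nothing        = here refl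
  ∈-vertices (just (i , j)) = there (∈-branches j (∈ₚ.∈-allFin i))

  segment-length : ∀ i m p → length (segment i m p) ≡ m
  segment-length i zero    p = refl
  segment-length i (suc m) p = cong suc (segment-length i m (ℕₚ.<⇒≤ p))

  branches-length : ∀ is → length (branches is) ≡ sum (map len is)
  branches-length []       = refl
  branches-length (i ∷ is) = ≡.trans (Listₚ.length-++ (segment i (len i) ℕₚ.≤-refl))
    (cong₂ ℕ._+_ (segment-length i (len i) ℕₚ.≤-refl) (branches-length is))

  adjacent : Vertex → Vertex → Bool
  adjacent = starAdj k len

  record Apart (v w : Vertex) : Set where
    constructor apart
    field
      distinct : v ≢ w
      nonadj   : adjacent v w ≡ false
      nonadj′  : adjacent w v ≡ false

  apart-branches : ∀ {i i′} j j′ → i ≢ i′ → Apart (just (i , j)) (just (i′ , j′))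
  apart-branches {i} {i′} j j′ i≢i′ = apart (i≢i′ ∘ just-injective₁)
    (cong (_∧ _) (isYes-false (i Finₚ.≟ i′) i≢i′)) (cong (_∧ _) (isYes-false (i′ Finₚ.≟ i) (i≢i′ ∘ ≡.sym)))

  apart-centre : ∀ i j → toℕ j ≢ 0 → Apart (just (i , j)) nothing
  apart-centre i j j≢0 = apart (λ ()) (isYes-false (toℕ j ℕ.≟ 0) j≢0) (isYes-false (toℕ j ℕ.≟ 0) j≢0)

  not-consecutive : ∀ {a b} → suc b ℕ.< a → ⌊ suc a ℕ.≟ b ⌋ ∨ ⌊ suc b ℕ.≟ a ⌋ ≡ false
  not-consecutive {a} {b} lt = cong₂ _∨_
    (isYes-false (suc a ℕ.≟ b) λ { refl → ℕₚ.<-asym lt (ℕₚ.m≤n⇒m≤1+n ℕₚ.≤-refl) })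
    (isYes-false (suc b ℕ.≟ a) λ { refl → ℕₚ.<-irrefl refl lt })

  not-consecutive′ : ∀ {a b} → suc b ℕ.< a → ⌊ suc b ℕ.≟ a ⌋ ∨ ⌊ suc a ℕ.≟ b ⌋ ≡ false
  not-consecutive′ {a} {b} lt = cong₂ _∨_
    (isYes-false (suc b ℕ.≟ a) λ { refl → ℕₚ.<-irrefl refl lt })
    (isYes-false (suc a ℕ.≟ b) λ { refl → ℕₚ.<-asym lt (ℕₚ.m≤n⇒m≤1+n ℕₚ.≤-refl) })

  apart-segment : ∀ i j j′ → suc (toℕ j′) ℕ.< toℕ j → Apart (just (i , j)) (just (i , j′))
  apart-segment i j j′ lt = apart (λ { refl → ℕₚ.<-asym lt ℕₚ.≤-refl })
    (cong₂ _∧_ (isYes-true (i Finₚ.≟ i) refl) (not-consecutive lt))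
    (cong₂ _∧_ (isYes-true (i Finₚ.≟ i) refl) (not-consecutive′ lt))

  adjacent-self : ∀ v → adjacent v v ≡ false
  adjacent-self nothing        = refl
  adjacent-self (just (i , j)) = cong₂ _∧_ (isYes-true (i Finₚ.≟ i) refl)
    (cong₂ _∨_ (isYes-false (suc (toℕ j) ℕ.≟ toℕ j) ℕₚ.1+n≢n) (isYes-false (suc (toℕ j) ℕ.≟ toℕ j) ℕₚ.1+n≢n))

  adjacent-consecutive : ∀ i j j′ → toℕ j ≡ suc (toℕ j′) →
    adjacent (just (i , j)) (just (i , j′)) ≡ true × adjacent (just (i , j′)) (just (i , j)) ≡ true
  adjacent-consecutive i j j′ e =
    cong₂ _∧_ (isYes-true (i Finₚ.≟ i) refl) (≡.trans (cong (⌊ suc (toℕ j) ℕ.≟ toℕ j′ ⌋ ∨_) step) (Boolₚ.∨-zeroʳ _))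
    , cong₂ _∧_ (isYes-true (i Finₚ.≟ i) refl) (cong (_∨ ⌊ suc (toℕ j) ℕ.≟ toℕ j′ ⌋) step)
    where
    step : ⌊ suc (toℕ j′) ℕ.≟ toℕ j ⌋ ≡ true
    step = isYes-true (suc (toℕ j′) ℕ.≟ toℕ j) (≡.sym e)

module StarDeterminant (R : CommutativeRing 0ℓ 0ℓ) (x : CommutativeRing.Carrier R) {n : ℕ} (A : Graph n)
  (k : ℕ) (len : Fin k → ℕ) (φ : Fin n ↔ StarV k len)
  (A≡ : ∀ u v → A u v ≡ starAdj k len (Inverse.to φ u) (Inverse.to φ v)) where
  open RingKit R
  open Star R
  open StarVertices k len
  open Inverse φ using (to; from; strictlyInverseˡ; strictlyInverseʳ)

  entry : Bool → Bool → Carrier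
  entry same adj = (if same then x else 0#) + - (if adj then 1# else 0#)

  matrix : Vertex → Vertex → Carrier
  matrix v w = charMatrix rawRing x A (from v) (from w)

  matrix≡entry : ∀ v w → matrix v w ≡ entry ⌊ from v Finₚ.≟ from w ⌋ (adjacent v w)
  matrix≡entry v w = cong (entry ⌊ from v Finₚ.≟ from w ⌋)
    (≡.trans (A≡ (from v) (from w)) (cong₂ adjacent (strictlyInverseˡ v) (strictlyInverseˡ w)))

  from-injective : ∀ {v w} → from v ≡ from w → v ≡ w
  from-injective {v} {w} e = ≡.trans (≡.sym (strictlyInverseˡ v)) (≡.trans (cong to e) (strictlyInverseˡ w))

  diagonal : ∀ v → matrix v v ≈ x
  diagonal v = ≈-trans (≈-reflexive (≡.trans (matrix≡entry v v)
      (cong₂ entry (isYes-true (from v Finₚ.≟ from v) refl) (adjacent-self v))))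
    (≈-trans (+-congˡ -0#≈0#) (+-identityʳ x))

  entry-apart : ∀ {v w} → v ≢ w → adjacent v w ≡ false → matrix v w ≈ 0#
  entry-apart {v} {w} v≢w e = ≈-trans (≈-reflexive (≡.trans (matrix≡entry v w)
      (cong₂ entry (isYes-false (from v Finₚ.≟ from w) (v≢w ∘ from-injective)) e)))
    (-‿inverseʳ 0#)

  entry-adjacent : ∀ {v w} → v ≢ w → adjacent v w ≡ true → matrix v w ≈ - 1#
  entry-adjacent {v} {w} v≢w e = ≈-trans (≈-reflexive (≡.trans (matrix≡entry v w)
      (cong₂ entry (isYes-false (from v Finₚ.≟ from w) (v≢w ∘ from-injective)) e)))
    (+-identityˡ _)

  open Determinants R matrix

  detached : ∀ {v ws} → All (Apart v) ws → Detached v ws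
  detached = All.map λ (apart v≢w e e′) → entry-apart v≢w e , entry-apart (v≢w ∘ ≡.sym) e′

  pendant : ∀ v w {ws} → All (Apart v) ws → v ≢ w → adjacent v w ≡ true → adjacent w v ≡ true →
    principal (v ∷ w ∷ ws) ≈ x * principal (w ∷ ws) + - principal ws
  pendant v w far v≢w vw wv = ≈-trans
    (principal-pendant v w (detached far) (entry-adjacent v≢w vw) (entry-adjacent (v≢w ∘ ≡.sym) wv))
    (+-congʳ (*-congʳ (diagonal v)))

  Elsewhere : Fin k → List Vertex → Set
  Elsewhere i = All λ w → ∃ λ i′ → ∃ λ j′ → i ≢ i′ × w ≡ just (i′ , j′)

  apart-elsewhere : ∀ {i ws} j → Elsewhere i ws → All (Apart (just (i , j))) ws
  apart-elsewhere j = All.map λ { (_ , j′ , i≢i′ , refl) → apart-branches j j′ i≢i′ }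

  apart-inner : ∀ i m p q → All (Apart (just (i , Fin.fromℕ< {suc m} p))) (segment i m q)
  apart-inner i m p q = All.map
    (λ { (j , refl , lt) → apart-segment i _ j (ℕₚ.<-≤-trans (s≤s lt) (ℕₚ.≤-reflexive (≡.sym (Finₚ.toℕ-fromℕ< p)))) })
    (segment-inner i m q)

  segment-step : ∀ i m p {ws} → All (Apart (just (i , Fin.fromℕ< p))) ws →
    principal (segment i (suc (suc m)) p ++ ws)
      ≈ x * principal (segment i (suc m) (ℕₚ.<⇒≤ p) ++ ws) + - principal (segment i m (ℕₚ.<⇒≤ (ℕₚ.<⇒≤ p)) ++ ws)
  segment-step i m p far = pendant _ _ (Allₚ.++⁺ (apart-inner i m p _) far)
    (λ { e → ℕₚ.1+n≢n (≡.trans (≡.sym outer≡) (≡.trans (cong (λ { (just (i , j)) → toℕ j ; nothing → 0 }) e) inner≡)) })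
    (proj₁ consecutive) (proj₂ consecutive)
    where
    outer≡ = Finₚ.toℕ-fromℕ< p
    inner≡ = Finₚ.toℕ-fromℕ< (ℕₚ.<⇒≤ p)
    consecutive = adjacent-consecutive i (Fin.fromℕ< p) (Fin.fromℕ< (ℕₚ.<⇒≤ p)) (≡.trans outer≡ (cong suc (≡.sym inner≡)))

  detached-segment : ∀ i m p {ws} → Elsewhere i ws → principal (segment i m p ++ ws) ≈ path x m * principal ws
  detached-segment i zero          p far = ≈-sym (*-identityˡ _)
  detached-segment i (suc zero)    p far = ≈-trans (principal-isolated _ (detached (apart-elsewhere _ far)))
    (*-congʳ (≈-trans (diagonal _) (solve 1 (λ x → x := x :* con (+ 1) :- con (+ 0)) ≈-refl x)))
  detached-segment i (suc (suc m)) p {ws} far = begin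
    principal (segment i (suc (suc m)) p ++ ws)   ≈⟨ segment-step i m p (apart-elsewhere _ far) ⟩
    _   ≈⟨ +-cong (*-congˡ (detached-segment i (suc m) _ far)) (-‿cong (detached-segment i m _ far)) ⟩
    x * (path x (suc m) * principal ws) + - (path x m * principal ws)
      ≈⟨ solve 4 (λ x a b f → x :* (a :* f) :- b :* f := (x :* a :- b) :* f) ≈-refl x (path x (suc m)) (path x m) (principal ws) ⟩
    path x (suc (suc m)) * principal ws ∎

  -- The outermost vertex is pendant, so both sides obey the path recursion in m. They agree for m =
  -- 0 and m = 1; in the latter case the neighbour of the pendant vertex is the centre.
  central-segment : ∀ i m p {ws} → Elsewhere i ws →
    principal (segment i m p ++ nothing ∷ ws) ≈ path x m * principal (nothing ∷ ws) + - (path⁻ x m * principal ws)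
  central-segment i zero p {ws} far =
    solve 2 (λ f g → f := con (+ 1) :* f :- con (+ 0) :* g) ≈-refl (principal (nothing ∷ ws)) (principal ws)
  central-segment i (suc zero) p {ws} far = begin
    principal (just (i , Fin.fromℕ< p) ∷ nothing ∷ ws)
      ≈⟨ pendant _ nothing (apart-elsewhere _ far) (λ ()) innermost innermost ⟩
    x * principal (nothing ∷ ws) + - principal ws
      ≈⟨ solve 3 (λ x f g → x :* f :- g := (x :* con (+ 1) :- con (+ 0)) :* f :- con (+ 1) :* g) ≈-refl x (principal (nothing ∷ ws)) (principal ws) ⟩
    path x 1 * principal (nothing ∷ ws) + - (path⁻ x 1 * principal ws) ∎
    where
    innermost : ⌊ toℕ (Fin.fromℕ< p) ℕ.≟ 0 ⌋ ≡ true
    innermost = isYes-true (toℕ (Fin.fromℕ< p) ℕ.≟ 0) (Finₚ.toℕ-fromℕ< p)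
  central-segment i (suc (suc m)) p {ws} far = begin
    principal (segment i (suc (suc m)) p ++ nothing ∷ ws)
      ≈⟨ segment-step i m p (apart-centre i _ (λ e → ℕₚ.1+n≢0 (≡.trans (≡.sym (Finₚ.toℕ-fromℕ< p)) e)) ∷ apart-elsewhere _ far) ⟩
    _ ≈⟨ +-cong (*-congˡ (central-segment i (suc m) _ far)) (-‿cong (central-segment i m _ far)) ⟩
    x * (path x (suc m) * f + - (path x m * g)) + - (path x m * f + - (path⁻ x m * g))
      ≈⟨ solve 6 (λ x a b c f g → x :* (a :* f :- b :* g) :- (b :* f :- c :* g) := (x :* a :- b) :* f :- (x :* b :- c) :* g)
           ≈-refl x (path x (suc m)) (path x m) (path⁻ x m) f g ⟩
    path x (suc (suc m)) * f + - (path⁻ x (suc (suc m)) * g) ∎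
    where
    f = principal (nothing ∷ ws)
    g = principal ws

  elsewhere : ∀ {i is} → All (i ≢_) is → Elsewhere i (branches is)
  elsewhere i∉ = All.map (λ (i′ , j , i′∈ , e) → i′ , j , All.lookup i∉ i′∈ , e) (branches-on _)

  principal-branches : ∀ {is} → Unique is → principal (branches is) ≈ paths x (map len is)
  principal-branches []       = ≈-refl
  principal-branches {i ∷ is} (i∉ ∷ u) =
    ≈-trans (detached-segment i (len i) ℕₚ.≤-refl (elsewhere i∉)) (*-congˡ (principal-branches u))

  principal-star : ∀ {is} → Unique is → principal (nothing ∷ branches is) ≈ star x (map len is)
  principal-star [] = ≈-trans (principal-isolated nothing []) (≈-trans (*-identityʳ _) (diagonal nothing))
  principal-star {i ∷ is} (i∉ ∷ u) = begin
    principal (nothing ∷ segment i (len i) ℕₚ.≤-refl ++ branches is)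
      -- The centre moves behind the branch, so that a pendant vertex stands first.
      ≈⟨ principal-↭ (Permₚ.shift nothing (segment i (len i) ℕₚ.≤-refl) (branches is)) ⟨
    principal (segment i (len i) ℕₚ.≤-refl ++ nothing ∷ branches is)
      ≈⟨ central-segment i (len i) ℕₚ.≤-refl (elsewhere i∉) ⟩
    _ ≈⟨ +-cong (*-congˡ (principal-star u)) (-‿cong (*-congˡ (principal-branches u))) ⟩
    star x (map len (i ∷ is)) ∎

  to-injective : ∀ {i j} → to i ≡ to j → i ≡ j
  to-injective {i} {j} e = ≡.trans (≡.sym (strictlyInverseʳ i)) (≡.trans (cong from e) (strictlyInverseʳ j))

  enumeration : tabulate to ↭ vertices
  enumeration = ∼bag⇒↭ (unique∧set⇒bag (Uniqueₚ.tabulate⁺ to-injective) vertices-unique (λ {v} → mk⇔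
    (λ _ → ∈-vertices v) (λ _ → subst (_∈ tabulate to) (strictlyInverseˡ v) (∈ₚ.∈-tabulate⁺ (from v)))))

  vertex-count : n ≡ suc (sum (tabulate len))
  vertex-count = ≡.trans (≡.sym (Listₚ.length-tabulate to)) (≡.trans (Permₚ.↭-length enumeration)
    (cong suc (≡.trans (branches-length (allFin k)) (cong sum (Listₚ.map-tabulate id len)))))

  det-star : det rawRing n (charMatrix rawRing x A) ≈ star x (tabulate len)
  det-star = begin
    det rawRing n (charMatrix rawRing x A)
      ≈⟨ det-minor n (charMatrix rawRing x A) to to (λ i j →
           ≈-reflexive (≡.sym (cong₂ (charMatrix rawRing x A) (strictlyInverseʳ i) (strictlyInverseʳ j)))) ⟩
    principal (tabulate to)   ≈⟨ principal-↭ enumeration ⟩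
    principal vertices        ≈⟨ principal-star (Uniqueₚ.allFin⁺ k) ⟩
    star x (map len (allFin k)) ≈⟨ ≈-reflexive (cong (star x) (Listₚ.map-tabulate id len)) ⟩
    star x (tabulate len)     ∎

-- The value at 2

module ValueAtTwo where
  open Star ℤRing
  open Cone ℤCone using (Nonneg; nonneg-+; nonneg-*)

  path-at-2 : ∀ l → path (+ 2) l ≡ + suc l × path⁻ (+ 2) l ≡ + l
  path-at-2 zero    = refl , refl
  path-at-2 (suc l) = ≡.trans (cong₂ (λ p q → + 2 ℤ.* p ℤ.+ ℤ.- q) (proj₁ (path-at-2 l)) (proj₂ (path-at-2 l)))
      (2[1+l]-l (+ l)) , proj₁ (path-at-2 l)
    where
    2[1+l]-l : ∀ l → + 2 ℤ.* (+ 1 ℤ.+ l) ℤ.+ ℤ.- l ≡ + 2 ℤ.+ l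
    2[1+l]-l = Z.solve 1 (λ l → Z.con (+ 2) Z.:* (Z.con (+ 1) Z.:+ l) Z.:+ Z.:- l Z.:= Z.con (+ 2) Z.:+ l) refl
      where module Z = RingKit ℤRing

  -- The state (star , paths) at 2 after none, one, two or more nonempty branches of lengths n + 1.
  data State {k} (len : Fin k → ℕ) (f q : ℤ) : Set where
    none : (∀ i → len i ≡ 0) → f ≡ + 2 → q ≡ + 1 → State len f q
    one  : ∀ i₀ n → Nonneg n → (∀ i → len i ≢ 0 → i ≡ i₀) → f ≡ + 3 ℤ.+ n → q ≡ + 2 ℤ.+ n → State len f q
    two  : ∀ i₀ i₁ n n′ → Nonneg n → Nonneg n′ → (∀ i → len i ≢ 0 → i ≡ i₀ ⊎ i ≡ i₁) →
           f ≡ + 4 ℤ.+ n ℤ.+ n′ → q ≡ (+ 2 ℤ.+ n) ℤ.* (+ 2 ℤ.+ n′) → State len f q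
    many : ∀ d e → Nonneg d → Nonneg e → f ≡ + 4 ℤ.- d → q ≡ + 4 ℤ.+ e → State len f q

  private
    module Z = RingKit ℤRing
    open Z using (_:+_; _:*_; _:-_; _:=_; con)

  -- At 2 a branch with m - 1 vertices has the path values m and m - 1, so this is the recursion of
  -- `star` there.
  step : ℤ → ℤ → ℤ → ℤ
  step m f q = m ℤ.* f ℤ.+ ℤ.- ((m ℤ.- + 1) ℤ.* q)

  step-1 : ∀ f q → step (+ 1) f q ≡ f
  step-1 = Z.solve 2 (λ f q → con (+ 1) :* f :- (con (+ 1) :- con (+ 1)) :* q := f) refl

  step-2 : ∀ m → step (+ 2 ℤ.+ m) (+ 2) (+ 1) ≡ + 3 ℤ.+ m
  step-2 = Z.solve 1 (λ m → (con (+ 2) :+ m) :* con (+ 2) :- ((con (+ 2) :+ m) :- con (+ 1)) :* con (+ 1) := con (+ 3) :+ m) refl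

  step-3 : ∀ m n → step (+ 2 ℤ.+ m) (+ 3 ℤ.+ n) (+ 2 ℤ.+ n) ≡ + 4 ℤ.+ m ℤ.+ n
  step-3 = Z.solve 2 (λ m n → (con (+ 2) :+ m) :* (con (+ 3) :+ n) :- ((con (+ 2) :+ m) :- con (+ 1)) :* (con (+ 2) :+ n)
    := con (+ 4) :+ m :+ n) refl

  step-4 : ∀ m n n′ → step (+ 2 ℤ.+ m) (+ 4 ℤ.+ n ℤ.+ n′) ((+ 2 ℤ.+ n) ℤ.* (+ 2 ℤ.+ n′))
    ≡ + 4 ℤ.- (m ℤ.* n ℤ.+ m ℤ.* n′ ℤ.+ n ℤ.* n′ ℤ.+ m ℤ.* (n ℤ.* n′))
  step-4 = Z.solve 3 (λ m n n′ → (con (+ 2) :+ m) :* (con (+ 4) :+ n :+ n′)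
      :- ((con (+ 2) :+ m) :- con (+ 1)) :* ((con (+ 2) :+ n) :* (con (+ 2) :+ n′))
    := con (+ 4) :- (m :* n :+ m :* n′ :+ n :* n′ :+ m :* (n :* n′))) refl

  product-4 : ∀ m n n′ → (+ 2 ℤ.+ m) ℤ.* ((+ 2 ℤ.+ n) ℤ.* (+ 2 ℤ.+ n′))
    ≡ + 4 ℤ.+ (+ 4 ℤ.+ (+ 4 ℤ.* (m ℤ.+ n ℤ.+ n′) ℤ.+ + 2 ℤ.* (m ℤ.* n ℤ.+ m ℤ.* n′ ℤ.+ n ℤ.* n′) ℤ.+ m ℤ.* (n ℤ.* n′)))
  product-4 = Z.solve 3 (λ m n n′ → (con (+ 2) :+ m) :* ((con (+ 2) :+ n) :* (con (+ 2) :+ n′))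
    := con (+ 4) :+ (con (+ 4) :+ (con (+ 4) :* (m :+ n :+ n′) :+ con (+ 2) :* (m :* n :+ m :* n′ :+ n :* n′) :+ m :* (n :* n′)))) refl

  step-many : ∀ m d e → step (+ 2 ℤ.+ m) (+ 4 ℤ.- d) (+ 4 ℤ.+ e) ≡ + 4 ℤ.- ((+ 2 ℤ.+ m) ℤ.* d ℤ.+ (+ 1 ℤ.+ m) ℤ.* e)
  step-many = Z.solve 3 (λ m d e → (con (+ 2) :+ m) :* (con (+ 4) :- d) :- ((con (+ 2) :+ m) :- con (+ 1)) :* (con (+ 4) :+ e)
    := con (+ 4) :- ((con (+ 2) :+ m) :* d :+ (con (+ 1) :+ m) :* e)) refl

  product-many : ∀ m e → (+ 2 ℤ.+ m) ℤ.* (+ 4 ℤ.+ e) ≡ + 4 ℤ.+ ((+ 4 ℤ.+ + 4 ℤ.* m) ℤ.+ (+ 2 ℤ.+ m) ℤ.* e)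
  product-many = Z.solve 2 (λ m e → (con (+ 2) :+ m) :* (con (+ 4) :+ e)
    := con (+ 4) :+ ((con (+ 4) :+ con (+ 4) :* m) :+ (con (+ 2) :+ m) :* e)) refl

  ℕ-nonneg : ∀ n → Nonneg (+ n)
  ℕ-nonneg n = n , refl

  -- An empty branch has m = 1 and changes nothing. The third nonempty branch brings about f ≤ 4 ≤
  -- q, with f = 4 for K_{1,3} itself, and this persists because mf - (m - 1)q = f - (m - 1)(q - f).
  advance : ∀ {k} (len : Fin (suc k) → ℕ) {f q} → State (len ∘ suc) f q →
    State len (step (+ suc (len zero)) f q) (+ suc (len zero) ℤ.* q)
  advance len {f} {q} s with len zero in l≡
  advance len {f} {q} s | zero = shift (subst₂-State (≡.sym (step-1 f q)) (≡.sym (ℤₚ.*-identityˡ q)) s)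
    where
    subst₂-State : ∀ {f f′ q q′} → f ≡ f′ → q ≡ q′ → State (len ∘ suc) f q → State (len ∘ suc) f′ q′
    subst₂-State refl refl s = s
    shift : ∀ {f q} → State (len ∘ suc) f q → State len f q
    shift (none z f≡ q≡) = none (λ { zero → l≡ ; (suc i) → z i }) f≡ q≡
    shift (one i₀ n n≥0 only f≡ q≡) = one (suc i₀) n n≥0
      (λ { zero l≢0 → ⊥-elim (l≢0 l≡) ; (suc i) l≢0 → cong suc (only i l≢0) }) f≡ q≡
    shift (two i₀ i₁ n n′ n≥0 n′≥0 only f≡ q≡) = two (suc i₀) (suc i₁) n n′ n≥0 n′≥0
      (λ { zero l≢0 → ⊥-elim (l≢0 l≡) ; (suc i) l≢0 → Data.Sum.map (cong suc) (cong suc) (only i l≢0) }) f≡ q≡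
    shift (many d e d≥0 e≥0 f≡ q≡) = many d e d≥0 e≥0 f≡ q≡
  advance len (none z refl refl) | suc l = one zero (+ l) (ℕ-nonneg l)
    (λ { zero _ → refl ; (suc i) l≢0 → ⊥-elim (l≢0 (z i)) }) (step-2 (+ l)) (ℤₚ.*-identityʳ _)
  advance len (one i₀ n n≥0 only refl refl) | suc l = two zero (suc i₀) (+ l) n (ℕ-nonneg l) n≥0
    (λ { zero _ → inj₁ refl ; (suc i) l≢0 → inj₂ (cong suc (only i l≢0)) }) (step-3 (+ l) n) refl
  advance len (two i₀ i₁ n n′ n≥0 n′≥0 only refl refl) | suc l = many _ _
    (nonneg-+ (nonneg-+ (nonneg-+ (nonneg-* m≥0 n≥0) (nonneg-* m≥0 n′≥0)) (nonneg-* n≥0 n′≥0)) (nonneg-* m≥0 (nonneg-* n≥0 n′≥0)))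
    (nonneg-+ (ℕ-nonneg 4) (nonneg-+ (nonneg-+ (nonneg-* (ℕ-nonneg 4) (nonneg-+ (nonneg-+ m≥0 n≥0) n′≥0))
      (nonneg-* (ℕ-nonneg 2) (nonneg-+ (nonneg-+ (nonneg-* m≥0 n≥0) (nonneg-* m≥0 n′≥0)) (nonneg-* n≥0 n′≥0)))) (nonneg-* m≥0 (nonneg-* n≥0 n′≥0))))
    (step-4 (+ l) n n′) (product-4 (+ l) n n′)
    where m≥0 = ℕ-nonneg l
  advance len (many d e d≥0 e≥0 refl refl) | suc l = many _ _
    (nonneg-+ (nonneg-* (ℕ-nonneg (2 ℕ.+ l)) d≥0) (nonneg-* (ℕ-nonneg (1 ℕ.+ l)) e≥0))
    (nonneg-+ (nonneg-+ (ℕ-nonneg 4) (nonneg-* (ℕ-nonneg 4) (ℕ-nonneg l))) (nonneg-* (ℕ-nonneg (2 ℕ.+ l)) e≥0))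
    (step-many (+ l) d e) (product-many (+ l) e)

  state : ∀ k (len : Fin k → ℕ) → State len (star (+ 2) (tabulate len)) (paths (+ 2) (tabulate len))
  state zero    len = none (λ ()) refl refl
  state (suc k) len = subst₂ (State len)
    (≡.sym (cong₂ (λ p p⁻ → p ℤ.* f ℤ.+ ℤ.- (p⁻ ℤ.* q)) (proj₁ (path-at-2 (len zero))) (proj₂ (path-at-2 (len zero)))))
    (≡.sym (cong (ℤ._* q) (proj₁ (path-at-2 (len zero)))))
    (advance len (state k (len ∘ suc)))
    where
    open ≡ using (subst₂)
    f = star (+ 2) (tabulate (len ∘ suc))
    q = paths (+ 2) (tabulate (len ∘ suc))

  star-at-2≤4 : ∀ k (len : Fin k → ℕ) (branch : Fin 3 → Fin k) → (∀ i j → branch i ≡ branch j → i ≡ j) →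
    (∀ i → len (branch i) ≢ 0) → ∃ λ d → star (+ 2) (tabulate len) ≡ + 4 ℤ.- + d
  star-at-2≤4 k len branch injective nonempty with state k len
  ... | none z _ _ = ⊥-elim (nonempty zero (z _))
  ... | one i₀ _ _ only _ _ with injective zero (suc zero) (≡.trans (only _ (nonempty zero)) (≡.sym (only _ (nonempty (suc zero)))))
  ...   | ()
  star-at-2≤4 k len branch injective nonempty | many _ _ (d , refl) _ f≡ _ = d , f≡
  star-at-2≤4 k len branch injective nonempty | two i₀ i₁ _ _ _ _ only _ _ = ⊥-elim (pigeonhole (λ i → only _ (nonempty i)))
    where
    same : ∀ i j {v} → branch i ≡ v → branch j ≡ v → i ≡ j
    same i j e e′ = injective i j (≡.trans e (≡.sym e′))
    0≢1 : zero ≢ (Fin 3 ∋ suc zero)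
    0≢1 ()
    0≢2 : zero ≢ (Fin 3 ∋ suc (suc zero))
    0≢2 ()
    1≢2 : suc zero ≢ (Fin 3 ∋ suc (suc zero))
    1≢2 ()
    pigeonhole : ¬ (∀ i → branch i ≡ i₀ ⊎ branch i ≡ i₁)
    pigeonhole h with h zero | h (suc zero) | h (suc (suc zero))
    ... | inj₁ a | inj₁ b | _      = 0≢1 (same _ _ a b)
    ... | inj₂ a | inj₂ b | _      = 0≢1 (same _ _ a b)
    ... | inj₁ a | inj₂ b | inj₁ c = 0≢2 (same _ _ a c)
    ... | inj₁ a | inj₂ b | inj₂ c = 1≢2 (same _ _ b c)
    ... | inj₂ a | inj₁ b | inj₁ c = 1≢2 (same _ _ b c)
    ... | inj₂ a | inj₁ b | inj₂ c = 0≢2 (same _ _ a c)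

-- The three branches of a claw

module Claw (k : ℕ) (len : Fin k → ℕ) where
  open StarVertices k len

  isYes⇒ : ∀ {P : Set} (p? : Dec P) → ⌊ p? ⌋ ≡ true → P
  isYes⇒ (yes p) _ = p

  Branches : Set
  Branches = Σ (Fin 3 → Fin k) λ branch → (∀ i j → branch i ≡ branch j → i ≡ j) × (∀ i → len (branch i) ≢ 0)

  inhabited : ∀ {m} → Fin m → m ≢ 0
  inhabited () refl

  centre-neighbour : ∀ v → adjacent nothing v ≡ true → ∃ λ i → ∃ λ j → v ≡ just (i , j) × toℕ j ≡ 0
  centre-neighbour (just (i , j)) e = i , j , refl , isYes⇒ (toℕ j ℕ.≟ 0) e

  Away Toward : ∀ i → Fin (len i) → Vertex → Set
  Away   i j v = ∃ λ j′ → v ≡ just (i , j′) × suc (toℕ j) ≡ toℕ j′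
  Toward i j v = (v ≡ nothing × toℕ j ≡ 0) ⊎ (∃ λ j′ → v ≡ just (i , j′) × suc (toℕ j′) ≡ toℕ j)

  branch-neighbour : ∀ i j v → adjacent (just (i , j)) v ≡ true → Away i j v ⊎ Toward i j v
  branch-neighbour i j nothing          e = inj₂ (inj₁ (refl , isYes⇒ (toℕ j ℕ.≟ 0) e))
  branch-neighbour i j (just (i′ , j′)) e with i Finₚ.≟ i′ | suc (toℕ j) ℕ.≟ toℕ j′ | suc (toℕ j′) ℕ.≟ toℕ j
  ... | yes refl | yes p | _     = inj₁ (j′ , refl , p)
  ... | yes refl | no  _ | yes p = inj₂ (inj₂ (j′ , refl , p))

  away-unique : ∀ {i j v w} → Away i j v → Away i j w → v ≡ w
  away-unique (_ , refl , e) (_ , refl , e′) = cong (λ j → just (_ , j)) (Finₚ.toℕ-injective (≡.trans (≡.sym e) e′))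

  toward-unique : ∀ {i j v w} → Toward i j v → Toward i j w → v ≡ w
  toward-unique (inj₁ (refl , _)) (inj₁ (refl , _)) = refl
  toward-unique (inj₁ (_ , e)) (inj₂ (_ , _ , e′)) = ⊥-elim (ℕₚ.1+n≢0 (≡.trans e′ e))
  toward-unique (inj₂ (_ , _ , e)) (inj₁ (_ , e′)) = ⊥-elim (ℕₚ.1+n≢0 (≡.trans e e′))
  toward-unique (inj₂ (_ , refl , e)) (inj₂ (_ , refl , e′)) =
    cong (λ j → just (_ , j)) (Finₚ.toℕ-injective (ℕₚ.suc-injective (≡.trans e (≡.sym e′))))

  -- A vertex on a branch has at most one neighbour away from the centre and at most one towards it.
  -- Hence the middle of a claw is the centre, and its leaves are the innermost vertices of three
  -- branches.
  claw-branches : ∀ c (leaf : Fin 3 → Vertex) → (∀ i j → leaf i ≡ leaf j → i ≡ j) → (∀ i → adjacent c (leaf i) ≡ true) → Branches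
  claw-branches nothing leaf injective adj = (λ i → proj₁ (at i)) , distinct , λ i → inhabited (proj₁ (proj₂ (at i)))
    where
    at : ∀ i → ∃ λ b → ∃ λ j → leaf i ≡ just (b , j) × toℕ j ≡ 0
    at i = centre-neighbour (leaf i) (adj i)
    same : ∀ {b b′} {j : Fin (len b)} {j′ : Fin (len b′)} → b ≡ b′ → toℕ j ≡ 0 → toℕ j′ ≡ 0 → _≡_ {A = Vertex} (just (b , j)) (just (b′ , j′))
    same refl e e′ = cong (λ j → just (_ , j)) (Finₚ.toℕ-injective (≡.trans e (≡.sym e′)))
    distinct : ∀ i j → proj₁ (at i) ≡ proj₁ (at j) → i ≡ j
    distinct i j e with at i | at j
    ... | _ , _ , l , z | _ , _ , l′ , z′ = injective i j (≡.trans l (≡.trans (same e z z′) (≡.sym l′)))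
  claw-branches (just (i , j)) leaf injective adj = ⊥-elim (pigeonhole (λ m → branch-neighbour i j (leaf m) (adj m)))
    where
    sameA : ∀ m m′ → Away i j (leaf m) → Away i j (leaf m′) → m ≡ m′
    sameA m m′ a b = injective m m′ (away-unique a b)
    sameT : ∀ m m′ → Toward i j (leaf m) → Toward i j (leaf m′) → m ≡ m′
    sameT m m′ a b = injective m m′ (toward-unique a b)
    pigeonhole : ¬ (∀ m → Away i j (leaf m) ⊎ Toward i j (leaf m))
    pigeonhole h with h zero | h (suc zero) | h (suc (suc zero))
    ... | inj₁ a | inj₁ b | _      with () ← sameA _ _ a b
    ... | inj₂ a | inj₂ b | _      with () ← sameT _ _ a b
    ... | inj₁ a | inj₂ b | inj₁ c with () ← sameA _ _ a c
    ... | inj₁ a | inj₂ b | inj₂ c with () ← sameT _ _ b c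
    ... | inj₂ a | inj₁ b | inj₁ c with () ← sameA _ _ b c
    ... | inj₂ a | inj₁ b | inj₂ c with () ← sameT _ _ a c

-- The edge count

module TopCoefficients where
  open ℤ[x]
  private module P = RingKit polRing
  open Star polRing

  shift : ℕ → Pol → Pol
  shift zero    p = p
  shift (suc d) p = + 0 ∷ shift d p

  shift-coef : ∀ d p i → coef (shift d p) (d ℕ.+ i) ≡ coef p i
  shift-coef zero    p i = refl
  shift-coef (suc d) p i = shift-coef d p i

  cons≈ : ∀ {a b p q} → a ≡ b → p ≈ᵖ q → (a ∷ p) ≈ᵖ (b ∷ q)
  cons≈ a≡b p≈q .at zero    = a≡b
  cons≈ a≡b p≈q .at (suc i) = at p≈q i

  shift-cong : ∀ d {p q} → p ≈ᵖ q → shift d p ≈ᵖ shift d q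
  shift-cong zero    e = e
  shift-cong (suc d) e = cons≈ refl (shift-cong d e)

  shift-+ : ∀ d p q → shift d (p +ᵖ q) ≡ shift d p +ᵖ shift d q
  shift-+ zero    p q = refl
  shift-+ (suc d) p q = cong (+ 0 ∷_) (shift-+ d p q)

  shift-neg : ∀ d p → shift d (-ᵖ p) ≡ -ᵖ shift d p
  shift-neg zero    p = refl
  shift-neg (suc d) p = cong (+ 0 ∷_) (shift-neg d p)

  zero-scale : ∀ q → map (+ 0 ℤ.*_) q ≈ᵖ []
  zero-scale q .at i = coef-scale (+ 0) q i

  shift-*ˡ : ∀ d p q → (shift d p *ᵖ q) ≈ᵖ shift d (p *ᵖ q)
  shift-*ˡ zero    p q = P.≈-refl
  shift-*ˡ (suc d) p q = P.≈-trans (P.+-congʳ {+ 0 ∷ (shift d p *ᵖ q)} (zero-scale q)) (cons≈ refl (shift-*ˡ d p q))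

  shift-*ʳ : ∀ d p q → (p *ᵖ shift d q) ≈ᵖ shift d (p *ᵖ q)
  shift-*ʳ d p q = P.≈-trans (P.*-comm p (shift d q)) (P.≈-trans (shift-*ˡ d q p) (shift-cong d (P.*-comm q p)))

  shift-shift : ∀ d d′ p → shift d (shift d′ p) ≡ shift (d ℕ.+ d′) p
  shift-shift zero    d′ p = refl
  shift-shift (suc d) d′ p = cong (+ 0 ∷_) (shift-shift d d′ p)

  shift-below : ∀ d p m → p belowᵖ m → shift d p belowᵖ (d ℕ.+ m)
  shift-below zero    p m p<         = p<
  shift-below (suc d) p m p< (suc i) (s≤s le) = shift-below d p m p< i le

  below-weaken : ∀ p {m m′} → m ℕ.≤ m′ → p belowᵖ m → p belowᵖ m′
  below-weaken p m≤m′ p< i le = p< i (ℕₚ.≤-trans m≤m′ le)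

  below-+ : ∀ p q m → p belowᵖ m → q belowᵖ m → (p +ᵖ q) belowᵖ m
  below-+ p q m p< q< i le = ≡.trans (coef-+ p q i) (cong₂ ℤ._+_ (p< i le) (q< i le))

  below-neg : ∀ p m → p belowᵖ m → (-ᵖ p) belowᵖ m
  below-neg p m p< i le = ≡.trans (coef-- p i) (cong ℤ.-_ (p< i le))

  below-resp : ∀ {p q} m → p ≈ᵖ q → p belowᵖ m → q belowᵖ m
  below-resp m p≈q p< i le = ≡.trans (≡.sym (at p≈q i)) (p< i le)

  top : ℤ → Pol
  top e = ℤ.- e ∷ + 0 ∷ + 1 ∷ []

  -- p = x^d - e x^(d-2) + (terms of degree < d - 2), multiplied by x² so that d - 2 makes sense.
  record Top (d : ℕ) (e : ℤ) (p : Pol) : Set where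
    constructor mkTop
    field
      rest       : Pol
      rest-below : rest belowᵖ d
      expansion  : shift 2 p ≈ᵖ (shift d (top e) +ᵖ rest)
  open Top

  top-resp : ∀ {d e p q} → p ≈ᵖ q → Top d e p → Top d e q
  top-resp p≈q (mkTop r r< ex) = mkTop r r< (P.≈-trans (shift-cong 2 (P.≈-sym p≈q)) ex)

  top-1 : Top 0 (+ 0) P.1#
  top-1 = mkTop [] (λ _ _ → refl) P.≈-refl

  top-X : Top 1 (+ 0) X₁
  top-X = mkTop [] (λ _ _ → refl) P.≈-refl

  top-below : ∀ e → top e belowᵖ 3
  top-below e (suc (suc (suc i))) _ = refl
  top-below e (suc (suc zero)) (s≤s (s≤s ()))
  top-below e (suc zero) (s≤s ())

  +-+-shift : ∀ d d′ → (d ℕ.+ 2) ℕ.+ d′ ≡ 2 ℕ.+ (d ℕ.+ d′)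
  +-+-shift d d′ = ≡.trans (cong (ℕ._+ d′) (ℕₚ.+-comm d 2)) refl

  top-*-top : ∀ e e′ → (top e *ᵖ top e′) ≈ᵖ (shift 2 (top (e ℤ.+ e′)) +ᵖ (e ℤ.* e′ ∷ []))
  top-*-top e e′ = eq λ where
      zero → ≡.trans (ℤₚ.+-identityʳ _) (≡.trans (neg-* e e′) (≡.sym (ℤₚ.+-identityˡ _)))
      (suc zero) → c₁ e e′
      (suc (suc zero)) → c₂ e e′
      (suc (suc (suc zero))) → refl
      (suc (suc (suc (suc zero)))) → refl
      (suc (suc (suc (suc (suc i))))) → refl
    where
    module Z = RingKit ℤRing
    open Z using (_:+_; _:*_; _:-_; :-_; _:=_; con; solve)
    neg-* : ∀ e e′ → ℤ.- e ℤ.* ℤ.- e′ ≡ e ℤ.* e′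
    neg-* = solve 2 (λ e e′ → (:- e) :* (:- e′) := e :* e′) refl
    c₁ : ∀ e e′ → ℤ.- e ℤ.* + 0 ℤ.+ (+ 0 ℤ.* ℤ.- e′ ℤ.+ + 0) ≡ + 0
    c₁ = solve 2 (λ e e′ → (:- e) :* con (+ 0) :+ (con (+ 0) :* (:- e′) :+ con (+ 0)) := con (+ 0)) refl
    c₂ : ∀ e e′ → ℤ.- e ℤ.* + 1 ℤ.+ (+ 0 ℤ.* + 0 ℤ.+ (+ 1 ℤ.* ℤ.- e′ ℤ.+ + 0)) ≡ ℤ.- (e ℤ.+ e′)
    c₂ = solve 2 (λ e e′ → (:- e) :* con (+ 1) :+ (con (+ 0) :* con (+ 0) :+ (con (+ 1) :* (:- e′) :+ con (+ 0))) := :- (e :+ e′)) refl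

  -- The two expansions multiply to one of x⁴ p q. So the remainder, defined as a difference, is
  -- bounded after a further factor x² and its coefficients are read two places higher.
  top-* : ∀ {d e d′ e′} p q → Top d e p → Top d′ e′ q → Top (d ℕ.+ d′) (e ℤ.+ e′) (p *ᵖ q)
  top-* {d} {e} {d′} {e′} p q (mkTop r r< ex) (mkTop r′ r′< ex′) = mkTop r″ r″-below
    (P.solve 2 (λ u v → u P.:= v P.:+ (u P.:- v)) P.≈-refl u v)
    where
    u v r″ rest″ : Pol
    u  = shift 2 (p *ᵖ q)
    v  = shift (d ℕ.+ d′) (top (e ℤ.+ e′))
    r″ = u +ᵖ (-ᵖ v)
    S S′ : Pol
    S  = shift d (top e)
    S′ = shift d′ (top e′)
    rest″ = shift (d ℕ.+ d′) (e ℤ.* e′ ∷ []) +ᵖ ((S *ᵖ r′) +ᵖ ((r *ᵖ S′) +ᵖ (r *ᵖ r′)))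
    SS′ : (S *ᵖ S′) ≈ᵖ (shift 2 v +ᵖ shift (d ℕ.+ d′) (e ℤ.* e′ ∷ []))
    SS′ = P.≈-trans (shift-*ˡ d (top e) S′) (P.≈-trans (shift-cong d (shift-*ʳ d′ (top e) (top e′)))
      (P.≈-trans (P.≈-reflexive (shift-shift d d′ (top e *ᵖ top e′)))
      (P.≈-trans (shift-cong (d ℕ.+ d′) (top-*-top e e′)) (P.≈-trans (P.≈-reflexive (shift-+ (d ℕ.+ d′) (shift 2 (top (e ℤ.+ e′))) (e ℤ.* e′ ∷ [])))
        (P.+-congʳ {shift (d ℕ.+ d′) (e ℤ.* e′ ∷ [])} (P.≈-reflexive (≡.trans (shift-shift (d ℕ.+ d′) 2 _)
          (≡.trans (cong (λ m → shift m (top (e ℤ.+ e′))) (ℕₚ.+-comm (d ℕ.+ d′) 2)) (≡.sym (shift-shift 2 (d ℕ.+ d′) _))))))))))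
    product : shift 2 u ≈ᵖ (shift 2 v +ᵖ rest″)
    product = P.≈-trans (P.≈-sym (P.≈-trans (shift-*ˡ 2 p (shift 2 q)) (shift-cong 2 (shift-*ʳ 2 p q))))
      (P.≈-trans (P.*-cong ex ex′)
      (P.≈-trans (P.solve 4 (λ s r s′ r′ → (s P.:+ r) P.:* (s′ P.:+ r′) P.:= s P.:* s′ P.:+ (s P.:* r′ P.:+ (r P.:* s′ P.:+ r P.:* r′))) P.≈-refl S r S′ r′)
      (P.≈-trans (P.+-congʳ {(S *ᵖ r′) +ᵖ ((r *ᵖ S′) +ᵖ (r *ᵖ r′))} SS′)
        (P.+-assoc (shift 2 v) (shift (d ℕ.+ d′) (e ℤ.* e′ ∷ [])) ((S *ᵖ r′) +ᵖ ((r *ᵖ S′) +ᵖ (r *ᵖ r′)))))))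
    S-below : S belowᵖ suc (d ℕ.+ 2)
    S-below = below-weaken S (ℕₚ.≤-reflexive (ℕₚ.+-suc d 2)) (shift-below d (top e) 3 (top-below e))
    S′-below : S′ belowᵖ suc (d′ ℕ.+ 2)
    S′-below = below-weaken S′ (ℕₚ.≤-reflexive (ℕₚ.+-suc d′ 2)) (shift-below d′ (top e′) 3 (top-below e′))
    m = 2 ℕ.+ (d ℕ.+ d′)
    rest″-below : rest″ belowᵖ m
    rest″-below = below-+ (shift (d ℕ.+ d′) (e ℤ.* e′ ∷ [])) _ m
      (below-weaken (shift (d ℕ.+ d′) (e ℤ.* e′ ∷ [])) (ℕₚ.≤-trans (ℕₚ.≤-reflexive (ℕₚ.+-comm (d ℕ.+ d′) 1)) (ℕₚ.n≤1+n _)) (shift-below (d ℕ.+ d′) (e ℤ.* e′ ∷ []) 1 (belowᵖ-length (e ℤ.* e′ ∷ []))))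
      (below-+ (S *ᵖ r′) _ m (below-weaken (S *ᵖ r′) (ℕₚ.≤-reflexive (+-+-shift d d′)) (*ᵖ-below (d ℕ.+ 2) d′ S r′ S-below r′<))
      (below-+ (r *ᵖ S′) _ m (below-resp m (P.*-comm S′ r)
          (below-weaken (S′ *ᵖ r) (ℕₚ.≤-reflexive (≡.trans (+-+-shift d′ d) (cong (2 ℕ.+_) (ℕₚ.+-comm d′ d)))) (*ᵖ-below (d′ ℕ.+ 2) d S′ r S′-below r<)))
        (below-weaken (r *ᵖ r′) (ℕₚ.m≤n+m (d ℕ.+ d′) 2) (*ᵖ-below d d′ r r′ (below-weaken r (ℕₚ.n≤1+n d) r<) r′<))))
    r″-below : r″ belowᵖ (d ℕ.+ d′)
    r″-below i le = at (P.≈-trans (P.+-congʳ { -ᵖ shift 2 v} product)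
      (P.solve 2 (λ v r → (v P.:+ r) P.:- v P.:= r) P.≈-refl (shift 2 v) rest″)) (2 ℕ.+ i) ⟨≡⟩ rest″-below (2 ℕ.+ i) (s≤s (s≤s le))
      where
      _⟨≡⟩_ = ≡.trans

  top-lead : ∀ {d e p} → Top d e p → coef p d ≡ + 1
  top-lead {d} {e} {p} (mkTop r r< ex) = ≡.trans (at ex (2 ℕ.+ d)) (≡.trans (coef-+ (shift d (top e)) r (2 ℕ.+ d))
    (cong₂ ℤ._+_ (≡.trans (cong (coef (shift d (top e))) (ℕₚ.+-comm 2 d)) (shift-coef d (top e) 2)) (r< (2 ℕ.+ d) (ℕₚ.m≤n+m d 2))))

  top-monic : ∀ {d e p} → Top d e p → Monicᵖ d p
  top-monic {d} {e} {p} t@(mkTop r r< ex) = top-lead t , λ i le → ≡.trans (at ex (2 ℕ.+ i)) (≡.trans (coef-+ (shift d (top e)) r (2 ℕ.+ i))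
    (cong₂ ℤ._+_ (shift-below d (top e) 3 (top-below e) (2 ℕ.+ i) (ℕₚ.≤-trans (ℕₚ.≤-reflexive (ℕₚ.+-comm d 3)) (s≤s (s≤s le))))
      (r< (2 ℕ.+ i) (ℕₚ.≤-trans (ℕₚ.n≤1+n d) (ℕₚ.≤-trans le (ℕₚ.m≤n+m i 2))))))

  top-degree : ∀ {d e d′ e′ p} → Top d e p → Top d′ e′ p → d ≡ d′
  top-degree {d} {e} {d′} {e′} {p} t t′ with ℕₚ.<-cmp d d′
  ... | tri≈ _ d≡d′ _ = d≡d′
  ... | tri< d<d′ _ _ with () ← ≡.trans (≡.sym (top-lead t′)) (proj₂ (top-monic t) d′ d<d′)
  ... | tri> _ _ d>d′ with () ← ≡.trans (≡.sym (top-lead t)) (proj₂ (top-monic t′) d d>d′)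

  top-second : ∀ {d e e′ p} → Top d e p → Top d e′ p → e ≡ e′
  top-second {d} {e} {e′} {p} t t′ = ℤₚ.neg-injective (≡.trans (≡.sym (coefficient t)) (coefficient t′))
    where
    coefficient : ∀ {e} → Top d e p → coef (shift 2 p) d ≡ ℤ.- e
    coefficient {e} (mkTop r r< ex) = ≡.trans (at ex d) (≡.trans (coef-+ (shift d (top e)) r d)
      (≡.trans (cong₂ ℤ._+_ (≡.trans (cong (coef (shift d (top e))) (≡.sym (ℕₚ.+-identityʳ d))) (shift-coef d (top e) 0)) (r< d ℕₚ.≤-refl))
        (ℤₚ.+-identityʳ _)))

  -- The subtracted polynomial starts two degrees lower, so its leading 1 does nothing but raise e.
  -- In the recursions of `path` and `star` this counts the edge that causes the subtraction.
  top-subtract : ∀ {d e} p q → Top (2 ℕ.+ d) e p → Monicᵖ d q → Top (2 ℕ.+ d) (e ℤ.+ + 1) (p +ᵖ (-ᵖ q))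
  top-subtract {d} {e} p q (mkTop r r< ex) (lead , q<) = mkTop (r +ᵖ (-ᵖ shift 2 low)) (below-+ r (-ᵖ shift 2 low) _ r< (below-neg (shift 2 low) _ (shift-below 2 low d low<)))
    (P.≈-trans (P.≈-reflexive (≡.trans (shift-+ 2 p (-ᵖ q)) (cong (shift 2 p +ᵖ_) (shift-neg 2 q))))
    (P.≈-trans (P.+-cong ex (P.-‿cong (shift-cong 2 split)))
    (P.≈-trans (P.≈-reflexive (cong (λ z → (shift (2 ℕ.+ d) (top e) +ᵖ r) +ᵖ (-ᵖ z)) (≡.trans (shift-+ 2 (shift d P.1#) low) (cong (_+ᵖ shift 2 low) (shift-shift 2 d P.1#)))))
    (P.≈-trans (P.solve 4 (λ t r o l → (t P.:+ r) P.:- (o P.:+ l) P.:= (t P.:- o) P.:+ (r P.:- l)) P.≈-refl (shift (2 ℕ.+ d) (top e)) r (shift (2 ℕ.+ d) P.1#) (shift 2 low))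
      (P.+-congʳ {r +ᵖ (-ᵖ shift 2 low)} (P.≈-trans (P.≈-reflexive (≡.trans (cong (shift (2 ℕ.+ d) (top e) +ᵖ_) (≡.sym (shift-neg (2 ℕ.+ d) P.1#))) (≡.sym (shift-+ (2 ℕ.+ d) (top e) (-ᵖ P.1#)))))
        (shift-cong (2 ℕ.+ d) (cons≈ (≡.sym (ℤₚ.neg-distrib-+ e (+ 1))) P.≈-refl))))))))
    where
    low : Pol
    low = q +ᵖ (-ᵖ shift d P.1#)
    split : q ≈ᵖ (shift d P.1# +ᵖ low)
    split = P.solve 2 (λ q o → q P.:= o P.:+ (q P.:- o)) P.≈-refl q (shift d P.1#)
    low< : low belowᵖ d
    low< i le with ℕₚ.m≤n⇒m<n∨m≡n le
    ... | inj₂ refl = ≡.trans (coef-+ q (-ᵖ shift d P.1#) d) (cong₂ ℤ._+_ lead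
          (≡.trans (coef-- (shift d P.1#) d) (cong ℤ.-_ (≡.trans (cong (coef (shift d P.1#)) (≡.sym (ℕₚ.+-identityʳ d))) (shift-coef d P.1# 0)))))
    ... | inj₁ d<i = ≡.trans (coef-+ q (-ᵖ shift d P.1#) i) (cong₂ ℤ._+_ (q< i d<i)
          (below-neg (shift d P.1#) (d ℕ.+ 1) (shift-below d P.1# 1 (belowᵖ-length P.1#)) i (ℕₚ.≤-trans (ℕₚ.≤-reflexive (ℕₚ.+-comm d 1)) d<i)))

  -- The exact count is given for `suc l`, since l - 1 is no edge count for the empty path; of the
  -- shorter path only the degree matters.
  top-path : ∀ l → Top (suc l) (+ l) (path X₁ (suc l)) × ∃ λ e → Top l e (path X₁ l)
  top-path zero = top-resp (P.solve 1 (λ x → x P.:= x P.:* P.con (+ 1) P.:- P.con (+ 0)) P.≈-refl X₁) top-X , + 0 , top-1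
  top-path (suc l) with top-path l
  ... | t , e , t⁻ = subst (λ e → Top (2 ℕ.+ l) e (path X₁ (2 ℕ.+ l))) (cong +_ (ℕₚ.+-comm l 1))
      (top-subtract (X₁ *ᵖ path X₁ (suc l)) (path X₁ l) (top-* X₁ (path X₁ (suc l)) top-X t) (top-monic t⁻)) , _ , t

  top-paths : ∀ ls → ∃ λ e → Top (sum ls) e (paths X₁ ls)
  top-paths []       = + 0 , top-1
  top-paths (l ∷ ls) = _ , top-* (path X₁ l) (paths X₁ ls) (proj₂ (proj₂ (top-path l))) (proj₂ (top-paths ls))

  top-star : ∀ ls → Top (suc (sum ls)) (+ sum ls) (starPoly ls)
  top-star []           = top-X
  top-star (zero ∷ ls)  = top-resp (P.solve 2 (λ f q → f P.:= P.con (+ 1) P.:* f P.:- P.con (+ 0) P.:* q) P.≈-refl (starPoly ls) (paths X₁ ls)) (top-star ls)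
  top-star (suc l ∷ ls) = subst (λ e → Top (2 ℕ.+ (l ℕ.+ sum ls)) e (starPoly (suc l ∷ ls))) (cong +_ (ℕₚ.+-comm (l ℕ.+ sum ls) 1))
    (top-subtract (path X₁ (suc l) *ᵖ starPoly ls) (path X₁ l *ᵖ paths X₁ ls)
      (subst (λ d → Top d (+ (l ℕ.+ sum ls)) (path X₁ (suc l) *ᵖ starPoly ls)) (cong suc (ℕₚ.+-suc l (sum ls)))
        (top-* (path X₁ (suc l)) (starPoly ls) (proj₁ (top-path l)) (top-star ls)))
      (top-monic (top-* (path X₁ l) (paths X₁ ls) (proj₂ (proj₂ (top-path l))) (proj₂ (top-paths ls)))))

  top-square : ∀ c → Top 2 c (quadratic (+ 0) (ℤ.- c))
  top-square c = mkTop [] (λ _ _ → refl) P.≈-refl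

  top-pair : ∀ a b → Top 4 (a ℤ.* a ℤ.- + 2 ℤ.* b) (quadratic a b *ᵖ quadratic (ℤ.- a) b)
  top-pair a b = mkTop (+ 0 ∷ + 0 ∷ b ℤ.* b ∷ []) (λ i le → belowᵖ-length (+ 0 ∷ + 0 ∷ b ℤ.* b ∷ []) i (ℕₚ.≤-trans (ℕₚ.n≤1+n 3) le))
    (eq λ where
      zero → refl
      (suc zero) → refl
      (suc (suc zero)) → ≡.trans (ℤₚ.+-identityʳ (b ℤ.* b)) (≡.sym (ℤₚ.+-identityˡ (b ℤ.* b)))
      (suc (suc (suc zero))) → c₁ a b
      (suc (suc (suc (suc zero)))) → c₂ a b
      (suc (suc (suc (suc (suc zero))))) → c₃ a
      (suc (suc (suc (suc (suc (suc zero)))))) → refl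
      (suc (suc (suc (suc (suc (suc (suc i))))))) → refl)
    where
    module Z = RingKit ℤRing
    open Z using (_:+_; _:*_; _:-_; :-_; _:=_; con; solve)
    c₁ : ∀ a b → b ℤ.* ℤ.- ℤ.- a ℤ.+ (ℤ.- a ℤ.* b ℤ.+ + 0) ≡ + 0
    c₁ = solve 2 (λ a b → b :* (:- (:- a)) :+ ((:- a) :* b :+ con (+ 0)) := con (+ 0)) refl
    c₂ : ∀ a b → b ℤ.* + 1 ℤ.+ (ℤ.- a ℤ.* ℤ.- ℤ.- a ℤ.+ (+ 1 ℤ.* b ℤ.+ + 0)) ≡ ℤ.- (a ℤ.* a ℤ.- + 2 ℤ.* b)
    c₂ = solve 2 (λ a b → b :* con (+ 1) :+ ((:- a) :* (:- (:- a)) :+ (con (+ 1) :* b :+ con (+ 0))) := :- (a :* a :- con (+ 2) :* b)) refl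
    c₃ : ∀ a → ℤ.- a ℤ.* + 1 ℤ.+ + 1 ℤ.* ℤ.- ℤ.- a ≡ + 0
    c₃ = solve 1 (λ a → (:- a) :* con (+ 1) :+ con (+ 1) :* (:- (:- a)) := con (+ 0)) refl

-- Gauss' lemma and factors of least degree

mapHom : ∀ {R S} → Hom R S → Hom (Polynomials.polRing R) (Polynomials.polRing S)
mapHom {R} {S} h = record
  { ⟦_⟧ = map ⟦_⟧
  ; ⟦⟧-cong = λ {p} {q} e → PS.eq λ i → S.≈-trans (coef-map p i) (S.≈-trans (⟦⟧-cong (PR.at e i)) (S.≈-sym (coef-map q i)))
  ; +-homo = λ p q → PS.eq λ i → S.≈-trans (coef-map (p PR.+ᵖ q) i) (S.≈-trans (⟦⟧-cong (PR.coef-+ p q i)) (S.≈-trans (+-homo _ _)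
      (S.≈-sym (S.≈-trans (PS.coef-+ (map ⟦_⟧ p) (map ⟦_⟧ q) i) (S.+-cong (coef-map p i) (coef-map q i))))))
  ; *-homo = λ p q → PS.eq λ i → S.≈-trans (coef-map (p PR.*ᵖ q) i) (S.≈-trans (⟦⟧-cong (PR.coef-* p q i)) (S.≈-trans (conv-homo (PR.coef p) (PR.coef q) i)
      (S.≈-sym (S.≈-trans (PS.coef-* (map ⟦_⟧ p) (map ⟦_⟧ q) i) (PS.conv-cong (coef-map p) (coef-map q) i)))))
  ; 1-homo = PS.eq λ { zero → 1-homo ; (suc i) → S.≈-refl } }
  where
  open Hom h
  module S = RingKit S
  module PR = Polynomials R
  module PS = Polynomials S
  coef-map : ∀ p i → PS.coef (map ⟦_⟧ p) i S.≈ ⟦ PR.coef p i ⟧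
  coef-map []      i       = S.≈-sym 0-homo
  coef-map (a ∷ p) zero    = S.≈-refl
  coef-map (a ∷ p) (suc i) = coef-map p i
  conv-homo : ∀ f g n → ⟦ PR.conv f g n ⟧ S.≈ PS.conv (⟦_⟧ ∘ f) (⟦_⟧ ∘ g) n
  conv-homo f g zero    = *-homo _ _
  conv-homo f g (suc n) = S.≈-trans (+-homo _ _) (S.+-cong (*-homo _ _) (conv-homo (f ∘ suc) g n))

ℚRing : CommutativeRing 0ℓ 0ℓ
ℚRing = ℚₚ.+-*-commutativeRing

module ℚ[x] = Polynomials ℚRing

fromℤHom : ∀ R → Hom ℤRing R
fromℤHom R = record
  { ⟦_⟧ = fromℤ ; ⟦⟧-cong = λ { refl → ≈-refl } ; +-homo = fromℤ-+ ; *-homo = fromℤ-* ; 1-homo = ≈-refl }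
  where open RingKit R

ι : Hom ℤ[x].polRing ℚ[x].polRing
ι = mapHom (fromℤHom ℚRing)

module IntegersInℚ where
  open RingKit ℚRing using (fromℕ; fromℕ-suc; fromℤ)

  integer : ℤ → ℚ
  integer z = ℚ.mkℚ z 0 (Coprimality.sym (Coprimality.1-coprimeTo _))

  1+integer : ∀ n → ℚ.1ℚ ℚ.+ integer (+ n) ≡ integer (+ suc n)
  1+integer n = ≡.trans (cong (ℚ._/ 1) (cong (ℤ._+_ (+ 1)) (ℤₚ.*-identityʳ (+ n)))) (ℚₚ.↥p/↧p≡p (integer (+ suc n)))

  fromℕ≡integer : ∀ n → fromℕ n ≡ integer (+ n)
  fromℕ≡integer zero    = refl
  fromℕ≡integer (suc n) = ≡.trans (fromℕ-suc n) (≡.trans (cong (ℚ._+_ ℚ.1ℚ) (fromℕ≡integer n)) (1+integer n))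

  fromℤ≡integer : ∀ z → fromℤ z ≡ integer z
  fromℤ≡integer (+ n)    = fromℕ≡integer n
  fromℤ≡integer -[1+ n ] = cong ℚ.-_ (fromℕ≡integer (suc n))

  fromℤ≡/1 : ∀ z → fromℤ z ≡ z ℚ./ 1
  fromℤ≡/1 z = ≡.trans (fromℤ≡integer z) (≡.sym (ℚₚ.↥p/↧p≡p (integer z)))

  fromℤ-injective : ∀ {i j} → fromℤ i ≡ fromℤ j → i ≡ j
  fromℤ-injective {i} {j} e = cong ℚ.↥_ (≡.trans (≡.sym (fromℤ≡integer i)) (≡.trans e (fromℤ≡integer j)))

  denominator-clears : ∀ q → fromℤ (ℚ.↧ q) ℚ.* q ≡ fromℤ (ℚ.↥ q)
  denominator-clears q@(ℚ.mkℚ n d-1 _) = ≡.trans (cong (ℚ._* q) (fromℤ≡integer (+ suc d-1)))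
    (≡.trans (ℚₚ.toℚᵘ-injective (ℚᵘₚ.≃-trans (ℚₚ.toℚᵘ-homo-* (integer (+ suc d-1)) q) (ℚᵘ.*≡* cross))) (≡.sym (fromℤ≡integer n)))
    where
    cross : (+ suc d-1 ℤ.* n) ℤ.* + 1 ≡ n ℤ.* (+ (suc d-1 ℕ.+ 0))
    cross = ≡.trans (ℤₚ.*-identityʳ _) (≡.trans (ℤₚ.*-comm (+ suc d-1) n) (cong (λ m → n ℤ.* + m) (≡.sym (ℕₚ.+-identityʳ (suc d-1)))))

open IntegersInℚ using (denominator-clears; fromℤ-injective)

ι-coef : ∀ p i → ℚ[x].coef (Hom.⟦_⟧ ι p) i ≡ RingKit.fromℤ ℚRing (ℤ[x].coef p i)
ι-coef []      i       = refl
ι-coef (a ∷ p) zero    = refl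
ι-coef (a ∷ p) (suc i) = ι-coef p i

ι-injective : ∀ p q → Hom.⟦_⟧ ι p ℚ[x].≈ᵖ Hom.⟦_⟧ ι q → p ℤ[x].≈ᵖ q
ι-injective p q e .ℤ[x].at i = fromℤ-injective (≡.trans (≡.sym (ι-coef p i)) (≡.trans (ℚ[x].at e i) (ι-coef q i)))

clear-denominators : ∀ p → ∃ λ c → ∃ λ P → Hom.⟦_⟧ ι P ℚ[x].≈ᵖ map (ℚ._*_ (RingKit.fromℤ ℚRing (+ suc c))) p
clear-denominators [] = 0 , [] , ℚ[x].eq λ _ → refl
clear-denominators (q@(ℚ.mkℚ n d-1 _) ∷ p) with clear-denominators p
... | c , P , e = d-1 ℕ.+ c ℕ.* suc d-1 , (+ suc c ℤ.* n ∷ map (ℤ._*_ (+ suc d-1)) P) , ℚ[x].eq λ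
    { zero → begin
        Q.fromℤ (+ suc c ℤ.* n)                         ≡⟨ Q.fromℤ-* (+ suc c) n ⟩
        Q.fromℤ (+ suc c) ℚ.* Q.fromℤ n                 ≡⟨ cong (ℚ._*_ (Q.fromℤ (+ suc c))) (denominator-clears q) ⟨
        Q.fromℤ (+ suc c) ℚ.* (Q.fromℤ (+ suc d-1) ℚ.* q) ≡⟨ ℚₚ.*-assoc (Q.fromℤ (+ suc c)) (Q.fromℤ (+ suc d-1)) q ⟨
        (Q.fromℤ (+ suc c) ℚ.* Q.fromℤ (+ suc d-1)) ℚ.* q ≡⟨ cong (ℚ._* q) product ⟨
        Q.fromℤ (+ (suc c ℕ.* suc d-1)) ℚ.* q           ∎
    ; (suc i) → begin
        ℚ[x].coef (Hom.⟦_⟧ ι (map (ℤ._*_ (+ suc d-1)) P)) i   ≡⟨ ι-coef (map (ℤ._*_ (+ suc d-1)) P) i ⟩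
        Q.fromℤ (ℤ[x].coef (map (ℤ._*_ (+ suc d-1)) P) i)     ≡⟨ cong Q.fromℤ (ℤ[x].coef-scale (+ suc d-1) P i) ⟩
        Q.fromℤ (+ suc d-1 ℤ.* ℤ[x].coef P i)                 ≡⟨ Q.fromℤ-* (+ suc d-1) (ℤ[x].coef P i) ⟩
        Q.fromℤ (+ suc d-1) ℚ.* Q.fromℤ (ℤ[x].coef P i)       ≡⟨ cong (ℚ._*_ (Q.fromℤ (+ suc d-1))) (≡.trans (≡.sym (ι-coef P i)) (≡.trans (ℚ[x].at e i) (ℚ[x].coef-scale (Q.fromℤ (+ suc c)) p i))) ⟩
        Q.fromℤ (+ suc d-1) ℚ.* (Q.fromℤ (+ suc c) ℚ.* ℚ[x].coef p i)
          ≡⟨ Q.solve 3 (λ a b x → a Q.:* (b Q.:* x) Q.:= (b Q.:* a) Q.:* x) refl (Q.fromℤ (+ suc d-1)) (Q.fromℤ (+ suc c)) (ℚ[x].coef p i) ⟩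
        (Q.fromℤ (+ suc c) ℚ.* Q.fromℤ (+ suc d-1)) ℚ.* ℚ[x].coef p i   ≡⟨ cong (ℚ._* ℚ[x].coef p i) product ⟨
        Q.fromℤ (+ (suc c ℕ.* suc d-1)) ℚ.* ℚ[x].coef p i               ≡⟨ ℚ[x].coef-scale (Q.fromℤ (+ (suc c ℕ.* suc d-1))) p i ⟨
        ℚ[x].coef (map (ℚ._*_ (Q.fromℤ (+ (suc c ℕ.* suc d-1)))) p) i   ∎ }
    where
    module Q = RingKit ℚRing
    open ≡.≡-Reasoning
    product : Q.fromℤ (+ (suc c ℕ.* suc d-1)) ≡ Q.fromℤ (+ suc c) ℚ.* Q.fromℤ (+ suc d-1)
    product = ≡.trans (cong Q.fromℤ (ℤₚ.pos-* (suc c) (suc d-1))) (Q.fromℤ-* (+ suc c) (+ suc d-1))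

module Gauss where
  open ℤ[x]
  private module P = RingKit polRing

  Divides : ℕ → Pol → Set
  Divides p h = ∀ i → + p ∣ coef h i

  -- If p divides a constant coefficient, that coefficient can be removed and the product stays
  -- divisible by p. If it divides neither, the constant coefficient of the product contradicts
  -- Euclid's lemma.
  prime-content : ∀ {p} → Prime p → ∀ g h → (∀ i → + p ∣ conv (coef g) (coef h) i) → Divides p g ⊎ Divides p h
  prime-content {p} pr [] h p∣gh = inj₁ λ i → divides (+ 0) refl
  prime-content {p} pr (a ∷ g) [] p∣gh = inj₂ λ i → divides (+ 0) refl
  prime-content {p} pr (a ∷ g) (b ∷ h) p∣gh = decide (+ p ∣? a) (+ p ∣? b)
    (λ p∣a → prime-content pr g (b ∷ h) (λ i → ∣m+n∣m⇒∣n (p∣gh (suc i)) (∣m⇒∣m*n (coef h i) p∣a)))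
    (λ p∣b → prime-content pr (a ∷ g) h (λ i → ∣m+n∣n⇒∣m
      (subst (+ p ∣_) (conv-sucʳ (coef (a ∷ g)) (coef (b ∷ h)) i) (p∣gh (suc i))) (∣n⇒∣m*n (coef g i) p∣b)))
    where
    decide : Dec (+ p ∣ a) → Dec (+ p ∣ b) → (+ p ∣ a → Divides p g ⊎ Divides p (b ∷ h)) →
      (+ p ∣ b → Divides p (a ∷ g) ⊎ Divides p h) → Divides p (a ∷ g) ⊎ Divides p (b ∷ h)
    decide (yes p∣a) _ left _ = map₁ (λ p∣g → λ { zero → p∣a ; (suc i) → p∣g i }) (left p∣a)
    decide (no _) (yes p∣b) _ right = map₂ (λ p∣h → λ { zero → p∣b ; (suc i) → p∣h i }) (right p∣b)
    decide (no p∤a) (no p∤b) _ _ with euclidsLemma ℤ.∣ a ∣ ℤ.∣ b ∣ pr (subst (p ℕ∣.∣_) (ℤₚ.abs-* a b) (∣⇒∣ᵤ (p∣gh 0)))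
    ... | inj₁ e = ⊥-elim (p∤a (∣ᵤ⇒∣ e))
    ... | inj₂ e = ⊥-elim (p∤b (∣ᵤ⇒∣ e))

  quotient : ∀ p h → Divides p h → ∃ λ h′ → h ≈ᵖ map (ℤ._*_ (+ p)) h′
  quotient p []      d = [] , P.≈-refl
  quotient p (a ∷ h) d with d 0 | quotient p h (d ∘ suc)
  ... | divides q a≡ | h′ , e = q ∷ h′ , eq λ { zero → ≡.trans a≡ (ℤₚ.*-comm q (+ p)) ; (suc i) → at e i }

  scale : ℤ → Pol → Pol
  scale c = map (ℤ._*_ c)

  scale-*ˡ : ∀ c g h → (scale c g *ᵖ h) ≈ᵖ scale c (g *ᵖ h)
  scale-*ˡ c g h .at i = ≡.trans (coef-* (scale c g) h i) (≡.trans (conv-cong (coef-scale c g) (λ _ → refl) i)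
    (≡.trans (conv-scaleˡ c (coef g) (coef h) i) (≡.sym (≡.trans (coef-scale c (g *ᵖ h) i) (cong (c ℤ.*_) (coef-* g h i))))))

  scale-cong : ∀ c {g h} → g ≈ᵖ h → scale c g ≈ᵖ scale c h
  scale-cong c {g} {h} e .at i = ≡.trans (coef-scale c g i) (≡.trans (cong (c ℤ.*_) (at e i)) (≡.sym (coef-scale c h i)))

  scale-scale : ∀ c d g → scale c (scale d g) ≈ᵖ scale (c ℤ.* d) g
  scale-scale c d g .at i = ≡.trans (coef-scale c (scale d g) i) (≡.trans (cong (c ℤ.*_) (coef-scale d g i))
    (≡.trans (≡.sym (ℤₚ.*-assoc c d (coef g i))) (≡.sym (coef-scale (c ℤ.* d) g i))))

  scale-cancel : ∀ c {g h} .{{_ : ℤ.NonZero c}} → scale c g ≈ᵖ scale c h → g ≈ᵖ h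
  scale-cancel c {g} {h} e .at i = ℤₚ.*-cancelˡ-≡ c _ _ (≡.trans (≡.sym (coef-scale c g i)) (≡.trans (at e i) (coef-scale c h i)))

  scale-1 : ∀ g → scale (+ 1) g ≈ᵖ g
  scale-1 g .at i = ≡.trans (coef-scale (+ 1) g i) (ℤₚ.*-identityˡ _)

  Factorisation : Pol → Pol → Set
  Factorisation f h = ∃ λ h′ → ∃ λ k′ → ∃ λ c → h ≈ᵖ scale (+ suc c) h′ × f ≈ᵖ (h′ *ᵖ k′)

  prime-divisor : ∀ m → ∃ λ p → ∃ λ q → Prime p × suc (suc m) ≡ p ℕ.* q
  prime-divisor m with factorise (suc (suc m))
  ... | record { factors = [] ; isFactorisation = () }
  ... | record { factors = p ∷ ps ; isFactorisation = e ; factorsPrime = pr ∷ _ } = p , _ , pr , e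

  -- Descent on N: a prime divisor of N divides all of h or all of k and is cancelled there. Only
  -- what leaves h is recorded, as it relates the new factor to the given one.
  gauss : ∀ f N → Acc ℕ._<_ N → N ≢ 0 → ∀ h k → scale (+ N) f ≈ᵖ (h *ᵖ k) → Factorisation f h
  gauss f zero          _        N≢0 h k e = ⊥-elim (N≢0 refl)
  gauss f (suc zero)    _        _   h k e = h , k , 0 , P.≈-sym (scale-1 h) , P.≈-trans (P.≈-sym (scale-1 f)) e
  gauss f (suc (suc m)) (acc rs) _   h k e with prime-divisor m
  ... | p , q , pr , N≡pq = finish (prime-content pr h k (λ i → subst (+ p ∣_) (divisible i) (∣m⇒∣m*n _ (divides (+ q) (≡.trans (ℤₚ.pos-* p q) (ℤₚ.*-comm (+ p) (+ q)))))))
    where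
    instance
      p≢0 : ℕ.NonZero p
      p≢0 = prime⇒nonZero pr
    e′ : scale (+ (p ℕ.* q)) f ≈ᵖ (h *ᵖ k)
    e′ = subst (λ N → scale (+ N) f ≈ᵖ (h *ᵖ k)) N≡pq e
    divisible : ∀ i → + (p ℕ.* q) ℤ.* coef f i ≡ conv (coef h) (coef k) i
    divisible i = ≡.trans (≡.sym (coef-scale (+ (p ℕ.* q)) f i)) (≡.trans (at e′ i) (coef-* h k i))
    q≢0 : q ≢ 0
    q≢0 refl with () ← ≡.trans N≡pq (ℕₚ.*-zeroʳ p)
    smaller : q ℕ.< suc (suc m)
    smaller = subst (q ℕ.<_) (≡.trans (ℕₚ.*-comm q p) (≡.sym N≡pq)) (ℕₚ.m<m*n q p {{ℕ.≢-nonZero q≢0}} (ℕ.nonTrivial⇒n>1 p {{prime⇒nonTrivial pr}}))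
    cancelled : ∀ g → (h *ᵖ k) ≈ᵖ scale (+ p) g → scale (+ q) f ≈ᵖ g
    cancelled g hk≈ = scale-cancel (+ p) (P.≈-trans (scale-scale (+ p) (+ q) f)
      (P.≈-trans (P.≈-reflexive (cong (λ c → scale c f) (≡.sym (ℤₚ.pos-* p q)))) (P.≈-trans e′ hk≈)))
    finish : Divides p h ⊎ Divides p k → Factorisation f h
    finish (inj₂ p∣k) with quotient p k p∣k
    ... | k₁ , k≈ = gauss f q (rs smaller) q≢0 h k₁ (cancelled (h *ᵖ k₁)
      (P.≈-trans (P.*-congˡ {h} k≈) (P.≈-trans (P.*-comm h (scale (+ p) k₁)) (P.≈-trans (scale-*ˡ (+ p) k₁ h) (scale-cong (+ p) (P.*-comm k₁ h))))))
    finish (inj₁ p∣h) with quotient p h p∣h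
    ... | h₁ , h≈ with gauss f q (rs smaller) q≢0 h₁ k (cancelled (h₁ *ᵖ k) (P.≈-trans (P.*-congʳ {k} h≈) (scale-*ˡ (+ p) h₁ k)))
    ...   | h′ , k′ , c , h₁≈ , f≈ = h′ , k′ , ℕ.pred (p ℕ.* suc c)
      , P.≈-trans h≈ (P.≈-trans (scale-cong (+ p) h₁≈) (P.≈-trans (scale-scale (+ p) (+ suc c) h′)
          (P.≈-reflexive (cong (λ z → scale z h′) (≡.trans (≡.sym (ℤₚ.pos-* p (suc c)))
            (cong +_ (≡.sym (ℕₚ.suc-pred (p ℕ.* suc c) {{ℕₚ.m*n≢0 p (suc c)}}))))))))
      , f≈

module DomainPolynomials (K : CommutativeRing 0ℓ 0ℓ)
  (_≟0 : ∀ x → Dec (CommutativeRing._≈_ K x (CommutativeRing.0# K)))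
  (domain : ∀ x y → CommutativeRing._≈_ K (CommutativeRing._*_ K x y) (CommutativeRing.0# K) →
            CommutativeRing._≈_ K x (CommutativeRing.0# K) ⊎ CommutativeRing._≈_ K y (CommutativeRing.0# K)) where
  open RingKit K
  open Polynomials K

  record Degree (d : ℕ) (p : Pol) : Set where
    constructor degree
    field
      lead≉0 : ¬ (coef p d ≈ 0#)
      below  : p belowᵖ suc d
  open Degree public

  degree? : ∀ p → p belowᵖ 0 ⊎ ∃ λ d → Degree d p
  degree? [] = inj₁ λ _ _ → ≈-refl
  degree? (a ∷ p) with degree? p
  ... | inj₂ (d , degree l b) = inj₂ (suc d , degree l λ { (suc i) (s≤s le) → b i le })
  ... | inj₁ p≈0 with a ≟0
  ...   | yes a≈0 = inj₁ λ { zero _ → a≈0 ; (suc i) _ → p≈0 i z≤n }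
  ...   | no a≉0  = inj₂ (0 , degree a≉0 λ { (suc i) _ → p≈0 i z≤n })

  degree-* : ∀ {a b} p q → Degree a p → Degree b q → Degree (a ℕ.+ b) (p *ᵖ q)
  degree-* {a} {b} p q (degree lp bp) (degree lq bq) = degree nonzero
    (λ i le → *ᵖ-below a (suc b) p q bp bq i (ℕₚ.≤-trans (ℕₚ.≤-reflexive (ℕₚ.+-suc a b)) le))
    where
    nonzero : ¬ (coef (p *ᵖ q) (a ℕ.+ b) ≈ 0#)
    nonzero e with domain _ _ (≈-trans (≈-sym (*ᵖ-top a b p q bp bq)) e)
    ... | inj₁ e′ = lp e′
    ... | inj₂ e′ = lq e′

  constant? : ∀ p → p belowᵖ 1 ⊎ ∃ λ d → Degree (suc d) p
  constant? p with degree? p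
  ... | inj₁ p≈0            = inj₁ λ i _ → p≈0 i z≤n
  ... | inj₂ (zero , deg)   = inj₁ (below deg)
  ... | inj₂ (suc d , deg)  = inj₂ (d , deg)

  below-cofactor : ∀ d e p q r → p belowᵖ suc (suc d) → p ≈ᵖ (q *ᵖ r) → Degree (suc e) r → q belowᵖ suc d
  below-cofactor d e p q r p< p≈qr deg with degree? q
  ... | inj₁ q≈0 = λ i _ → q≈0 i z≤n
  ... | inj₂ (c , deg′) = λ i le → below deg′ i (ℕₚ.≤-trans (s≤s c≤d) le)
    where
    c≤d : c ℕ.≤ d
    c≤d with c ℕ.≤? d
    ... | yes le = le
    ... | no nle = ⊥-elim (lead≉0 (degree-* q r deg′ deg) (≈-trans (≈-sym (at p≈qr (c ℕ.+ suc e)))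
      (p< (c ℕ.+ suc e) (ℕₚ.≤-trans (s≤s (ℕₚ.≰⇒> nle)) (ℕₚ.≤-trans (s≤s (ℕₚ.m≤m+n c e)) (ℕₚ.≤-reflexive (≡.sym (ℕₚ.+-suc c e))))))))

module ℤDomain = DomainPolynomials ℤRing (λ x → x ℤ.≟ + 0) (λ x y → ℤₚ.i*j≡0⇒i≡0∨j≡0 x {y})

*-zero-ℚ : ∀ x y → x ℚ.* y ≡ ℚ.0ℚ → x ≡ ℚ.0ℚ ⊎ y ≡ ℚ.0ℚ
*-zero-ℚ x y e with x ℚ.≟ ℚ.0ℚ
... | yes x≡0 = inj₁ x≡0
... | no  x≢0 = inj₂ (begin
  y                                   ≡⟨ ℚₚ.*-identityˡ y ⟨
  ℚ.1ℚ ℚ.* y                          ≡⟨ cong (ℚ._* y) (ℚₚ.*-inverseˡ x) ⟨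
  ((ℚ.1/ x) ℚ.* x) ℚ.* y              ≡⟨ ℚₚ.*-assoc (ℚ.1/ x) x y ⟩
  (ℚ.1/ x) ℚ.* (x ℚ.* y)              ≡⟨ cong (ℚ._*_ (ℚ.1/ x)) e ⟩
  (ℚ.1/ x) ℚ.* ℚ.0ℚ                   ≡⟨ ℚₚ.*-zeroʳ (ℚ.1/ x) ⟩
  ℚ.0ℚ                                ∎)
  where
  open ≡.≡-Reasoning
  instance
    x-nonzero : ℚ.NonZero x
    x-nonzero = ℚ.≢-nonZero x≢0

module ℚDomain = DomainPolynomials ℚRing (λ x → x ℚ.≟ ℚ.0ℚ) *-zero-ℚ

-- The characteristic polynomial as a polynomial over ℚ

coeff≡coef : ∀ p i → coeff p i ≡ ℚ[x].coef p i
coeff≡coef []      i       = refl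
coeff≡coef (a ∷ p) zero    = refl
coeff≡coef (a ∷ p) (suc i) = coeff≡coef p i

+ₚ≡+ᵖ : ∀ p q → p +ₚ q ≡ p ℚ[x].+ᵖ q
+ₚ≡+ᵖ []      q       = refl
+ₚ≡+ᵖ (a ∷ p) []      = refl
+ₚ≡+ᵖ (a ∷ p) (b ∷ q) = cong (a ℚ.+ b ∷_) (+ₚ≡+ᵖ p q)

*ₚ≡*ᵖ : ∀ p q → p *ₚ q ≡ p ℚ[x].*ᵖ q
*ₚ≡*ᵖ []      q = refl
*ₚ≡*ᵖ (a ∷ p) q = ≡.trans (+ₚ≡+ᵖ (map (a ℚ.*_) q) _) (cong (λ r → map (a ℚ.*_) q ℚ[x].+ᵖ (ℚ.0ℚ ∷ r)) (*ₚ≡*ᵖ p q))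

≈ₚ⇒≈ᵖ : ∀ {p q} → p ≈ₚ q → p ℚ[x].≈ᵖ q
≈ₚ⇒≈ᵖ {p} {q} e .ℚ[x].at i = ≡.trans (≡.sym (coeff≡coef p i)) (≡.trans (e i) (coeff≡coef q i))

≈ᵖ⇒≈ₚ : ∀ {p q} → p ℚ[x].≈ᵖ q → p ≈ₚ q
≈ᵖ⇒≈ₚ {p} {q} e i = ≡.trans (coeff≡coef p i) (≡.trans (ℚ[x].at e i) (≡.sym (coeff≡coef q i)))

module CharacteristicPolynomial where
  private Q = CommutativeRing.rawRing ℚ[x].polRing

  sumFin≡ : ∀ {n} {f g : Fin n → Poly} → (∀ i → f i ≡ g i) → sumFin polyRawRing f ≡ sumFin Q g
  sumFin≡ {zero}  e = refl
  sumFin≡ {suc n} {f} {g} e = ≡.trans (+ₚ≡+ᵖ (f zero) _) (cong₂ ℚ[x]._+ᵖ_ (e zero) (sumFin≡ (e ∘ suc)))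

  alt≡ : ∀ k p → alt polyRawRing k p ≡ alt Q k p
  alt≡ zero    p = refl
  alt≡ (suc k) p = cong -ₚ_ (alt≡ k p)

  det≡ : ∀ n {M N} → (∀ i j → M i j ≡ N i j) → det polyRawRing n M ≡ det Q n N
  det≡ zero    e = refl
  det≡ (suc n) {M} {N} e = sumFin≡ λ j → ≡.trans (alt≡ (toℕ j) _) (cong (alt Q (toℕ j))
    (≡.trans (*ₚ≡*ᵖ (M zero j) _) (cong₂ ℚ[x]._*ᵖ_ (e zero j) (det≡ n (λ i k → e (suc i) (punchIn j k))))))

  ι-star : ∀ ls → Hom.⟦_⟧ ι (starPoly ls) ℚ[x].≈ᵖ Star.star ℚ[x].polRing X ls
  ι-star = Hom.star-homo ι X₁

  charPoly-star : ∀ {n} (A : Graph n) k len (φ : Fin n ↔ StarV k len) →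
    (∀ u v → A u v ≡ starAdj k len (Inverse.to φ u) (Inverse.to φ v)) →
    charPoly A ℚ[x].≈ᵖ Hom.⟦_⟧ ι (starPoly (tabulate len))
  charPoly-star {n} A k len φ A≡ = P.≈-trans (P.≈-reflexive (det≡ n (λ i j → +ₚ≡+ᵖ (if ⌊ i Finₚ.≟ j ⌋ then X else []) _)))
    (P.≈-trans (StarDeterminant.det-star ℚ[x].polRing X A k len φ A≡) (P.≈-sym (ι-star (tabulate len))))
    where module P = RingKit ℚ[x].polRing

-- Monic integral factors of degree at most 2

open IntegersInℚ using (fromℤ-injective)

-- A factor over ℚ of least positive degree is irreducible, hence at most quadratic, and Gauss' lemma makes it integral.
module LowDegreeFactor (F : ℤ[x].Pol)
  (low : ∀ g → Irreducible g → ∀ h → Hom.⟦_⟧ ι F ℚ[x].≈ᵖ (g ℚ[x].*ᵖ h) → g ℚ[x].belowᵖ 3)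
  (f r : ℤ[x].Pol) (F≈fr : F ℤ[x].≈ᵖ (f ℤ[x].*ᵖ r)) (m : ℕ) (f-monic : ℤ[x].Monicᵖ (suc m) f) where
  open ℤ[x]
  private
    module P = RingKit polRing
    module Q = RingKit ℚ[x].polRing
  open Hom ι using (⟦_⟧; *-homo; ⟦⟧-cong)

  Found : Set
  Found = ∃ λ e → ∃ λ g → ∃ λ k → e ℕ.< 2 × Monicᵖ (suc e) g × f ≈ᵖ (g *ᵖ k)

  unit : ∀ i j → i ℤ.* j ≡ + 1 → i ≡ + 1 ⊎ i ≡ ℤ.- + 1
  unit i j e = absolute i (ℕₚ.m*n≡1⇒m≡1 ℤ.∣ i ∣ ℤ.∣ j ∣ (≡.trans (≡.sym (ℤₚ.abs-* i j)) (cong ℤ.∣_∣ e)))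
    where
    absolute : ∀ i → ℤ.∣ i ∣ ≡ 1 → i ≡ + 1 ⊎ i ≡ ℤ.- + 1
    absolute (+ .1)      refl = inj₁ refl
    absolute -[1+ zero ] refl = inj₂ refl

  neg*neg : ∀ g k → (g *ᵖ k) ≈ᵖ ((-ᵖ g) *ᵖ (-ᵖ k))
  neg*neg = P.solve 2 (λ g k → g P.:* k P.:= (P.:- g) P.:* (P.:- k)) P.≈-refl

  -- As f is monic, the leading coefficients of g and k are integers with product 1, so both are 1
  -- or both are -1; in the second case both factors are negated.
  monicise : ∀ e g k → e ℕ.< 2 → ℤDomain.Degree (suc e) g → f ≈ᵖ (g *ᵖ k) → Found
  monicise e g k e<2 deg f≈gk with ℤDomain.degree? k
  ... | inj₁ k≈0 with () ← ≡.trans (≡.sym (proj₁ f-monic)) (≡.trans (at f≈gk (suc m)) (≡.trans (coef-* g k (suc m))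
        (≡.trans (conv-comm (coef g) (coef k) (suc m)) (conv-zeroˡ (coef g) (λ i → k≈0 i z≤n) (suc m)))))
  ... | inj₂ (e′ , deg′) = signed (unit (coef g (suc e)) (coef k e′) leads)
    where
    product : ℤDomain.Degree (suc e ℕ.+ e′) (g *ᵖ k)
    product = ℤDomain.degree-* g k deg deg′
    degrees : suc e ℕ.+ e′ ≡ suc m
    degrees with ℕₚ.<-cmp (suc e ℕ.+ e′) (suc m)
    ... | tri≈ _ e≡ _ = e≡
    ... | tri< lt _ _ with () ← ≡.trans (≡.sym (proj₁ f-monic)) (≡.trans (at f≈gk (suc m)) (ℤDomain.below product (suc m) lt))
    ... | tri> _ _ gt = ⊥-elim (ℤDomain.lead≉0 product (≡.trans (≡.sym (at f≈gk _)) (proj₂ f-monic _ gt)))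
    leads : coef g (suc e) ℤ.* coef k e′ ≡ + 1
    leads = ≡.trans (≡.sym (*ᵖ-top (suc e) e′ g k (ℤDomain.below deg) (ℤDomain.below deg′)))
      (≡.trans (≡.sym (at f≈gk _)) (≡.trans (cong (coef f) degrees) (proj₁ f-monic)))
    signed : coef g (suc e) ≡ + 1 ⊎ coef g (suc e) ≡ ℤ.- + 1 → Found
    signed (inj₁ lead) = e , g , k , e<2 , (lead , ℤDomain.below deg) , f≈gk
    signed (inj₂ lead) = e , -ᵖ g , -ᵖ k , e<2
      , (≡.trans (coef-- g (suc e)) (cong ℤ.-_ lead) , λ i le → ≡.trans (coef-- g i) (cong ℤ.-_ (ℤDomain.below deg i le)))
      , P.≈-trans f≈gk (neg*neg g k)

  S : ℤ → ℚ
  S = RingKit.fromℤ ℚRing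

  cleared : ∀ c d h k H K → ⟦ H ⟧ ℚ[x].≈ᵖ map (ℚ._*_ (S (+ suc c))) h → ⟦ K ⟧ ℚ[x].≈ᵖ map (ℚ._*_ (S (+ suc d))) k →
    ⟦ f ⟧ ℚ[x].≈ᵖ (h ℚ[x].*ᵖ k) → Gauss.scale (+ (suc c ℕ.* suc d)) f ≈ᵖ (H *ᵖ K)
  cleared c d h k H K ιH≈ ιK≈ f≈hk = ι-injective _ (H *ᵖ K) (ℚ[x].eq λ i → begin
    ℚ[x].coef ⟦ Gauss.scale (+ (suc c ℕ.* suc d)) f ⟧ i     ≡⟨ ι-coef (Gauss.scale (+ (suc c ℕ.* suc d)) f) i ⟩
    S (coef (Gauss.scale (+ (suc c ℕ.* suc d)) f) i)        ≡⟨ cong S (coef-scale (+ (suc c ℕ.* suc d)) f i) ⟩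
    S (+ (suc c ℕ.* suc d) ℤ.* coef f i)                    ≡⟨ RingKit.fromℤ-* ℚRing (+ (suc c ℕ.* suc d)) (coef f i) ⟩
    S (+ (suc c ℕ.* suc d)) ℚ.* S (coef f i)                ≡⟨ cong₂ ℚ._*_ (≡.trans (cong S (ℤₚ.pos-* (suc c) (suc d))) (RingKit.fromℤ-* ℚRing (+ suc c) (+ suc d)))
                                                                 (≡.trans (≡.sym (ι-coef f i)) (≡.trans (ℚ[x].at f≈hk i) (ℚ[x].coef-* h k i))) ⟩
    (S (+ suc c) ℚ.* S (+ suc d)) ℚ.* ℚ[x].conv (ℚ[x].coef h) (ℚ[x].coef k) i
      ≡⟨ ℚₚ.*-assoc (S (+ suc c)) (S (+ suc d)) _ ⟩
    S (+ suc c) ℚ.* (S (+ suc d) ℚ.* ℚ[x].conv (ℚ[x].coef h) (ℚ[x].coef k) i)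
      ≡⟨ cong (S (+ suc c) ℚ.*_) (≡.trans (cong (S (+ suc d) ℚ.*_) (ℚ[x].conv-comm (ℚ[x].coef h) (ℚ[x].coef k) i))
           (≡.sym (ℚ[x].conv-scaleˡ (S (+ suc d)) (ℚ[x].coef k) (ℚ[x].coef h) i))) ⟩
    S (+ suc c) ℚ.* ℚ[x].conv (λ i → S (+ suc d) ℚ.* ℚ[x].coef k i) (ℚ[x].coef h) i
      ≡⟨ cong (S (+ suc c) ℚ.*_) (ℚ[x].conv-comm (λ i → S (+ suc d) ℚ.* ℚ[x].coef k i) (ℚ[x].coef h) i) ⟩
    S (+ suc c) ℚ.* ℚ[x].conv (ℚ[x].coef h) (λ i → S (+ suc d) ℚ.* ℚ[x].coef k i) i
      ≡⟨ ℚ[x].conv-scaleˡ (S (+ suc c)) (ℚ[x].coef h) (λ i → S (+ suc d) ℚ.* ℚ[x].coef k i) i ⟨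
    ℚ[x].conv (λ i → S (+ suc c) ℚ.* ℚ[x].coef h i) (λ i → S (+ suc d) ℚ.* ℚ[x].coef k i) i
      ≡⟨ ℚ[x].conv-cong (λ i → ≡.trans (ℚ[x].at ιH≈ i) (ℚ[x].coef-scale (S (+ suc c)) h i)) (λ i → ≡.trans (ℚ[x].at ιK≈ i) (ℚ[x].coef-scale (S (+ suc d)) k i)) i ⟨
    ℚ[x].conv (ℚ[x].coef ⟦ H ⟧) (ℚ[x].coef ⟦ K ⟧) i         ≡⟨ ℚ[x].coef-* ⟦ H ⟧ ⟦ K ⟧ i ⟨
    ℚ[x].coef (⟦ H ⟧ ℚ[x].*ᵖ ⟦ K ⟧) i                       ≡⟨ ℚ[x].at (*-homo H K) i ⟨
    ℚ[x].coef ⟦ H *ᵖ K ⟧ i                                  ∎)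
    where open ≡.≡-Reasoning

  integral : ∀ h k → ¬ (h ℚ[x].belowᵖ 1) → h ℚ[x].belowᵖ 3 → ⟦ f ⟧ ℚ[x].≈ᵖ (h ℚ[x].*ᵖ k) → Found
  integral h k h-nonconstant h< f≈hk with clear-denominators h | clear-denominators k
  ... | c , H , ιH≈ | d , K , ιK≈ with Gauss.gauss f (suc c ℕ.* suc d) (<-wellFounded _) (λ ()) H K (cleared c d h k H K ιH≈ ιK≈ f≈hk)
  ... | H′ , K′ , c′ , H≈ , f≈ = finish (ℤDomain.constant? H′)
    where
    S≢0 : ∀ c → S (+ suc c) ≢ ℚ.0ℚ
    S≢0 c e with () ← fromℤ-injective {+ suc c} {+ 0} e
    coefficients : ∀ i → S (+ suc c′ ℤ.* coef H′ i) ≡ S (+ suc c) ℚ.* ℚ[x].coef h i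
    coefficients i = ≡.trans (cong S (≡.sym (≡.trans (at H≈ i) (coef-scale (+ suc c′) H′ i))))
      (≡.trans (≡.sym (ι-coef H i)) (≡.trans (ℚ[x].at ιH≈ i) (ℚ[x].coef-scale (S (+ suc c)) h i)))
    h≡0⇒H′≡0 : ∀ i → ℚ[x].coef h i ≡ ℚ.0ℚ → coef H′ i ≡ + 0
    h≡0⇒H′≡0 i e with ℤₚ.i*j≡0⇒i≡0∨j≡0 (+ suc c′) (fromℤ-injective {+ suc c′ ℤ.* coef H′ i} {+ 0}
      (≡.trans (coefficients i) (≡.trans (cong (S (+ suc c) ℚ.*_) e) (ℚₚ.*-zeroʳ (S (+ suc c))))))
    ... | inj₂ e′ = e′
    H′≡0⇒h≡0 : ∀ i → coef H′ i ≡ + 0 → ℚ[x].coef h i ≡ ℚ.0ℚ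
    H′≡0⇒h≡0 i e with *-zero-ℚ (S (+ suc c)) (ℚ[x].coef h i) (≡.trans (≡.sym (coefficients i)) (cong S (≡.trans (cong (+ suc c′ ℤ.*_) e) (ℤₚ.*-zeroʳ (+ suc c′)))))
    ... | inj₁ e′ = ⊥-elim (S≢0 c e′)
    ... | inj₂ e′ = e′
    finish : H′ belowᵖ 1 ⊎ (∃ λ d → ℤDomain.Degree (suc d) H′) → Found
    finish (inj₁ H′<) = ⊥-elim (h-nonconstant λ i le → H′≡0⇒h≡0 i (H′< i le))
    finish (inj₂ (d , deg)) with d ℕ.<? 2
    ... | yes d<2 = monicise d H′ K′ d<2 deg f≈
    ... | no d≮2  = ⊥-elim (ℤDomain.lead≉0 deg (h≡0⇒H′≡0 (suc d) (h< (suc d) (s≤s (ℕₚ.≮⇒≥ d≮2)))))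

  -- Induction on the degree bound. In a proper splitting of h the first factor has smaller degree
  -- and still divides f, which the induction excludes; so h is irreducible, `low` bounds its degree
  -- and `integral` produces what was assumed absent. No factorisation is ever computed.
  no-factor : ¬ Found → ∀ d h k → h ℚ[x].belowᵖ suc d → ¬ (h ℚ[x].belowᵖ 1) → ¬ (⟦ f ⟧ ℚ[x].≈ᵖ (h ℚ[x].*ᵖ k))
  no-factor none zero    h k h< h-nonconstant f≈hk = h-nonconstant h<
  no-factor none (suc d) h k h< h-nonconstant f≈hk =
    none (integral h k h-nonconstant (low h irreducible (k ℚ[x].*ᵖ ⟦ r ⟧)
      (Q.≈-trans (⟦⟧-cong F≈fr) (Q.≈-trans (*-homo f r) (Q.≈-trans (Q.*-congʳ {⟦ r ⟧} f≈hk) (Q.*-assoc h k ⟦ r ⟧))))) f≈hk)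
    where
    constant : ∀ p → p ℚ[x].belowᵖ 1 → IsConstant p
    constant p p< i lt = ≡.trans (coeff≡coef p i) (p< i lt)
    irreducible : Irreducible h
    irreducible = (λ h-const → h-nonconstant (λ i le → ≡.trans (≡.sym (coeff≡coef h i)) (h-const i le))) , split
      where
      split : ∀ h₁ h₂ → h ≈ₚ (h₁ *ₚ h₂) → IsConstant h₁ ⊎ IsConstant h₂
      split h₁ h₂ e with ℚDomain.constant? h₁ | ℚDomain.constant? h₂
      ... | inj₁ const | _          = inj₁ (constant h₁ const)
      ... | inj₂ _     | inj₁ const = inj₂ (constant h₂ const)
      ... | inj₂ (e₁ , deg₁) | inj₂ (e₂ , deg₂) = ⊥-elim (no-factor none d h₁ (h₂ ℚ[x].*ᵖ k)
        (ℚDomain.below-cofactor d e₂ h h₁ h₂ h< h≈h₁h₂ deg₂)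
        (λ const → ℚDomain.lead≉0 deg₁ (const (suc e₁) (s≤s z≤n)))
        (Q.≈-trans f≈hk (Q.≈-trans (Q.*-congʳ {k} h≈h₁h₂) (Q.*-assoc h₁ h₂ k))))
        where
        h≈h₁h₂ : h ℚ[x].≈ᵖ (h₁ ℚ[x].*ᵖ h₂)
        h≈h₁h₂ = Q.≈-trans (≈ₚ⇒≈ᵖ e) (Q.≈-reflexive (*ₚ≡*ᵖ h₁ h₂))

  found : ¬ ¬ Found
  found none = no-factor none (suc m) ⟦ f ⟧ Q.1#
    (λ i le → ≡.trans (ι-coef f i) (cong (RingKit.fromℤ ℚRing) (proj₂ f-monic i le)))
    (λ const → 1≢0 (≡.trans (≡.sym (≡.trans (ι-coef f (suc m)) (cong (RingKit.fromℤ ℚRing) (proj₁ f-monic)))) (const (suc m) (s≤s z≤n))))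
    (Q.≈-sym (Q.*-identityʳ ⟦ f ⟧))
    where
    1≢0 : ℚ.1ℚ ≢ ℚ.0ℚ
    1≢0 ()

-- The symmetry x ↦ -x

module EvalQuadratic (R : CommutativeRing 0ℓ 0ℓ) where
  open RingKit R
  open Evaluation R

  eval-x²-ax+b : ∀ x a b → eval x (quadratic a b) ≈ (x * x + - (fromℤ a * x)) + fromℤ b
  eval-x²-ax+b x a b = ≈-trans (+-congˡ (*-congˡ (+-congʳ (fromℤ-neg a))))
    (solve 3 (λ x a b → b :+ x :* ((:- a) :+ x :* (con (+ 1) :+ x :* con (+ 0))) := (x :* x :+ (:- (a :* x))) :+ b) ≈-refl x (fromℤ a) (fromℤ b))

  eval-compose : ∀ x q p → eval x (Evaluation.eval ℤ[x].polRing q p) ≈ eval (eval x q) p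
  eval-compose x q []      = ≈-refl
  eval-compose x q (a ∷ p) = ≈-trans (+-homo (P.fromℤ a) (q P.* Evaluation.eval ℤ[x].polRing q p))
    (+-cong (fromℤ-homo a) (≈-trans (*-homo q (Evaluation.eval ℤ[x].polRing q p)) (*-congˡ (eval-compose x q p))))
    where
    open Hom (evaluate x)
    module P = RingKit ℤ[x].polRing

module Reflection where
  open ℤ[x]
  open RingKit polRing
  open Evaluation polRing
  open EvalQuadratic polRing
  open Star polRing using (Sign; sign-*; star-parity)

  constant-fromℤ : ∀ a → (a ∷ []) ≈ᵖ fromℤ a
  constant-fromℤ a = ≈-trans (≈-reflexive (cong (_∷ []) (≡.sym (fromℤ-ℤ a)))) (Hom.fromℤ-homo (PolynomialHoms.constant ℤRing) a)

  cons-expand : ∀ a p → (a ∷ p) ≈ᵖ (fromℤ a +ᵖ (X₁ *ᵖ p))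
  cons-expand a p = ≈-trans (eq λ { zero → ≡.sym (ℤₚ.+-identityʳ a) ; (suc i) → refl })
    (+-cong {a ∷ []} {fromℤ a} {+ 0 ∷ p} {X₁ *ᵖ p} (constant-fromℤ a) (eq λ i → ≡.sym (≡.trans (coef-* X₁ p i) (shifted-coef i))))
    where
    shifted-coef : ∀ i → conv (coef X₁) (coef p) i ≡ coef (+ 0 ∷ p) i
    shifted-coef zero    = refl
    shifted-coef (suc i) = ≡.trans (ℤₚ.+-identityˡ _) (unit i)
      where
      unit : ∀ i → conv (coef (+ 1 ∷ [])) (coef p) i ≡ coef p i
      unit i = ≡.trans (≡.sym (coef-* (+ 1 ∷ []) p i)) (at (*ᵖ-identityˡ p) i)

  -- Turns a list of coefficients into a ring expression in `X₁`, which brings identities between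
  -- explicit polynomials within reach of the ring solver.
  eval-X₁ : ∀ p → eval X₁ p ≈ᵖ p
  eval-X₁ []      = ≈-refl
  eval-X₁ (a ∷ p) = ≈-trans (+-congˡ {fromℤ a} (*-congˡ {X₁} (eval-X₁ p))) (≈-sym (cons-expand a p))

  quadratic-expand : ∀ a b → quadratic a b ≈ᵖ (((X₁ *ᵖ X₁) +ᵖ (-ᵖ (fromℤ a *ᵖ X₁))) +ᵖ fromℤ b)
  quadratic-expand a b = ≈-trans (≈-sym (eval-X₁ (quadratic a b))) (eval-x²-ax+b X₁ a b)

  reflect : Hom polRing polRing
  reflect = evaluate (-ᵖ X₁)
  open Hom reflect

  reflect-quadratic : ∀ a b → ⟦ quadratic a b ⟧ ≈ᵖ quadratic (ℤ.- a) b
  reflect-quadratic a b = ≈-trans (eval-x²-ax+b (-ᵖ X₁) a b)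
    (≈-trans (solve 3 (λ x a b → ((:- x) :* (:- x) :+ (:- (a :* (:- x)))) :+ b := (x :* x :+ (:- ((:- a) :* x))) :+ b) ≈-refl X₁ (fromℤ a) (fromℤ b))
    (≈-trans (+-congʳ {fromℤ b} (+-congˡ {X₁ *ᵖ X₁} (-‿cong (*-congʳ {X₁} (≈-sym (fromℤ-neg a))))))
      (≈-sym (quadratic-expand (ℤ.- a) b))))

  record Symmetric (f : Pol) : Set where
    constructor symmetric
    field
      sign     : Pol
      isSign   : Sign sign
      reflects : ⟦ f ⟧ ≈ᵖ (sign *ᵖ f)
  open Symmetric public

  sign-square : ∀ {s} → Sign s → (s *ᵖ s) ≈ᵖ 1#
  sign-square (inj₁ e) = ≈-trans (*-cong e e) (*-identityˡ 1#)
  sign-square (inj₂ e) = ≈-trans (*-cong e e) (solve 0 ((:- con (+ 1)) :* (:- con (+ 1)) := con (+ 1)) ≈-refl)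

  starPoly-symmetric : ∀ ls → Symmetric (starPoly ls)
  starPoly-symmetric ls with star-parity X₁ ls
  ... | s , sgn , e , _ = symmetric s sgn (≈-trans (QuadraticRoots.eval-star polRing (-ᵖ X₁) ls) e)

  -- Reflection sends gk to t g times the reflection of k, and t² = 1. So g times the reflection of
  -- k is ts · gk, and the monic g is cancelled.
  symmetric-cofactor : ∀ d f g k → Monicᵖ d g → Symmetric f → Symmetric g → f ≈ᵖ (g *ᵖ k) → Symmetric k
  symmetric-cofactor d f g k monic (symmetric s sgn σf) (symmetric t tgn σg) f≈gk =
    symmetric (t *ᵖ s) (sign-* tgn sgn) (monic-cancelˡ d g ⟦ k ⟧ ((t *ᵖ s) *ᵖ k) monic (begin
      g *ᵖ ⟦ k ⟧                   ≈⟨ *-congʳ {⟦ k ⟧} (≈-trans (≈-sym (*-identityˡ g)) (*-congʳ {g} (≈-sym (sign-square tgn)))) ⟩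
      ((t *ᵖ t) *ᵖ g) *ᵖ ⟦ k ⟧     ≈⟨ solve 3 (λ t g k → ((t :* t) :* g) :* k := t :* ((t :* g) :* k)) ≈-refl t g ⟦ k ⟧ ⟩
      t *ᵖ ((t *ᵖ g) *ᵖ ⟦ k ⟧)     ≈⟨ *-congˡ {t} (*-congʳ {⟦ k ⟧} σg) ⟨
      t *ᵖ (⟦ g ⟧ *ᵖ ⟦ k ⟧)        ≈⟨ *-congˡ {t} (*-homo g k) ⟨
      t *ᵖ ⟦ g *ᵖ k ⟧              ≈⟨ *-congˡ {t} (⟦⟧-cong f≈gk) ⟨
      t *ᵖ ⟦ f ⟧                   ≈⟨ *-congˡ {t} σf ⟩
      t *ᵖ (s *ᵖ f)                ≈⟨ *-congˡ {t} (*-congˡ {s} f≈gk) ⟩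
      t *ᵖ (s *ᵖ (g *ᵖ k))         ≈⟨ solve 4 (λ t s g k → t :* (s :* (g :* k)) := g :* ((t :* s) :* k)) ≈-refl t s g k ⟩
      g *ᵖ ((t *ᵖ s) *ᵖ k)         ∎))

  symmetric-X : Symmetric X₁
  symmetric-X = symmetric (-ᵖ 1#) (inj₂ ≈-refl) (≈-trans (eval-X (-ᵖ X₁)) (solve 1 (λ x → :- x := (:- con (+ 1)) :* x) ≈-refl X₁))

  symmetric-square : ∀ b → Symmetric (quadratic (+ 0) b)
  symmetric-square b = symmetric 1# (inj₁ ≈-refl) (≈-trans (reflect-quadratic (+ 0) b) (≈-sym (*-identityˡ (quadratic (+ 0) b))))

  symmetric-pair : ∀ a b → Symmetric (quadratic a b *ᵖ quadratic (ℤ.- a) b)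
  symmetric-pair a b = symmetric 1# (inj₁ ≈-refl) (begin
    ⟦ quadratic a b *ᵖ quadratic (ℤ.- a) b ⟧                ≈⟨ *-homo (quadratic a b) (quadratic (ℤ.- a) b) ⟩
    ⟦ quadratic a b ⟧ *ᵖ ⟦ quadratic (ℤ.- a) b ⟧            ≈⟨ *-cong (reflect-quadratic a b) (reflect-quadratic (ℤ.- a) b) ⟩
    quadratic (ℤ.- a) b *ᵖ quadratic (ℤ.- ℤ.- a) b          ≈⟨ *-congˡ {quadratic (ℤ.- a) b} (≈-reflexive (cong (λ a → quadratic a b) (ℤₚ.neg-involutive a))) ⟩
    quadratic (ℤ.- a) b *ᵖ quadratic a b                    ≈⟨ *-comm (quadratic (ℤ.- a) b) (quadratic a b) ⟩
    quadratic a b *ᵖ quadratic (ℤ.- a) b                    ≈⟨ *-identityˡ (quadratic a b *ᵖ quadratic (ℤ.- a) b) ⟨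
    1# *ᵖ (quadratic a b *ᵖ quadratic (ℤ.- a) b)            ∎)

  linear : ℤ → Pol
  linear ρ = ℤ.- ρ ∷ + 1 ∷ []

  linear-expand : ∀ ρ → linear ρ ≈ᵖ (X₁ +ᵖ (-ᵖ fromℤ ρ))
  linear-expand ρ = ≈-trans (≈-sym (eval-X₁ (linear ρ))) (≈-trans (+-congʳ {X₁ *ᵖ (1# +ᵖ (X₁ *ᵖ [])) } (fromℤ-neg ρ))
    (solve 2 (λ x r → (:- r) :+ x :* (con (+ 1) :+ x :* con (+ 0)) := x :- r) ≈-refl X₁ (fromℤ ρ)))

  monic-linear : ∀ ρ → Monicᵖ 1 (linear ρ)
  monic-linear ρ = refl , λ i le → belowᵖ-length (linear ρ) i le

  monic-quadratic : ∀ a b → Monicᵖ 2 (quadratic a b)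
  monic-quadratic a b = refl , λ i le → belowᵖ-length (quadratic a b) i le

  module ℤEval = Evaluation ℤRing

  remainder-theorem : ∀ ρ p → ∃ λ q → p ≈ᵖ ((linear ρ *ᵖ q) +ᵖ fromℤ (ℤEval.eval ρ p))
  remainder-theorem ρ [] = [] , solve 1 (λ l → con (+ 0) := l :* con (+ 0) :+ con (+ 0)) ≈-refl (linear ρ)
  remainder-theorem ρ (a ∷ p) with remainder-theorem ρ p
  ... | q , e = fromℤ c +ᵖ (X₁ *ᵖ q) , (begin
      a ∷ p                                               ≈⟨ cons-expand a p ⟩
      fromℤ a +ᵖ (X₁ *ᵖ p)                                ≈⟨ +-congˡ {fromℤ a} (*-congˡ {X₁} e) ⟩
      fromℤ a +ᵖ (X₁ *ᵖ ((linear ρ *ᵖ q) +ᵖ fromℤ c))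
        ≈⟨ solve 6 (λ a x l q c r → a :+ x :* (l :* q :+ c) := (l :* (x :* q) :+ (x :- r) :* c) :+ (a :+ r :* c)) ≈-refl (fromℤ a) X₁ (linear ρ) q (fromℤ c) (fromℤ ρ) ⟩
      ((linear ρ *ᵖ (X₁ *ᵖ q)) +ᵖ ((X₁ +ᵖ (-ᵖ fromℤ ρ)) *ᵖ fromℤ c)) +ᵖ (fromℤ a +ᵖ (fromℤ ρ *ᵖ fromℤ c))
        ≈⟨ +-cong (+-congˡ {linear ρ *ᵖ (X₁ *ᵖ q)} (*-congʳ {fromℤ c} (≈-sym (linear-expand ρ)))) (value a) ⟩
      ((linear ρ *ᵖ (X₁ *ᵖ q)) +ᵖ (linear ρ *ᵖ fromℤ c)) +ᵖ fromℤ (ℤEval.eval ρ (a ∷ p))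
        ≈⟨ +-congʳ {fromℤ (ℤEval.eval ρ (a ∷ p))} (solve 3 (λ l u c → l :* u :+ l :* c := l :* (c :+ u)) ≈-refl (linear ρ) (X₁ *ᵖ q) (fromℤ c)) ⟩
      (linear ρ *ᵖ (fromℤ c +ᵖ (X₁ *ᵖ q))) +ᵖ fromℤ (ℤEval.eval ρ (a ∷ p)) ∎)
    where
    c = ℤEval.eval ρ p
    value : ∀ a → (fromℤ a +ᵖ (fromℤ ρ *ᵖ fromℤ c)) ≈ᵖ fromℤ (ℤEval.eval ρ (a ∷ p))
    value a = ≈-trans (+-congˡ {fromℤ a} (≈-sym (fromℤ-* ρ c)))
      (≈-trans (≈-sym (fromℤ-+ a (ρ ℤ.* c))) (≈-reflexive (cong (λ a′ → fromℤ (a′ ℤ.+ ρ ℤ.* c)) (≡.sym (fromℤ-ℤ a)))))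

  factor-theorem : ∀ ρ p → ℤEval.eval ρ p ≡ + 0 → ∃ λ q → p ≈ᵖ (linear ρ *ᵖ q)
  factor-theorem ρ p e with remainder-theorem ρ p
  ... | q , p≈ = q , ≈-trans p≈ (≈-trans (+-congˡ {linear ρ *ᵖ q} (≈-reflexive (cong fromℤ e))) (+-identityʳ (linear ρ *ᵖ q)))

  -- Horner's scheme: in x(r₀ + r₁x) the square is replaced by ax - b, and r₁ moves into the
  -- quotient.
  quadratic-division : ∀ a b p → ∃ λ q → ∃ λ r₀ → ∃ λ r₁ → p ≈ᵖ ((quadratic a b *ᵖ q) +ᵖ (fromℤ r₀ +ᵖ (fromℤ r₁ *ᵖ X₁)))
  quadratic-division a b [] = [] , + 0 , + 0 , solve 2 (λ g x → con (+ 0) := g :* con (+ 0) :+ (con (+ 0) :+ con (+ 0) :* x)) ≈-refl (quadratic a b) X₁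
  quadratic-division a b (c ∷ p) with quadratic-division a b p
  ... | q , r₀ , r₁ , e = fromℤ r₁ +ᵖ (X₁ *ᵖ q) , c ℤ.- b ℤ.* r₁ , r₀ ℤ.+ a ℤ.* r₁ , (begin
      c ∷ p                                  ≈⟨ cons-expand c p ⟩
      fromℤ c +ᵖ (X₁ *ᵖ p)                   ≈⟨ +-congˡ {fromℤ c} (*-congˡ {X₁} e) ⟩
      fromℤ c +ᵖ (X₁ *ᵖ ((g *ᵖ q) +ᵖ (fromℤ r₀ +ᵖ (fromℤ r₁ *ᵖ X₁))))
        ≈⟨ solve 8 (λ c x g q r₀ r₁ a b → c :+ x :* (g :* q :+ (r₀ :+ r₁ :* x))
             := (g :* (x :* q) :+ r₁ :* ((x :* x :+ (:- (a :* x))) :+ b)) :+ ((c :- b :* r₁) :+ (r₀ :+ a :* r₁) :* x))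
             ≈-refl (fromℤ c) X₁ g q (fromℤ r₀) (fromℤ r₁) (fromℤ a) (fromℤ b) ⟩
      ((g *ᵖ (X₁ *ᵖ q)) +ᵖ (fromℤ r₁ *ᵖ (((X₁ *ᵖ X₁) +ᵖ (-ᵖ (fromℤ a *ᵖ X₁))) +ᵖ fromℤ b)))
          +ᵖ ((fromℤ c +ᵖ (-ᵖ (fromℤ b *ᵖ fromℤ r₁))) +ᵖ ((fromℤ r₀ +ᵖ (fromℤ a *ᵖ fromℤ r₁)) *ᵖ X₁))
        ≈⟨ +-cong (+-congˡ {g *ᵖ (X₁ *ᵖ q)} (*-congˡ {fromℤ r₁} (≈-sym (quadratic-expand a b))))
             (+-cong (≈-trans (+-congˡ {fromℤ c} (≈-trans (-‿cong (≈-sym (fromℤ-* b r₁))) (≈-sym (fromℤ-neg (b ℤ.* r₁))))) (≈-sym (fromℤ-+ c (ℤ.- (b ℤ.* r₁)))))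
               (*-congʳ {X₁} (≈-trans (+-congˡ {fromℤ r₀} (≈-sym (fromℤ-* a r₁))) (≈-sym (fromℤ-+ r₀ (a ℤ.* r₁)))))) ⟩
      ((g *ᵖ (X₁ *ᵖ q)) +ᵖ (fromℤ r₁ *ᵖ g)) +ᵖ (fromℤ (c ℤ.- b ℤ.* r₁) +ᵖ (fromℤ (r₀ ℤ.+ a ℤ.* r₁) *ᵖ X₁))
        ≈⟨ +-congʳ {fromℤ (c ℤ.- b ℤ.* r₁) +ᵖ (fromℤ (r₀ ℤ.+ a ℤ.* r₁) *ᵖ X₁)}
             (solve 3 (λ g u r → g :* u :+ r :* g := g :* (r :+ u)) ≈-refl g (X₁ *ᵖ q) (fromℤ r₁)) ⟩
      (g *ᵖ (fromℤ r₁ +ᵖ (X₁ *ᵖ q))) +ᵖ (fromℤ (c ℤ.- b ℤ.* r₁) +ᵖ (fromℤ (r₀ ℤ.+ a ℤ.* r₁) *ᵖ X₁)) ∎)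
    where g = quadratic a b

square? : ∀ z → Dec (∃ λ m → z ≡ + (m ℕ.* m))
square? -[1+ _ ] = no λ ()
square? (+ n) = Decidable.map′ (λ (m , _ , e) → m , cong +_ e) (λ (m , e) → m , s≤s (bound m (ℤₚ.+-injective e)) , ℤₚ.+-injective e)
  (ℕₚ.anyUpTo? (λ m → n ℕ.≟ m ℕ.* m) (suc n))
  where
  bound : ∀ m → n ≡ m ℕ.* m → m ℕ.≤ n
  bound zero    _    = z≤n
  bound (suc m) refl = ℕₚ.m≤m+n (suc m) _

discriminant : ℤ → ℤ → ℤ
discriminant a b = a ℤ.* a ℤ.- + 4 ℤ.* b

2∣i*i⇒2∣i : ∀ i → + 2 ∣ i ℤ.* i → + 2 ∣ i
2∣i*i⇒2∣i i d with euclidsLemma ℤ.∣ i ∣ ℤ.∣ i ∣ prime[2] (subst (2 ℕ∣.∣_) (ℤₚ.abs-* i i) (∣⇒∣ᵤ d))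
... | inj₁ e = ∣ᵤ⇒∣ e
... | inj₂ e = ∣ᵤ⇒∣ e

-- The root is (a + m)/2. It is integral because (a + m)² = 2(a² + am - 2b) is even.
rational-root : ∀ a b m → discriminant a b ≡ + (m ℕ.* m) → ∃ λ t → (t ℤ.* t ℤ.+ ℤ.- (a ℤ.* t)) ℤ.+ b ≡ + 0
rational-root a b m D≡m² = root (2∣i*i⇒2∣i s (divides (a ℤ.* a ℤ.+ a ℤ.* + m ℤ.- + 2 ℤ.* b) s²≡))
  where
  module Z = RingKit ℤRing
  open Z using (_:+_; _:*_; _:-_; :-_; _:=_; con; solve)
  s = a ℤ.+ + m
  m² : + m ℤ.* + m ≡ discriminant a b
  m² = ≡.trans (≡.sym (ℤₚ.pos-* m m)) (≡.sym D≡m²)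
  s²≡ : s ℤ.* s ≡ (a ℤ.* a ℤ.+ a ℤ.* + m ℤ.- + 2 ℤ.* b) ℤ.* + 2
  s²≡ = ≡.trans (solve 2 (λ a m → (a :+ m) :* (a :+ m) := (a :* a :+ con (+ 2) :* (a :* m)) :+ m :* m) refl a (+ m))
    (≡.trans (cong (λ z → (a ℤ.* a ℤ.+ + 2 ℤ.* (a ℤ.* + m)) ℤ.+ z) m²)
      (solve 3 (λ a m b → (a :* a :+ con (+ 2) :* (a :* m)) :+ (a :* a :- con (+ 4) :* b) := (a :* a :+ a :* m :- con (+ 2) :* b) :* con (+ 2)) refl a (+ m) b))
  root : + 2 ∣ s → ∃ λ t → (t ℤ.* t ℤ.+ ℤ.- (a ℤ.* t)) ℤ.+ b ≡ + 0
  root (divides t s≡) = t , quarter _ (≡.trans (solve 3 (λ t a b → con (+ 4) :* ((t :* t :+ (:- (a :* t))) :+ b)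
      := (t :* con (+ 2)) :* (t :* con (+ 2)) :- con (+ 2) :* a :* (t :* con (+ 2)) :+ con (+ 4) :* b) refl t a b)
    (≡.trans (cong (λ s → s ℤ.* s ℤ.- + 2 ℤ.* a ℤ.* s ℤ.+ + 4 ℤ.* b) (≡.sym s≡))
    (≡.trans (solve 3 (λ a m b → (a :+ m) :* (a :+ m) :- con (+ 2) :* a :* (a :+ m) :+ con (+ 4) :* b := m :* m :- (a :* a :- con (+ 4) :* b)) refl a (+ m) b)
      (ℤₚ.i≡j⇒i-j≡0 m²))))
    where
    quarter : ∀ i → + 4 ℤ.* i ≡ + 0 → i ≡ + 0
    quarter i e with ℤₚ.i*j≡0⇒i≡0∨j≡0 (+ 4) e
    ... | inj₂ i≡0 = i≡0

-- Factors that are symmetric under x ↦ -x. The arguments of `square-atom` and the first one of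
-- `pair-atom` stand for their successors, which makes them positive. `square-atom` also takes in
-- the reducible x² - ρ² that two opposite integral roots produce.
data Atom : Set where
  x-atom      : Atom
  square-atom : ℕ → Atom
  pair-atom   : ∀ a b → NonSquarePos (discriminant (+ suc a) b) → Atom

open ℤ[x] using (Pol; _≈ᵖ_; _*ᵖ_; _+ᵖ_; -ᵖ_; polRing; Monicᵖ) public

atom : Atom → Pol
atom x-atom            = X₁
atom (square-atom c)   = quadratic (+ 0) -[1+ c ]
atom (pair-atom a b _) = quadratic (+ suc a) b *ᵖ quadratic (ℤ.- + suc a) b

module Extraction where
  open RingKit polRing
  open EvalQuadratic ℤRing
  open Reflection
  open Hom reflect using (⟦_⟧; ⟦⟧-cong; *-homo)

  Extracted : Pol → Set
  Extracted f = ∃ λ A → ∃ λ k → f ≈ᵖ (atom A *ᵖ k) × Symmetric k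

  eval-reflect : ∀ ρ p → ℤEval.eval ρ ⟦ p ⟧ ≡ ℤEval.eval (ℤ.- ρ) p
  eval-reflect ρ p = ≡.trans (eval-compose ρ (-ᵖ X₁) p) (cong (λ t → ℤEval.eval t p)
    (≡.trans (Hom.neg-homo (ℤEval.evaluate ρ) X₁) (cong ℤ.-_ (ℤEval.eval-X ρ))))

  eval-linear : ∀ t ρ → ℤEval.eval t (linear ρ) ≡ t ℤ.- ρ
  eval-linear t ρ = ≡.trans (cong (ℤ._+ (t ℤ.* (+ 1 ℤ.+ t ℤ.* + 0))) (fromℤ-ℤ (ℤ.- ρ)))
    (Z.solve 2 (λ t r → (Z.:- r) Z.:+ t Z.:* (Z.con (+ 1) Z.:+ t Z.:* Z.con (+ 0)) Z.:= t Z.:- r) refl t ρ)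
    where module Z = RingKit ℤRing

  conjugate-roots : ∀ ρ → (linear ρ *ᵖ linear (ℤ.- ρ)) ≈ᵖ quadratic (+ 0) (ℤ.- (ρ ℤ.* ρ))
  conjugate-roots ρ = begin
    linear ρ *ᵖ linear (ℤ.- ρ)                                  ≈⟨ *-cong (linear-expand ρ) (linear-expand (ℤ.- ρ)) ⟩
    (X₁ +ᵖ (-ᵖ fromℤ ρ)) *ᵖ (X₁ +ᵖ (-ᵖ fromℤ (ℤ.- ρ)))         ≈⟨ *-congˡ {X₁ +ᵖ (-ᵖ fromℤ ρ)} (+-congˡ {X₁} (-‿cong (fromℤ-neg ρ))) ⟩
    (X₁ +ᵖ (-ᵖ fromℤ ρ)) *ᵖ (X₁ +ᵖ (-ᵖ (-ᵖ fromℤ ρ)))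
      ≈⟨ solve 2 (λ x r → (x :- r) :* (x :- (:- r)) := (x :* x :+ (:- (con (+ 0) :* x))) :+ (:- (r :* r))) ≈-refl X₁ (fromℤ ρ) ⟩
    ((X₁ *ᵖ X₁) +ᵖ (-ᵖ (fromℤ (+ 0) *ᵖ X₁))) +ᵖ (-ᵖ (fromℤ ρ *ᵖ fromℤ ρ))
      ≈⟨ +-congˡ {(X₁ *ᵖ X₁) +ᵖ (-ᵖ (fromℤ (+ 0) *ᵖ X₁))} (≈-trans (-‿cong (≈-sym (fromℤ-* ρ ρ))) (≈-sym (fromℤ-neg (ρ ℤ.* ρ)))) ⟩
    ((X₁ *ᵖ X₁) +ᵖ (-ᵖ (fromℤ (+ 0) *ᵖ X₁))) +ᵖ fromℤ (ℤ.- (ρ ℤ.* ρ))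
      ≈⟨ quadratic-expand (+ 0) (ℤ.- (ρ ℤ.* ρ)) ⟨
    quadratic (+ 0) (ℤ.- (ρ ℤ.* ρ)) ∎

  eval-factor : ∀ t f g k → f ≈ᵖ (g *ᵖ k) → ℤEval.eval t f ≡ ℤEval.eval t g ℤ.* ℤEval.eval t k
  eval-factor t f g k e = ≡.trans (Hom.⟦⟧-cong (ℤEval.evaluate t) {f} {g *ᵖ k} e) (Hom.*-homo (ℤEval.evaluate t) g k)

  -- By symmetry f vanishes at -ρ, where x - ρ has the nonzero value -2ρ.
  opposite-root : ∀ f ρ k → ρ ≢ + 0 → Symmetric f → f ≈ᵖ (linear ρ *ᵖ k) → ℤEval.eval (ℤ.- ρ) k ≡ + 0
  opposite-root f ρ k ρ≢0 (symmetric s _ σf) f≈ = nonzero ρ (ℤEval.eval (ℤ.- ρ) k) ρ≢0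
    (combine (ℤEval.eval (ℤ.- ρ) f) _ (ℤEval.eval ρ f) (ℤEval.eval ρ s) (ℤEval.eval ρ k) (≡.trans (eval-factor (ℤ.- ρ) f (linear ρ) k f≈) (cong (ℤ._* ℤEval.eval (ℤ.- ρ) k) (eval-linear (ℤ.- ρ) ρ)))
      (≡.trans (≡.sym (eval-reflect ρ f)) (eval-factor ρ ⟦ f ⟧ s f σf))
      (≡.trans (eval-factor ρ f (linear ρ) k f≈) (cong (ℤ._* ℤEval.eval ρ k) (≡.trans (eval-linear ρ ρ) (ℤₚ.+-inverseʳ ρ)))))
    where
    combine : ∀ x y z s u → x ≡ y → x ≡ s ℤ.* z → z ≡ + 0 ℤ.* u → y ≡ + 0
    combine x .x z s u refl x≡sz z≡0 = ≡.trans x≡sz (≡.trans (cong (s ℤ.*_) z≡0) (ℤₚ.*-zeroʳ s))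
    nonzero : ∀ ρ z → ρ ≢ + 0 → (ℤ.- ρ ℤ.- ρ) ℤ.* z ≡ + 0 → z ≡ + 0
    nonzero ρ z ρ≢0 e with ℤₚ.i*j≡0⇒i≡0∨j≡0 (ℤ.- ρ ℤ.- ρ) e
    ... | inj₂ z≡0 = z≡0
    ... | inj₁ -2ρ≡0 = ⊥-elim (ρ≢0 (2i≡0⇒i≡0 ρ (≡.trans (Z.solve 1 (λ r → Z.con (+ 2) Z.:* r Z.:= Z.:- ((Z.:- r) Z.:- r)) refl ρ) (cong ℤ.-_ -2ρ≡0))))
      where module Z = RingKit ℤRing

  square-factor : ∀ f ρ c k q → ρ ℤ.* ρ ≡ + suc c → f ≈ᵖ (linear ρ *ᵖ k) → k ≈ᵖ (linear (ℤ.- ρ) *ᵖ q) → f ≈ᵖ (quadratic (+ 0) -[1+ c ] *ᵖ q)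
  square-factor f ρ c k q ρ²≡ f≈ k≈ = ≈-trans f≈ (≈-trans (*-congˡ {linear ρ} {k} {linear (ℤ.- ρ) *ᵖ q} k≈)
    (≈-trans (≈-sym (*-assoc (linear ρ) (linear (ℤ.- ρ)) q))
      (*-congʳ {q} (≈-trans (conjugate-roots ρ) (≈-reflexive (cong (λ z → quadratic (+ 0) (ℤ.- z)) ρ²≡))))))

  extract-square : ∀ f c q → Symmetric f → f ≈ᵖ (quadratic (+ 0) -[1+ c ] *ᵖ q) → Extracted f
  extract-square f c q sym e = square-atom c , q , e
    , symmetric-cofactor 2 f (quadratic (+ 0) -[1+ c ]) q (monic-quadratic (+ 0) -[1+ c ]) sym (symmetric-square -[1+ c ]) e

  extract-root≢0 : ∀ f ρ c k → ρ ≢ + 0 → ρ ℤ.* ρ ≡ + suc c → Symmetric f → f ≈ᵖ (linear ρ *ᵖ k) → Extracted f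
  extract-root≢0 f ρ c k ρ≢0 ρ²≡ sym f≈ =
    let q , k≈ = factor-theorem (ℤ.- ρ) k (opposite-root f ρ k ρ≢0 sym f≈)
    in extract-square f c q sym (square-factor f ρ c k q ρ²≡ f≈ k≈)

  extract-root : ∀ f ρ k → Symmetric f → f ≈ᵖ (linear ρ *ᵖ k) → Extracted f
  extract-root f (+ zero)   k sym f≈ = x-atom , k , f≈ , symmetric-cofactor 1 f X₁ k (monic-linear (+ 0)) sym symmetric-X f≈
  extract-root f (+ suc n)  k sym f≈ = extract-root≢0 f (+ suc n) (n ℕ.+ n ℕ.* suc n) k (λ ()) refl sym f≈
  extract-root f -[1+ n ]   k sym f≈ = extract-root≢0 f -[1+ n ] (n ℕ.+ n ℕ.* suc n) k (λ ()) refl sym f≈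

  -- At a root ω of x² + ax + b the cofactor of x² - ax + b vanishes, because x² - ax + b takes the value -2aω there.
  conjugate-factor : ∀ f a b k → a ≢ + 0 → b ≢ + 0 → Symmetric f → f ≈ᵖ (quadratic a b *ᵖ k) → ∃ λ q → k ≈ᵖ (quadratic (ℤ.- a) b *ᵖ q)
  conjugate-factor f a b k a≢0 b≢0 (symmetric s sgn σf) f≈ with quadratic-division (ℤ.- a) b k
  ... | q , r₀ , r₁ , k≈ = q , ≈-trans k≈ (≈-trans (+-congˡ {quadratic (ℤ.- a) b *ᵖ q} (+-cong (≈-reflexive (cong fromℤ r₀≡0)) (*-congʳ {X₁} (≈-reflexive (cong fromℤ r₁≡0)))))
      (solve 2 (λ g x → g :+ (con (+ 0) :+ con (+ 0) :* x) := g) ≈-refl (quadratic (ℤ.- a) b *ᵖ q) X₁))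
    where
    open QuadraticExtension ℤRing (ℤ.- a) (ℤ.- b)
    module E = RingKit extRing
    module Z = RingKit ℤRing
    module EE = Evaluation extRing
    module EQ = EvalQuadratic extRing
    open Hom (EE.evaluate ω) using () renaming (⟦_⟧ to ⟪_⟫; *-homo to ⟪*⟫; +-homo to ⟪+⟫; ⟦⟧-cong to ⟪⟫-cong; fromℤ-homo to ⟪fromℤ⟫)
    embed-ℤ : ∀ z → E.fromℤ z E.≈ (z +ω + 0)
    embed-ℤ z = E.≈-sym (E.≈-trans (≡.sym (fromℤ-ℤ z) & refl) (Hom.fromℤ-homo embed z))
    value : ∀ c → EE.eval ω (quadratic c b) E.≈ (((ω E.* ω) E.+ E.- ((c +ω + 0) E.* ω)) E.+ (b +ω + 0))
    value c = E.≈-trans (EQ.eval-x²-ax+b ω c b) (E.+-cong (E.+-congˡ {ω E.* ω} (E.-‿cong (E.*-congʳ {ω} (embed-ℤ c)))) (embed-ℤ b))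
    root : EE.eval ω (quadratic (ℤ.- a) b) E.≈ E.0#
    root = E.≈-trans (value (ℤ.- a)) (re₀ a b & im₀ a b)
      where
      re₀ : ∀ a b → ((+ 0 ℤ.* + 0 ℤ.+ ℤ.- b ℤ.* (+ 1 ℤ.* + 1)) ℤ.+ ℤ.- (ℤ.- a ℤ.* + 0 ℤ.+ ℤ.- b ℤ.* (+ 0 ℤ.* + 1))) ℤ.+ b ≡ + 0
      re₀ = Z.solve 2 (λ a b → ((Z.con (+ 0) Z.:* Z.con (+ 0) Z.:+ (Z.:- b) Z.:* (Z.con (+ 1) Z.:* Z.con (+ 1)))
        Z.:+ Z.:- ((Z.:- a) Z.:* Z.con (+ 0) Z.:+ (Z.:- b) Z.:* (Z.con (+ 0) Z.:* Z.con (+ 1)))) Z.:+ b Z.:= Z.con (+ 0)) refl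
      im₀ : ∀ a b → (((+ 0 ℤ.* + 1 ℤ.+ + 1 ℤ.* + 0) ℤ.+ ℤ.- a ℤ.* (+ 1 ℤ.* + 1))
        ℤ.+ ℤ.- ((ℤ.- a ℤ.* + 1 ℤ.+ + 0 ℤ.* + 0) ℤ.+ ℤ.- a ℤ.* (+ 0 ℤ.* + 1))) ℤ.+ + 0 ≡ + 0
      im₀ = Z.solve 2 (λ a b → (((Z.con (+ 0) Z.:* Z.con (+ 1) Z.:+ Z.con (+ 1) Z.:* Z.con (+ 0)) Z.:+ (Z.:- a) Z.:* (Z.con (+ 1) Z.:* Z.con (+ 1)))
        Z.:+ Z.:- (((Z.:- a) Z.:* Z.con (+ 1) Z.:+ Z.con (+ 0) Z.:* Z.con (+ 0)) Z.:+ (Z.:- a) Z.:* (Z.con (+ 0) Z.:* Z.con (+ 1)))) Z.:+ Z.con (+ 0) Z.:= Z.con (+ 0)) refl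
    sf≈ : (s *ᵖ f) ≈ᵖ (quadratic (ℤ.- a) b *ᵖ ⟦ k ⟧)
    sf≈ = ≈-trans (≈-sym σf) (≈-trans (⟦⟧-cong f≈) (≈-trans (*-homo (quadratic a b) k) (*-congʳ {⟦ k ⟧} (reflect-quadratic a b))))
    f≈s²f : f ≈ᵖ (s *ᵖ (s *ᵖ f))
    f≈s²f = ≈-trans (≈-sym (*-identityˡ f)) (≈-trans (*-congʳ {f} (≈-sym (sign-square sgn))) (*-assoc s s f))
    f[ω]≈0 : ⟪ f ⟫ E.≈ E.0#
    f[ω]≈0 = E.≈-trans (⟪⟫-cong (≈-trans f≈s²f (*-congˡ {s} sf≈)))
      (E.≈-trans (⟪*⟫ s (quadratic (ℤ.- a) b *ᵖ ⟦ k ⟧)) (E.≈-trans (E.*-congˡ {⟪ s ⟫} (E.≈-trans (⟪*⟫ (quadratic (ℤ.- a) b) ⟦ k ⟧)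
        (E.≈-trans (E.*-congʳ {⟪ ⟦ k ⟧ ⟫} root) (E.zeroˡ ⟪ ⟦ k ⟧ ⟫)))) (E.zeroʳ ⟪ s ⟫)))
    g[ω]≈ : EE.eval ω (quadratic a b) E.≈ (+ 0 +ω ℤ.- (+ 2 ℤ.* a))
    g[ω]≈ = E.≈-trans (value a) (re₁ a b & im₁ a b)
      where
      re₁ : ∀ a b → ((+ 0 ℤ.* + 0 ℤ.+ ℤ.- b ℤ.* (+ 1 ℤ.* + 1)) ℤ.+ ℤ.- (a ℤ.* + 0 ℤ.+ ℤ.- b ℤ.* (+ 0 ℤ.* + 1))) ℤ.+ b ≡ + 0
      re₁ = Z.solve 2 (λ a b → ((Z.con (+ 0) Z.:* Z.con (+ 0) Z.:+ (Z.:- b) Z.:* (Z.con (+ 1) Z.:* Z.con (+ 1)))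
        Z.:+ Z.:- (a Z.:* Z.con (+ 0) Z.:+ (Z.:- b) Z.:* (Z.con (+ 0) Z.:* Z.con (+ 1)))) Z.:+ b Z.:= Z.con (+ 0)) refl
      im₁ : ∀ a b → (((+ 0 ℤ.* + 1 ℤ.+ + 1 ℤ.* + 0) ℤ.+ ℤ.- a ℤ.* (+ 1 ℤ.* + 1))
        ℤ.+ ℤ.- ((a ℤ.* + 1 ℤ.+ + 0 ℤ.* + 0) ℤ.+ ℤ.- a ℤ.* (+ 0 ℤ.* + 1))) ℤ.+ + 0 ≡ ℤ.- (+ 2 ℤ.* a)
      im₁ = Z.solve 2 (λ a b → (((Z.con (+ 0) Z.:* Z.con (+ 1) Z.:+ Z.con (+ 1) Z.:* Z.con (+ 0)) Z.:+ (Z.:- a) Z.:* (Z.con (+ 1) Z.:* Z.con (+ 1)))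
        Z.:+ Z.:- ((a Z.:* Z.con (+ 1) Z.:+ Z.con (+ 0) Z.:* Z.con (+ 0)) Z.:+ (Z.:- a) Z.:* (Z.con (+ 0) Z.:* Z.con (+ 1)))) Z.:+ Z.con (+ 0) Z.:= Z.:- (Z.con (+ 2) Z.:* a)) refl
    k[ω]≈ : ⟪ k ⟫ E.≈ (r₀ +ω r₁)
    k[ω]≈ = E.≈-trans (⟪⟫-cong k≈) (E.≈-trans (⟪+⟫ (quadratic (ℤ.- a) b *ᵖ q) (fromℤ r₀ +ᵖ (fromℤ r₁ *ᵖ X₁)))
      (E.≈-trans (E.+-cong (E.≈-trans (⟪*⟫ (quadratic (ℤ.- a) b) q) (E.≈-trans (E.*-congʳ {⟪ q ⟫} root) (E.zeroˡ ⟪ q ⟫)))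
          (E.≈-trans (⟪+⟫ (fromℤ r₀) (fromℤ r₁ *ᵖ X₁)) (E.+-cong (E.≈-trans (⟪fromℤ⟫ r₀) (embed-ℤ r₀))
            (E.≈-trans (⟪*⟫ (fromℤ r₁) X₁) (E.*-cong (E.≈-trans (⟪fromℤ⟫ r₁) (embed-ℤ r₁)) (EE.eval-X ω))))))
        (re₂ a b r₀ r₁ & im₂ a r₁)))
      where
      re₂ : ∀ a b r₀ r₁ → + 0 ℤ.+ (r₀ ℤ.+ (r₁ ℤ.* + 0 ℤ.+ ℤ.- b ℤ.* (+ 0 ℤ.* + 1))) ≡ r₀
      re₂ = Z.solve 4 (λ a b r₀ r₁ → Z.con (+ 0) Z.:+ (r₀ Z.:+ (r₁ Z.:* Z.con (+ 0) Z.:+ (Z.:- b) Z.:* (Z.con (+ 0) Z.:* Z.con (+ 1)))) Z.:= r₀) refl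
      im₂ : ∀ a r₁ → + 0 ℤ.+ (+ 0 ℤ.+ ((r₁ ℤ.* + 1 ℤ.+ + 0 ℤ.* + 0) ℤ.+ ℤ.- a ℤ.* (+ 0 ℤ.* + 1))) ≡ r₁
      im₂ = Z.solve 2 (λ a r₁ → Z.con (+ 0) Z.:+ (Z.con (+ 0) Z.:+ ((r₁ Z.:* Z.con (+ 1) Z.:+ Z.con (+ 0) Z.:* Z.con (+ 0)) Z.:+ (Z.:- a) Z.:* (Z.con (+ 0) Z.:* Z.con (+ 1)))) Z.:= r₁) refl
    product : ((+ 0 +ω ℤ.- (+ 2 ℤ.* a)) E.* (r₀ +ω r₁)) E.≈ E.0#
    product = E.≈-trans (E.≈-sym (E.≈-trans (⟪⟫-cong f≈) (E.≈-trans (⟪*⟫ (quadratic a b) k) (E.*-cong g[ω]≈ k[ω]≈)))) f[ω]≈0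
    cancel : ∀ c r → c ≢ + 0 → a ℤ.* (c ℤ.* r) ≡ + 0 → r ≡ + 0
    cancel c r c≢0 e with ℤₚ.i*j≡0⇒i≡0∨j≡0 a e
    ... | inj₁ a≡0 = ⊥-elim (a≢0 a≡0)
    ... | inj₂ cr≡0 with ℤₚ.i*j≡0⇒i≡0∨j≡0 c cr≡0
    ...   | inj₁ c≡0 = ⊥-elim (c≢0 c≡0)
    ...   | inj₂ r≡0 = r≡0
    r₁≡0 : r₁ ≡ + 0
    -- The first coordinate of -2aω (r₀ + r₁ω) is 2ab r₁. With a and b nonzero this settles r₁, and
    -- then the second coordinate settles r₀, by cancellation in ℤ alone.
    r₁≡0 = cancel b r₁ b≢0 (2i≡0⇒i≡0 _ (≡.trans (twice a b r₀ r₁) (re≈ product)))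
      where
      twice : ∀ a b r₀ r₁ → + 2 ℤ.* (a ℤ.* (b ℤ.* r₁)) ≡ + 0 ℤ.* r₀ ℤ.+ ℤ.- b ℤ.* (ℤ.- (+ 2 ℤ.* a) ℤ.* r₁)
      twice = Z.solve 4 (λ a b r₀ r₁ → Z.con (+ 2) Z.:* (a Z.:* (b Z.:* r₁)) Z.:= Z.con (+ 0) Z.:* r₀ Z.:+ (Z.:- b) Z.:* ((Z.:- (Z.con (+ 2) Z.:* a)) Z.:* r₁)) refl
    r₀≡0 : r₀ ≡ + 0
    r₀≡0 = cancel (+ 1) r₀ (λ ()) (2i≡0⇒i≡0 _ (≡.trans (twice a r₀) (≡.trans (cong ℤ.-_ (≡.trans
        (cong (λ r → (+ 0 ℤ.* r ℤ.+ ℤ.- (+ 2 ℤ.* a) ℤ.* r₀) ℤ.+ ℤ.- a ℤ.* (ℤ.- (+ 2 ℤ.* a) ℤ.* r)) (≡.sym r₁≡0)) (im≈ product))) refl)))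
      where
      twice : ∀ a r₀ → + 2 ℤ.* (a ℤ.* (+ 1 ℤ.* r₀)) ≡ ℤ.- ((+ 0 ℤ.* + 0 ℤ.+ ℤ.- (+ 2 ℤ.* a) ℤ.* r₀) ℤ.+ ℤ.- a ℤ.* (ℤ.- (+ 2 ℤ.* a) ℤ.* + 0))
      twice = Z.solve 2 (λ a r₀ → Z.con (+ 2) Z.:* (a Z.:* (Z.con (+ 1) Z.:* r₀)) Z.:= Z.:- ((Z.con (+ 0) Z.:* Z.con (+ 0) Z.:+ (Z.:- (Z.con (+ 2) Z.:* a)) Z.:* r₀) Z.:+ (Z.:- a) Z.:* ((Z.:- (Z.con (+ 2) Z.:* a)) Z.:* Z.con (+ 0)))) refl

  pair : ℤ → ℤ → Pol
  pair a b = quadratic a b *ᵖ quadratic (ℤ.- a) b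

  symmetric-cofactor-pair : ∀ f a b q → Symmetric f → f ≈ᵖ (pair a b *ᵖ q) → Symmetric q
  symmetric-cofactor-pair f a b q sym e = symmetric-cofactor 4 f (pair a b) q
    (TopCoefficients.top-monic {4} {a ℤ.* a ℤ.- + 2 ℤ.* b} {pair a b} (TopCoefficients.top-pair a b)) sym (symmetric-pair a b) e

  extract-pair : ∀ f a b k → a ≢ + 0 → b ≢ + 0 → Symmetric f → f ≈ᵖ (quadratic a b *ᵖ k) →
    ∃ λ q → f ≈ᵖ (pair a b *ᵖ q) × Symmetric q
  extract-pair f a b k a≢0 b≢0 sym f≈ =
    let q , k≈ = conjugate-factor f a b k a≢0 b≢0 sym f≈
        e = ≈-trans f≈ (≈-trans (*-congˡ {quadratic a b} {k} {quadratic (ℤ.- a) b *ᵖ q} k≈) (≈-sym (*-assoc (quadratic a b) (quadratic (ℤ.- a) b) q)))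
    in q , e , symmetric-cofactor-pair f a b q sym e

  extract-reducible : ∀ f a b k t → (t ℤ.* t ℤ.+ ℤ.- (a ℤ.* t)) ℤ.+ b ≡ + 0 → Symmetric f → f ≈ᵖ (quadratic a b *ᵖ k) → Extracted f
  extract-reducible f a b k t root sym f≈ = let q , f≈q = factor-theorem t f f[t]≡0 in extract-root f t q sym f≈q
    where
    g[t]≡0 : ℤEval.eval t (quadratic a b) ≡ + 0
    g[t]≡0 = ≡.trans (eval-x²-ax+b t a b) (≡.trans (cong₂ (λ a b → (t ℤ.* t ℤ.+ ℤ.- (a ℤ.* t)) ℤ.+ b) (fromℤ-ℤ a) (fromℤ-ℤ b)) root)
    f[t]≡0 : ℤEval.eval t f ≡ + 0
    f[t]≡0 = ≡.trans (eval-factor t f (quadratic a b) k f≈) (cong (ℤ._* ℤEval.eval t k) g[t]≡0)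

  discriminant-0 : ∀ a → discriminant a (+ 0) ≡ + (ℤ.∣ a ∣ ℕ.* ℤ.∣ a ∣)
  discriminant-0 a = ≡.trans (ℤₚ.+-identityʳ (a ℤ.* a)) (square-nonneg a)

  4b≡a²-D : ∀ a b D → discriminant a b ≡ D → + 4 ℤ.* b ≡ a ℤ.* a ℤ.+ ℤ.- D
  4b≡a²-D a b D refl = Z.solve 2 (λ x y → y Z.:= x Z.:- (x Z.:- y)) refl (a ℤ.* a) (+ 4 ℤ.* b)
    where module Z = RingKit ℤRing

  nonsquarePos : ∀ Δ D → Δ ≡ + suc D → ¬ (∃ λ m → Δ ≡ + (m ℕ.* m)) → NonSquarePos Δ
  nonsquarePos _ D refl ns = ℤ.+<+ (s≤s z≤n) , ns

  module _ (ls : List ℕ) (f r : Pol) (F≈ : starPoly ls ≈ᵖ (f *ᵖ r)) (sym : Symmetric f) where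
    -- `D` is separate so that its sign can be matched on. Zero is a square; a negative value means
    -- non-real roots, excluded for the whole of `starPoly ls`, which is why r occurs. If b were 0,
    -- the discriminant would be the square a². For a = 0 the quadratic is symmetric by itself.
    extract-irreducible : ∀ a b D k → discriminant a b ≡ D → ¬ (∃ λ m → discriminant a b ≡ + (m ℕ.* m)) → f ≈ᵖ (quadratic a b *ᵖ k) → Extracted f
    extract-irreducible a b (+ zero) k D≡ ns f≈ = ⊥-elim (ns (0 , D≡))
    extract-irreducible a b -[1+ d ] k D≡ ns f≈ = ⊥-elim (NonRealRoot.non-real-impossible a b d (4b≡a²-D a b -[1+ d ] D≡) ls (k *ᵖ r)
        (≈-trans F≈ (≈-trans (*-congʳ {r} {f} {quadratic a b *ᵖ k} f≈) (*-assoc (quadratic a b) k r))))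
    extract-irreducible (+ suc a) b (+ suc D) k D≡ ns f≈ =
      let q , e , symq = extract-pair f (+ suc a) b k (λ ()) (λ { refl → ns (suc a , discriminant-0 (+ suc a)) }) sym f≈
      in pair-atom a b (nonsquarePos (discriminant (+ suc a) b) D D≡ ns) , q , e , symq
    extract-irreducible -[1+ a ] b (+ suc D) k D≡ ns f≈ =
      let q , e , symq = extract-pair f -[1+ a ] b k (λ ()) (λ { refl → ns (suc a , discriminant-0 -[1+ a ]) }) sym f≈
      in pair-atom a b (nonsquarePos (discriminant (+ suc a) b) D D≡ ns) , q
         , ≈-trans e (*-congʳ {q} {pair -[1+ a ] b} {pair (+ suc a) b} (*-comm (quadratic -[1+ a ] b) (quadratic (+ suc a) b))) , symq
    extract-irreducible (+ zero) -[1+ c ]  (+ suc D) k D≡ ns f≈ = extract-square f c k sym f≈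
    extract-irreducible (+ zero) (+ zero)  (+ suc D) k () ns f≈
    extract-irreducible (+ zero) (+ suc b) (+ suc D) k () ns f≈

    extract-quadratic : ∀ a b k → f ≈ᵖ (quadratic a b *ᵖ k) → Extracted f
    extract-quadratic a b k f≈ with square? (discriminant a b)
    ... | no nonsquare   = extract-irreducible a b (discriminant a b) k refl nonsquare f≈
    ... | yes (m , D≡)   = let t , root = rational-root a b m D≡ in extract-reducible f a b k t root sym f≈

-- Decomposition into symmetric factors

atomProduct : List Atom → Pol
atomProduct []       = RingKit.1# polRing
atomProduct (A ∷ As) = atom A *ᵖ atomProduct As

atomDegree : Atom → ℕ
atomDegree x-atom            = 1
atomDegree (square-atom _)   = 2
atomDegree (pair-atom _ _ _) = 4

monic-atom : ∀ A → Monicᵖ (atomDegree A) (atom A)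
monic-atom x-atom            = Reflection.monic-linear (+ 0)
monic-atom (square-atom c)   = Reflection.monic-quadratic (+ 0) -[1+ c ]
monic-atom (pair-atom a b ns) = TopCoefficients.top-monic {4} {+ suc a ℤ.* + suc a ℤ.- + 2 ℤ.* b} {atom (pair-atom a b ns)} (TopCoefficients.top-pair (+ suc a) b)

atomDegree>0 : ∀ A → ∃ λ d → atomDegree A ≡ suc d
atomDegree>0 x-atom            = 0 , refl
atomDegree>0 (square-atom _)   = 1 , refl
atomDegree>0 (pair-atom _ _ _) = 3 , refl

module _ where
  open ℤ[x]
  open RingKit polRing

  monic-cofactor : ∀ d m g f k → Monicᵖ d g → Monicᵖ m f → f ≈ᵖ (g *ᵖ k) → ∃ λ m′ → Monicᵖ m′ k × m ≡ d ℕ.+ m′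
  monic-cofactor d m g f k (g-lead , g<) (f-lead , f<) f≈ = cofactor (ℤDomain.degree? k)
    where
    1≢0 : + 1 ≢ + 0
    1≢0 ()
    g-degree : ℤDomain.Degree d g
    g-degree = ℤDomain.degree (λ e → 1≢0 (≡.trans (≡.sym g-lead) e)) g<
    f-degree : ℤDomain.Degree m f
    f-degree = ℤDomain.degree (λ e → 1≢0 (≡.trans (≡.sym f-lead) e)) f<
    cofactor : k belowᵖ 0 ⊎ (∃ λ e → ℤDomain.Degree e k) → ∃ λ m′ → Monicᵖ m′ k × m ≡ d ℕ.+ m′
    cofactor (inj₁ k≈0) = ⊥-elim (ℤDomain.lead≉0 f-degree (≡.trans (at f≈ m) (≡.trans (coef-* g k m)
      (≡.trans (conv-comm (coef g) (coef k) m) (conv-zeroˡ (coef g) (λ i → k≈0 i z≤n) m)))))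
    cofactor (inj₂ (e , deg)) = e , (lead , ℤDomain.below deg) , m≡d+e
      where
      product : ℤDomain.Degree (d ℕ.+ e) (g *ᵖ k)
      product = ℤDomain.degree-* g k g-degree deg
      m≡d+e : m ≡ d ℕ.+ e
      m≡d+e with ℕₚ.<-cmp m (d ℕ.+ e)
      ... | tri≈ _ m≡ _ = m≡
      ... | tri< lt _ _ = ⊥-elim (ℤDomain.lead≉0 product (≡.trans (≡.sym (at f≈ (d ℕ.+ e))) (f< (d ℕ.+ e) lt)))
      ... | tri> _ _ gt = ⊥-elim (ℤDomain.lead≉0 f-degree (≡.trans (at f≈ m) (ℤDomain.below product m gt)))
      lead : coef k e ≡ + 1
      lead = ≡.trans (≡.sym (ℤₚ.*-identityˡ (coef k e))) (≡.trans (cong (ℤ._* coef k e) (≡.sym g-lead))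
        (≡.trans (≡.sym (*ᵖ-top d e g k g< (ℤDomain.below deg))) (≡.trans (≡.sym (at f≈ (d ℕ.+ e))) (≡.trans (cong (coef f) (≡.sym m≡d+e)) f-lead))))

  monic-1 : ∀ g → Monicᵖ 1 g → g ≈ᵖ Reflection.linear (ℤ.- coef g 0)
  monic-1 g (lead , g<) .at zero          = ≡.sym (ℤₚ.neg-involutive (coef g 0))
  monic-1 g (lead , g<) .at (suc zero)    = lead
  monic-1 g (lead , g<) .at (suc (suc i)) = g< (suc (suc i)) (s≤s (s≤s z≤n))

  monic-2 : ∀ g → Monicᵖ 2 g → g ≈ᵖ quadratic (ℤ.- coef g 1) (coef g 0)
  monic-2 g (lead , g<) .at zero                = refl
  monic-2 g (lead , g<) .at (suc zero)          = ≡.sym (ℤₚ.neg-involutive (coef g 1))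
  monic-2 g (lead , g<) .at (suc (suc zero))    = lead
  monic-2 g (lead , g<) .at (suc (suc (suc i))) = g< (suc (suc (suc i))) (s≤s (s≤s (s≤s z≤n)))

  module Decomposition (ls : List ℕ)
    (low : ∀ g → Irreducible g → ∀ h → Hom.⟦_⟧ ι (starPoly ls) ℚ[x].≈ᵖ (g ℚ[x].*ᵖ h) → g ℚ[x].belowᵖ 3) where
    open Reflection using (Symmetric)

    Decomposed : Pol → Set
    Decomposed f = ∃ λ As → f ≈ᵖ atomProduct As

    extract : ∀ f r → starPoly ls ≈ᵖ (f *ᵖ r) → Symmetric f →
      (∃ λ e → ∃ λ g → ∃ λ k → e ℕ.< 2 × Monicᵖ (suc e) g × f ≈ᵖ (g *ᵖ k)) → Extraction.Extracted f
    extract f r F≈ sym (zero , g , k , _ , monic , f≈) =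
      Extraction.extract-root f (ℤ.- coef g 0) k sym (≈-trans f≈ (*-congʳ {k} (monic-1 g monic)))
    extract f r F≈ sym (suc zero , g , k , _ , monic , f≈) =
      Extraction.extract-quadratic ls f r F≈ sym (ℤ.- coef g 1) (coef g 0) k (≈-trans f≈ (*-congʳ {k} (monic-2 g monic)))
    extract f r F≈ sym (suc (suc e) , g , k , s≤s (s≤s ()) , monic , f≈)

    -- The cofactor r gathers the atoms already split off: what remains has to be known as a factor
    -- of `starPoly ls`, because `low` and the exclusion of non-real roots speak of that polynomial
    -- only.
    decompose : ∀ fuel m f r → m ℕ.≤ fuel → Monicᵖ m f → Symmetric f → starPoly ls ≈ᵖ (f *ᵖ r) → ¬ ¬ Decomposed f
    decompose fuel zero f r _ (lead , f<) sym F≈ none =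
      none ([] , eq λ { zero → lead ; (suc i) → f< (suc i) (s≤s z≤n) })
    decompose (suc fuel) (suc m) f r (s≤s m≤) monic sym F≈ none =
      LowDegreeFactor.found (starPoly ls) low f r F≈ m monic (λ found → continue (extract f r F≈ sym found))
      where
      continue : ¬ Extraction.Extracted f
      continue (A , k , f≈ , symk) =
        let m′ , k-monic , m≡ = monic-cofactor (atomDegree A) (suc m) (atom A) f k (monic-atom A) monic f≈
            d , d≡ = atomDegree>0 A
            m′≤m = ℕₚ.≤-trans (ℕₚ.m≤n+m m′ d) (ℕₚ.≤-reflexive (ℕₚ.suc-injective (≡.trans (cong (ℕ._+ m′) (≡.sym d≡)) (≡.sym m≡))))
            F≈k = ≈-trans F≈ (≈-trans (*-congʳ {r} f≈) (solve 3 (λ a k r → (a :* k) :* r := k :* (a :* r)) ≈-refl (atom A) k r))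
        in decompose fuel m′ k (atom A *ᵖ r) (ℕₚ.≤-trans m′≤m m≤) k-monic symk F≈k
             (λ (As , k≈) → none (A ∷ As , ≈-trans f≈ (*-congˡ {atom A} k≈)))

    decomposition : ¬ ¬ Decomposed (starPoly ls)
    decomposition = decompose (suc (sum ls)) (suc (sum ls)) (starPoly ls) 1# ℕₚ.≤-refl
      (TopCoefficients.top-monic (TopCoefficients.top-star ls)) (Reflection.starPoly-symmetric ls) (≈-sym (*-identityʳ (starPoly ls)))

-- Classification of the factors

infixr 8 _^ᵖ_
_^ᵖ_ : Pol → ℕ → Pol
p ^ᵖ zero  = RingKit.1# polRing
p ^ᵖ suc t = p *ᵖ (p ^ᵖ t)

squareMinus : ℕ → Pol
squareMinus c = quadratic (+ 0) (ℤ.- + c)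

symmetricPair : ℤ → ℤ → Pol
symmetricPair a b = quadratic a b *ᵖ quadratic (ℤ.- a) b

common : ℕ → ℕ → ℕ → ℕ → ℕ → Pol
common t₁ t₂ t₃ t₄ t₅ = (X₁ ^ᵖ t₁) *ᵖ ((squareMinus 1 ^ᵖ t₂) *ᵖ ((squareMinus 2 ^ᵖ t₃)
  *ᵖ ((symmetricPair (+ 1) -[1+ 0 ] ^ᵖ t₄) *ᵖ (squareMinus 3 ^ᵖ t₅))))

-- The symmetric factors with exactly one root ≥ 2: for x² - (a+1)x + b and x = X + 2 this means X² - uX - v with u = a - 3 and v ≥ 0.
data Big : Set where
  bigSquare : ℕ → Big
  bigPair   : ∀ a b v → NonSquarePos (discriminant (+ suc a) b) → b ≡ + 2 ℤ.* (+ suc a ℤ.- + 4) ℤ.+ + 4 ℤ.- + v → Big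

big : Big → Pol
big (bigSquare c)       = squareMinus (4 ℕ.+ c)
big (bigPair a b _ _ _) = symmetricPair (+ suc a) b

-- The position of the roots of x² - ax + b relative to 2. In `golden` both are smaller. In
-- `straddling` the roots of X² - uX - v have the product -v ≤ 0. In `both>2` they have the sum U >
-- 0 and the product w + 1 > 0, split into the m, e and n that `double-root-impossible` takes.
data PairKind : ℤ → ℤ → Set where
  golden     : PairKind (+ 1) -[1+ 0 ]
  straddling : ∀ a b v → NonSquarePos (discriminant (+ suc a) b) → b ≡ + 2 ℤ.* (+ suc a ℤ.- + 4) ℤ.+ + 4 ℤ.- + v → PairKind (+ suc a) b
  both>2     : ∀ U m e n w → U ≡ suc m ℕ.+ suc m ℕ.+ e → suc m ℕ.* suc m ℕ.+ e ℕ.* suc m ≡ suc w ℕ.+ n →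
               PairKind (+ U ℤ.+ + 4) (+ 2 ℤ.* + U ℤ.+ + 4 ℤ.- -[1+ w ])

data Kind : Pol → Set where
  is-x          : Kind X₁
  is-1          : Kind (squareMinus 1)
  is-2          : Kind (squareMinus 2)
  is-3          : Kind (squareMinus 3)
  is-big-square : ∀ c → Kind (squareMinus (4 ℕ.+ c))
  is-pair       : ∀ a b → PairKind a b → Kind (symmetricPair a b)

positive-difference : ∀ x y → + 0 ℤ.< + x ℤ.- + y → y ℕ.< x
positive-difference x y lt = ℕₚ.≰⇒> λ x≤y → ℤₚ.<-irrefl refl
  (ℤₚ.<-≤-trans lt (ℤₚ.≤-trans (ℤₚ.+-monoˡ-≤ (ℤ.- + y) (ℤ.+≤+ x≤y)) (ℤₚ.≤-reflexive (ℤₚ.+-inverseʳ (+ y)))))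

module Classification where
  private
    module Z = RingKit ℤRing
    open Z using (_:+_; _:*_; _:-_; :-_; _:=_; con; solve)

  -- b = 2u + 4 - v for u = a - 4, v = 2a - 4 - b, and the discriminant is u² + 4v.
  b-from-v : ∀ a b → b ≡ + 2 ℤ.* (a ℤ.- + 4) ℤ.+ + 4 ℤ.- (+ 2 ℤ.* a ℤ.- + 4 ℤ.- b)
  b-from-v = solve 2 (λ a b → b := con (+ 2) :* (a :- con (+ 4)) :+ con (+ 4) :- (con (+ 2) :* a :- con (+ 4) :- b)) refl

  discriminant-shift : ∀ u v → discriminant (u ℤ.+ + 4) (+ 2 ℤ.* u ℤ.+ + 4 ℤ.- v) ≡ u ℤ.* u ℤ.+ + 4 ℤ.* v
  discriminant-shift = solve 2 (λ u v → (u :+ con (+ 4)) :* (u :+ con (+ 4)) :- con (+ 4) :* (con (+ 2) :* u :+ con (+ 4) :- v)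
    := u :* u :+ con (+ 4) :* v) refl

  -- For e ≤ 1 the right-hand side is the integral part of (2m + e)²/4.
  half-bound : ∀ m e w → e ℕ.≤ 1 → 4 ℕ.* w ℕ.< (m ℕ.+ m ℕ.+ e) ℕ.* (m ℕ.+ m ℕ.+ e) → w ℕ.≤ m ℕ.* m ℕ.+ e ℕ.* m
  half-bound m zero w _ lt = ℕₚ.<⇒≤ (ℕₚ.*-cancelˡ-< 4 w _ (ℕₚ.<-≤-trans lt (ℕₚ.≤-reflexive (square m))))
    where
    square : ∀ m → (m ℕ.+ m ℕ.+ 0) ℕ.* (m ℕ.+ m ℕ.+ 0) ≡ 4 ℕ.* (m ℕ.* m ℕ.+ 0 ℕ.* m)
    square = +-*-Solver.solve 1 (λ m → (m S.:+ m S.:+ S.con 0) S.:* (m S.:+ m S.:+ S.con 0) S.:= S.con 4 S.:* (m S.:* m S.:+ S.con 0 S.:* m)) refl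
      where module S = +-*-Solver
  half-bound m (suc zero) w _ lt = ℕₚ.≤-pred (ℕₚ.*-cancelˡ-< 4 w _ (ℕₚ.<-≤-trans lt (ℕₚ.≤-trans (ℕₚ.m≤m+n _ 3) (ℕₚ.≤-reflexive (square m)))))
    where
    square : ∀ m → (m ℕ.+ m ℕ.+ 1) ℕ.* (m ℕ.+ m ℕ.+ 1) ℕ.+ 3 ≡ 4 ℕ.* suc (m ℕ.* m ℕ.+ 1 ℕ.* m)
    square = +-*-Solver.solve 1 (λ m → (m S.:+ m S.:+ S.con 1) S.:* (m S.:+ m S.:+ S.con 1) S.:+ S.con 3 S.:= S.con 4 S.:* (S.con 1 S.:+ (m S.:* m S.:+ S.con 1 S.:* m))) refl
      where module S = +-*-Solver
  half-bound m (suc (suc e)) w (s≤s ()) lt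

  halve : ∀ n → ∃ λ m → ∃ λ e → e ℕ.≤ 1 × n ≡ m ℕ.+ m ℕ.+ e
  halve zero          = 0 , 0 , z≤n , refl
  halve (suc zero)    = 0 , 1 , s≤s z≤n , refl
  halve (suc (suc n)) with halve n
  ... | m , e , e≤1 , n≡ = suc m , e , e≤1 , cong suc (≡.trans (cong suc n≡) (cong (ℕ._+ e) (≡.sym (ℕₚ.+-suc m m))))

  4w<u² : ∀ u w → + 0 ℤ.< u ℤ.* u ℤ.+ + 4 ℤ.* -[1+ w ] → 4 ℕ.* suc w ℕ.< ℤ.∣ u ∣ ℕ.* ℤ.∣ u ∣
  4w<u² u w lt = positive-difference _ _ (subst (+ 0 ℤ.<_)
    (cong₂ ℤ._+_ (square-nonneg u) (≡.trans (≡.sym (ℤₚ.neg-distribʳ-* (+ 4) (+ suc w))) (cong ℤ.-_ (≡.sym (ℤₚ.pos-* 4 (suc w)))))) lt)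

  w-bound : ∀ U w K → 4 ℕ.* suc w ℕ.< U → U ℕ.≤ 4 ℕ.* K → suc w ℕ.< K
  w-bound U w K lt le = ℕₚ.*-cancelˡ-< 4 _ K (ℕₚ.<-≤-trans lt le)

  w-bounded : ∀ u w → NonSquarePos (discriminant (u ℤ.+ + 4) (+ 2 ℤ.* u ℤ.+ + 4 ℤ.- -[1+ w ])) → 4 ℕ.* suc w ℕ.< ℤ.∣ u ∣ ℕ.* ℤ.∣ u ∣
  w-bounded u w (D>0 , _) = 4w<u² u w (subst (+ 0 ℤ.<_) (discriminant-shift u -[1+ w ]) D>0)

  both-above : ∀ U w → 4 ℕ.* suc w ℕ.< U ℕ.* U → PairKind (+ U ℤ.+ + 4) (+ 2 ℤ.* + U ℤ.+ + 4 ℤ.- -[1+ w ])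
  both-above U w lt = split (halve U)
    where
    split : (∃ λ m → ∃ λ e → e ℕ.≤ 1 × U ≡ m ℕ.+ m ℕ.+ e) → PairKind (+ U ℤ.+ + 4) (+ 2 ℤ.* + U ℤ.+ + 4 ℤ.- -[1+ w ])
    split (zero  , e , e≤1 , U≡) = ⊥-elim (ℕₚ.<⇒≱ (s≤s z≤n) (ℕₚ.≤-trans (half-bound 0 e (suc w) e≤1 (subst (λ U → 4 ℕ.* suc w ℕ.< U ℕ.* U) U≡ lt)) (ℕₚ.≤-reflexive (ℕₚ.*-zeroʳ e))))
    split (suc m , e , e≤1 , U≡) = both>2 U m e _ w U≡ (≡.sym (ℕₚ.m+[n∸m]≡n
      (half-bound (suc m) e (suc w) e≤1 (subst (λ U → 4 ℕ.* suc w ℕ.< U ℕ.* U) U≡ lt))))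

  -- v = -(w + 1) < 0 means that both roots are < 2 or both are > 2.
  same-side : ∀ u w a → + suc a ≡ u ℤ.+ + 4 → NonSquarePos (discriminant (u ℤ.+ + 4) (+ 2 ℤ.* u ℤ.+ + 4 ℤ.- -[1+ w ])) →
    PairKind (u ℤ.+ + 4) (+ 2 ℤ.* u ℤ.+ + 4 ℤ.- -[1+ w ])
  -- Since a + 1 ≥ 1, u is at least -3. For u = -3 the discriminant 9 - 4(w + 1) can only be 5, the
  -- golden pair, or 1, a square; for u = -2, -1, 0 it is never positive.
  same-side -[1+ 2 ] zero a _ ns = golden
  same-side -[1+ 2 ] (suc zero) a _ (_ , ns) = ⊥-elim (ns (1 , refl))
  same-side -[1+ 2 ] (suc (suc w)) a _ ns = ⊥-elim (ℕₚ.<⇒≱ (w-bound 9 (suc (suc w)) 3 (w-bounded -[1+ 2 ] (suc (suc w)) ns) (ℕₚ.m≤m+n 9 3)) (s≤s (s≤s (s≤s z≤n))))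
  same-side -[1+ 1 ] w a _ ns = ⊥-elim (ℕₚ.<⇒≱ (w-bound 4 w 1 (w-bounded -[1+ 1 ] w ns) ℕₚ.≤-refl) (s≤s z≤n))
  same-side -[1+ 0 ] w a _ ns = ⊥-elim (ℕₚ.<⇒≱ (w-bound 1 w 1 (w-bounded -[1+ 0 ] w ns) (ℕₚ.m≤m+n 1 3)) (s≤s z≤n))
  same-side (+ zero) w a _ ns = ⊥-elim (ℕₚ.<⇒≱ (w-bound 0 w 0 (w-bounded (+ 0) w ns) z≤n) z≤n)
  same-side (+ suc U) w a _ ns = both-above (suc U) w (w-bounded (+ suc U) w ns)
  same-side -[1+ suc (suc (suc zero)) ] w a () ns
  same-side -[1+ suc (suc (suc (suc j))) ] w a () ns

  a-4+4 : ∀ a → a ℤ.- + 4 ℤ.+ + 4 ≡ a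
  a-4+4 = solve 1 (λ a → a :- con (+ 4) :+ con (+ 4) := a) refl

  classify-pair : ∀ a b v → NonSquarePos (discriminant (+ suc a) b) → b ≡ + 2 ℤ.* (+ suc a ℤ.- + 4) ℤ.+ + 4 ℤ.- v → PairKind (+ suc a) b
  classify-pair a b (+ v)    ns b≡ = straddling a b v ns b≡
  classify-pair a b -[1+ w ] ns b≡ = ≡.subst₂ PairKind (a-4+4 (+ suc a)) (≡.sym b≡)
    (same-side (+ suc a ℤ.- + 4) w a (≡.sym (a-4+4 (+ suc a))) (subst NonSquarePos (cong₂ discriminant (≡.sym (a-4+4 (+ suc a))) b≡) ns))

  classify : ∀ A → Kind (atom A)
  classify x-atom              = is-x
  classify (square-atom 0)     = is-1
  classify (square-atom 1)     = is-2
  classify (square-atom 2)     = is-3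
  classify (square-atom (suc (suc (suc c)))) = is-big-square c
  classify (pair-atom a b ns)  = is-pair (+ suc a) b (classify-pair a b _ ns (b-from-v (+ suc a) b))

bigs : List Big → Pol
bigs []       = RingKit.1# polRing
bigs (B ∷ Bs) = big B *ᵖ bigs Bs

module Rearrangements (R : CommutativeRing 0ℓ 0ℓ) where
  open RingKit R

  module _ (a b c d e B : Carrier) where
    bump₁ : ∀ y → (y * ((a * (b * (c * (d * e)))) * B)) ≈ (((y * a) * (b * (c * (d * e)))) * B)
    bump₁ y = solve 7 (λ y a b c d e B → y :* ((a :* (b :* (c :* (d :* e)))) :* B) := ((y :* a) :* (b :* (c :* (d :* e)))) :* B) ≈-refl y a b c d e B
    bump₂ : ∀ y → (y * ((a * (b * (c * (d * e)))) * B)) ≈ ((a * ((y * b) * (c * (d * e)))) * B)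
    bump₂ y = solve 7 (λ y a b c d e B → y :* ((a :* (b :* (c :* (d :* e)))) :* B) := (a :* ((y :* b) :* (c :* (d :* e)))) :* B) ≈-refl y a b c d e B
    bump₃ : ∀ y → (y * ((a * (b * (c * (d * e)))) * B)) ≈ ((a * (b * ((y * c) * (d * e)))) * B)
    bump₃ y = solve 7 (λ y a b c d e B → y :* ((a :* (b :* (c :* (d :* e)))) :* B) := (a :* (b :* ((y :* c) :* (d :* e)))) :* B) ≈-refl y a b c d e B
    bump₄ : ∀ y → (y * ((a * (b * (c * (d * e)))) * B)) ≈ ((a * (b * (c * ((y * d) * e)))) * B)
    bump₄ y = solve 7 (λ y a b c d e B → y :* ((a :* (b :* (c :* (d :* e)))) :* B) := (a :* (b :* (c :* ((y :* d) :* e)))) :* B) ≈-refl y a b c d e B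
    bump₅ : ∀ y → (y * ((a * (b * (c * (d * e)))) * B)) ≈ ((a * (b * (c * (d * (y * e))))) * B)
    bump₅ y = solve 7 (λ y a b c d e B → y :* ((a :* (b :* (c :* (d :* e)))) :* B) := (a :* (b :* (c :* (d :* (y :* e))))) :* B) ≈-refl y a b c d e B

  swap-big : ∀ y c B → y * (c * B) ≈ c * (y * B)
  swap-big = solve 3 (λ y c B → y :* (c :* B) := c :* (y :* B)) ≈-refl

  regroup-4 : ∀ s k q r → ((s * k) * q) * r ≈ s * (k * (q * r))
  regroup-4 = solve 4 (λ s k q r → ((s :* k) :* q) :* r := s :* (k :* (q :* r))) ≈-refl

  rotate : ∀ a q r → (a * q) * r ≈ q * (a * r)
  rotate = solve 3 (λ a q r → (a :* q) :* r := q :* (a :* r)) ≈-refl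

  unit-product : 1# ≈ (1# * (1# * (1# * (1# * 1#)))) * 1#
  unit-product = solve 0 (con (+ 1) := (con (+ 1) :* (con (+ 1) :* (con (+ 1) :* (con (+ 1) :* con (+ 1))))) :* con (+ 1)) ≈-refl

  pull-tail : ∀ c x y z → c * (x * (y * z)) ≈ (c * z) * (x * y)
  pull-tail = solve 4 (λ c x y z → c :* (x :* (y :* z)) := (c :* z) :* (x :* y)) ≈-refl

  pull-pair : ∀ p s k s′ k′ → p * ((s * k) * (s′ * k′)) ≈ (s * s′) * (p * (k * k′))
  pull-pair = solve 5 (λ p s k s′ k′ → p :* ((s :* k) :* (s′ :* k′)) := (s :* s′) :* (p :* (k :* k′))) ≈-refl

module Collection (ls : List ℕ) where
  open RingKit polRing
  open Rearrangements polRing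
  private F = starPoly ls

  Collected : Pol → Set
  Collected p = ∃ λ t₁ → ∃ λ t₂ → ∃ λ t₃ → ∃ λ t₄ → ∃ λ t₅ → ∃ λ Bs → p ≈ᵖ (common t₁ t₂ t₃ t₄ t₅ *ᵖ bigs Bs)

  cofactor : ℤ → ℤ → Pol
  cofactor u v = quadratic (ℤ.- (u ℤ.+ + 4)) (+ 2 ℤ.* u ℤ.+ + 4 ℤ.- v)

  pair-shifted : ∀ u v → symmetricPair (u ℤ.+ + 4) (+ 2 ℤ.* u ℤ.+ + 4 ℤ.- v) ≡ shifted u v *ᵖ cofactor u v
  pair-shifted u v = refl

  above-impossible : ∀ U m e n w q r → U ≡ suc m ℕ.+ suc m ℕ.+ e → suc m ℕ.* suc m ℕ.+ e ℕ.* suc m ≡ suc w ℕ.+ n →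
    ∀ p → p ≡ shifted (+ U) -[1+ w ] *ᵖ cofactor (+ U) -[1+ w ] → ¬ (F ≈ᵖ ((p *ᵖ q) *ᵖ r))
  above-impossible _ m e n w q r refl m≡ p p≡ F≈ = double-root-impossible ls m e n (suc w) (k *ᵖ (q *ᵖ r)) m≡
    (≈-trans F≈ (≈-trans (≈-reflexive (cong (λ p → (p *ᵖ q) *ᵖ r) p≡)) (regroup-4 (shifted u -[1+ w ]) k q r)))
    where
    u = + (suc m ℕ.+ suc m ℕ.+ e)
    k = cofactor u -[1+ w ]

  -- Each kind either raises one exponent or joins the list of big factors. A pair with both roots
  -- above 2 is refuted, and this takes a factorisation of all of F, hence the cofactor r.
  absorb : ∀ {p} q r → Kind p → F ≈ᵖ ((p *ᵖ q) *ᵖ r) → Collected q → Collected (p *ᵖ q)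
  absorb {p} q r kind F≈ (t₁ , t₂ , t₃ , t₄ , t₅ , Bs , q≈) = by kind
    where
    a₁ = X₁ ^ᵖ t₁
    a₂ = squareMinus 1 ^ᵖ t₂
    a₃ = squareMinus 2 ^ᵖ t₃
    a₄ = symmetricPair (+ 1) -[1+ 0 ] ^ᵖ t₄
    a₅ = squareMinus 3 ^ᵖ t₅
    B  = bigs Bs
    times : ∀ p → (p *ᵖ q) ≈ᵖ (p *ᵖ (common t₁ t₂ t₃ t₄ t₅ *ᵖ B))
    times p = *-congˡ {p} {q} {common t₁ t₂ t₃ t₄ t₅ *ᵖ B} q≈
    by : Kind p → Collected (p *ᵖ q)
    by is-x = suc t₁ , t₂ , t₃ , t₄ , t₅ , Bs , ≈-trans (times X₁) (bump₁ a₁ a₂ a₃ a₄ a₅ B X₁)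
    by is-1 = t₁ , suc t₂ , t₃ , t₄ , t₅ , Bs , ≈-trans (times (squareMinus 1)) (bump₂ a₁ a₂ a₃ a₄ a₅ B (squareMinus 1))
    by is-2 = t₁ , t₂ , suc t₃ , t₄ , t₅ , Bs , ≈-trans (times (squareMinus 2)) (bump₃ a₁ a₂ a₃ a₄ a₅ B (squareMinus 2))
    by is-3 = t₁ , t₂ , t₃ , t₄ , suc t₅ , Bs , ≈-trans (times (squareMinus 3)) (bump₅ a₁ a₂ a₃ a₄ a₅ B (squareMinus 3))
    by (is-big-square c) = t₁ , t₂ , t₃ , t₄ , t₅ , bigSquare c ∷ Bs
      , ≈-trans (times (squareMinus (4 ℕ.+ c))) (swap-big (squareMinus (4 ℕ.+ c)) (common t₁ t₂ t₃ t₄ t₅) B)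
    by (is-pair _ _ golden) = t₁ , t₂ , t₃ , suc t₄ , t₅ , Bs
      , ≈-trans (times (symmetricPair (+ 1) -[1+ 0 ])) (bump₄ a₁ a₂ a₃ a₄ a₅ B (symmetricPair (+ 1) -[1+ 0 ]))
    by (is-pair _ _ (straddling a b v ns b≡)) = t₁ , t₂ , t₃ , t₄ , t₅ , bigPair a b v ns b≡ ∷ Bs
      , ≈-trans (times (symmetricPair (+ suc a) b)) (swap-big (symmetricPair (+ suc a) b) (common t₁ t₂ t₃ t₄ t₅) B)
    by (is-pair _ _ (both>2 U m e n w U≡ m≡)) = ⊥-elim (above-impossible U m e n w q r U≡ m≡ p (pair-shifted (+ U) -[1+ w ]) F≈)

  collect : ∀ As r → F ≈ᵖ (atomProduct As *ᵖ r) → Collected (atomProduct As)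
  collect [] r F≈ = 0 , 0 , 0 , 0 , 0 , [] , unit-product
  collect (A ∷ As) r F≈ = absorb {atom A} (atomProduct As) r (Classification.classify A) F≈
    (collect As (atom A *ᵖ r) (≈-trans F≈ (rotate (atom A) (atomProduct As) r)))

  big-shifted : ∀ B → ∃ λ u → ∃ λ v → ∃ λ k → big B ≈ᵖ (shifted u (+ v) *ᵖ k)
  -- For x = X + 2 one has x² - (4 + c) = X² + 4X - c.
  big-shifted (bigSquare c) = ℤ.- + 4 , c , 1# , ≈-trans (≈-reflexive (cong (quadratic (+ 0)) (-[4+c] c))) (≈-sym (*-identityʳ (shifted (ℤ.- + 4) (+ c))))
    where
    -[4+c] : ∀ c → ℤ.- + (4 ℕ.+ c) ≡ ℤ.- + 4 ℤ.- + c
    -[4+c] c = ℤₚ.neg-distrib-+ (+ 4) (+ c)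
  big-shifted (bigPair a b v _ b≡) = + suc a ℤ.- + 4 , v , quadratic (ℤ.- + suc a) b
    , *-congʳ {quadratic (ℤ.- + suc a) b} (≈-reflexive (cong₂ quadratic (≡.sym (Classification.a-4+4 (+ suc a))) b≡))

  at-most-one-big : ∀ B B′ p → ¬ (F ≈ᵖ (p *ᵖ (big B *ᵖ big B′)))
  at-most-one-big B B′ p F≈ =
    let u , v , k , B≈ = big-shifted B
        u′ , v′ , k′ , B′≈ = big-shifted B′
    in two-roots-impossible ls u v u′ v′ (p *ᵖ (k *ᵖ k′)) (≈-trans F≈ (≈-trans (*-congˡ {p} (*-cong B≈ B′≈))
      (pull-pair p (shifted u (+ v)) k (shifted u′ (+ v′)) k′)))

-- Bounded search for the exponents

module Counting where
  open TopCoefficients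
  open Star ℤRing using (star)

  -- For a factor x^d - e x^(d-2) + ... the number e is half the sum of the squares of its roots. It
  -- is additive over products, which gives the weights 0, 1, 2, 3, 3.
  commonDegree commonEdges : ℕ → ℕ → ℕ → ℕ → ℕ → ℕ
  commonDegree t₁ t₂ t₃ t₄ t₅ = t₁ ℕ.* 1 ℕ.+ (t₂ ℕ.* 2 ℕ.+ (t₃ ℕ.* 2 ℕ.+ (t₄ ℕ.* 4 ℕ.+ t₅ ℕ.* 2)))
  commonEdges  t₁ t₂ t₃ t₄ t₅ = t₁ ℕ.* 0 ℕ.+ (t₂ ℕ.* 1 ℕ.+ (t₃ ℕ.* 2 ℕ.+ (t₄ ℕ.* 3 ℕ.+ t₅ ℕ.* 3)))

  top-^ : ∀ d e p → Top d (+ e) p → ∀ t → Top (t ℕ.* d) (+ (t ℕ.* e)) (p ^ᵖ t)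
  top-^ d e p top zero    = top-1
  top-^ d e p top (suc t) = top-* {d} {+ e} {t ℕ.* d} {+ (t ℕ.* e)} p (p ^ᵖ t) top (top-^ d e p top t)

  top-common : ∀ t₁ t₂ t₃ t₄ t₅ → Top (commonDegree t₁ t₂ t₃ t₄ t₅) (+ commonEdges t₁ t₂ t₃ t₄ t₅) (common t₁ t₂ t₃ t₄ t₅)
  top-common t₁ t₂ t₃ t₄ t₅ =
    top-* (X₁ ^ᵖ t₁) _ (top-^ 1 0 X₁ top-X t₁)
    (top-* (squareMinus 1 ^ᵖ t₂) _ (top-^ 2 1 (squareMinus 1) (top-square (+ 1)) t₂)
    (top-* (squareMinus 2 ^ᵖ t₃) _ (top-^ 2 2 (squareMinus 2) (top-square (+ 2)) t₃)
    (top-* (symmetricPair (+ 1) -[1+ 0 ] ^ᵖ t₄) _ (top-^ 4 3 (symmetricPair (+ 1) -[1+ 0 ]) (top-pair (+ 1) -[1+ 0 ]) t₄)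
      (top-^ 2 3 (squareMinus 3) (top-square (+ 3)) t₅))))

  at2 : Pol → ℤ
  at2 = Evaluation.eval ℤRing (+ 2)

  at2-* : ∀ p q m n → at2 p ≡ + m → at2 q ≡ + n → at2 (p *ᵖ q) ≡ + (m ℕ.* n)
  at2-* p q m n e f = ≡.trans (Evaluation.eval-* ℤRing (+ 2) p q) (≡.trans (cong₂ ℤ._*_ e f) (≡.sym (ℤₚ.pos-* m n)))

  at2-^ : ∀ p m → at2 p ≡ + m → ∀ t → at2 (p ^ᵖ t) ≡ + (m ℕ.^ t)
  at2-^ p m e zero    = refl
  at2-^ p m e (suc t) = at2-* p (p ^ᵖ t) m (m ℕ.^ t) e (at2-^ p m e t)

  at2-common : ∀ t₁ t₂ t₃ t₄ t₅ → at2 (common t₁ t₂ t₃ t₄ t₅) ≡ + (2 ℕ.^ t₁ ℕ.* (3 ℕ.^ t₂ ℕ.* (2 ℕ.^ t₃ ℕ.* (5 ℕ.^ t₄ ℕ.* 1 ℕ.^ t₅))))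
  at2-common t₁ t₂ t₃ t₄ t₅ =
    at2-* (X₁ ^ᵖ t₁) _ _ _ (at2-^ X₁ 2 refl t₁)
    (at2-* (squareMinus 1 ^ᵖ t₂) _ _ _ (at2-^ (squareMinus 1) 3 refl t₂)
    (at2-* (squareMinus 2 ^ᵖ t₃) _ _ _ (at2-^ (squareMinus 2) 2 refl t₃)
    (at2-* (symmetricPair (+ 1) -[1+ 0 ] ^ᵖ t₄) _ _ _ (at2-^ (symmetricPair (+ 1) -[1+ 0 ]) 5 refl t₄)
      (at2-^ (squareMinus 3) 1 refl t₅))))

  1≤m^t : ∀ m t → 1 ℕ.≤ suc m ℕ.^ t
  1≤m^t m t = ℕₚ.m^n>0 (suc m) t

  dropˡ : ∀ {a b k} → 1 ℕ.≤ a → a ℕ.* b ℕ.≤ k → b ℕ.≤ k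
  dropˡ {suc a} {b} _ le = ℕₚ.≤-trans (ℕₚ.m≤m+n b (a ℕ.* b)) le

  dropʳ : ∀ {a b k} → 1 ℕ.≤ b → a ℕ.* b ℕ.≤ k → a ℕ.≤ k
  dropʳ {a} {suc b} _ le = ℕₚ.≤-trans (ℕₚ.m≤m*n a (suc b)) le

  -- A factor x² - 3 adds 2 to the degree and 3 to the edges, so a tree, with one vertex more than
  -- edges, has its multiplicity determined by the other exponents.
  surplus : ∀ A B t → A ℕ.+ t ℕ.* 2 ≡ suc B ℕ.+ t ℕ.* 3 → A ≡ suc B ℕ.+ t
  surplus A B t e = ℕₚ.+-cancelʳ-≡ (t ℕ.* 2) A (suc B ℕ.+ t) (≡.trans e (≡.trans (cong (suc B ℕ.+_) (≡.trans (ℕₚ.*-suc t 2) refl)) (≡.sym (ℕₚ.+-assoc (suc B) t (t ℕ.* 2)))))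

  -- Degree and edge count leave at most four vertices once the value at 2 is at most 4.
  only-common : ∀ t₁ t₂ t₃ t₄ t₅ → 2 ℕ.^ t₁ ℕ.* (3 ℕ.^ t₂ ℕ.* (2 ℕ.^ t₃ ℕ.* (5 ℕ.^ t₄ ℕ.* 1 ℕ.^ t₅))) ℕ.≤ 4 →
    commonDegree t₁ t₂ t₃ t₄ t₅ ≡ suc (commonEdges t₁ t₂ t₃ t₄ t₅) → commonDegree t₁ t₂ t₃ t₄ t₅ ℕ.≤ 4
  only-common t₁ t₂ t₃ t₄ t₅ le balance = cases t₁ t₂ t₃ t₄ t₅ (subst (λ z → 2 ℕ.^ t₁ ℕ.* (3 ℕ.^ t₂ ℕ.* (2 ℕ.^ t₃ ℕ.* (5 ℕ.^ t₄ ℕ.* z))) ℕ.≤ 4) (ℕₚ.^-zeroˡ t₅) le) balance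
    where
    value : ℕ → ℕ → ℕ → ℕ → ℕ
    value t₁ t₂ t₃ t₄ = 2 ℕ.^ t₁ ℕ.* (3 ℕ.^ t₂ ℕ.* (2 ℕ.^ t₃ ℕ.* (5 ℕ.^ t₄ ℕ.* 1)))
    rest₄ : ∀ t₄ → 1 ℕ.≤ 5 ℕ.^ t₄ ℕ.* 1
    rest₄ t₄ = ℕₚ.*-mono-≤ (1≤m^t 4 t₄) (ℕₚ.≤-refl {1})
    rest₃ : ∀ t₃ t₄ → 1 ℕ.≤ 2 ℕ.^ t₃ ℕ.* (5 ℕ.^ t₄ ℕ.* 1)
    rest₃ t₃ t₄ = ℕₚ.*-mono-≤ (1≤m^t 1 t₃) (rest₄ t₄)
    rest₂ : ∀ t₂ t₃ t₄ → 1 ℕ.≤ 3 ℕ.^ t₂ ℕ.* (2 ℕ.^ t₃ ℕ.* (5 ℕ.^ t₄ ℕ.* 1))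
    rest₂ t₂ t₃ t₄ = ℕₚ.*-mono-≤ (1≤m^t 2 t₂) (rest₃ t₃ t₄)
    big-power : ∀ k j t → 4 ℕ.< suc k ℕ.^ j → ¬ (suc k ℕ.^ (j ℕ.+ t) ℕ.≤ 4)
    big-power k j t lt le = ℕₚ.<⇒≱ (ℕₚ.<-≤-trans lt (ℕₚ.^-monoʳ-≤ (suc k) (ℕₚ.m≤m+n j t))) le
    cases : ∀ t₁ t₂ t₃ t₄ t₅ → value t₁ t₂ t₃ t₄ ℕ.≤ 4 → commonDegree t₁ t₂ t₃ t₄ t₅ ≡ suc (commonEdges t₁ t₂ t₃ t₄ t₅) → commonDegree t₁ t₂ t₃ t₄ t₅ ℕ.≤ 4
    cases t₁ t₂ t₃ (suc t₄) t₅ le bal = ⊥-elim (big-power 4 1 t₄ (ℕₚ.≤-refl {5}) (dropʳ {5 ℕ.^ suc t₄} {1} ℕₚ.≤-refl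
      (dropˡ (1≤m^t 1 t₃) (dropˡ (1≤m^t 2 t₂) (dropˡ (1≤m^t 1 t₁) le)))))
    cases (suc (suc (suc t₁))) t₂ t₃ zero t₅ le bal = ⊥-elim (big-power 1 3 t₁ (ℕₚ.m≤m+n 5 3) (dropʳ (rest₂ t₂ t₃ 0) le))
    cases t₁ (suc (suc t₂)) t₃ zero t₅ le bal = ⊥-elim (big-power 2 2 t₂ (ℕₚ.m≤m+n 5 4) (dropʳ (rest₃ t₃ 0) (dropˡ (1≤m^t 1 t₁) le)))
    cases t₁ t₂ (suc (suc (suc t₃))) zero t₅ le bal = ⊥-elim (big-power 1 3 t₃ (ℕₚ.m≤m+n 5 3) (dropʳ {2 ℕ.^ (3 ℕ.+ t₃)} {1} ℕₚ.≤-refl (dropˡ (1≤m^t 2 t₂) (dropˡ (1≤m^t 1 t₁) le))))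
    cases 0 0 0 zero t₅ le bal with () ← surplus 0 0 t₅ bal
    cases 0 0 1 zero t₅ le bal with () ← surplus 2 2 t₅ bal
    cases 0 0 2 zero t₅ le bal with () ← surplus 4 4 t₅ bal
    cases 0 1 0 zero t₅ le bal with t₅ | surplus 2 1 t₅ bal
    ... | zero | refl = ℕₚ.m≤m+n 2 2
    cases 1 0 0 zero t₅ le bal with t₅ | surplus 1 0 t₅ bal
    ... | zero | refl = ℕₚ.m≤m+n 1 3
    cases 1 0 1 zero t₅ le bal with t₅ | surplus 3 2 t₅ bal
    ... | zero | refl = ℕₚ.m≤m+n 3 1
    -- This is x²(x² - 3), the polynomial of K_{1,3}, which satisfies both conditions; the bound 4
    -- on the degree comes from here. The three cases above belong to K₂, K₁ and the path on three
    -- vertices.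
    cases 2 0 0 zero t₅ le bal with t₅ | surplus 2 0 t₅ bal
    ... | suc zero | refl = ℕₚ.≤-refl
    cases 0 1 1 zero t₅ (s≤s (s≤s (s≤s (s≤s ())))) bal
    cases 0 1 2 zero t₅ (s≤s (s≤s (s≤s (s≤s ())))) bal
    cases 1 0 2 zero t₅ (s≤s (s≤s (s≤s (s≤s ())))) bal
    cases 1 1 0 zero t₅ (s≤s (s≤s (s≤s (s≤s ())))) bal
    cases 1 1 1 zero t₅ (s≤s (s≤s (s≤s (s≤s ())))) bal
    cases 1 1 2 zero t₅ (s≤s (s≤s (s≤s (s≤s ())))) bal
    cases 2 0 1 zero t₅ (s≤s (s≤s (s≤s (s≤s ())))) bal
    cases 2 0 2 zero t₅ (s≤s (s≤s (s≤s (s≤s ())))) bal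
    cases 2 1 0 zero t₅ (s≤s (s≤s (s≤s (s≤s ())))) bal
    cases 2 1 1 zero t₅ (s≤s (s≤s (s≤s (s≤s ())))) bal
    cases 2 1 2 zero t₅ (s≤s (s≤s (s≤s (s≤s ())))) bal

  no-common-star : ∀ ls d t₁ t₂ t₃ t₄ t₅ → star (+ 2) ls ≡ + 4 ℤ.- + d → 3 ℕ.< sum ls → ¬ (starPoly ls ≈ᵖ common t₁ t₂ t₃ t₄ t₅)
  no-common-star ls d t₁ t₂ t₃ t₄ t₅ f≡ large F≈ = ℕₚ.<⇒≱ (s≤s large) (subst (ℕ._≤ 4) (≡.sym degree≡)
      (only-common t₁ t₂ t₃ t₄ t₅ value≤4 (≡.trans (≡.sym degree≡) (cong suc edges≡))))
    where
    top′ : Top (commonDegree t₁ t₂ t₃ t₄ t₅) (+ commonEdges t₁ t₂ t₃ t₄ t₅) (starPoly ls)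
    top′ = top-resp (ℤ[x]≈-sym F≈) (top-common t₁ t₂ t₃ t₄ t₅)
      where ℤ[x]≈-sym = λ {p} {q} → RingKit.≈-sym polRing {p} {q}
    degree≡ : suc (sum ls) ≡ commonDegree t₁ t₂ t₃ t₄ t₅
    degree≡ = top-degree (top-star ls) top′
    edges≡ : sum ls ≡ commonEdges t₁ t₂ t₃ t₄ t₅
    edges≡ = ℤₚ.+-injective (top-second (subst (λ n → Top n (+ sum ls) (starPoly ls)) degree≡ (top-star ls)) top′)
    value≡ : + 4 ℤ.- + d ≡ + (2 ℕ.^ t₁ ℕ.* (3 ℕ.^ t₂ ℕ.* (2 ℕ.^ t₃ ℕ.* (5 ℕ.^ t₄ ℕ.* 1 ℕ.^ t₅))))
    value≡ = ≡.trans (≡.sym f≡) (≡.trans (≡.sym (QuadraticRoots.eval-star ℤRing (+ 2) ls))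
      (≡.trans (Hom.⟦⟧-cong (Evaluation.evaluate ℤRing (+ 2)) {starPoly ls} {common t₁ t₂ t₃ t₄ t₅} F≈) (at2-common t₁ t₂ t₃ t₄ t₅)))
    value≤4 : 2 ℕ.^ t₁ ℕ.* (3 ℕ.^ t₂ ℕ.* (2 ℕ.^ t₃ ℕ.* (5 ℕ.^ t₄ ℕ.* 1 ℕ.^ t₅))) ℕ.≤ 4
    value≤4 = ℤₚ.drop‿+≤+ (ℤₚ.≤-trans (ℤₚ.≤-reflexive (≡.sym value≡)) (ℤₚ.i≤j⇒i-k≤j {+ 4} (+ d) ℤₚ.≤-refl))

module Search (ls : List ℕ) where
  open TopCoefficients
  open Counting
  private
    F = starPoly ls
    module P = RingKit polRing

  record FactorsI : Set where
    constructor factorsI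
    field
      c t₁ t₂ t₃ t₄ t₅ : ℕ
      4≤c   : 4 ℕ.≤ c
      F≈    : F ≈ᵖ (common t₁ t₂ t₃ t₄ t₅ *ᵖ squareMinus c)

  record FactorsII : Set where
    constructor factorsII
    field
      a     : ℕ
      b     : ℤ
      t₁ t₂ t₃ t₄ t₅ : ℕ
      0<a   : 0 ℕ.< a
      D     : NonSquarePos (discriminant (+ a) b)
      -- The value 4 - 2a + b at 2 is negative, so the larger root exceeds 2; this is what
      -- identifies λ₁ later on.
      above : b ℤ.+ + 4 ℤ.< + 2 ℤ.* + a
      F≈    : F ≈ᵖ (common t₁ t₂ t₃ t₄ t₅ *ᵖ symmetricPair (+ a) b)

  _≈ᵖ?_ : ∀ p q → Dec (p ≈ᵖ q)
  []      ≈ᵖ? []      = yes P.≈-refl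
  []      ≈ᵖ? (b ∷ q) = map′ (λ (b≡0 , e) → ℤ[x].eq λ { zero → ≡.sym b≡0 ; (suc i) → ℤ[x].at e i })
    (λ e → ≡.sym (ℤ[x].at e 0) , ℤ[x].eq (λ i → ℤ[x].at e (suc i))) ((b ℤ.≟ + 0) ×-dec ([] ≈ᵖ? q))
  (a ∷ p) ≈ᵖ? []      = map′ (λ (a≡0 , e) → ℤ[x].eq λ { zero → a≡0 ; (suc i) → ℤ[x].at e i })
    (λ e → ℤ[x].at e 0 , ℤ[x].eq (λ i → ℤ[x].at e (suc i))) ((a ℤ.≟ + 0) ×-dec (p ≈ᵖ? []))
  (a ∷ p) ≈ᵖ? (b ∷ q) = map′ (λ (a≡b , e) → ℤ[x].eq λ { zero → a≡b ; (suc i) → ℤ[x].at e i })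
    (λ e → ℤ[x].at e 0 , ℤ[x].eq (λ i → ℤ[x].at e (suc i))) ((a ℤ.≟ b) ×-dec (p ≈ᵖ? q))

  -- One bound for every parameter: the exponents and c are at most S, while the edge count gives a
  -- ≤ a² ≤ 2S and ∣b∣ ≤ 3S.
  S N : ℕ
  S = sum ls
  N = suc (3 ℕ.* suc S)

  Below : (ℕ → Set) → Set
  Below Q = ∃ λ m → m ℕ.< N × Q m

  below? : ∀ {Q} → (∀ m → Dec (Q m)) → Dec (Below Q)
  below? Q? = ℕₚ.anyUpTo? Q? N

  Multiplicities : Pol → Set
  Multiplicities p = Below λ t₁ → Below λ t₂ → Below λ t₃ → Below λ t₄ → Below λ t₅ → F ≈ᵖ (common t₁ t₂ t₃ t₄ t₅ *ᵖ p)

  multiplicities? : ∀ p → Dec (Multiplicities p)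
  multiplicities? p = below? λ t₁ → below? λ t₂ → below? λ t₃ → below? λ t₄ → below? λ t₅ → F ≈ᵖ? (common t₁ t₂ t₃ t₄ t₅ *ᵖ p)

  BoundedI : Set
  BoundedI = Below λ c → 4 ℕ.≤ c × Multiplicities (squareMinus c)

  CandidateII : ℕ → ℤ → Set
  CandidateII a b = 0 ℕ.< a × NonSquarePos (discriminant (+ a) b) × (b ℤ.+ + 4 ℤ.< + 2 ℤ.* + a) × Multiplicities (symmetricPair (+ a) b)

  BoundedII : Set
  BoundedII = Below λ a → Below λ m → CandidateII a (+ m) ⊎ CandidateII a (ℤ.- + m)

  nonSquarePos? : ∀ Δ → Dec (NonSquarePos Δ)
  nonSquarePos? Δ = (+ 0 ℤ.<? Δ) ×-dec ¬? (square? Δ)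

  candidateII? : ∀ a b → Dec (CandidateII a b)
  candidateII? a b = (0 ℕ.<? a) ×-dec (nonSquarePos? (discriminant (+ a) b) ×-dec ((b ℤ.+ + 4 ℤ.<? + 2 ℤ.* + a) ×-dec multiplicities? (symmetricPair (+ a) b)))

  bounded? : Dec (BoundedI ⊎ BoundedII)
  bounded? = (below? λ c → (4 ℕ.≤? c) ×-dec multiplicities? (squareMinus c))
    ⊎-dec (below? λ a → below? λ m → candidateII? a (+ m) ⊎-dec candidateII? a (ℤ.- + m))

  fromBounded : BoundedI ⊎ BoundedII → FactorsI ⊎ FactorsII
  fromBounded (inj₁ (c , _ , 4≤c , t₁ , _ , t₂ , _ , t₃ , _ , t₄ , _ , t₅ , _ , F≈)) = inj₁ (factorsI c t₁ t₂ t₃ t₄ t₅ 4≤c F≈)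
  fromBounded (inj₂ (a , _ , m , _ , inj₁ (0<a , D , above , t₁ , _ , t₂ , _ , t₃ , _ , t₄ , _ , t₅ , _ , F≈))) = inj₂ (factorsII a (+ m) t₁ t₂ t₃ t₄ t₅ 0<a D above F≈)
  fromBounded (inj₂ (a , _ , m , _ , inj₂ (0<a , D , above , t₁ , _ , t₂ , _ , t₃ , _ , t₄ , _ , t₅ , _ , F≈))) = inj₂ (factorsII a (ℤ.- + m) t₁ t₂ t₃ t₄ t₅ 0<a D above F≈)

  S<N : S ℕ.< N
  S<N = s≤s (ℕₚ.≤-trans (ℕₚ.n≤1+n S) (ℕₚ.m≤m+n (suc S) (2 ℕ.* suc S)))

  module _ (t₁ t₂ t₃ t₄ t₅ d : ℕ) (p : Pol) (e : ℤ) (top-p : Top (suc d) e p) (F≈ : F ≈ᵖ (common t₁ t₂ t₃ t₄ t₅ *ᵖ p)) where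
    top′ : Top (commonDegree t₁ t₂ t₃ t₄ t₅ ℕ.+ suc d) (+ commonEdges t₁ t₂ t₃ t₄ t₅ ℤ.+ e) F
    top′ = top-resp {p = common t₁ t₂ t₃ t₄ t₅ *ᵖ p} (P.≈-sym F≈) (top-* (common t₁ t₂ t₃ t₄ t₅) p (top-common t₁ t₂ t₃ t₄ t₅) top-p)

    degrees : suc S ≡ commonDegree t₁ t₂ t₃ t₄ t₅ ℕ.+ suc d
    degrees = top-degree (top-star ls) top′

    edges : + S ≡ + commonEdges t₁ t₂ t₃ t₄ t₅ ℤ.+ e
    edges = top-second (subst (λ n → Top n (+ S) F) degrees (top-star ls)) top′

    small : ∀ t → t ℕ.≤ commonDegree t₁ t₂ t₃ t₄ t₅ → t ℕ.< N
    small t le = ℕₚ.≤-<-trans (ℕₚ.≤-trans le (ℕₚ.m≤m+n _ d)) (ℕₚ.≤-<-trans (ℕₚ.≤-reflexive (ℕₚ.suc-injective (≡.trans (≡.sym (ℕₚ.+-suc _ d)) (≡.sym degrees)))) S<N)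

    multiplicities : Multiplicities p
    multiplicities = t₁ , small t₁ (ℕₚ.≤-trans (ℕₚ.m≤m*n t₁ 1) (ℕₚ.m≤m+n (t₁ ℕ.* 1) _))
      , t₂ , small t₂ (ℕₚ.≤-trans (ℕₚ.m≤m*n t₂ 2) (ℕₚ.≤-trans (ℕₚ.m≤m+n (t₂ ℕ.* 2) _) (ℕₚ.m≤n+m _ (t₁ ℕ.* 1))))
      , t₃ , small t₃ (ℕₚ.≤-trans (ℕₚ.m≤m*n t₃ 2) (ℕₚ.≤-trans (ℕₚ.m≤m+n (t₃ ℕ.* 2) _) (ℕₚ.≤-trans (ℕₚ.m≤n+m _ (t₂ ℕ.* 2)) (ℕₚ.m≤n+m _ (t₁ ℕ.* 1)))))
      , t₄ , small t₄ (ℕₚ.≤-trans (ℕₚ.m≤m*n t₄ 4) (ℕₚ.≤-trans (ℕₚ.m≤m+n (t₄ ℕ.* 4) _) (ℕₚ.≤-trans (ℕₚ.m≤n+m _ (t₃ ℕ.* 2)) (ℕₚ.≤-trans (ℕₚ.m≤n+m _ (t₂ ℕ.* 2)) (ℕₚ.m≤n+m _ (t₁ ℕ.* 1))))))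
      , t₅ , small t₅ (ℕₚ.≤-trans (ℕₚ.m≤m*n t₅ 2) (ℕₚ.≤-trans (ℕₚ.m≤n+m _ (t₄ ℕ.* 4)) (ℕₚ.≤-trans (ℕₚ.m≤n+m _ (t₃ ℕ.* 2)) (ℕₚ.≤-trans (ℕₚ.m≤n+m _ (t₂ ℕ.* 2)) (ℕₚ.m≤n+m _ (t₁ ℕ.* 1))))))
      , F≈

  boundI : FactorsI → BoundedI
  boundI (factorsI c t₁ t₂ t₃ t₄ t₅ 4≤c F≈) = c , ℕₚ.≤-<-trans c≤S S<N , 4≤c
    , multiplicities t₁ t₂ t₃ t₄ t₅ 1 (squareMinus c) (+ c) (top-square (+ c)) F≈
    where
    c≤S : c ℕ.≤ S
    c≤S = ℕₚ.≤-trans (ℕₚ.m≤n+m c (commonEdges t₁ t₂ t₃ t₄ t₅))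
      (ℕₚ.≤-reflexive (≡.sym (ℤₚ.+-injective (edges t₁ t₂ t₃ t₄ t₅ 1 (squareMinus c) (+ c) (top-square (+ c)) F≈))))

  -- With e = a² - 2b and D = a² - 4b > 0 one has 2e = a² + D and 2b = a² - e, where e ≤ S by edge counting.
  boundsII : ∀ a b E → + 0 ℤ.< discriminant (+ a) b → + S ≡ + E ℤ.+ (+ a ℤ.* + a ℤ.- + 2 ℤ.* b) → a ℕ.< N × ℤ.∣ b ∣ ℕ.< N
  boundsII a b E D>0 edges = positive (discriminant (+ a) b) refl D>0
    where
    module Z = RingKit ℤRing
    e₀ : ℤ
    e₀ = + a ℤ.* + a ℤ.- + 2 ℤ.* b
    2e≡ : ∀ D → discriminant (+ a) b ≡ + D → + 2 ℤ.* e₀ ≡ + (a ℕ.* a ℕ.+ D)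
    2e≡ D D≡ = ≡.trans (Z.solve 2 (λ s b → Z.con (+ 2) Z.:* (s Z.:- Z.con (+ 2) Z.:* b) Z.:= s Z.:+ (s Z.:- Z.con (+ 4) Z.:* b)) refl (+ a ℤ.* + a) b)
      (cong₂ ℤ._+_ (≡.sym (ℤₚ.pos-* a a)) D≡)
    2b≡ : + 2 ℤ.* b ≡ + a ℤ.* + a ℤ.- e₀
    2b≡ = Z.solve 2 (λ s t → t Z.:= s Z.:- (s Z.:- t)) refl (+ a ℤ.* + a) (+ 2 ℤ.* b)
    doubled-nonneg : ∀ i m → + 2 ℤ.* i ≡ + m → ∃ λ e → i ≡ + e
    doubled-nonneg (+ e) m _ = e , refl
    doubled-nonneg -[1+ e ] m ()
    a≤a² : ∀ a → a ℕ.≤ a ℕ.* a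
    a≤a² zero    = z≤n
    a≤a² (suc a) = ℕₚ.m≤m+n (suc a) _
    bounds : ∀ D e → discriminant (+ a) b ≡ + D → e₀ ≡ + e → a ℕ.< N × ℤ.∣ b ∣ ℕ.< N
    bounds D e D≡ e≡ = s≤s (ℕₚ.≤-trans (a≤a² a) (ℕₚ.≤-trans a²≤2S (ℕₚ.≤-trans (ℕₚ.*-monoˡ-≤ S (ℕₚ.n≤1+n 2)) (ℕₚ.*-monoʳ-≤ 3 (ℕₚ.n≤1+n S)))))
        , s≤s (ℕₚ.≤-trans ∣b∣≤3S (ℕₚ.*-monoʳ-≤ 3 (ℕₚ.n≤1+n S)))
      where
      e≤S : e ℕ.≤ S
      e≤S = ℕₚ.≤-trans (ℕₚ.m≤n+m e E) (ℕₚ.≤-reflexive (≡.sym (ℤₚ.+-injective (≡.trans edges (cong (λ e → + E ℤ.+ e) e≡)))))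
      a²≤2S : a ℕ.* a ℕ.≤ 2 ℕ.* S
      a²≤2S = ℕₚ.≤-trans (ℕₚ.m≤m+n (a ℕ.* a) D) (ℕₚ.≤-trans (ℕₚ.≤-reflexive (ℤₚ.+-injective (≡.trans (≡.sym (2e≡ D D≡)) (≡.trans (cong (ℤ._*_ (+ 2)) e≡) (≡.sym (ℤₚ.pos-* 2 e))))))
        (ℕₚ.*-monoʳ-≤ 2 e≤S))
      ∣b∣≤3S : ℤ.∣ b ∣ ℕ.≤ 3 ℕ.* S
      ∣b∣≤3S = ℕₚ.≤-trans (ℕₚ.m≤n*m ℤ.∣ b ∣ 2) (ℕₚ.≤-trans (ℕₚ.≤-reflexive (≡.sym (ℤₚ.abs-* (+ 2) b)))
        (ℕₚ.≤-trans (ℕₚ.≤-reflexive (cong ℤ.∣_∣ (≡.trans 2b≡ (cong₂ ℤ._-_ (≡.sym (ℤₚ.pos-* a a)) e≡))))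
        (ℕₚ.≤-trans (ℤₚ.∣i-j∣≤∣i∣+∣j∣ (+ (a ℕ.* a)) (+ e)) (ℕₚ.≤-trans (ℕₚ.+-mono-≤ a²≤2S e≤S) (ℕₚ.≤-reflexive (ℕₚ.+-comm (2 ℕ.* S) S))))))
    positive : ∀ Δ → discriminant (+ a) b ≡ Δ → + 0 ℤ.< Δ → a ℕ.< N × ℤ.∣ b ∣ ℕ.< N
    positive -[1+ _ ] _ ()
    positive (+ D) D≡ _ = let e , e≡ = doubled-nonneg e₀ _ (2e≡ D D≡) in bounds D e D≡ e≡

  boundII : FactorsII → BoundedII
  boundII (factorsII a b t₁ t₂ t₃ t₄ t₅ 0<a D above F≈) =
    let a<N , b<N = boundsII a b (commonEdges t₁ t₂ t₃ t₄ t₅) (proj₁ D)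
          (edges t₁ t₂ t₃ t₄ t₅ 3 (symmetricPair (+ a) b) (+ a ℤ.* + a ℤ.- + 2 ℤ.* b) (top-pair (+ a) b) F≈)
    in a , a<N , ℤ.∣ b ∣ , b<N , signed b (0<a , D , above , multiplicities t₁ t₂ t₃ t₄ t₅ 3 (symmetricPair (+ a) b) (+ a ℤ.* + a ℤ.- + 2 ℤ.* b) (top-pair (+ a) b) F≈)
    where
    signed : ∀ b → CandidateII a b → CandidateII a (+ ℤ.∣ b ∣) ⊎ CandidateII a (ℤ.- + ℤ.∣ b ∣)
    signed (+ _)    cand = inj₁ cand
    signed -[1+ _ ] cand = inj₂ cand

  factors : ¬ ¬ (FactorsI ⊎ FactorsII) → FactorsI ⊎ FactorsII
  factors nn = fromBounded (decidable-stable bounded? (λ none → nn λ { (inj₁ f) → none (inj₁ (boundI f)) ; (inj₂ f) → none (inj₂ (boundII f)) }))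

-- The largest root in a real closed field

module RealRoots (R : RealClosedField) where
  open RealClosedField R using (cring; _≤_; isTotalOrder; +-mono-≤; *-nonneg; nontrivial; inverse; sqrt)
  open RingKit cring
  open EvalQuadratic cring
  open Evaluation cring
  private module T = IsTotalOrder isTotalOrder

  ≤-resp : ∀ {x x′ y y′} → x ≈ x′ → y ≈ y′ → x ≤ y → x′ ≤ y′
  ≤-resp e f le = T.trans (T.reflexive (≈-sym e)) (T.trans le (T.reflexive f))

  0≤y-x : ∀ {x y} → x ≤ y → 0# ≤ (y + - x)
  0≤y-x {x} le = ≤-resp (-‿inverseʳ x) ≈-refl (+-mono-≤ (- x) le)

  x≤y : ∀ {x y} → 0# ≤ (y + - x) → x ≤ y
  x≤y {x} {y} le = ≤-resp (+-identityˡ x) (solve 2 (λ x y → (y :- x) :+ x := y) ≈-refl x y) (+-mono-≤ x le)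

  0≤-+ : ∀ {x y} → 0# ≤ x → 0# ≤ y → 0# ≤ (x + y)
  0≤-+ {x} {y} x≥0 y≥0 = T.trans y≥0 (≤-resp (+-identityˡ y) ≈-refl (+-mono-≤ y x≥0))

  0≤-neg : ∀ {x} → x ≤ 0# → 0# ≤ (- x)
  0≤-neg le = ≤-resp ≈-refl (+-identityˡ _) (0≤y-x le)

  0≤1 : 0# ≤ 1#
  0≤1 with T.total 0# 1#
  ... | inj₁ le = le
  ... | inj₂ le = ≤-resp ≈-refl (solve 0 ((:- con (+ 1)) :* (:- con (+ 1)) := con (+ 1)) ≈-refl) (*-nonneg (0≤-neg le) (0≤-neg le))

  order : Cone cring
  order = record
    { Nonneg = 0# ≤_
    ; nonneg-resp = λ e → ≤-resp ≈-refl e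
    ; nonneg-0 = T.refl
    ; nonneg-1 = 0≤1
    ; nonneg-+ = 0≤-+
    ; nonneg-* = *-nonneg
    ; -1-negative = λ le → nontrivial (T.antisym (x≤y (≤-resp ≈-refl (≈-sym (+-identityˡ _)) le)) 0≤1) }
  open ConeStar cring order using (Positive; positive-1; positive-+; positive-*; positive-resp; positive⇒nonneg; positive≉0)
  open RootsAboveTwo cring order using (nonneg-fromℕ; positive-fromℕ)

  cancel-positive : ∀ {x y} → Positive x → x * y ≈ 0# → y ≈ 0#
  cancel-positive {x} {y} pos e with inverse x (positive≉0 pos)
  ... | z , xz≈1 = begin
    y             ≈⟨ *-identityˡ y ⟨
    1# * y        ≈⟨ *-congʳ xz≈1 ⟨
    (x * z) * y   ≈⟨ solve 3 (λ x y z → (x :* z) :* y := z :* (x :* y)) ≈-refl x y z ⟩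
    z * (x * y)   ≈⟨ *-congˡ e ⟩
    z * 0#        ≈⟨ zeroʳ z ⟩
    0#            ∎

  2# : Carrier
  2# = fromℤ (+ 2)

  excess : ∀ {x} → 2# ≤ x → ∃ λ a → 0# ≤ a × x ≈ 2# + a
  excess {x} le = _ , 0≤y-x le , solve 1 (λ x → x := con (+ 2) :+ (x :- con (+ 2))) ≈-refl x

  module CommonFactors {x a : Carrier} (a≥0 : 0# ≤ a) (x≈ : x ≈ 2# + a) where
    positive-by : ∀ {z} r → 0# ≤ r → z ≈ 1# + r → Positive z
    positive-by r r≥0 e = r , r≥0 , e

    a² : 0# ≤ (a * a)
    a² = *-nonneg a≥0 a≥0

    -- (2 + a)² - p (2 + a) + q = 1 + ((3 - 2p + q) + (4 - p) a + a²)
    quadratic-positive : ∀ p q m n → + 3 ℤ.- + 2 ℤ.* p ℤ.+ q ≡ + m → + 4 ℤ.- p ≡ + n → Positive (eval x (quadratic p q))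
    quadratic-positive p q m n e f = positive-by _ (0≤-+ (0≤-+ (nonneg-fromℕ m) (*-nonneg (nonneg-fromℕ n) a≥0)) a²) (begin
      eval x (quadratic p q)                                    ≈⟨ eval-x²-ax+b x p q ⟩
      (x * x + - (fromℤ p * x)) + fromℤ q                       ≈⟨ +-congʳ (+-cong (*-cong x≈ x≈) (-‿cong (*-congˡ x≈))) ⟩
      ((2# + a) * (2# + a) + - (fromℤ p * (2# + a))) + fromℤ q
        ≈⟨ solve 3 (λ a p q → ((con (+ 2) :+ a) :* (con (+ 2) :+ a) :+ (:- (p :* (con (+ 2) :+ a)))) :+ q
             := con (+ 1) :+ (((con (+ 3) :- con (+ 2) :* p :+ q) :+ (con (+ 4) :- p) :* a) :+ a :* a)) ≈-refl a (fromℤ p) (fromℤ q) ⟩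
      1# + (((fromℤ (+ 3) + - (2# * fromℤ p) + fromℤ q) + (fromℤ (+ 4) + - fromℤ p) * a) + a * a)
        ≈⟨ +-congˡ (+-congʳ (+-cong constant-part (*-congʳ linear-part))) ⟩
      1# + ((fromℕ m + fromℕ n * a) + a * a)                    ∎)
      where
      constant-part : fromℤ (+ 3) + - (2# * fromℤ p) + fromℤ q ≈ fromℕ m
      constant-part = begin
        fromℤ (+ 3) + - (2# * fromℤ p) + fromℤ q               ≈⟨ +-congʳ (+-congˡ (-‿cong (fromℤ-* (+ 2) p))) ⟨
        fromℤ (+ 3) + - fromℤ (+ 2 ℤ.* p) + fromℤ q            ≈⟨ +-congʳ (+-congˡ (fromℤ-neg (+ 2 ℤ.* p))) ⟨
        fromℤ (+ 3) + fromℤ (ℤ.- (+ 2 ℤ.* p)) + fromℤ q        ≈⟨ +-congʳ (fromℤ-+ (+ 3) (ℤ.- (+ 2 ℤ.* p))) ⟨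
        fromℤ (+ 3 ℤ.- + 2 ℤ.* p) + fromℤ q                    ≈⟨ fromℤ-+ (+ 3 ℤ.- + 2 ℤ.* p) q ⟨
        fromℤ (+ 3 ℤ.- + 2 ℤ.* p ℤ.+ q)                        ≈⟨ ≈-reflexive (cong fromℤ e) ⟩
        fromℕ m                                                ∎
      linear-part : fromℤ (+ 4) + - fromℤ p ≈ fromℕ n
      linear-part = ≈-trans (+-congˡ (≈-sym (fromℤ-neg p))) (≈-trans (≈-sym (fromℤ-+ (+ 4) (ℤ.- p))) (≈-reflexive (cong fromℤ f)))

    product-positive : ∀ p q → Positive (eval x p) → Positive (eval x q) → Positive (eval x (p *ᵖ q))
    product-positive p q pos pos′ = positive-resp (≈-sym (eval-* x p q)) (positive-* pos pos′)

    power-positive : ∀ p t → Positive (eval x p) → Positive (eval x (p ^ᵖ t))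
    power-positive p zero    pos = positive-resp (≈-sym (Hom.1-homo (evaluate x))) positive-1
    power-positive p (suc t) pos = product-positive p (p ^ᵖ t) pos (power-positive p t pos)

    x-positive : Positive (eval x X₁)
    x-positive = positive-by (1# + a) (0≤-+ 0≤1 a≥0)
      (≈-trans (eval-X x) (≈-trans x≈ (solve 1 (λ a → con (+ 2) :+ a := con (+ 1) :+ (con (+ 1) :+ a)) ≈-refl a)))

    common-positive : ∀ t₁ t₂ t₃ t₄ t₅ → Positive (eval x (common t₁ t₂ t₃ t₄ t₅))
    common-positive t₁ t₂ t₃ t₄ t₅ =
      product-positive (X₁ ^ᵖ t₁) _ (power-positive X₁ t₁ x-positive)
      (product-positive (squareMinus 1 ^ᵖ t₂) _ (power-positive (squareMinus 1) t₂ (quadratic-positive (+ 0) (ℤ.- + 1) 2 4 refl refl))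
      (product-positive (squareMinus 2 ^ᵖ t₃) _ (power-positive (squareMinus 2) t₃ (quadratic-positive (+ 0) (ℤ.- + 2) 1 4 refl refl))
      (product-positive (symmetricPair (+ 1) -[1+ 0 ] ^ᵖ t₄) _ (power-positive (symmetricPair (+ 1) -[1+ 0 ]) t₄
          (product-positive (quadratic (+ 1) -[1+ 0 ]) (quadratic (ℤ.- + 1) -[1+ 0 ])
            (quadratic-positive (+ 1) -[1+ 0 ] 0 3 refl refl) (quadratic-positive (ℤ.- + 1) -[1+ 0 ] 4 5 refl refl)))
        (power-positive (squareMinus 3) t₅ (quadratic-positive (+ 0) (ℤ.- + 3) 0 4 refl refl)))))

  fromℕR≈fromℕ : ∀ n → fromℕR R n ≈ fromℕ n
  fromℕR≈fromℕ zero    = ≈-refl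
  fromℕR≈fromℕ (suc n) = ≈-trans (+-congˡ (fromℕR≈fromℕ n)) (≈-sym (fromℕ-suc n))

  fromℤR≈fromℤ : ∀ z → fromℤR R z ≈ fromℤ z
  fromℤR≈fromℤ (+ n)    = fromℕR≈fromℕ n
  fromℤR≈fromℤ -[1+ n ] = -‿cong (fromℕR≈fromℕ (suc n))

  nonnegative-root : ∀ x → 0# ≤ x → ∃ λ y → 0# ≤ y × y * y ≈ x
  nonnegative-root x x≥0 with sqrt x x≥0
  ... | y , y²≈x with T.total 0# y
  ...   | inj₁ y≥0 = y , y≥0 , y²≈x
  ...   | inj₂ y≤0 = - y , 0≤-neg y≤0 , ≈-trans (solve 1 (λ y → (:- y) :* (:- y) := y :* y) ≈-refl y) y²≈x

  Root : Pol → Carrier → Set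
  Root p x = eval x p ≈ 0#

  root-of-factor : ∀ F p q x → F ≈ᵖ (p *ᵖ q) → Root q x → Root F x
  root-of-factor F p q x F≈ e = ≈-trans (Hom.⟦⟧-cong (evaluate x) {F} {p *ᵖ q} F≈)
    (≈-trans (eval-* x p q) (≈-trans (*-congˡ e) (zeroʳ _)))

  module LargestRoot (F : Pol) (λ₁ : Carrier) (λ₁-root : Root F λ₁) (largest : ∀ μ → Root F μ → μ ≤ λ₁) where

    root-of-cofactor : ∀ p q → F ≈ᵖ (p *ᵖ q) → Positive (eval λ₁ p) → Root q λ₁
    root-of-cofactor p q F≈ pos = cancel-positive pos (≈-trans (≈-sym (eval-* λ₁ p q))
      (≈-trans (≈-sym (Hom.⟦⟧-cong (evaluate λ₁) {F} {p *ᵖ q} F≈)) λ₁-root))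

    -- As s is a root of F, maximality gives λ₁ ≥ s ≥ 2, and there the common part is positive.
    beyond-two : ∀ t₁ t₂ t₃ t₄ t₅ q s → F ≈ᵖ (common t₁ t₂ t₃ t₄ t₅ *ᵖ q) → Root q s → 2# ≤ s → Root q λ₁
    beyond-two t₁ t₂ t₃ t₄ t₅ q s F≈ q[s]≈0 2≤s =
      let a , a≥0 , λ≈ = excess (T.trans 2≤s (largest s (root-of-factor F (common t₁ t₂ t₃ t₄ t₅) q s F≈ q[s]≈0)))
      in root-of-cofactor (common t₁ t₂ t₃ t₄ t₅) q F≈ (CommonFactors.common-positive a≥0 λ≈ t₁ t₂ t₃ t₄ t₅)

    largest-square : ∀ c t₁ t₂ t₃ t₄ t₅ → F ≈ᵖ (common t₁ t₂ t₃ t₄ t₅ *ᵖ squareMinus (4 ℕ.+ c)) → Root (squareMinus (4 ℕ.+ c)) λ₁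
    largest-square c t₁ t₂ t₃ t₄ t₅ F≈ = from (nonnegative-root (fromℕ (4 ℕ.+ c)) (nonneg-fromℕ (4 ℕ.+ c)))
      where
      from : (∃ λ s → 0# ≤ s × s * s ≈ fromℕ (4 ℕ.+ c)) → Root (squareMinus (4 ℕ.+ c)) λ₁
      from (s , s≥0 , s²≈) = beyond-two t₁ t₂ t₃ t₄ t₅ (squareMinus (4 ℕ.+ c)) s F≈ s-root 2≤s
        where
        s-root : Root (squareMinus (4 ℕ.+ c)) s
        s-root = ≈-trans (eval-x²-ax+b s (+ 0) (ℤ.- + (4 ℕ.+ c))) (≈-trans (+-cong (+-congʳ s²≈) (fromℤ-neg (+ (4 ℕ.+ c))))
          (solve 2 (λ n s → (n :+ (:- (con (+ 0) :* s))) :- n := con (+ 0)) ≈-refl (fromℕ (4 ℕ.+ c)) s))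
        4-s² : fromℤ (+ 4) + - (s * s) ≈ - fromℕ c
        4-s² = ≈-trans (+-congˡ (-‿cong (≈-trans s²≈ (fromℤ-+ (+ 4) (+ c)))))
          (solve 1 (λ c → con (+ 4) :- (con (+ 4) :+ c) := :- c) ≈-refl (fromℕ c))
        2≤s : 2# ≤ s
        2≤s with T.total 2# s
        ... | inj₁ le = le
        -- This case is consistent for c = 0: (2 + s)(2 - s) = -c is then both nonnegative and
        -- nonpositive, which forces s = 2.
        ... | inj₂ s≤2 = T.reflexive (≈-sym (≈-trans (≈-trans (solve 1 (λ s → s := con (+ 2) :- (con (+ 2) :- s)) ≈-refl s) (+-congˡ (-‿cong 2-s≈0))) (solve 0 (con (+ 2) :- con (+ 0) := con (+ 2)) ≈-refl)))
          where
          factorised : (2# + s) * (2# + - s) ≈ - fromℕ c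
          factorised = ≈-trans (solve 1 (λ s → (con (+ 2) :+ s) :* (con (+ 2) :- s) := con (+ 4) :- s :* s) ≈-refl s) 4-s²
          product≈0 : (2# + s) * (2# + - s) ≈ 0#
          product≈0 = T.antisym (≤-resp (≈-sym factorised) ≈-refl
              (x≤y (≤-resp ≈-refl (solve 1 (λ c → c := con (+ 0) :- (:- c)) ≈-refl (fromℕ c)) (nonneg-fromℕ c))))
            (*-nonneg (0≤-+ (nonneg-fromℕ 2) s≥0) (0≤y-x s≤2))
          2-s≈0 : 2# + - s ≈ 0#
          2-s≈0 = cancel-positive (positive-+ (positive-fromℕ 1) s≥0) product≈0

    -- s = (a + δ) / 2 with δ² = a² - 4b is a root; were s ≤ 2, then 4 - 2a + b = (2 - s)(2 - s̄) ≥ 0.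
    largest-pair : ∀ a b D w t₁ t₂ t₃ t₄ t₅ → discriminant (+ suc a) b ≡ + D → b ℤ.+ + 4 ℤ.+ + suc w ≡ + 2 ℤ.* + suc a →
      F ≈ᵖ (common t₁ t₂ t₃ t₄ t₅ *ᵖ symmetricPair (+ suc a) b) → Root (quadratic (+ suc a) b) λ₁
    largest-pair a b D w t₁ t₂ t₃ t₄ t₅ D≡ w≡ F≈ = from (inverse 2# (positive≉0 (positive-fromℕ 1))) (nonnegative-root (fromℕ D) (nonneg-fromℕ D))
      where
      A B : Carrier
      A = fromℕ (suc a)
      B = fromℤ b
      A²-4B : A * A + - (fromℤ (+ 4) * B) ≈ fromℕ D
      A²-4B = ≈-trans (+-cong (≈-sym (fromℤ-* (+ suc a) (+ suc a))) (≈-trans (-‿cong (≈-sym (fromℤ-* (+ 4) b))) (≈-sym (fromℤ-neg (+ 4 ℤ.* b)))))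
        (≈-trans (≈-sym (fromℤ-+ (+ suc a ℤ.* + suc a) (ℤ.- (+ 4 ℤ.* b)))) (≈-reflexive (cong fromℤ D≡)))
      2A : B + fromℤ (+ 4) + fromℕ (suc w) ≈ 2# * A
      2A = ≈-trans (+-congʳ (≈-sym (fromℤ-+ b (+ 4)))) (≈-trans (≈-sym (fromℤ-+ (b ℤ.+ + 4) (+ suc w)))
        (≈-trans (≈-reflexive (cong fromℤ w≡)) (fromℤ-* (+ 2) (+ suc a))))
      from : (∃ λ h → 2# * h ≈ 1#) → (∃ λ δ → 0# ≤ δ × δ * δ ≈ fromℕ D) → Root (quadratic (+ suc a) b) λ₁
      -- The product of both quadratics vanishes at λ₁, and x² + (a + 1)x + b is positive there,
      -- because λ₁ ≥ s.
      from (h , 2h≈1) (δ , δ≥0 , δ²≈) = cancel-positive plus-positive (≈-trans (*-comm _ _) pair-root)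
        where
        s s̄ : Carrier
        s = h * (A + δ)
        s̄ = h * (A + - δ)
        s+s̄ : s + s̄ ≈ A
        s+s̄ = ≈-trans (solve 3 (λ h a d → h :* (a :+ d) :+ h :* (a :- d) := (con (+ 2) :* h) :* a) ≈-refl h A δ) (≈-trans (*-congʳ 2h≈1) (*-identityˡ A))
        s*s̄ : s * s̄ ≈ B
        s*s̄ = ≈-trans (solve 3 (λ h a d → (h :* (a :+ d)) :* (h :* (a :- d)) := (h :* h) :* (a :* a :- d :* d)) ≈-refl h A δ)
          (≈-trans (*-congˡ (+-congˡ (-‿cong (≈-trans δ²≈ (≈-sym A²-4B)))))
          (≈-trans (solve 3 (λ h a b → (h :* h) :* (a :* a :- (a :* a :- con (+ 4) :* b)) := ((con (+ 2) :* h) :* (con (+ 2) :* h)) :* b) ≈-refl h A B)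
          (≈-trans (*-congʳ (≈-trans (*-cong 2h≈1 2h≈1) (*-identityˡ 1#))) (*-identityˡ B))))
        s-root : Root (quadratic (+ suc a) b) s
        s-root = QuadraticRoots.eval-root cring (+ suc a) b s+s̄ s*s̄
        0≤h : 0# ≤ h
        0≤h with T.total 0# h
        ... | inj₁ le = le
        ... | inj₂ h≤0 = ⊥-elim (positive≉0 (positive-+ positive-1 (*-nonneg (nonneg-fromℕ 2) (0≤-neg h≤0)))
          (≈-trans (+-congʳ (≈-sym 2h≈1)) (solve 1 (λ h → con (+ 2) :* h :+ con (+ 2) :* (:- h) := con (+ 0)) ≈-refl h)))
        s≤2⇒⊥ : ¬ (s ≤ 2#)
        s≤2⇒⊥ s≤2 = positive≉0 (positive-+ (positive-fromℕ w) (*-nonneg (0≤y-x s≤2) 0≤2-s̄)) (begin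
          fromℕ (suc w) + (2# + - s) * (2# + - s̄)
            ≈⟨ solve 3 (λ w s t → w :+ (con (+ 2) :- s) :* (con (+ 2) :- t) := (s :* t :+ con (+ 4) :+ w) :- con (+ 2) :* (s :+ t)) ≈-refl (fromℕ (suc w)) s s̄ ⟩
          (s * s̄ + fromℤ (+ 4) + fromℕ (suc w)) + - (2# * (s + s̄))
            ≈⟨ +-cong (≈-trans (+-congʳ (+-congʳ s*s̄)) 2A) (-‿cong (*-congˡ s+s̄)) ⟩
          2# * A + - (2# * A)    ≈⟨ -‿inverseʳ (2# * A) ⟩
          0#                     ∎)
          where
          0≤2-s̄ : 0# ≤ (2# + - s̄)
          0≤2-s̄ = ≤-resp ≈-refl (solve 3 (λ h a d → (con (+ 2) :- h :* (a :+ d)) :+ con (+ 2) :* (h :* d) := con (+ 2) :- h :* (a :- d)) ≈-refl h A δ)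
            (0≤-+ (0≤y-x s≤2) (*-nonneg (nonneg-fromℕ 2) (*-nonneg 0≤h δ≥0)))
        2≤s : 2# ≤ s
        2≤s with T.total 2# s
        ... | inj₁ le  = le
        ... | inj₂ s≤2 = ⊥-elim (s≤2⇒⊥ s≤2)
        pair[s] : Root (symmetricPair (+ suc a) b) s
        pair[s] = ≈-trans (eval-* s (quadratic (+ suc a) b) (quadratic (ℤ.- + suc a) b)) (≈-trans (*-congʳ s-root) (zeroˡ _))
        pair-root : eval λ₁ (quadratic (+ suc a) b) * eval λ₁ (quadratic (ℤ.- + suc a) b) ≈ 0#
        pair-root = ≈-trans (≈-sym (eval-* λ₁ (quadratic (+ suc a) b) (quadratic (ℤ.- + suc a) b)))
          (beyond-two t₁ t₂ t₃ t₄ t₅ (symmetricPair (+ suc a) b) s F≈ pair[s] 2≤s)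
        s≤λ₁ : s ≤ λ₁
        s≤λ₁ = largest s (root-of-factor F (common t₁ t₂ t₃ t₄ t₅) (symmetricPair (+ suc a) b) s F≈ pair[s])
        t : Carrier
        t = λ₁ + - s
        s-positive : Positive s
        s-positive = let r , r≥0 , s≈ = excess 2≤s in 1# + r , 0≤-+ 0≤1 r≥0
          , ≈-trans s≈ (solve 1 (λ r → con (+ 2) :+ r := con (+ 1) :+ (con (+ 1) :+ r)) ≈-refl r)
        0≤s : 0# ≤ s
        0≤s = positive⇒nonneg s-positive
        -- λ₁² + aλ₁ + b = 2as + (2st + t² + at) for λ₁ = s + t
        plus-positive : Positive (eval λ₁ (quadratic (ℤ.- + suc a) b))
        plus-positive = positive-resp (≈-sym (begin
          eval λ₁ (quadratic (ℤ.- + suc a) b)                   ≈⟨ eval-x²-ax+b λ₁ (ℤ.- + suc a) b ⟩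
          (λ₁ * λ₁ + - (- A * λ₁)) + B                          ≈⟨ +-cong (+-congˡ (-‿cong (*-congʳ (-‿cong (≈-sym s+s̄))))) (≈-sym s*s̄) ⟩
          (λ₁ * λ₁ + - (- (s + s̄) * λ₁)) + s * s̄
            ≈⟨ solve 3 (λ l s s̄ → (l :* l :+ (:- ((:- (s :+ s̄)) :* l))) :+ s :* s̄
                 := (con (+ 2) :* (s :+ s̄)) :* s :+ ((con (+ 2) :* (s :* (l :- s)) :+ (l :- s) :* (l :- s)) :+ (s :+ s̄) :* (l :- s))) ≈-refl λ₁ s s̄ ⟩
          (2# * (s + s̄)) * s + ((2# * (s * t) + t * t) + (s + s̄) * t)
            ≈⟨ +-cong (*-congʳ (*-congˡ s+s̄)) (+-congˡ (*-congʳ s+s̄)) ⟩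
          (2# * A) * s + ((2# * (s * t) + t * t) + A * t)      ∎))
          (positive-+ (positive-* (positive-* (positive-fromℕ 1) (positive-fromℕ a)) s-positive)
            (0≤-+ (0≤-+ (*-nonneg (nonneg-fromℕ 2) (*-nonneg 0≤s t≥0)) (*-nonneg t≥0 t≥0)) (*-nonneg (nonneg-fromℕ (suc a)) t≥0)))
          where
          t≥0 : 0# ≤ t
          t≥0 = 0≤y-x s≤λ₁

-- Translation into the polynomials of the statement

module Translation where
  open Hom ι using (⟦_⟧; *-homo; 1-homo)
  open RingKit ℚ[x].polRing using (≈-refl; ≈-trans; ≈-reflexive; *-cong)

  _Represents_ : Pol → Poly → Set
  p Represents q = ⟦ p ⟧ ℚ[x].≈ᵖ q

  represents-* : ∀ p q p′ q′ → p Represents p′ → q Represents q′ → (p *ᵖ q) Represents (p′ *ₚ q′)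
  represents-* p q p′ q′ e f = ≈-trans (*-homo p q) (≈-trans (*-cong e f) (≈-reflexive (≡.sym (*ₚ≡*ᵖ p′ q′))))

  represents-^ : ∀ p p′ → p Represents p′ → ∀ t → (p ^ᵖ t) Represents (p′ ^ₚ t)
  represents-^ p p′ e zero    = 1-homo
  represents-^ p p′ e (suc t) = represents-* p (p ^ᵖ t) p′ (p′ ^ₚ t) e (represents-^ p p′ e t)

  represents-quadratic : ∀ a b → quadratic a b Represents quad (ℤ.- a) b
  represents-quadratic a b = ℚ[x].eq λ where
    zero                → IntegersInℚ.fromℤ≡/1 b
    (suc zero)          → IntegersInℚ.fromℤ≡/1 (ℤ.- a)
    (suc (suc zero))    → refl
    (suc (suc (suc i))) → refl

  represents-square : ∀ c → squareMinus c Represents sq- (+ c)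
  represents-square c = ℚ[x].eq λ where
    zero                → IntegersInℚ.fromℤ≡/1 (ℤ.- + c)
    (suc zero)          → refl
    (suc (suc zero))    → refl
    (suc (suc (suc i))) → refl

  represents-pair : ∀ a b → symmetricPair a b Represents (quad (ℤ.- a) b *ₚ quad a b)
  represents-pair a b = represents-* (quadratic a b) (quadratic (ℤ.- a) b) (quad (ℤ.- a) b) (quad a b) (represents-quadratic a b)
    (subst (λ a′ → quadratic (ℤ.- a) b Represents quad a′ b) (ℤₚ.neg-involutive a) (represents-quadratic (ℤ.- a) b))

  represents-common : ∀ t₁ t₂ t₃ t₄ t₅ → common t₁ t₂ t₃ t₄ t₅ Represents commonPart t₁ t₂ t₃ t₄ t₅
  represents-common t₁ t₂ t₃ t₄ t₅ =
    represents-* _ _ _ _ (represents-^ X₁ X ≈-refl t₁)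
    (represents-* _ _ _ _ (represents-^ (squareMinus 1) (sq- (+ 1)) (represents-square 1) t₂)
    (represents-* _ _ _ _ (represents-^ (squareMinus 2) (sq- (+ 2)) (represents-square 2) t₃)
    (represents-* _ _ _ _ (represents-^ (symmetricPair (+ 1) -[1+ 0 ]) (quad (ℤ.- + 1) -[1+ 0 ] *ₚ quad (+ 1) -[1+ 0 ]) (represents-pair (+ 1) -[1+ 0 ]) t₄)
      (represents-^ (squareMinus 3) (sq- (+ 3)) (represents-square 3) t₅))))

-- Assembly of the two forms

i<i+1+w : ∀ i w j → i ℤ.+ + suc w ≡ j → i ℤ.< j
i<i+1+w i w _ refl = subst (ℤ._< i ℤ.+ + suc w) (ℤₚ.+-identityʳ i) (ℤₚ.+-monoʳ-< i (ℤ.+<+ (s≤s z≤n)))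

gap : ∀ i j → i ℤ.< j → ∃ λ w → i ℤ.+ + suc w ≡ j
gap i j i<j = positive (j ℤ.- i) refl
  where
  module Z = RingKit ℤRing
  restore : ∀ d → j ℤ.- i ≡ d → i ℤ.+ d ≡ j
  restore d refl = Z.solve 2 (λ i j → i Z.:+ (j Z.:- i) Z.:= j) refl i j
  positive : ∀ d → j ℤ.- i ≡ d → ∃ λ w → i ℤ.+ + suc w ≡ j
  positive (+ suc w) e = w , restore (+ suc w) e
  positive (+ zero)  e = ⊥-elim (ℤₚ.<-irrefl (≡.trans (≡.sym (ℤₚ.+-identityʳ i)) (restore (+ 0) e)) i<j)
  positive -[1+ w ]  e = ⊥-elim (ℤₚ.<-asym i<j (i<i+1+w j w i (≡.trans (cong (ℤ._+ + suc w) (≡.sym (restore -[1+ w ] e)))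
    (Z.solve 2 (λ i w → (i Z.:+ (Z.:- w)) Z.:+ w Z.:= i) refl i (+ suc w)))))

module Main {n : ℕ} (T : Graph n) (k : ℕ) (len : Fin k → ℕ) (φ : Fin n ↔ StarV k len)
  (T≡ : ∀ u v → T u v ≡ starAdj k len (Inverse.to φ u) (Inverse.to φ v)) where
  ls : List ℕ
  ls = tabulate len

  F : Pol
  F = starPoly ls

  charPoly≈ : charPoly T ℚ[x].≈ᵖ Hom.⟦_⟧ ι F
  charPoly≈ = CharacteristicPolynomial.charPoly-star T k len φ T≡

  vertices≡ : n ≡ suc (sum ls)
  vertices≡ = StarDeterminant.vertex-count ℤRing (+ 0) T k len φ T≡

  module P = RingKit polRing
  module Q = RingKit ℚ[x].polRing
  open Search ls using (FactorsI; FactorsII; factorsI; factorsII)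

  low-degree : Quadratic T → ∀ g → Irreducible g → ∀ h → Hom.⟦_⟧ ι F ℚ[x].≈ᵖ (g ℚ[x].*ᵖ h) → g ℚ[x].belowᵖ 3
  low-degree quadr g irr h F≈ i le = ≡.trans (≡.sym (coeff≡coef g i)) (quadr g irr
    (h , ≈ᵖ⇒≈ₚ (Q.≈-trans charPoly≈ (Q.≈-trans F≈ (Q.≈-reflexive (≡.sym (*ₚ≡*ᵖ g h)))))) i le)

  claw : ContainsK13Properly T → Claw.Branches k len
  claw (_ , ψ , injective , adjacency) = Claw.claw-branches k len (to (ψ zero)) (λ i → to (ψ (suc i)))
    (λ i j e → Finₚ.suc-injective (injective (suc i) (suc j) (to-injective e)))
    (λ i → ≡.trans (≡.sym (T≡ (ψ zero) (ψ (suc i)))) (adjacency zero (suc i)))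
    where
    open Inverse φ using (to)
    open StarDeterminant ℤRing (+ 0) T k len φ T≡ using (to-injective)

  value-at-2 : Claw.Branches k len → ∃ λ d → Star.star ℤRing (+ 2) ls ≡ + 4 ℤ.- + d
  value-at-2 (branch , injective , nonempty) = ValueAtTwo.star-at-2≤4 k len branch injective nonempty

  -- The quadratic has the value -v at 2. For v = 0 the number 2 would be a root and the
  -- discriminant the square u², so the value is strictly negative.
  pair-factors : ∀ a b v t₁ t₂ t₃ t₄ t₅ → NonSquarePos (discriminant (+ suc a) b) → b ≡ + 2 ℤ.* (+ suc a ℤ.- + 4) ℤ.+ + 4 ℤ.- + v →
    F ≈ᵖ (common t₁ t₂ t₃ t₄ t₅ *ᵖ symmetricPair (+ suc a) b) → FactorsII
  pair-factors a b zero t₁ t₂ t₃ t₄ t₅ (_ , ns) b≡ F≈ = ⊥-elim (ns (ℤ.∣ u ∣ ,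
    ≡.trans (cong₂ discriminant (≡.sym (Classification.a-4+4 (+ suc a))) b≡)
    (≡.trans (Classification.discriminant-shift u (+ 0)) (≡.trans (ℤₚ.+-identityʳ (u ℤ.* u)) (square-nonneg u)))))
    where u = + suc a ℤ.- + 4
  pair-factors a b (suc v) t₁ t₂ t₃ t₄ t₅ ns b≡ F≈ = factorsII (suc a) b t₁ t₂ t₃ t₄ t₅ (s≤s z≤n) ns
    (i<i+1+w (b ℤ.+ + 4) v (+ 2 ℤ.* + suc a) (≡.trans (cong (λ b → b ℤ.+ + 4 ℤ.+ + suc v) b≡)
      (Z.solve 2 (λ a v → ((Z.con (+ 2) Z.:* (a Z.:- Z.con (+ 4)) Z.:+ Z.con (+ 4)) Z.:- v) Z.:+ Z.con (+ 4) Z.:+ v Z.:= Z.con (+ 2) Z.:* a) refl (+ suc a) (+ suc v)))) F≈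
    where module Z = RingKit ℤRing

  big-factor : ∀ B p → F ≈ᵖ (p *ᵖ (big B *ᵖ P.1#)) → F ≈ᵖ (p *ᵖ big B)
  big-factor B p F≈ = P.≈-trans F≈ (P.*-congˡ {p} (P.*-identityʳ (big B)))

  factors : Quadratic T → ContainsK13Properly T → FactorsI ⊎ FactorsII
  factors quadr k13-in = Search.factors ls λ none →
    Decomposition.decomposition ls (low-degree quadr) λ (As , F≈) → none (collected As F≈)
    where
    large : 3 ℕ.< sum ls
    large = ℕₚ.≤-pred (ℕₚ.≤-trans (proj₁ k13-in) (ℕₚ.≤-reflexive vertices≡))
    one-big : ∀ t₁ t₂ t₃ t₄ t₅ Bs → F ≈ᵖ (common t₁ t₂ t₃ t₄ t₅ *ᵖ bigs Bs) → FactorsI ⊎ FactorsII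
    one-big t₁ t₂ t₃ t₄ t₅ [] F≈ = let d , f≡ = value-at-2 (claw k13-in) in
      ⊥-elim (Counting.no-common-star ls d t₁ t₂ t₃ t₄ t₅ f≡ large (P.≈-trans F≈ (P.*-identityʳ (common t₁ t₂ t₃ t₄ t₅))))
    one-big t₁ t₂ t₃ t₄ t₅ (bigSquare c ∷ []) F≈ =
      inj₁ (factorsI (4 ℕ.+ c) t₁ t₂ t₃ t₄ t₅ (ℕₚ.m≤m+n 4 c) (big-factor (bigSquare c) (common t₁ t₂ t₃ t₄ t₅) F≈))
    one-big t₁ t₂ t₃ t₄ t₅ (bigPair a b v ns b≡ ∷ []) F≈ =
      inj₂ (pair-factors a b v t₁ t₂ t₃ t₄ t₅ ns b≡ (big-factor (bigPair a b v ns b≡) (common t₁ t₂ t₃ t₄ t₅) F≈))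
    one-big t₁ t₂ t₃ t₄ t₅ (B ∷ B′ ∷ Bs) F≈ = ⊥-elim (Collection.at-most-one-big ls B B′ (common t₁ t₂ t₃ t₄ t₅ *ᵖ bigs Bs)
      (P.≈-trans F≈ (Rearrangements.pull-tail polRing (common t₁ t₂ t₃ t₄ t₅) (big B) (big B′) (bigs Bs))))
    collected : ∀ As → F ≈ᵖ atomProduct As → FactorsI ⊎ FactorsII
    collected As F≈ = let t₁ , t₂ , t₃ , t₄ , t₅ , Bs , As≈ = Collection.collect ls As P.1# (P.≈-trans F≈ (P.≈-sym (P.*-identityʳ (atomProduct As))))
      in one-big t₁ t₂ t₃ t₄ t₅ Bs (P.≈-trans F≈ As≈)

  module Eigenvalues (R : RealClosedField) (λ₁ : RealClosedField.Carrier R) (largest : IsLargestEigenvalue R T λ₁) where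
    open RealClosedField R using (cring)
    open RingKit cring
    open RealRoots R

    eval-F : ∀ x → Evaluation.eval cring x F ≈ det rawRing n (charMatrix rawRing x T)
    eval-F x = ≈-trans (QuadraticRoots.eval-star cring x ls) (≈-sym (StarDeterminant.det-star cring x T k len φ T≡))

    open LargestRoot F λ₁ (≈-trans (eval-F λ₁) (proj₁ largest)) (λ μ e → proj₂ largest μ (≈-trans (≈-sym (eval-F μ)) e)) public

  represented : ∀ p q p′ q′ → p Translation.Represents p′ → q Translation.Represents q′ → F ≈ᵖ (p *ᵖ q) → charPoly T ≈ₚ (p′ *ₚ q′)
  represented p q p′ q′ e f F≈ = ≈ᵖ⇒≈ₚ (Q.≈-trans charPoly≈ (Q.≈-trans (Hom.⟦⟧-cong ι {F} {p *ᵖ q} F≈) (Translation.represents-* p q p′ q′ e f)))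

  formI : FactorsI → FormI T
  formI (factorsI c t₁ t₂ t₃ t₄ t₅ 4≤c F≈) = c , t₁ , t₂ , t₃ , t₄ , t₅ , 4≤c
    , represented (common t₁ t₂ t₃ t₄ t₅) (squareMinus c) _ _ (Translation.represents-common t₁ t₂ t₃ t₄ t₅) (Translation.represents-square c) F≈
    , λ R λ₁ largest → root R λ₁ largest (c ℕ.∸ 4) (≡.sym (ℕₚ.m+[n∸m]≡n 4≤c))
    where
    root : ∀ R λ₁ → IsLargestEigenvalue R T λ₁ → ∀ c′ → c ≡ 4 ℕ.+ c′ → let open RealClosedField R in (λ₁ * λ₁ + - fromℤR R (+ c)) ≈ 0#
    root R λ₁ largest c′ refl = begin
      λ₁ * λ₁ + - fromℤR R (+ c)                                 ≈⟨ +-congˡ (-‿cong (RealRoots.fromℤR≈fromℤ R (+ c))) ⟩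
      λ₁ * λ₁ + - fromℕ c                                        ≈⟨ solve 2 (λ l c → l :* l :- c := (l :* l :+ (:- (con (+ 0) :* l))) :- c) ≈-refl λ₁ (fromℕ c) ⟩
      (λ₁ * λ₁ + - (fromℤ (+ 0) * λ₁)) + - fromℕ c               ≈⟨ +-congˡ (fromℤ-neg (+ c)) ⟨
      (λ₁ * λ₁ + - (fromℤ (+ 0) * λ₁)) + fromℤ (ℤ.- + c)         ≈⟨ EvalQuadratic.eval-x²-ax+b cring λ₁ (+ 0) (ℤ.- + c) ⟨
      Evaluation.eval cring λ₁ (squareMinus c)                   ≈⟨ Eigenvalues.largest-square R λ₁ largest c′ t₁ t₂ t₃ t₄ t₅ F≈ ⟩
      0#                                                         ∎
      where
      open RealClosedField R using (cring)
      open RingKit cring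

  formII : FactorsII → FormII T
  formII (factorsII zero b t₁ t₂ t₃ t₄ t₅ () D above F≈)
  formII (factorsII (suc a) b t₁ t₂ t₃ t₄ t₅ 0<a D above F≈) = suc a , b , t₁ , t₂ , t₃ , t₄ , t₅ , 0<a , D
    , represented (common t₁ t₂ t₃ t₄ t₅) (symmetricPair (+ suc a) b) _ _ (Translation.represents-common t₁ t₂ t₃ t₄ t₅) (Translation.represents-pair (+ suc a) b) F≈
    , root
    where
    positive : ∀ Δ → + 0 ℤ.< Δ → ∃ λ d → Δ ≡ + d
    positive (+ d) _ = d , refl
    positive -[1+ d ] ()
    root : ∀ R λ₁ → IsLargestEigenvalue R T λ₁ → let open RealClosedField R in (λ₁ * λ₁ + - (fromℤR R (+ suc a) * λ₁) + fromℤR R b) ≈ 0#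
    root R λ₁ largest =
      let d , D≡ = positive (discriminant (+ suc a) b) (proj₁ D)
          w , w≡ = gap (b ℤ.+ + 4) (+ 2 ℤ.* + suc a) above
      in ≈-trans (+-cong (+-congˡ (-‿cong (*-congʳ (RealRoots.fromℤR≈fromℤ R (+ suc a))))) (RealRoots.fromℤR≈fromℤ R b))
        (≈-trans (≈-sym (EvalQuadratic.eval-x²-ax+b cring λ₁ (+ suc a) b))
          (Eigenvalues.largest-pair R λ₁ largest a b d w t₁ t₂ t₃ t₄ t₅ D≡ w≡ F≈))
      where
      open RealClosedField R using (cring)
      open RingKit cring

theorem3p6 : ∀ {n : ℕ} (T : Graph n) → StarlikeTree T → Quadratic T →
    ContainsK13Properly T → FormI T ⊎ FormII T
theorem3p6 T (k , len , φ , T≡) quadr k13-in = form (factors quadr k13-in)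
  where
  open Main T k len φ T≡
  form : Search.FactorsI (tabulate len) ⊎ Search.FactorsII (tabulate len) → FormI T ⊎ FormII T
  form (inj₁ f) = inj₁ (formI f)
  form (inj₂ f) = inj₂ (formII f)
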